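{- (1) For all integers $r \geq 3$ and $t \geq r+3$, $$tn + \Omega\left(n^{1/(t-r+2)}\right) \leq \mathrm{tsat}(n,K_r,t) \leq tn + O\left(n^{4/(t-r+2)}\right).$$ (2) For all integers $t \geq 6$, $$tn + \Omega\left(n^{2/(t-3)}\right) \leq \mathrm{tsat}(n,K_3,t) \leq tn + O\left(n^{4/(t-1)}\right).$$ (3) For all integers $r \geq 3$ and $r-2 \leq t \leq r+2$, $$(r+2)n + o(n) \leq \mathrm{tsat}(n,K_r,t) \leq (r+3)n + o(n).$$ (4) For all integers $1 \leq t \leq 5$, $$\left(5+\tfrac{2}{3}\right)n + o(n) \leq \mathrm{tsat}(n,K_3,t) \leq 6n + o(n).$$
   Context: All graphs are finite and simple; $\delta(G)$ is the minimum degree. Two distinct vertices are twins if they have the same (open) neighbourhood. A graph $G$ is $K_r$-saturated if it contains no $K_r$ but adding any missing edge creates a $K_r$. For integers $r \geq 3$, $t \geq r-2$ and sufficiently large $n$, $\mathrm{tsat}(n,K_r,t)$ is the minimum number of edges in a $K_r$-saturated graph $G$ on $n$ vertices with $\delta(G) \geq t$ in which every pair of twins has a common neighbour of degree exactly $t$ (equivalently, $G$ cannot be obtained by blowing up a smaller $K_r$-saturated graph $H$ with $\delta(H)\ge t$). Asymptotic notation is as $n\to\infty$ with $r,t$ fixed; implied constants may depend on $r,t$. -}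

module Defs where

open import Data.Nat using (ℕ; zero; suc; _+_; _*_; _∸_; _^_; _≤_; _<ᵇ_)
open import Data.Bool using (Bool; true; false; if_then_else_; _∧_; _∨_)
open import Data.Fin using (Fin; toℕ) renaming (zero to fzero; suc to fsuc)
open import Data.Fin.Properties using (_≟_)
open import Data.Product using (Σ; _×_)
open import Relation.Nullary using (¬_)
open import Relation.Nullary.Decidable using (⌊_⌋)
open import Relation.Binary.PropositionalEquality using (_≡_; _≢_)

record SimpleGraph (n : ℕ) : Set where
  field
    adj    : Fin n → Fin n → Bool
    sym    : ∀ u v → adj u v ≡ adj v u
    irrefl : ∀ v → adj v v ≡ false
open SimpleGraph public

count : ∀ {n} → (Fin n → Bool) → ℕ
count {zero}  f = 0
count {suc n} f = (if f fzero then 1 else 0) + count (λ i → f (fsuc i))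

sumFin : ∀ {n} → (Fin n → ℕ) → ℕ
sumFin {zero}  f = 0
sumFin {suc n} f = f fzero + sumFin (λ i → f (fsuc i))

deg : ∀ {n} → SimpleGraph n → Fin n → ℕ
deg G v = count (adj G v)

edges : ∀ {n} → SimpleGraph n → ℕ
edges G = sumFin (λ i → count (λ j → adj G i j ∧ (toℕ i <ᵇ toℕ j)))

HasClique : ∀ {n} → ℕ → (Fin n → Fin n → Bool) → Set
HasClique {n} r A = Σ (Fin r → Fin n) λ f → ∀ i j → i ≢ j → A (f i) (f j) ≡ true

addEdge : ∀ {n} → (Fin n → Fin n → Bool) → Fin n → Fin n → Fin n → Fin n → Bool
addEdge A u v x y =
  A x y ∨ ((⌊ x ≟ u ⌋ ∧ ⌊ y ≟ v ⌋) ∨ (⌊ x ≟ v ⌋ ∧ ⌊ y ≟ u ⌋))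

Saturated : ∀ {n} → ℕ → SimpleGraph n → Set
Saturated r G =
  ¬ HasClique r (adj G) ×
  (∀ u v → u ≢ v → adj G u v ≡ false → HasClique r (addEdge (adj G) u v))

Twins : ∀ {n} → SimpleGraph n → Fin n → Fin n → Set
Twins G u v = u ≢ v × (∀ w → adj G u w ≡ adj G v w)

Admissible : (n r t : ℕ) → SimpleGraph n → Set
Admissible n r t G =
  Saturated r G ×
  (∀ v → t ≤ deg G v) ×
  (∀ u v → Twins G u v →
     Σ (Fin n) λ w → adj G u w ≡ true × adj G v w ≡ true × deg G w ≡ t)

IsTsat : (n r t e : ℕ) → Set
IsTsat n r t e =
  (Σ (SimpleGraph n) λ G → Admissible n r t G × edges G ≡ e) ×
  (∀ (G : SimpleGraph n) → Admissible n r t G → e ≤ edges G)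

-- t n + Ω(n^(a/k)) ≤ tsat ≤ t n + O(n^(b/l)), with tsat defined for large n
-- (c n^(a/k) ≤ x  iff  (x/c)^k ≥ n^a; with c = 1/m)
PolyBounds : (r t a k b l : ℕ) → Set
PolyBounds r t a k b l =
  Σ ℕ λ m → Σ ℕ λ C → Σ ℕ λ N → ∀ n → N ≤ n →
    Σ ℕ λ e → IsTsat n r t e ×
      (n ^ a ≤ (m * (e ∸ t * n)) ^ k) ×
      ((e ∸ t * n) ^ l ≤ C ^ l * n ^ b)

-- (p/q) n + o(n) ≤ tsat ≤ (p'/q) n + o(n): for every ε = 1/m, eventually
-- (p/q - 1/m) n ≤ tsat ≤ (p'/q + 1/m) n, with tsat defined for large n
LinBounds : (r t p p' q : ℕ) → Set
LinBounds r t p p' q =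
  ∀ m → 1 ≤ m → Σ ℕ λ N → ∀ n → N ≤ n →
    Σ ℕ λ e → IsTsat n r t e ×
      (m * p * n ≤ m * q * e + q * n) ×
      (m * q * e ≤ m * p' * n + q * n)

{-# OPTIONS --safe #-}

-- Upper bounds: for k = t - 1 ≥ 5 and an alphabet [Q], join an apex to a set Λ ⊆ [Q]^k of words, a word a to
-- the vertices (i , a_i , a_{i+1}), i ∈ ℤ/k, and (i , b , c) to (i + 1 , b′ , c′) when c ≠ b′. If Λ contains all
-- words with a letter 0, this graph is K₃-saturated and twin-free, words have degree t, and there are only
-- O(Q²) = O(n^(2/k)) other vertices; the freedom in Λ reaches every large n. Dominating vertices raise r,
-- and twin-free graphs with larger minimum degree also serve for t ≤ r + 2.
--
-- Lower bounds: in a saturated G, adding to R the neighbourhoods N[y] of low-degree y with an edge u y such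
-- that u has few neighbours in R stops after boundedly many steps, by a skew set-pair inequality. Then the
-- vertices outside R have many neighbours in R (the set P), have large degree, or are of low degree with all
-- neighbours in R ∪ P (the set L). Group the vertices v of L by N(v) ∩ R, which contains a K_{r-2}, so that the
-- sets T_v = N(v) ∩ P of a group have a fixed size k ≤ d(v) - r + 2. The excess e - t n bounds |P| and the number
-- of edges inside P. Saturation makes the T_v of a group dominate each other: y ∈ T_v ∖ T_v′ has a neighbour in
-- T_v′ ∖ T_v. This bounds the number of sets: trivially by |P|^k for (1); and for (2)-(4) by weighing, where the
-- key fact is that a triangle-free graph on p vertices has at most p + 64 maximal independent sets T_v of size 3.

module Submission where

open import Defs
open import Data.Nat using (ℕ; zero; suc; _+_; _*_; _∸_; _^_; _≤_; _<_; z≤n; s≤s; s≤s⁻¹; NonZero; >-nonZero; >-nonZero⁻¹; _<ᵇ_; _%_)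
open import Data.Nat.Properties renaming (_≟_ to _≟ℕ_)
open import Data.Nat.DivMod using (m%n<n; %-distribˡ-+; m%n%n≡m%n; m<n⇒m%n≡m; [m+n]%n≡m%n)
open import Data.Nat.Tactic.RingSolver using (solve-∀)
open import Data.Bool using (Bool; true; false; if_then_else_; _∧_; _∨_; not)
open import Data.Bool.Properties using (∧-comm; ∨-comm) renaming (_≟_ to _≟ᵇ_)
open import Data.Fin using (Fin; toℕ; fromℕ<; inject≤; punchIn; punchOut; _↑ˡ_; _↑ʳ_; splitAt; combine; remQuot; finToFun; funToFin) renaming (zero to fzero; suc to fsuc)
open import Data.Fin.Properties using (_≟_; any?; all?; toℕ-injective; toℕ<n; toℕ-fromℕ<; inject≤-injective; punchInᵢ≢i; punchIn-injective; punchIn-punchOut; toℕ-↑ˡ; toℕ-↑ʳ; splitAt-↑ˡ; splitAt-↑ʳ; splitAt⁻¹-↑ˡ; splitAt⁻¹-↑ʳ; remQuot-combine; combine-remQuot; funToFin-finToFin; finToFun-funToFin) renaming (suc-injective to fsuc-injective)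
open import Data.List using (List; []; _∷_; length; lookup; tabulate) renaming (map to mapᴸ)
open import Data.List.Properties using (length-map; length-tabulate)
open import Data.List.Membership.Propositional using (_∈_; lose) renaming (find to findᵐ)
open import Data.List.Membership.Propositional.Properties using (∈-map⁺; ∈-lookup)
import Data.List.Relation.Unary.All as All
open import Data.List.Relation.Unary.All using (All; []; _∷_)
import Data.List.Relation.Unary.All.Properties as Allₚ
open import Data.List.Relation.Unary.All.Properties using (¬All⇒Any¬)
import Data.List.Relation.Unary.AllPairs.Properties as AllPairsₚ
open import Data.List.Relation.Unary.AllPairs using (AllPairs; []; _∷_)
import Data.List.Relation.Unary.Any as Any
open import Data.List.Relation.Unary.Any using (here; there)
open import Data.Product using (Σ; ∃; _×_; _,_; proj₁; proj₂)
open import Data.Sum using (_⊎_; inj₁; inj₂; [_,_]′)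
open import Data.Empty using (⊥; ⊥-elim)
open import Function using (_∘_; case_of_)
open import Relation.Nullary using (¬_; Dec; yes; no; ¬?; _×-dec_; _⊎-dec_; _→-dec_)
open import Relation.Nullary.Decidable using (⌊_⌋; map′; decidable-stable)
open import Relation.Binary.Definitions using (tri<; tri≈; tri>)
open import Relation.Binary.PropositionalEquality using (_≡_; _≢_; refl; trans; cong; cong₂; subst; module ≡-Reasoning) renaming (sym to ≡-sym)

-- Let N be the number of members of a family of k-sets, p the size of its ground set and Z twice
-- the number of edges in it. Domination gives N p ≤ k N + Z W if every vertex lies in at most W
-- members; with N ≤ p W this yields N² = O(Z W²), so each unit of k costs a factor √Z. Starting
-- from 1-sets, which form a clique, this alone would give O(Z) for 3-sets and O(Z^(3/2)) for
-- 4-sets. The bound N ≤ p + 64 improves these to O(Z^(3/4)) and O(Z). The first makes vertices of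
-- degree at most r + 1 negligible in (3); the second starts the recursion of (2) at 4-sets and
-- leads to the exponent 2/(t-3). In (4) the constant counts: a single family of 4-sets has N ≤ (3/4
-- + o(1)) Z, the weighing gives 12 n + Z ≤ 2 e + 2 N + o(n), and with N ≤ n this becomes e ≥ (6 -
-- 1/3 - o(1)) n. A constant factor lost in N would destroy this, so the classes cannot simply be
-- added up there. The exponent 4/(t-r+2) of the upper bounds is a crude count: O(Q²) vertices span
-- at most O(Q⁴) edges, while n is about Q^k.

𝟙 : Bool → ℕ
𝟙 b = if b then 1 else 0

Bool-dichotomy : ∀ b → b ≡ true ⊎ b ≡ false
Bool-dichotomy true  = inj₁ refl
Bool-dichotomy false = inj₂ refl

t≢f : ∀ {b} → b ≡ true → b ≡ false → ⊥
t≢f refl ()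

¬t⇒f : ∀ {b} → ¬ (b ≡ true) → b ≡ false
¬t⇒f {true}  h = ⊥-elim (h refl)
¬t⇒f {false} h = refl

∧-intro : ∀ {a b} → a ≡ true → b ≡ true → a ∧ b ≡ true
∧-intro refl refl = refl

∧-fst : ∀ {a b} → a ∧ b ≡ true → a ≡ true
∧-fst {true} _ = refl

∧-snd : ∀ {a b} → a ∧ b ≡ true → b ≡ true
∧-snd {true} h = h

not-intro : ∀ {a} → a ≡ false → not a ≡ true
not-intro refl = refl

not-elim : ∀ {a} → not a ≡ true → a ≡ false
not-elim {false} _ = refl

∨-elim : ∀ {a b} → a ∨ b ≡ true → a ≡ true ⊎ b ≡ true
∨-elim {true}  _ = inj₁ refl
∨-elim {false} h = inj₂ h

∨-introˡ : ∀ {a b} → a ≡ true → a ∨ b ≡ true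
∨-introˡ refl = refl

∨-introʳ : ∀ {a b} → b ≡ true → a ∨ b ≡ true
∨-introʳ {true}  _ = refl
∨-introʳ {false} h = h

⌊⌋-intro : ∀ {P : Set} (d : Dec P) → P → ⌊ d ⌋ ≡ true
⌊⌋-intro (yes _) _ = refl
⌊⌋-intro (no ¬p) p = ⊥-elim (¬p p)

⌊⌋-elim : ∀ {P : Set} (d : Dec P) → ⌊ d ⌋ ≡ true → P
⌊⌋-elim (yes p) _ = p

⌊⌋-false : ∀ {P : Set} (d : Dec P) → ¬ P → ⌊ d ⌋ ≡ false
⌊⌋-false (yes p) ¬p = ⊥-elim (¬p p)
⌊⌋-false (no _) _ = refl

⌊⌋-refute : ∀ {P : Set} (d : Dec P) → ⌊ d ⌋ ≡ false → ¬ P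
⌊⌋-refute (no ¬p) _ = ¬p

-- Decidable subsets of `Fin n`, sums and counting.

Pred : ℕ → Set
Pred n = Fin n → Bool

infix 4 _∈ᵖ_ _⊆ᵖ_
infixr 6 _∩_

_∈ᵖ_ : ∀ {n} → Fin n → Pred n → Set
v ∈ᵖ F = F v ≡ true

_⊆ᵖ_ : ∀ {n} → Pred n → Pred n → Set
F ⊆ᵖ H = ∀ v → v ∈ᵖ F → v ∈ᵖ H

_∩_ : ∀ {n} → Pred n → Pred n → Pred n
(F ∩ H) v = F v ∧ H v

_except_ : ∀ {n} → Pred n → Fin n → Pred n
(U except a) y = U y ∧ not ⌊ y ≟ a ⌋

except-intro : ∀ {n} {U : Pred n} {a y} → y ∈ᵖ U → y ≢ a → y ∈ᵖ (U except a)
except-intro {a = a} {y} h y≢a = ∧-intro h (not-intro (⌊⌋-false (y ≟ a) y≢a))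

except-≢ : ∀ {n} {U : Pred n} {a y} → y ∈ᵖ (U except a) → y ≢ a
except-≢ {U = U} {a} {y} h = ⌊⌋-refute (y ≟ a) (not-elim (∧-snd {U y} h))

find : ∀ {n} (F : Pred n) → (∃ λ v → v ∈ᵖ F) ⊎ (∀ v → F v ≡ false)
find {zero} F = inj₂ λ ()
find {suc n} F with Bool-dichotomy (F fzero)
... | inj₁ h = inj₁ (fzero , h)
... | inj₂ h with find (F ∘ fsuc)
...   | inj₁ (v , hv) = inj₁ (fsuc v , hv)
...   | inj₂ g = inj₂ λ { fzero → h ; (fsuc v) → g v }

sum-cong : ∀ {n} {f g : Fin n → ℕ} → (∀ i → f i ≡ g i) → sumFin f ≡ sumFin g
sum-cong {zero} h = refl
sum-cong {suc n} h = cong₂ _+_ (h fzero) (sum-cong (h ∘ fsuc))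

sum-mono : ∀ {n} {f g : Fin n → ℕ} → (∀ i → f i ≤ g i) → sumFin f ≤ sumFin g
sum-mono {zero} h = z≤n
sum-mono {suc n} h = +-mono-≤ (h fzero) (sum-mono (h ∘ fsuc))

sum-+ : ∀ {n} (f g : Fin n → ℕ) → sumFin (λ i → f i + g i) ≡ sumFin f + sumFin g
sum-+ {zero} f g = refl
sum-+ {suc n} f g rewrite sum-+ (f ∘ fsuc) (g ∘ fsuc) = lem (f fzero) (g fzero) _ _
  where
  lem : ∀ a b c d → a + b + (c + d) ≡ a + c + (b + d)
  lem = solve-∀

sum-*ˡ : ∀ {n} c (f : Fin n → ℕ) → sumFin (λ i → c * f i) ≡ c * sumFin f
sum-*ˡ {zero} c f = ≡-sym (*-zeroʳ c)
sum-*ˡ {suc n} c f rewrite sum-*ˡ c (f ∘ fsuc) = ≡-sym (*-distribˡ-+ c (f fzero) _)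

sum-*ʳ : ∀ {n} (f : Fin n → ℕ) c → sumFin (λ i → f i * c) ≡ sumFin f * c
sum-*ʳ f c = trans (sum-cong (λ i → *-comm (f i) c)) (trans (sum-*ˡ c f) (*-comm c _))

sum-0 : ∀ {n} → sumFin {n} (λ _ → 0) ≡ 0
sum-0 {zero} = refl
sum-0 {suc n} = sum-0 {n}

sum-const : ∀ {n} c → sumFin {n} (λ _ → c) ≡ n * c
sum-const {zero} c = refl
sum-const {suc n} c = cong (c +_) (sum-const {n} c)

sum-swap : ∀ {n m} (f : Fin n → Fin m → ℕ) →
  sumFin (λ i → sumFin (f i)) ≡ sumFin (λ j → sumFin (λ i → f i j))
sum-swap {zero} {m} f = ≡-sym (sum-0 {m})
sum-swap {suc n} f rewrite sum-swap (f ∘ fsuc) =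
  ≡-sym (sum-+ (f fzero) (λ j → sumFin (λ i → f (fsuc i) j)))

sum-≥ : ∀ {n} (f : Fin n → ℕ) i → f i ≤ sumFin f
sum-≥ f fzero = m≤m+n _ _
sum-≥ f (fsuc i) = ≤-trans (sum-≥ (f ∘ fsuc) i) (m≤n+m _ _)

count≡sum : ∀ {n} (F : Pred n) → count F ≡ sumFin (𝟙 ∘ F)
count≡sum {zero} F = refl
count≡sum {suc n} F = cong (𝟙 (F fzero) +_) (count≡sum (F ∘ fsuc))

count-cong : ∀ {n} {F H : Pred n} → (∀ v → F v ≡ H v) → count F ≡ count H
count-cong {zero} h = refl
count-cong {suc n} h = cong₂ _+_ (cong 𝟙 (h fzero)) (count-cong (h ∘ fsuc))

𝟙-true : ∀ {b} → b ≡ true → 𝟙 b ≡ 1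
𝟙-true refl = refl

𝟙-false : ∀ {b} → b ≡ false → 𝟙 b ≡ 0
𝟙-false refl = refl

𝟙-∧ : ∀ a b → 𝟙 (a ∧ b) ≡ 𝟙 a * 𝟙 b
𝟙-∧ true  true  = refl
𝟙-∧ true  false = refl
𝟙-∧ false b = refl

𝟙-≤ : ∀ {b m} → (b ≡ true → 1 ≤ m) → 𝟙 b ≤ m
𝟙-≤ {true} h = h refl
𝟙-≤ {false} h = z≤n

count-mono : ∀ {n} {F H : Pred n} → F ⊆ᵖ H → count F ≤ count H
count-mono {F = F} {H} h rewrite count≡sum F | count≡sum H =
  sum-mono λ i → 𝟙-≤ λ e → ≤-reflexive (≡-sym (𝟙-true (h i e)))

count-none : ∀ {n} {F : Pred n} → (∀ v → F v ≡ false) → count F ≡ 0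
count-none {n} {F} h rewrite count≡sum F = trans (sum-cong (λ i → 𝟙-false (h i))) (sum-0 {n})

count-all : ∀ {n} {F : Pred n} → (∀ v → F v ≡ true) → count F ≡ n
count-all {n} {F} h rewrite count≡sum F =
  trans (sum-cong (λ i → 𝟙-true (h i))) (trans (sum-const {n} 1) (*-identityʳ n))

count-cover : ∀ {n} {F H K : Pred n} → (∀ v → v ∈ᵖ F → v ∈ᵖ H ⊎ v ∈ᵖ K) → count F ≤ count H + count K
count-cover {F = F} {H} {K} h rewrite count≡sum F | count≡sum H | count≡sum K
  | ≡-sym (sum-+ (𝟙 ∘ H) (𝟙 ∘ K)) = sum-mono λ i → 𝟙-≤ λ e → go i (h i e)
  where
  go : ∀ i → i ∈ᵖ H ⊎ i ∈ᵖ K → 1 ≤ 𝟙 (H i) + 𝟙 (K i)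
  go i (inj₁ p) rewrite p = s≤s z≤n
  go i (inj₂ p) rewrite p = m≤n+m 1 _

count-split : ∀ {n} (F H : Pred n) → count F ≡ count (F ∩ H) + count (F ∩ (not ∘ H))
count-split F H rewrite count≡sum F | count≡sum (F ∩ H) | count≡sum (F ∩ (not ∘ H))
  | ≡-sym (sum-+ (𝟙 ∘ (F ∩ H)) (𝟙 ∘ (F ∩ (not ∘ H)))) = sum-cong λ i → go (F i) (H i)
  where
  go : ∀ a b → 𝟙 a ≡ 𝟙 (a ∧ b) + 𝟙 (a ∧ not b)
  go true  true  = refl
  go true  false = refl
  go false b = refl

count-≥1 : ∀ {n} {F : Pred n} {v} → v ∈ᵖ F → 1 ≤ count F
count-≥1 {F = F} {v} h rewrite count≡sum F = ≤-trans (≤-reflexive (≡-sym (𝟙-true h))) (sum-≥ (𝟙 ∘ F) v)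

count-single : ∀ {n} (a : Fin n) → count (λ y → ⌊ y ≟ a ⌋) ≡ 1
count-single {suc n} fzero = cong suc (count-none {n} λ v → ⌊⌋-false (fsuc v ≟ fzero) λ ())
count-single {suc n} (fsuc a) = trans (count-cong eq) (count-single a)
  where
  eq : ∀ v → ⌊ fsuc v ≟ fsuc a ⌋ ≡ ⌊ v ≟ a ⌋
  eq v with v ≟ a
  ... | yes _ = refl
  ... | no _ = refl

count-except : ∀ {n} (F : Pred n) {a} → a ∈ᵖ F → count F ≡ suc (count (F except a))
count-except F {a} h = trans (count-split F (λ y → ⌊ y ≟ a ⌋)) (cong (_+ count (F except a))
   (trans (count-cong eq) (count-single a)))
  where
  eq : ∀ v → F v ∧ ⌊ v ≟ a ⌋ ≡ ⌊ v ≟ a ⌋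
  eq v with v ≟ a
  ... | yes refl rewrite h = refl
  ... | no _ with F v
  ...   | true = refl
  ...   | false = refl

count-≤1 : ∀ {n} {F : Pred n} → (∀ u v → u ∈ᵖ F → v ∈ᵖ F → u ≡ v) → count F ≤ 1
count-≤1 {F = F} h with find F
... | inj₂ g = ≤-trans (≤-reflexive (count-none g)) z≤n
... | inj₁ (a , ha) = ≤-trans (count-mono {H = λ y → ⌊ y ≟ a ⌋} λ v hv → ⌊⌋-intro (v ≟ a) (h v a hv ha))
                              (≤-reflexive (count-single a))

count-inhabited : ∀ {n} {F : Pred n} → 1 ≤ count F → ∃ λ v → v ∈ᵖ F
count-inhabited {F = F} h with find F
... | inj₁ p = p
... | inj₂ g = ⊥-elim (<-irrefl (≡-sym (count-none g)) h)

count-union : ∀ {n m} {F G₀ : Pred n} (H : Pred m) (K : Fin m → Pred n) →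
  (∀ y → y ∈ᵖ F → y ∈ᵖ G₀ ⊎ (∃ λ z → z ∈ᵖ H × y ∈ᵖ K z)) →
  count F ≤ count G₀ + sumFin (λ z → 𝟙 (H z) * count (K z))
count-union {F = F} {G₀} H K h = begin
  count F ≡⟨ count≡sum F ⟩
  sumFin (𝟙 ∘ F) ≤⟨ sum-mono (λ y → 𝟙-≤ λ e → go y (h y e)) ⟩
  sumFin (λ y → 𝟙 (G₀ y) + sumFin (λ z → 𝟙 (H z) * 𝟙 (K z y))) ≡⟨ sum-+ (𝟙 ∘ G₀) _ ⟩
  sumFin (𝟙 ∘ G₀) + sumFin (λ y → sumFin (λ z → 𝟙 (H z) * 𝟙 (K z y)))
    ≡⟨ cong₂ _+_ (≡-sym (count≡sum G₀)) (trans (sum-swap (λ y z → 𝟙 (H z) * 𝟙 (K z y))) (sum-cong λ z →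
        trans (sum-*ˡ (𝟙 (H z)) (𝟙 ∘ K z)) (cong (𝟙 (H z) *_) (≡-sym (count≡sum (K z)))))) ⟩
  count G₀ + sumFin (λ z → 𝟙 (H z) * count (K z)) ∎
  where
  open ≤-Reasoning
  go : ∀ y → y ∈ᵖ G₀ ⊎ (∃ λ z → z ∈ᵖ H × y ∈ᵖ K z) →
       1 ≤ 𝟙 (G₀ y) + sumFin (λ z → 𝟙 (H z) * 𝟙 (K z y))
  go y (inj₁ p) rewrite p = s≤s z≤n
  go y (inj₂ (z , hz , ky)) = ≤-trans
    (≤-trans (≤-reflexive (≡-sym (cong₂ _*_ (𝟙-true hz) (𝟙-true ky)))) (sum-≥ (λ z → 𝟙 (H z) * 𝟙 (K z y)) z))
    (m≤n+m _ _)

sum-≤-count* : ∀ {n} (H : Pred n) (g : Fin n → ℕ) B → (∀ z → z ∈ᵖ H → g z ≤ B) →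
  sumFin (λ z → 𝟙 (H z) * g z) ≤ count H * B
sum-≤-count* H g B h rewrite count≡sum H | ≡-sym (sum-*ʳ (𝟙 ∘ H) B) = sum-mono go
  where
  go : ∀ z → 𝟙 (H z) * g z ≤ 𝟙 (H z) * B
  go z with Bool-dichotomy (H z)
  ... | inj₁ e = *-monoʳ-≤ (𝟙 (H z)) (h z e)
  ... | inj₂ e rewrite e = z≤n

count-≤-cover : ∀ {n m} {F : Pred n} (H : Pred m) (K : Fin m → Pred n) B →
  (∀ z → z ∈ᵖ H → count (K z) ≤ B) → (∀ y → y ∈ᵖ F → ∃ λ z → z ∈ᵖ H × y ∈ᵖ K z) → count F ≤ count H * B
count-≤-cover {n = n} {F = F} H K B hB h = ≤-trans
  (count-union {F = F} {G₀ = λ _ → false} H K (λ y hy → inj₂ (h y hy)))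
  (subst (_≤ count H * B) (cong (_+ sumFin (λ z → 𝟙 (H z) * count (K z))) (≡-sym (count-none {n} {λ _ → false} λ _ → refl)))
    (sum-≤-count* H (count ∘ K) B hB))

double-count : ∀ {n m} (F : Pred n) (U : Pred m) (I : Fin n → Pred m) (g : Fin m → ℕ) →
  sumFin (λ v → 𝟙 (F v) * sumFin (λ a → 𝟙 (U a ∧ I v a) * g a)) ≡
  sumFin (λ a → 𝟙 (U a) * (count (λ v → F v ∧ I v a) * g a))
double-count F U I g = begin
  sumFin (λ v → 𝟙 (F v) * sumFin (λ a → 𝟙 (U a ∧ I v a) * g a))
    ≡⟨ sum-cong (λ v → ≡-sym (sum-*ˡ (𝟙 (F v)) (λ a → 𝟙 (U a ∧ I v a) * g a))) ⟩
  sumFin (λ v → sumFin (λ a → 𝟙 (F v) * (𝟙 (U a ∧ I v a) * g a)))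
    ≡⟨ sum-swap (λ v a → 𝟙 (F v) * (𝟙 (U a ∧ I v a) * g a)) ⟩
  sumFin (λ a → sumFin (λ v → 𝟙 (F v) * (𝟙 (U a ∧ I v a) * g a)))
    ≡⟨ sum-cong (λ a → trans (sum-cong (λ v → pt a v)) (sum-*ʳ (λ v → 𝟙 (F v ∧ I v a)) (𝟙 (U a) * g a))) ⟩
  sumFin (λ a → sumFin (λ v → 𝟙 (F v ∧ I v a)) * (𝟙 (U a) * g a))
    ≡⟨ sum-cong (λ a → trans (cong (_* (𝟙 (U a) * g a)) (≡-sym (count≡sum (λ v → F v ∧ I v a))))
                             (lem (count (λ v → F v ∧ I v a)) (𝟙 (U a)) (g a))) ⟩
  sumFin (λ a → 𝟙 (U a) * (count (λ v → F v ∧ I v a) * g a)) ∎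
  where
  open ≡-Reasoning
  lem : ∀ a b c → a * (b * c) ≡ b * (a * c)
  lem = solve-∀
  lem₂ : ∀ a b c d → a * (b * c * d) ≡ a * c * (b * d)
  lem₂ = solve-∀
  pt : ∀ a v → 𝟙 (F v) * (𝟙 (U a ∧ I v a) * g a) ≡ 𝟙 (F v ∧ I v a) * (𝟙 (U a) * g a)
  pt a v rewrite 𝟙-∧ (U a) (I v a) | 𝟙-∧ (F v) (I v a) = lem₂ (𝟙 (F v)) (𝟙 (U a)) (𝟙 (I v a)) (g a)

Constant : ∀ {n} → List (Pred n) → Pred n → Set
Constant ts F = All (λ t → ∀ u v → u ∈ᵖ F → v ∈ᵖ F → t u ≡ t v) ts

-- Halving `F` by one test after the other leaves at most 2 ^ length ts classes on which all tests
-- are constant.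
count-classes : ∀ {n} (ts : List (Pred n)) (F : Pred n) B →
  (∀ F′ → F′ ⊆ᵖ F → Constant ts F′ → count F′ ≤ B) → count F ≤ 2 ^ length ts * B
count-classes [] F B h = ≤-trans (h F (λ _ e → e) []) (≤-reflexive (≡-sym (+-identityʳ B)))
count-classes (t ∷ ts) F B h = begin
  count F ≡⟨ count-split F t ⟩
  count (F ∩ t) + count (F ∩ (not ∘ t)) ≤⟨ +-mono-≤
     (count-classes ts (F ∩ t) B λ F′ s c → h F′ (λ v e → ∧-fst (s v e))
        ((λ u v hu hv → trans (∧-snd {F u} (s u hu)) (≡-sym (∧-snd {F v} (s v hv)))) ∷ c))
     (count-classes ts (F ∩ (not ∘ t)) B λ F′ s c → h F′ (λ v e → ∧-fst (s v e))
        ((λ u v hu hv → trans (not-elim (∧-snd {F u} (s u hu))) (≡-sym (not-elim (∧-snd {F v} (s v hv))))) ∷ c)) ⟩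
  2 ^ length ts * B + 2 ^ length ts * B ≡⟨ lem (2 ^ length ts) B ⟩
  2 ^ length (t ∷ ts) * B ∎
  where
  open ≤-Reasoning
  lem : ∀ a b → a * b + a * b ≡ (a + (a + 0)) * b
  lem = solve-∀

elems : ∀ {n} → Pred n → List (Fin n)
elems {zero} F = []
elems {suc n} F = if F fzero then fzero ∷ mapᴸ fsuc (elems (F ∘ fsuc)) else mapᴸ fsuc (elems (F ∘ fsuc))

elems-length : ∀ {n} (F : Pred n) → length (elems F) ≡ count F
elems-length {zero} F = refl
elems-length {suc n} F with F fzero
... | true  = cong suc (trans (length-map fsuc (elems (F ∘ fsuc))) (elems-length (F ∘ fsuc)))
... | false = trans (length-map fsuc (elems (F ∘ fsuc))) (elems-length (F ∘ fsuc))

elems-∈ : ∀ {n} (F : Pred n) {v} → v ∈ᵖ F → v ∈ elems F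
elems-∈ {suc n} F {fzero} h rewrite h = here refl
elems-∈ {suc n} F {fsuc v} h with F fzero
... | true  = there (∈-map⁺ fsuc (elems-∈ (F ∘ fsuc) h))
... | false = ∈-map⁺ fsuc (elems-∈ (F ∘ fsuc) h)

≤-count : ∀ {m n} (F : Pred n) (g : Fin m → Fin n) → (∀ i j → g i ≡ g j → i ≡ j) → (∀ i → g i ∈ᵖ F) → m ≤ count F
≤-count {zero} F g inj h = z≤n
≤-count {suc m} F g inj h rewrite count-except F (h fzero) =
  s≤s (≤-count (F except g fzero) (g ∘ fsuc) (λ i j e → fsuc-injective (inj _ _ e))
    λ i → except-intro {U = F} (h (fsuc i)) (λ e → case inj _ _ e of λ ()))

count-≤ : ∀ {m n} {F : Pred n} (g : Fin m → Fin n) → (∀ v → v ∈ᵖ F → ∃ λ i → g i ≡ v) → count F ≤ m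
count-≤ {m} {F = F} g h = ≤-trans
  (count-≤-cover {F = F} (λ _ → true) (λ i v → ⌊ v ≟ g i ⌋) 1 (λ i _ → ≤-reflexive (count-single (g i)))
    λ v hv → let (i , e) = h v hv in i , refl , ⌊⌋-intro (v ≟ g i) (≡-sym e))
  (≤-reflexive (trans (*-identityʳ _) (count-all {m} λ _ → refl)))

count-≡⇒⊇ : ∀ {n} {F H : Pred n} → F ⊆ᵖ H → count H ≤ count F → H ⊆ᵖ F
count-≡⇒⊇ {F = F} {H} s le v hv with Bool-dichotomy (F v)
... | inj₁ e = e
... | inj₂ e = ⊥-elim (<-irrefl refl (≤-trans (≤-trans (s≤s (count-mono {F = F} {H except v}
        λ u hu → except-intro {U = H} (s u hu) λ { refl → t≢f hu e })) (≤-reflexive (≡-sym (count-except H hv)))) le))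

<ᵇ-true : ∀ {m n} → m < n → (m <ᵇ n) ≡ true
<ᵇ-true {zero} {suc n} _ = refl
<ᵇ-true {suc m} {suc n} (s≤s h) = <ᵇ-true h

<ᵇ-false : ∀ {m n} → n ≤ m → (m <ᵇ n) ≡ false
<ᵇ-false {m} {zero} _ = refl
<ᵇ-false {suc m} {suc n} (s≤s h) = <ᵇ-false h

-- Edges, cliques, and the clique behind a missing edge.

module _ {n : ℕ} (G : SimpleGraph n) where

  adj-sym : ∀ {u v b} → adj G u v ≡ b → adj G v u ≡ b
  adj-sym {u} {v} h = trans (sym G v u) h

  adj⇒≢ : ∀ {u v} → adj G u v ≡ true → u ≢ v
  adj⇒≢ {u} h refl = t≢f h (irrefl G u)

  handshake : sumFin (deg G) ≡ 2 * edges G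
  handshake = begin
    sumFin (deg G) ≡⟨ sum-cong (λ i → count≡sum (adj G i)) ⟩
    sumFin (λ i → sumFin (λ j → 𝟙 (adj G i j)))
      ≡⟨ sum-cong (λ i → trans (sum-cong (λ j → pt i j)) (sum-+ (λ j → up i j) (λ j → up j i))) ⟩
    sumFin (λ i → sumFin (λ j → up i j) + sumFin (λ j → up j i))
      ≡⟨ sum-+ (λ i → sumFin (λ j → up i j)) (λ i → sumFin (λ j → up j i)) ⟩
    sumFin (λ i → sumFin (λ j → up i j)) + sumFin (λ i → sumFin (λ j → up j i))
      ≡⟨ cong₂ _+_ (sum-cong (λ i → ≡-sym (count≡sum (λ j → adj G i j ∧ (toℕ i <ᵇ toℕ j)))))
          (trans (sum-swap (λ i j → up j i)) (sum-cong (λ i → ≡-sym (count≡sum (λ j → adj G i j ∧ (toℕ i <ᵇ toℕ j)))))) ⟩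
    edges G + edges G ≡⟨ cong (edges G +_) (≡-sym (+-identityʳ _)) ⟩
    2 * edges G ∎
    where
    open ≡-Reasoning
    up : Fin n → Fin n → ℕ
    up i j = 𝟙 (adj G i j ∧ (toℕ i <ᵇ toℕ j))
    pt : ∀ i j → 𝟙 (adj G i j) ≡ up i j + up j i
    pt i j rewrite sym G j i with <-cmp (toℕ i) (toℕ j)
    ... | tri< lt _ _ rewrite <ᵇ-true lt | <ᵇ-false (<⇒≤ lt) with adj G i j
    ...   | true = refl
    ...   | false = refl
    pt i j | tri> _ _ gt rewrite <ᵇ-true gt | <ᵇ-false (<⇒≤ gt) with adj G i j
    ...   | true = refl
    ...   | false = refl
    pt i j | tri≈ _ eq _ with toℕ-injective eq
    ... | refl rewrite irrefl G i = refl

  -- Twice the number of edges inside `U`, each being counted from both ends.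
  s₂ : Pred n → ℕ
  s₂ U = sumFin (λ z → 𝟙 (U z) * count (U ∩ adj G z))

  s₂-mono : ∀ {U U′} → U ⊆ᵖ U′ → s₂ U ≤ s₂ U′
  s₂-mono {U} {U′} h = sum-mono λ z → *-mono-≤ (𝟙-≤ λ e → ≤-reflexive (≡-sym (𝟙-true (h z e))))
    (count-mono {F = U ∩ adj G z} {U′ ∩ adj G z} λ y e → ∧-intro (h y (∧-fst e)) (∧-snd {U y} e))

  Clique : List (Fin n) → Set
  Clique = AllPairs (λ x y → adj G x y ≡ true)

  Clique-lookup : ∀ {xs} → Clique xs → ∀ i j → i ≢ j → adj G (lookup xs i) (lookup xs j) ≡ true
  Clique-lookup (h ∷ c) fzero fzero ne = ⊥-elim (ne refl)
  Clique-lookup (h ∷ c) fzero (fsuc j) ne = All.lookup h (∈-lookup j)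
  Clique-lookup (h ∷ c) (fsuc i) fzero ne = adj-sym (All.lookup h (∈-lookup i))
  Clique-lookup (h ∷ c) (fsuc i) (fsuc j) ne = Clique-lookup c i j (λ e → ne (cong fsuc e))

  Clique⇒HasClique : ∀ {r xs} → Clique xs → r ≤ length xs → HasClique r (adj G)
  Clique⇒HasClique {xs = xs} c le = (λ i → lookup xs (inject≤ i le)) ,
    λ i j ne → Clique-lookup c _ _ (λ e → ne (inject≤-injective le le i j e))

  addEdge-true : ∀ u v {x y} → addEdge (adj G) u v x y ≡ true →
    adj G x y ≡ true ⊎ (x ≡ u × y ≡ v) ⊎ (x ≡ v × y ≡ u)
  addEdge-true u v {x} {y} h with ∨-elim {adj G x y} h
  ... | inj₁ e = inj₁ e
  ... | inj₂ e with ∨-elim {⌊ x ≟ u ⌋ ∧ ⌊ y ≟ v ⌋} e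
  ...   | inj₁ e′ = inj₂ (inj₁ (⌊⌋-elim (x ≟ u) (∧-fst e′) , ⌊⌋-elim (y ≟ v) (∧-snd {⌊ x ≟ u ⌋} e′)))
  ...   | inj₂ e′ = inj₂ (inj₂ (⌊⌋-elim (x ≟ v) (∧-fst e′) , ⌊⌋-elim (y ≟ u) (∧-snd {⌊ x ≟ v ⌋} e′)))

  -- A clique created by the new edge must use both of its ends, since `G` itself has none of that
  -- size; the other `q` vertices are returned. The lower bounds use the edge-adding half of
  -- saturation only in this form.
  common-clique : ∀ {q u v} → Saturated (2 + q) G → u ≢ v → adj G u v ≡ false →
    ∃ λ xs → length xs ≡ q × Clique xs × All (λ z → adj G u z ≡ true × adj G v z ≡ true) xs
  common-clique {q} {u} {v} (free , sat) u≢v nadj with sat u v u≢v nadj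
  ... | f , hf with any? (λ i → f i ≟ u) | any? (λ i → f i ≟ v)
  ... | no ¬u | _ = ⊥-elim (free (f , λ i j ne → case addEdge-true u v (hf i j ne) of λ
        { (inj₁ e) → e ; (inj₂ (inj₁ (e , _))) → ⊥-elim (¬u (i , e)) ; (inj₂ (inj₂ (_ , e))) → ⊥-elim (¬u (j , e)) }))
  ... | yes _ | no ¬v = ⊥-elim (free (f , λ i j ne → case addEdge-true u v (hf i j ne) of λ
        { (inj₁ e) → e ; (inj₂ (inj₁ (_ , e))) → ⊥-elim (¬v (j , e)) ; (inj₂ (inj₂ (e , _))) → ⊥-elim (¬v (i , e)) }))
  ... | yes (i₀ , iu) | yes (j₀ , jv) = tabulate g , length-tabulate g ,
        AllPairsₚ.tabulate⁺ (λ {i} {j} ne → pairs i j ne) , Allₚ.tabulate⁺ nbrs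
    where
    i≢j : i₀ ≢ j₀
    i≢j refl = u≢v (trans (≡-sym iu) jv)
    ix : Fin q → Fin (2 + q)
    ix l = punchIn i₀ (punchIn (punchOut i≢j) l)
    g : Fin q → Fin n
    g = f ∘ ix
    ix≢i : ∀ l → ix l ≢ i₀
    ix≢i l = punchInᵢ≢i i₀ _
    ix≢j : ∀ l → ix l ≢ j₀
    ix≢j l e = punchInᵢ≢i (punchOut i≢j) l (punchIn-injective i₀ _ _ (trans e (≡-sym (punchIn-punchOut i≢j))))
    inj : ∀ {i j} → f i ≡ f j → i ≢ j → ⊥
    inj {i} {j} e ne with addEdge-true u v (hf i j ne)
    ... | inj₁ a = adj⇒≢ a e
    ... | inj₂ (inj₁ (a , b)) = u≢v (trans (≡-sym a) (trans e b))
    ... | inj₂ (inj₂ (a , b)) = u≢v (trans (≡-sym b) (trans (≡-sym e) a))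
    g≢u : ∀ l → g l ≢ u
    g≢u l e = inj (trans e (≡-sym iu)) (ix≢i l)
    g≢v : ∀ l → g l ≢ v
    g≢v l e = inj (trans e (≡-sym jv)) (ix≢j l)
    pairs : ∀ i j → i ≢ j → adj G (g i) (g j) ≡ true
    pairs i j ne with addEdge-true u v (hf (ix i) (ix j)
                        (λ e → ne (punchIn-injective _ _ _ (punchIn-injective i₀ _ _ e))))
    ... | inj₁ e = e
    ... | inj₂ (inj₁ (e , _)) = ⊥-elim (g≢u i e)
    ... | inj₂ (inj₂ (e , _)) = ⊥-elim (g≢v i e)
    nbrs : ∀ l → adj G u (g l) ≡ true × adj G v (g l) ≡ true
    nbrs l with addEdge-true u v (hf i₀ (ix l) (λ e → ix≢i l (≡-sym e)))
              | addEdge-true u v (hf j₀ (ix l) (λ e → ix≢j l (≡-sym e)))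
    ... | inj₁ a | inj₁ b = subst (λ z → adj G z (g l) ≡ true) iu a , subst (λ z → adj G z (g l) ≡ true) jv b
    ... | inj₂ (inj₁ (_ , e)) | _ = ⊥-elim (g≢v l e)
    ... | inj₂ (inj₂ (_ , e)) | _ = ⊥-elim (g≢u l e)
    ... | inj₁ _ | inj₂ (inj₁ (_ , e)) = ⊥-elim (g≢v l e)
    ... | inj₁ _ | inj₂ (inj₂ (_ , e)) = ⊥-elim (g≢u l e)

-- A skew version of Bollobás' set-pair inequality, with a weaker bound

-- The geometric sum 1 + b + ... + b ^ a.
skewBound : ℕ → ℕ → ℕ
skewBound b zero = 1
skewBound b (suc a) = 1 + b * skewBound b a

SetPair : ℕ → Set
SetPair n = Pred n × Pred n

-- Directed: under `AllPairs`, the second set of a pair meets the first set of every pair further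
-- down the list. As `grow` adds new pairs in front, each new `B` has to meet all former `A`.
Meets : ∀ {n} → SetPair n → SetPair n → Set
Meets (_ , B) (A , _) = ∃ λ z → z ∈ᵖ B × z ∈ᵖ A

Small : ∀ {n} → ℕ → ℕ → SetPair n → Set
Small a b (A , B) = (∀ z → z ∈ᵖ A → z ∈ᵖ B → ⊥) × count A ≤ a × count B ≤ b

through : ∀ {n} → Fin n → List (SetPair n) → List (SetPair n)
through z [] = []
through z ((A , B) ∷ h) = if A z then (A except z , B) ∷ through z h else through z h

through-length : ∀ {n} (z : Fin n) A B h → length (through z ((A , B) ∷ h)) ≡ 𝟙 (A z) + length (through z h)
through-length z A B h with A z
... | true = refl
... | false = refl

through-true : ∀ {n} (z : Fin n) A B h → z ∈ᵖ A → through z ((A , B) ∷ h) ≡ (A except z , B) ∷ through z h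
through-true z A B h e rewrite e = refl

through-total : ∀ {n} (X : Pred n) (h : List (SetPair n)) → All (Meets (X , X)) h →
  length h ≤ sumFin (λ z → 𝟙 (X z) * length (through z h))
through-total X [] [] = z≤n
through-total X ((A , B) ∷ h) ((z , Xz , Az) ∷ ms) = begin
  1 + length h ≤⟨ +-mono-≤ (≤-trans (≤-reflexive (≡-sym (cong₂ _*_ (𝟙-true Xz) (𝟙-true Az))))
                              (sum-≥ (λ y → 𝟙 (X y) * 𝟙 (A y)) z)) (through-total X h ms) ⟩
  sumFin (λ y → 𝟙 (X y) * 𝟙 (A y)) + sumFin (λ y → 𝟙 (X y) * length (through y h))
    ≡⟨ ≡-sym (sum-+ (λ y → 𝟙 (X y) * 𝟙 (A y)) (λ y → 𝟙 (X y) * length (through y h))) ⟩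
  sumFin (λ y → 𝟙 (X y) * 𝟙 (A y) + 𝟙 (X y) * length (through y h))
    ≡⟨ sum-cong (λ y → trans (≡-sym (*-distribˡ-+ (𝟙 (X y)) (𝟙 (A y)) (length (through y h)))) (cong (𝟙 (X y) *_) (≡-sym (through-length y A B h)))) ⟩
  sumFin (λ y → 𝟙 (X y) * length (through y ((A , B) ∷ h))) ∎
  where open ≤-Reasoning

through-small : ∀ {n} (z : Fin n) {a b} h → All (Small (suc a) b) h → All (Small a b) (through z h)
through-small z [] [] = []
through-small z ((A , B) ∷ h) ((d , ca , cb) ∷ s) with Bool-dichotomy (A z)
... | inj₂ e rewrite e = through-small z h s
... | inj₁ e = subst (All _) (≡-sym (through-true z A B h e))
      (((λ y p q → d y (∧-fst p) q) , ≤-pred (subst (_≤ _) (count-except A e) ca) , cb) ∷ through-small z h s)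

through-meets : ∀ {n} (z : Fin n) {B₀} {A₀} → ¬ (z ∈ᵖ B₀) → ∀ h →
  All (Meets (A₀ , B₀)) h → All (Meets (A₀ except z , B₀)) (through z h)
through-meets z nz [] [] = []
through-meets z {B₀} {A₀} nz ((A , B) ∷ h) ((y , p , q) ∷ m) with Bool-dichotomy (A z)
... | inj₂ e rewrite e = through-meets z {B₀} {A₀} nz h m
... | inj₁ e = subst (All _) (≡-sym (through-true z A B h e))
      ((y , p , except-intro {U = A} q (λ { refl → nz p })) ∷ through-meets z {B₀} {A₀} nz h m)

through-skew : ∀ {n} (z : Fin n) h → AllPairs Meets h → All (λ p → ∀ y → y ∈ᵖ proj₁ p → y ∈ᵖ proj₂ p → ⊥) h →
  AllPairs Meets (through z h)
through-skew z [] [] [] = []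
through-skew z ((A , B) ∷ h) (m ∷ s) (d ∷ ds) with Bool-dichotomy (A z)
... | inj₂ e rewrite e = through-skew z h s ds
... | inj₁ e = subst (AllPairs _) (≡-sym (through-true z A B h e))
      (through-meets z {B} {A} (d z e) h m ∷ through-skew z h s ds)

-- Every other `A` meets the `B` of the head in one of at most `b` points z. The pairs with z in
-- `A`, with z deleted there, are again skew: z is not in their own `B`, so no intersection that is
-- relied on gets lost. Their sets `A` are smaller by one, so induction on `a` applies to each z.
skew-bound : ∀ {n} a b (h : List (SetPair n)) → AllPairs Meets h → All (Small a b) h → length h ≤ skewBound b a
skew-bound a b [] _ _ = z≤n
skew-bound zero b (_ ∷ []) _ _ = ≤-refl
skew-bound zero b (_ ∷ (A , B) ∷ h) (((z , _ , Az) ∷ _) ∷ _) (_ ∷ (_ , ca , _) ∷ _) =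
  ⊥-elim (<-irrefl refl (≤-trans (count-≥1 {F = A} Az) ca))
skew-bound (suc a) b ((A , B) ∷ h) (m ∷ s) ((_ , _ , cb) ∷ sm) = s≤s (begin
  length h ≤⟨ through-total B h (All.map (λ x → x) m) ⟩
  sumFin (λ z → 𝟙 (B z) * length (through z h)) ≤⟨ sum-≤-count* B (λ z → length (through z h)) (skewBound b a)
     (λ z _ → skew-bound a b (through z h) (through-skew z h s (All.map proj₁ sm)) (through-small z h sm)) ⟩
  count B * skewBound b a ≤⟨ *-monoˡ-≤ (skewBound b a) cb ⟩
  b * skewBound b a ∎)
  where open ≤-Reasoning

-- The bounded core

-- Kept abstract because 2 ^ coreSize C D must never be evaluated for numerals C and D.
abstract
  coreSize : ℕ → ℕ → ℕ
  coreSize C D = suc (suc (skewBound C (suc D))) * suc D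

  coreSize-≥ : ∀ C D → suc (suc (skewBound C (suc D))) * suc D ≤ coreSize C D
  coreSize-≥ C D = ≤-refl

module _ {n : ℕ} (G : SimpleGraph n) where

  degIn : Pred n → Fin n → ℕ
  degIn R v = count (R ∩ adj G v)

  N[_] : Fin n → Pred n
  N[ y ] z = adj G y z ∨ ⌊ z ≟ y ⌋

  count-N[] : ∀ y → count N[ y ] ≤ suc (deg G y)
  count-N[] y = ≤-trans (count-cover {F = N[ y ]} {adj G y} {λ z → ⌊ z ≟ y ⌋} λ v h → ∨-elim {adj G y v} h)
    (≤-reflexive (trans (cong (deg G y +_) (count-single y)) (+-comm _ 1)))

  -- R is made stable by adding N[ y ] while some edge u y violates stability; the pairs B = N(u) ∩ R,
  -- N[ y ] ∖ B met on the way form a skew system, which bounds the number of steps.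
  Stable : (C D : ℕ) → Pred n → Set
  Stable C D R = ∀ u y → adj G u y ≡ true → R u ≡ false → R y ≡ false → deg G y ≤ D → C ≤ degIn R u

  private
    Bad : (C D : ℕ) (R : Pred n) → Fin n → Fin n → Set
    Bad C D R u y = adj G u y ≡ true × R u ≡ false × R y ≡ false × deg G y ≤ D × degIn R u < C

    bad? : ∀ C D R u y → Dec (Bad C D R u y)
    bad? C D R u y = (adj G u y ≟ᵇ true) ×-dec (R u ≟ᵇ false) ×-dec
      (R y ≟ᵇ false) ×-dec (deg G y ≤? D) ×-dec (degIn R u <? C)

    -- The invariant that makes the system skew: a later bad `u` lies outside `R`, hence has a
    -- neighbour in A ∩ R, and so its set N(u) ∩ R meets `A`.
    Hits : Pred n → SetPair n → Set
    Hits R (A , _) = ∀ u → R u ≡ false → ∃ λ z → z ∈ᵖ A × adj G u z ≡ true × z ∈ᵖ R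

    module Step {q : ℕ} (sat : Saturated (2 + q) G) (C D : ℕ) (R : Pred n) {u y : Fin n} (bad : Bad C D R u y) where
      uy = proj₁ bad
      Ru = proj₁ (proj₂ bad)
      Ry = proj₁ (proj₂ (proj₂ bad))

      R⁺ B A : Pred n
      R⁺ z = R z ∨ N[ y ] z
      B = R ∩ adj G u
      A z = N[ y ] z ∧ not (B z)

      R⊆ : R ⊆ᵖ R⁺
      R⊆ v h = ∨-introˡ h

      small : Small (suc D) C (A , B)
      small = (λ z p p′ → t≢f p′ (not-elim (∧-snd {N[ y ] z} p))) ,
        ≤-trans (count-mono {F = A} {N[ y ]} λ v h → ∧-fst h)
          (≤-trans (count-N[] y) (s≤s (proj₁ (proj₂ (proj₂ (proj₂ bad)))))) ,
        <⇒≤ (proj₂ (proj₂ (proj₂ (proj₂ bad))))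

      count-R⁺ : count R⁺ ≤ suc D + count R
      count-R⁺ = ≤-trans (count-cover {F = R⁺} {R} {N[ y ]} λ v h → ∨-elim {R v} h)
        (≤-trans (+-monoʳ-≤ (count R) (≤-trans (count-N[] y) (s≤s (proj₁ (proj₂ (proj₂ (proj₂ bad))))))) (≤-reflexive (+-comm (count R) _)))

      outside : ∀ xs → Clique G xs → length xs ≡ q → All (λ z → adj G y z ≡ true) xs →
        (∀ z → z ∈ xs → z ∈ᵖ B) ⊎ (∃ λ z → z ∈ xs × B z ≡ false)
      outside xs _ _ _ with All.all? (λ z → B z ≟ᵇ true) xs
      ... | yes a = inj₁ λ z m → All.lookup a m
      ... | no ¬a with ¬All⇒Any¬ (λ z → B z ≟ᵇ true) xs ¬a
      ...   | an with findᵐ an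
      ...     | z , m , nz = inj₂ (z , m , ¬t⇒f nz)

      -- A neighbour `w` of `y` hits `A` in `y`. Otherwise `w` and `y` share a q-clique inside N(y).
      -- If it had no vertex in `A`, it would lie in `B`, thus in N(u), and together with `u` and
      -- `y` it would be a forbidden clique.
      hits : Hits R⁺ (A , B)
      hits w Rw with Bool-dichotomy (adj G w y)
      ... | inj₁ wy = y , ∧-intro yN (not-intro yB) , wy , ∨-introʳ {R y} yN
        where
        yN : y ∈ᵖ N[ y ]
        yN = ∨-introʳ {adj G y y} (⌊⌋-intro (y ≟ y) refl)
        yB : B y ≡ false
        yB rewrite Ry = refl
      ... | inj₂ wy with common-clique G sat (λ { refl → t≢f (∨-introʳ {R y} (∨-introʳ {adj G y y} (⌊⌋-intro (y ≟ y) refl))) Rw }) wy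
      ...   | xs , len , cl , nb with outside xs cl len (All.map proj₂ nb)
      ...     | inj₂ (z , m , Bz) = z , ∧-intro zN (not-intro Bz) , proj₁ (All.lookup nb m) , ∨-introʳ {R z} zN
        where
        zN : z ∈ᵖ N[ y ]
        zN = ∨-introˡ (proj₂ (All.lookup nb m))
      ...     | inj₁ inB = ⊥-elim (proj₁ sat (Clique⇒HasClique G
                 ((uy ∷ All.tabulate (λ {z} m → ∧-snd {R z} (inB z m))) ∷ All.map proj₂ nb ∷ cl)
                 (≤-reflexive (cong (suc ∘ suc) (≡-sym len)))))

    -- `f` counts the remaining steps; `f + length h` is always one more than `skew-bound` permits,
    -- so `f` cannot run out.
    grow : ∀ {q} → Saturated (2 + q) G → ∀ C D f R (h : List (SetPair n)) →
      AllPairs Meets h → All (Small (suc D) C) h → All (Hits R) h → f + length h ≡ suc (skewBound C (suc D)) →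
      ∃ λ R′ → R ⊆ᵖ R′ × count R′ ≤ f * suc D + count R × Stable C D R′
    grow sat C D zero R h sk sm hi len =
      ⊥-elim (<-irrefl refl (≤-trans (≤-reflexive (≡-sym len)) (skew-bound (suc D) C h sk sm)))
    grow sat C D (suc f) R h sk sm hi len with any? (λ u → any? (bad? C D R u))
    ... | no ¬b = R , (λ _ e → e) , m≤n+m _ _ , λ u y a b c d → ≮⇒≥ λ lt → ¬b (u , y , a , b , c , d , lt)
    ... | yes (u , y , bad) with grow sat C D f R⁺ ((A , B) ∷ h)
            (All.map {P = Hits R} (λ {p} hp → let (z , a , b , c) = hp u Ru in z , ∧-intro c b , a) hi ∷ sk) (small ∷ sm)
            (hits ∷ All.map {P = Hits R} (λ {p} hp w nw → let (z , a , b , c) = hp w (¬t⇒f λ e → t≢f (R⊆ w e) nw)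
                                               in z , a , b , R⊆ z c) hi)
            (trans (+-suc f _) len)
      where open Step sat C D R bad
    ...   | R′ , s , c , st = R′ , (λ v e → s v (R⊆ v e)) ,
            ≤-trans c (≤-trans (+-monoʳ-≤ (f * suc D) count-R⁺) (≤-reflexive (lem (f * suc D) (suc D) (count R)))) , st
      where
      open Step sat C D R bad
      lem : ∀ a b c → a + (b + c) ≡ b + a + c
      lem = solve-∀

  -- Each step adds at most `suc D` vertices and there are `suc (skewBound C (suc D))` steps
  -- available; the start set counts as one more batch, whence the second `suc` in `coreSize`.
  stable-core : ∀ {q} → Saturated (2 + q) G → ∀ C D R₀ → count R₀ ≤ suc D →
    ∃ λ R → R₀ ⊆ᵖ R × count R ≤ coreSize C D × Stable C D R
  stable-core sat C D R₀ c₀ with grow sat C D (suc (skewBound C (suc D))) R₀ [] [] [] [] (+-identityʳ _)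
  ... | R , s , c , st = R , s , ≤-trans c (≤-trans (+-monoʳ-≤ _ c₀) (≤-trans (≤-reflexive (+-comm (suc (skewBound C (suc D)) * suc D) (suc D))) (coreSize-≥ C D))) , st

-- The partition into R, L, P and Q and the weighing of edges.

data Cls : Bool → Bool → Bool → Bool → Set where
  inR : Cls true false false false
  inL : Cls false true false false
  inP : Cls false false true false
  inQ : Cls false false false true

module _ {n : ℕ} (G : SimpleGraph n) where

  -- `Q` collects the vertices with degree above 3 C and fewer than C neighbours in `R`, which
  -- leaves at least 2 C neighbours outside `R`. Even half of each of these edges gives a vertex of
  -- `Q` the same weight as the C full edges from a vertex of `P` to `R`.
  record Core (q C : ℕ) : Set where
    field
      R L P Q  : Pred n
      cls      : ∀ v → Cls (R v) (L v) (P v) (Q v)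
      R-small  : count R ≤ coreSize C (3 * C)
      P-deg    : ∀ v → v ∈ᵖ P → C ≤ degIn G R v
      Q-deg    : ∀ v → v ∈ᵖ Q → 2 * C ≤ degIn G (not ∘ R) v
      L-nbr    : ∀ v y → v ∈ᵖ L → adj G v y ≡ true → y ∈ᵖ R ⊎ y ∈ᵖ P
      L-clique : ∀ v → v ∈ᵖ L → ∃ λ xs → length xs ≡ q × Clique G xs × All (λ z → z ∈ᵖ R × adj G v z ≡ true) xs

  core : ∀ {q} → Saturated (2 + q) G → ∀ C → Core q C
  core {q} sat C = build start
    where
    D : ℕ
    D = 3 * C
    Start : Pred n → Set
    Start R₀ = count R₀ ≤ suc D × (∀ v → R₀ v ≡ false → deg G v ≤ D →
      ∃ λ xs → length xs ≡ q × Clique G xs × All (λ z → z ∈ᵖ R₀ × adj G v z ≡ true) xs)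
    start : ∃ Start
    -- A low-degree vertex outside N[v₀] shares a q-clique with v₀, and this clique lies in N[v₀];
    -- starting from N[v₀] thus yields `L-clique`. If no degree is at most D, the condition is
    -- vacuous.
    start with any? (λ v → deg G v ≤? D)
    ... | no ¬v = (λ _ → false) , ≤-trans (≤-reflexive (count-none {n} λ _ → refl)) z≤n , λ v _ d → ⊥-elim (¬v (v , d))
    ... | yes (v₀ , d₀) = N[_] G v₀ , ≤-trans (count-N[] G v₀) (s≤s d₀) , λ v out _ →
          let (xs , len , cl , nb) = common-clique G sat
                 (λ { refl → t≢f (∨-introʳ {adj G v v} (⌊⌋-intro (v ≟ v) refl)) out })
                 (¬t⇒f λ e → t≢f (∨-introˡ (adj-sym G e)) out)
          in xs , len , cl , All.map (λ { (a , b) → ∨-introˡ b , a }) nb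
    build : ∃ Start → Core q C
    build (R₀ , c₀ , hq) with stable-core G sat C D R₀ c₀
    ... | R , s , c , st = record
      { R = R ; L = L ; P = P ; Q = Q ; cls = cls ; R-small = c
      ; P-deg = λ v h → ⌊⌋-elim (C ≤? degIn G R v) (∧-snd {not (R v)} h)
      ; Q-deg = Q-deg
      ; L-nbr = L-nbr
      ; L-clique = λ v h → let (xs , len , cl , nb) = hq v (¬t⇒f λ e → t≢f (s v e) (not-elim (∧-fst h)))
                                   (⌊⌋-elim (deg G v ≤? D) (∧-snd {not ⌊ C ≤? degIn G R v ⌋} (∧-snd {not (R v)} h)))
                           in xs , len , cl , All.map (λ { (a , b) → s _ a , b }) nb }
      where
      L P Q : Pred n
      P v = not (R v) ∧ ⌊ C ≤? degIn G R v ⌋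
      L v = not (R v) ∧ (not ⌊ C ≤? degIn G R v ⌋ ∧ ⌊ deg G v ≤? D ⌋)
      Q v = not (R v) ∧ (not ⌊ C ≤? degIn G R v ⌋ ∧ not ⌊ deg G v ≤? D ⌋)
      cls : ∀ v → Cls (R v) (L v) (P v) (Q v)
      cls v with R v | ⌊ C ≤? degIn G R v ⌋ | ⌊ deg G v ≤? D ⌋
      ... | true  | _     | _     = inR
      ... | false | true  | _     = inP
      ... | false | false | true  = inL
      ... | false | false | false = inQ
      Q-deg : ∀ v → v ∈ᵖ Q → 2 * C ≤ degIn G (not ∘ R) v
      Q-deg v h = +-cancelˡ-≤ C (2 * C) _ (≤-trans (<⇒≤ (≰⇒> (⌊⌋-refute (deg G v ≤? D) (not-elim (∧-snd {not ⌊ C ≤? degIn G R v ⌋} h′)))))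
        (≤-trans (≤-reflexive (trans (count-split (adj G v) R) (cong₂ _+_ (count-cong λ y → ∧-comm (adj G v y) (R y)) (count-cong λ y → ∧-comm (adj G v y) (not (R y))))))
          (+-monoˡ-≤ _ (<⇒≤ (≰⇒> (⌊⌋-refute (C ≤? degIn G R v) (not-elim (∧-fst {not ⌊ C ≤? degIn G R v ⌋} h′))))))))
        where
        h′ = ∧-snd {not (R v)} h
      L-nbr : ∀ v y → v ∈ᵖ L → adj G v y ≡ true → y ∈ᵖ R ⊎ y ∈ᵖ P
      L-nbr v y h a with Bool-dichotomy (R y)
      ... | inj₁ e = inj₁ e
      ... | inj₂ e = inj₂ (∧-intro (not-intro e) (⌊⌋-intro (C ≤? degIn G R y)
              (st y v (adj-sym G a) e (not-elim (∧-fst h)) (⌊⌋-elim (deg G v ≤? D) (∧-snd {not ⌊ C ≤? degIn G R v ⌋} (∧-snd {not (R v)} h))))))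

  weighted-edges : (w : Fin n → Fin n → ℕ) → (∀ i j → adj G i j ≡ true → w i j + w j i ≤ 2) →
    sumFin (λ i → sumFin (λ j → 𝟙 (adj G i j) * w i j)) ≤ 2 * edges G
  weighted-edges w h = *-cancelˡ-≤ 2 (begin
    2 * S ≡⟨ cong (S +_) (+-identityʳ S) ⟩
    S + S ≡⟨ cong (S +_) (trans (sum-swap (λ i j → 𝟙 (adj G i j) * w i j))
               (sum-cong λ i → sum-cong λ j → cong (λ b → 𝟙 b * w j i) (sym G j i))) ⟩
    S + sumFin (λ i → sumFin (λ j → 𝟙 (adj G i j) * w j i))
      ≡⟨ trans (≡-sym (sum-+ (λ i → sumFin (λ j → 𝟙 (adj G i j) * w i j)) (λ i → sumFin (λ j → 𝟙 (adj G i j) * w j i))))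
           (sum-cong λ i → ≡-sym (sum-+ (λ j → 𝟙 (adj G i j) * w i j) (λ j → 𝟙 (adj G i j) * w j i))) ⟩
    sumFin (λ i → sumFin (λ j → 𝟙 (adj G i j) * w i j + 𝟙 (adj G i j) * w j i))
      ≤⟨ sum-mono (λ i → sum-mono λ j → pt i j) ⟩
    sumFin (λ i → sumFin (λ j → 2 * 𝟙 (adj G i j)))
      ≡⟨ trans (sum-cong λ i → trans (sum-*ˡ 2 (λ j → 𝟙 (adj G i j))) (cong (2 *_) (≡-sym (count≡sum (adj G i))))) (sum-*ˡ 2 (deg G)) ⟩
    2 * sumFin (deg G) ≡⟨ cong (2 *_) (handshake G) ⟩
    2 * (2 * edges G) ∎)
    where
    open ≤-Reasoning
    S = sumFin (λ i → sumFin (λ j → 𝟙 (adj G i j) * w i j))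
    pt : ∀ i j → 𝟙 (adj G i j) * w i j + 𝟙 (adj G i j) * w j i ≤ 2 * 𝟙 (adj G i j)
    pt i j with Bool-dichotomy (adj G i j)
    ... | inj₂ e rewrite e = z≤n
    ... | inj₁ e = subst (_≤ 2 * 𝟙 (adj G i j)) (*-distribˡ-+ (𝟙 (adj G i j)) (w i j) (w j i))
          (≤-trans (*-monoʳ-≤ (𝟙 (adj G i j)) (h i j e)) (≤-reflexive (*-comm (𝟙 (adj G i j)) 2)))

  private
    -- The share that a vertex receives of the two units on an edge: both go to an end in L, and to
    -- an end in P if the other end is in R; inside P they are split evenly; an end in Q gets one
    -- unit if the other end is outside R. `L-nbr` excludes edges inside L and between L and Q,
    -- where the shares would exceed two.
    W : (l p q r′ p′ : Bool) → ℕ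
    W l p q r′ p′ = 2 * 𝟙 l + 2 * 𝟙 p * 𝟙 r′ + 𝟙 p * 𝟙 p′ + 𝟙 q * 𝟙 (not r′)

    W-pair : ∀ {r l p q r′ l′ p′ q′} → Cls r l p q → Cls r′ l′ p′ q′ →
      (l ≡ true → r′ ≡ true ⊎ p′ ≡ true) → (l′ ≡ true → r ≡ true ⊎ p ≡ true) → W l p q r′ p′ + W l′ p′ q′ r p ≤ 2
    W-pair inR inR _ _ = z≤n
    W-pair inR inL _ _ = ≤-refl
    W-pair inR inP _ _ = ≤-refl
    W-pair inR inQ _ _ = z≤n
    W-pair inL inR _ _ = ≤-refl
    W-pair inL inL h _ with h refl
    ... | inj₁ ()
    ... | inj₂ ()
    W-pair inL inP _ _ = ≤-refl
    W-pair inL inQ h _ with h refl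
    ... | inj₁ ()
    ... | inj₂ ()
    W-pair inP inR _ _ = ≤-refl
    W-pair inP inL _ _ = ≤-refl
    W-pair inP inP _ _ = ≤-refl
    W-pair inP inQ _ _ = s≤s z≤n
    W-pair inQ inR _ _ = z≤n
    W-pair inQ inL _ h with h refl
    ... | inj₁ ()
    ... | inj₂ ()
    W-pair inQ inP _ _ = s≤s z≤n
    W-pair inQ inQ _ _ = ≤-refl

  module _ {q C} (K : Core q C) where
    open Core K

    -- Adds up the shares `W` vertex by vertex. Keeping the term `s₂ G P` is essential: it makes the
    -- edges inside P, which bound the families of sets, compete with the edges counted for L.
    core-weight : 2 * sumFin (λ v → 𝟙 (L v) * deg G v) + 2 * C * (count P + count Q) + s₂ G P ≤ 2 * edges G
    core-weight = begin
      2 * sumFin (λ v → 𝟙 (L v) * deg G v) + 2 * C * (count P + count Q) + s₂ G P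
        ≡⟨ cong (_+ s₂ G P) (cong₂ _+_ (≡-sym (sum-*ˡ 2 (λ v → 𝟙 (L v) * deg G v)))
             (trans (*-distribˡ-+ (2 * C) (count P) (count Q)) (cong₂ _+_
               (trans (cong (2 * C *_) (count≡sum P)) (≡-sym (sum-*ˡ (2 * C) (𝟙 ∘ P))))
               (trans (cong (2 * C *_) (count≡sum Q)) (≡-sym (sum-*ˡ (2 * C) (𝟙 ∘ Q))))))) ⟩
      sumFin a + (sumFin b + sumFin c) + sumFin d
        ≡⟨ cong (_+ sumFin d) (trans (cong (sumFin a +_) (≡-sym (sum-+ b c))) (≡-sym (sum-+ a (λ i → b i + c i)))) ⟩
      sumFin (λ i → a i + (b i + c i)) + sumFin d ≡⟨ ≡-sym (sum-+ (λ i → a i + (b i + c i)) d) ⟩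
      sumFin (λ i → a i + (b i + c i) + d i) ≤⟨ sum-mono row ⟩
      sumFin (λ i → sumFin (λ j → 𝟙 (adj G i j) * w i j))
        ≤⟨ weighted-edges w (λ i j e → W-pair (cls i) (cls j) (λ l → L-nbr i j l e) (λ l → L-nbr j i l (adj-sym G e))) ⟩
      2 * edges G ∎
      where
      open ≤-Reasoning
      a b c d : Fin n → ℕ
      a v = 2 * (𝟙 (L v) * deg G v)
      b v = 2 * C * 𝟙 (P v)
      c v = 2 * C * 𝟙 (Q v)
      d v = 𝟙 (P v) * count (P ∩ adj G v)
      w : Fin n → Fin n → ℕ
      w i j = W (L i) (P i) (Q i) (R j) (P j)
      col : ∀ i (X : Pred n) → sumFin (λ j → 𝟙 (adj G i j) * 𝟙 (X j)) ≡ count (X ∩ adj G i)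
      col i X = trans (sum-cong λ j → trans (*-comm (𝟙 (adj G i j)) (𝟙 (X j))) (≡-sym (𝟙-∧ (X j) (adj G i j)))) (≡-sym (count≡sum (X ∩ adj G i)))
      expand : ∀ x l p q r pp nr → x * (2 * l + 2 * p * r + p * pp + q * nr) ≡ (2 * l) * x + ((2 * p) * (x * r) + (p * (x * pp) + q * (x * nr)))
      expand = solve-∀
      rowsum : ∀ i → sumFin (λ j → 𝟙 (adj G i j) * w i j) ≡
        (2 * 𝟙 (L i)) * deg G i + ((2 * 𝟙 (P i)) * degIn G R i + (𝟙 (P i) * degIn G P i + 𝟙 (Q i) * degIn G (not ∘ R) i))
      rowsum i = trans (sum-cong λ j → expand (𝟙 (adj G i j)) (𝟙 (L i)) (𝟙 (P i)) (𝟙 (Q i)) (𝟙 (R j)) (𝟙 (P j)) (𝟙 (not (R j))))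
        (trans (sum-+ (λ j → (2 * 𝟙 (L i)) * 𝟙 (adj G i j)) _) (cong₂ _+_
          (trans (sum-*ˡ (2 * 𝟙 (L i)) (λ j → 𝟙 (adj G i j))) (cong (2 * 𝟙 (L i) *_) (≡-sym (count≡sum (adj G i)))))
          (trans (sum-+ (λ j → (2 * 𝟙 (P i)) * (𝟙 (adj G i j) * 𝟙 (R j))) _) (cong₂ _+_
            (trans (sum-*ˡ (2 * 𝟙 (P i)) (λ j → 𝟙 (adj G i j) * 𝟙 (R j))) (cong (2 * 𝟙 (P i) *_) (col i R)))
            (trans (sum-+ (λ j → 𝟙 (P i) * (𝟙 (adj G i j) * 𝟙 (P j))) _) (cong₂ _+_
              (trans (sum-*ˡ (𝟙 (P i)) (λ j → 𝟙 (adj G i j) * 𝟙 (P j))) (cong (𝟙 (P i) *_) (col i P)))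
              (trans (sum-*ˡ (𝟙 (Q i)) (λ j → 𝟙 (adj G i j) * 𝟙 (not (R j)))) (cong (𝟙 (Q i) *_) (col i (not ∘ R))))))))))
      le-𝟙 : ∀ f m k → (f ≡ true → m ≤ k) → m * 𝟙 f ≤ 𝟙 f * k
      le-𝟙 true m k h = ≤-trans (≤-reflexive (*-comm m 1)) (*-monoʳ-≤ 1 (h refl))
      le-𝟙 false m k h = ≤-reflexive (*-zeroʳ m)
      row : ∀ i → a i + (b i + c i) + d i ≤ sumFin (λ j → 𝟙 (adj G i j) * w i j)
      row i = begin
        a i + (b i + c i) + d i ≤⟨ +-monoˡ-≤ (d i) (+-mono-≤ (≤-reflexive (≡-sym (*-assoc 2 (𝟙 (L i)) (deg G i))))
            (+-mono-≤ (≤-trans (≤-reflexive (*-assoc 2 C (𝟙 (P i)))) (≤-trans (*-monoʳ-≤ 2 (le-𝟙 (P i) C (degIn G R i) (P-deg i)))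
                        (≤-reflexive (≡-sym (*-assoc 2 (𝟙 (P i)) (degIn G R i))))))
                      (le-𝟙 (Q i) (2 * C) (degIn G (not ∘ R) i) (Q-deg i)))) ⟩
        (2 * 𝟙 (L i)) * deg G i + ((2 * 𝟙 (P i)) * degIn G R i + 𝟙 (Q i) * degIn G (not ∘ R) i) + 𝟙 (P i) * degIn G P i
          ≡⟨ re ((2 * 𝟙 (L i)) * deg G i) ((2 * 𝟙 (P i)) * degIn G R i) (𝟙 (Q i) * degIn G (not ∘ R) i) (𝟙 (P i) * degIn G P i) ⟩
        _ ≡⟨ ≡-sym (rowsum i) ⟩
        _ ∎
        where
        re : ∀ x y z t → x + (y + z) + t ≡ x + (y + (t + z))
        re = solve-∀

-- Integer roots

rootBelow : (k Y x : ℕ) → ℕ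
rootBelow k Y zero = 0
rootBelow k Y (suc x) with suc x ^ suc k ≤? Y
... | yes _ = suc x
... | no _  = rootBelow k Y x

-- The integer part of the root of order `suc k`: `root 1` is the square root and `root 3` the
-- fourth root.
root : ℕ → ℕ → ℕ
root k Y = rootBelow k Y Y

rootBelow-^ : ∀ k Y x → rootBelow k Y x ^ suc k ≤ Y
rootBelow-^ k Y zero = z≤n
rootBelow-^ k Y (suc x) with suc x ^ suc k ≤? Y
... | yes h = h
... | no _  = rootBelow-^ k Y x

rootBelow-max : ∀ k Y x y → y ≤ x → y ^ suc k ≤ Y → y ≤ rootBelow k Y x
rootBelow-max k Y zero y le _ = le
rootBelow-max k Y (suc x) y le h with suc x ^ suc k ≤? Y
... | yes _ = le
... | no ¬h with m≤n⇒m<n∨m≡n le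
...   | inj₁ (s≤s lt) = rootBelow-max k Y x y lt h
...   | inj₂ refl = ⊥-elim (¬h h)

root-^ : ∀ k Y → root k Y ^ suc k ≤ Y
root-^ k Y = rootBelow-^ k Y Y

m≤m^suc : ∀ m k → m ≤ m ^ suc k
m≤m^suc zero k = z≤n
m≤m^suc (suc m) k = ≤-trans (≤-reflexive (≡-sym (*-identityʳ (suc m)))) (*-monoʳ-≤ (suc m) (m^n>0 (suc m) k))

root-max : ∀ k {Y y} → y ^ suc k ≤ Y → y ≤ root k Y
root-max k {Y} {y} h = rootBelow-max k Y Y y (≤-trans (m≤m^suc y k) h) h

-- Families of k-sets T v = N(v) ∩ U, indexed by v ∈ F

module _ {n : ℕ} (G : SimpleGraph n) where

  -- `dist` will come from the absence of twins and `star` from saturation. The last clause of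
  -- `star` puts `z` outside T v; in a link at `a`, where T v contains `a`, it guarantees that `z`
  -- is not the deleted vertex.
  record Sys (F U : Pred n) (k : ℕ) : Set where
    field
      size : ∀ v → v ∈ᵖ F → degIn G U v ≡ k
      dist : ∀ v v′ → v ∈ᵖ F → v′ ∈ᵖ F → (∀ y → y ∈ᵖ U → adj G v y ≡ adj G v′ y) → v ≡ v′
      star : ∀ v v′ y → v ∈ᵖ F → v′ ∈ᵖ F → y ∈ᵖ U → adj G v y ≡ true → adj G v′ y ≡ false →
             ∃ λ z → z ∈ᵖ U × adj G z y ≡ true × adj G v′ z ≡ true × adj G v z ≡ false
  open Sys

  weight : Pred n → Fin n → ℕ
  weight F a = count (F ∩ adj G a)

  Supported : Pred n → Pred n → Set
  Supported F U = ∀ y → y ∈ᵖ U → ∃ λ v → v ∈ᵖ F × adj G v y ≡ true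

  support : Pred n → Pred n → Pred n
  support F U y = U y ∧ ⌊ 1 ≤? weight F y ⌋

  support-⊆ : ∀ F U → support F U ⊆ᵖ U
  support-⊆ F U v h = ∧-fst h

  support-intro : ∀ {F U v y} → v ∈ᵖ F → y ∈ᵖ U → adj G v y ≡ true → y ∈ᵖ support F U
  support-intro {F} {U} {v} {y} hv hy a = ∧-intro hy (⌊⌋-intro (1 ≤? weight F y) (count-≥1 {F = F ∩ adj G y} {v} (∧-intro hv (adj-sym G a))))

  supported : ∀ F U → Supported F (support F U)
  supported F U y h with count-inhabited {F = F ∩ adj G y} (⌊⌋-elim (1 ≤? weight F y) (∧-snd {U y} h))
  ... | v , hv = v , ∧-fst hv , adj-sym G (∧-snd {F v} hv)

  degIn-⊆ : ∀ {U U′} v → (∀ y → y ∈ᵖ U → adj G v y ≡ true → y ∈ᵖ U′) → degIn G U v ≤ degIn G U′ v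
  degIn-⊆ {U} {U′} v h = count-mono {F = U ∩ adj G v} {U′ ∩ adj G v} λ y e → ∧-intro (h y (∧-fst e) (∧-snd {U y} e)) (∧-snd {U y} e)

  -- The witness of `star` lies in T v′, hence in the union of the sets. Cutting the ground set down
  -- to this union is what makes every set dominate all of it.
  sys-support : ∀ {F U k} → Sys F U k → Sys F (support F U) k
  sys-support {F} {U} S .size v hv = trans (≤-antisym (degIn-⊆ v λ y h _ → support-⊆ F U y h)
    (degIn-⊆ {U} v λ y hy a → support-intro {F} {U} hv hy a)) (size S v hv)
  sys-support {F} {U} S .dist v v′ hv hv′ eq = dist S v v′ hv hv′ go
    where
    go : ∀ y → y ∈ᵖ U → adj G v y ≡ adj G v′ y
    go y hy with Bool-dichotomy (adj G v y) | Bool-dichotomy (adj G v′ y)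
    ... | inj₁ a | _ = eq y (support-intro {F} {U} hv hy a)
    ... | inj₂ _ | inj₁ b = eq y (support-intro {F} {U} hv′ hy b)
    ... | inj₂ a | inj₂ b = trans a (≡-sym b)
  sys-support {F} {U} S .star v v′ y hv hv′ hy a b with star S v v′ y hv hv′ (support-⊆ F U y hy) a b
  ... | z , hz , zy , v′z , vz = z , support-intro {F} {U} hv′ hz v′z , zy , v′z , vz

  sys-sub : ∀ {F F′ U k} → F′ ⊆ᵖ F → Sys F U k → Sys F′ U k
  sys-sub s S .size v hv = size S v (s v hv)
  sys-sub s S .dist v v′ hv hv′ = dist S v v′ (s v hv) (s v′ hv′)
  sys-sub s S .star v v′ y hv hv′ = star S v v′ y (s v hv) (s v′ hv′)

  degIn-except : ∀ U v a → a ∈ᵖ U → adj G v a ≡ true → degIn G U v ≡ suc (degIn G (U except a) v)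
  degIn-except U v a ha va = trans (count-except (U ∩ adj G v) (∧-intro ha va)) (cong suc (count-cong λ y → lem (U y) (adj G v y) (not ⌊ y ≟ a ⌋)))
    where
    lem : ∀ x y z → (x ∧ y) ∧ z ≡ (x ∧ z) ∧ y
    lem false y z = refl
    lem true y z = ∧-comm y z

  sys-link : ∀ {F U k} a → a ∈ᵖ U → Sys F U (suc k) → Sys (F ∩ adj G a) (U except a) k
  sys-link {F} {U} a ha S .size v hv = suc-injective (trans (≡-sym (degIn-except U v a ha (adj-sym G (∧-snd {F v} hv)))) (size S v (∧-fst hv)))
  sys-link {F} {U} a ha S .dist v v′ hv hv′ eq = dist S v v′ (∧-fst hv) (∧-fst hv′) go
    where
    go : ∀ y → y ∈ᵖ U → adj G v y ≡ adj G v′ y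
    go y hy with y ≟ a
    ... | yes refl = trans (adj-sym G (∧-snd {F v} hv)) (≡-sym (adj-sym G (∧-snd {F v′} hv′)))
    ... | no ne = eq y (except-intro {U = U} hy ne)
  sys-link {F} {U} a ha S .star v v′ y hv hv′ hy vy v′y with star S v v′ y (∧-fst hv) (∧-fst hv′) (∧-fst hy) vy v′y
  ... | z , hz , zy , v′z , vz = z , except-intro {U = U} hz (λ { refl → t≢f (adj-sym G (∧-snd {F v} hv)) vz }) , zy , v′z , vz

  count-0⇒ : ∀ {F : Pred n} → count F ≡ 0 → ∀ v → F v ≡ false
  count-0⇒ {F} e v = ¬t⇒f λ h → <-irrefl (≡-sym e) (count-≥1 {F = F} {v} h)

  degIn-0⇒ : ∀ {U v y} → degIn G U v ≡ 0 → y ∈ᵖ U → adj G v y ≡ false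
  degIn-0⇒ {U} {v} {y} e hy = ¬t⇒f λ a → t≢f (∧-intro hy a) (count-0⇒ {U ∩ adj G v} e y)

  sys-0 : ∀ {F U} → Sys F U 0 → count F ≤ 1
  sys-0 S = count-≤1 λ u v hu hv → dist S u v hu hv λ y hy →
    trans (degIn-0⇒ (size S u hu) hy) (≡-sym (degIn-0⇒ (size S v hv) hy))

  sys-member : ∀ {F U k} → Sys F U (suc k) → ∀ v → v ∈ᵖ F → ∃ λ a → a ∈ᵖ U × v ∈ᵖ (F ∩ adj G a)
  sys-member {F} {U} S v hv with count-inhabited {F = U ∩ adj G v} (≤-trans (s≤s z≤n) (≤-reflexive (≡-sym (size S v hv))))
  ... | a , h = a , ∧-fst h , ∧-intro hv (adj-sym G (∧-snd {U a} h))

  sys-≤* : ∀ {F U k} W → Sys F U (suc k) → (∀ a → a ∈ᵖ U → weight F a ≤ W) → count F ≤ count U * W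
  sys-≤* {F} {U} W S h = count-≤-cover {F = F} U (λ a → F ∩ adj G a) W h (sys-member S)

  -- Choosing the `k` elements one after the other, each choice passing to a link.
  sys-≤^ : ∀ k {F U} → Sys F U k → count F ≤ count U ^ k
  sys-≤^ zero S = sys-0 S
  sys-≤^ (suc k) {F} {U} S = sys-≤* (count U ^ k) S λ a ha → ≤-trans (sys-≤^ k (sys-link a ha S))
    (^-monoˡ-≤ k (count-mono {F = U except a} {U} λ v h → ∧-fst h))

  -- Every T v dominates U, so |U| is at most k plus the degrees in U of the members of T v.
  sys-weigh : ∀ {F U k} → Sys F U k → Supported F U →
    count F * count U ≤ count F * k + sumFin (λ a → 𝟙 (U a) * (weight F a * degIn G U a))
  sys-weigh {F} {U} {k} S sup = begin
    count F * count U ≡⟨ cong (_* count U) (count≡sum F) ⟩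
    sumFin (𝟙 ∘ F) * count U ≡⟨ ≡-sym (sum-*ʳ (𝟙 ∘ F) (count U)) ⟩
    sumFin (λ v → 𝟙 (F v) * count U) ≤⟨ sum-mono row ⟩
    sumFin (λ v → 𝟙 (F v) * k + 𝟙 (F v) * T v) ≡⟨ sum-+ (λ v → 𝟙 (F v) * k) (λ v → 𝟙 (F v) * T v) ⟩
    sumFin (λ v → 𝟙 (F v) * k) + sumFin (λ v → 𝟙 (F v) * T v)
      ≡⟨ cong₂ _+_ (trans (sum-*ʳ (𝟙 ∘ F) k) (cong (_* k) (≡-sym (count≡sum F))))
          (trans (double-count F U (adj G) (degIn G U)) (sum-cong λ a → cong (λ m → 𝟙 (U a) * (m * degIn G U a))
            (count-cong λ v → cong (F v ∧_) (sym G v a)))) ⟩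
    count F * k + sumFin (λ a → 𝟙 (U a) * (weight F a * degIn G U a)) ∎
    where
    open ≤-Reasoning
    T : Fin n → ℕ
    T v = sumFin (λ a → 𝟙 (U a ∧ adj G v a) * degIn G U a)
    dominated : ∀ v → v ∈ᵖ F → ∀ y → y ∈ᵖ U → y ∈ᵖ (U ∩ adj G v) ⊎ (∃ λ z → z ∈ᵖ (U ∩ adj G v) × y ∈ᵖ (U ∩ adj G z))
    dominated v hv y hy with Bool-dichotomy (adj G v y)
    ... | inj₁ e = inj₁ (∧-intro hy e)
    ... | inj₂ e with sup y hy
    ...   | u , hu , uy with star S u v y hu hv hy uy e
    ...     | z , hz , zy , vz , _ = inj₂ (z , ∧-intro hz vz , ∧-intro hy zy)
    row : ∀ v → 𝟙 (F v) * count U ≤ 𝟙 (F v) * k + 𝟙 (F v) * T v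
    row v with Bool-dichotomy (F v)
    ... | inj₂ e rewrite e = z≤n
    ... | inj₁ e = ≤-trans (*-monoʳ-≤ (𝟙 (F v)) (≤-trans (count-union {F = U} {U ∩ adj G v} (U ∩ adj G v) (λ z → U ∩ adj G z) (dominated v e))
                     (≤-reflexive (cong (_+ T v) (size S v e))))) (≤-reflexive (*-distribˡ-+ (𝟙 (F v)) k (T v)))

  sys-weight-sum : ∀ {F U k} → Sys F U k → count F * k ≡ sumFin (λ a → 𝟙 (U a) * weight F a)
  sys-weight-sum {F} {U} {k} S = begin
    count F * k ≡⟨ cong (_* k) (count≡sum F) ⟩
    sumFin (𝟙 ∘ F) * k ≡⟨ ≡-sym (sum-*ʳ (𝟙 ∘ F) k) ⟩
    sumFin (λ v → 𝟙 (F v) * k) ≡⟨ sum-cong row ⟩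
    sumFin (λ v → 𝟙 (F v) * sumFin (λ a → 𝟙 (U a ∧ adj G v a) * 1)) ≡⟨ double-count F U (adj G) (λ _ → 1) ⟩
    sumFin (λ a → 𝟙 (U a) * (count (λ v → F v ∧ adj G v a) * 1)) ≡⟨ sum-cong (λ a → cong (𝟙 (U a) *_)
       (trans (*-identityʳ _) (count-cong λ v → cong (F v ∧_) (sym G v a)))) ⟩
    sumFin (λ a → 𝟙 (U a) * weight F a) ∎
    where
    open ≡-Reasoning
    row : ∀ v → 𝟙 (F v) * k ≡ 𝟙 (F v) * sumFin (λ a → 𝟙 (U a ∧ adj G v a) * 1)
    row v with Bool-dichotomy (F v)
    ... | inj₂ e rewrite e = refl
    ... | inj₁ e = cong (𝟙 (F v) *_) (trans (≡-sym (size S v e)) (trans (count≡sum (U ∩ adj G v)) (sum-cong {f = 𝟙 ∘ (U ∩ adj G v)} λ a → ≡-sym (*-identityʳ (𝟙 (U a ∧ adj G v a))))))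

  sys-rec : ∀ {F U k} W → Sys F U k → Supported F U → (∀ a → a ∈ᵖ U → weight F a ≤ W) →
    count F * count U ≤ count F * k + s₂ G U * W
  sys-rec {F} {U} {k} W S sup h = ≤-trans (sys-weigh S sup) (+-monoʳ-≤ (count F * k)
    (≤-trans (sum-mono pt) (≤-reflexive (sum-*ʳ (λ a → 𝟙 (U a) * degIn G U a) W))))
    where
    pt : ∀ a → 𝟙 (U a) * (weight F a * degIn G U a) ≤ 𝟙 (U a) * degIn G U a * W
    pt a with Bool-dichotomy (U a)
    ... | inj₂ e rewrite e = z≤n
    ... | inj₁ e = ≤-trans (*-monoʳ-≤ (𝟙 (U a)) (*-monoˡ-≤ (degIn G U a) (h a e)))
                           (≤-reflexive (lem (𝟙 (U a)) W (degIn G U a)))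
      where
      lem : ∀ x y z → x * (y * z) ≡ x * z * y
      lem = solve-∀

  sys-tiny : ∀ {F U k} → Sys F U k → count U ≤ k → count F ≤ 1
  sys-tiny {F} {U} {k} S le = count-≤1 λ u v hu hv → dist S u v hu hv λ y hy → trans (full u hu y hy) (≡-sym (full v hv y hy))
    where
    full : ∀ v → v ∈ᵖ F → ∀ y → y ∈ᵖ U → adj G v y ≡ true
    full v hv y hy = ∧-snd {U y} (count-≡⇒⊇ {F = U ∩ adj G v} {U} (λ u h → ∧-fst h) (≤-trans le (≤-reflexive (≡-sym (size S v hv)))) y hy)

  -- With p the size of the support, domination gives N (p - k - 1) ≤ Z W and covering by links
  -- gives N ≤ p W. In the product of the two the factor p - k - 1 cancels. If it is not positive
  -- there is at most one set, which accounts for the summand 1.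
  sys-sq : ∀ {F U k} W Z → Sys F U (suc k) → s₂ G U ≤ Z → (∀ a → a ∈ᵖ U → weight F a ≤ W) →
    count F * count F ≤ (2 + k) * Z * (W * W) + 1
  sys-sq {F} {U₀} {k} W Z S₀ hZ₀ hW₀ with count (support F U₀) ≤? suc k
  ... | yes le = ≤-trans (*-mono-≤ N≤1 N≤1) (m≤n+m 1 _)
    where N≤1 = sys-tiny (sys-support S₀) le
  ... | no ¬le = ≤-trans (*-cancelʳ-≤ (N * N) ((2 + k) * Z * (W * W)) g key) (m≤m+n _ 1)
    where
    U = support F U₀
    S = sys-support S₀
    N = count F
    g = count U ∸ suc k
    instance
      gnz : NonZero g
      gnz = >-nonZero (m<n⇒0<n∸m (≰⇒> ¬le))
    p≡ : count U ≡ suc k + g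
    p≡ = ≡-sym (m+[n∸m]≡n (<⇒≤ (≰⇒> ¬le)))
    hW : ∀ a → a ∈ᵖ U → weight F a ≤ W
    hW a h = hW₀ a (support-⊆ F U₀ a h)
    a₁ : N * g ≤ Z * W
    a₁ = ≤-trans (+-cancelˡ-≤ (N * suc k) (N * g) (s₂ G U * W) (≤-trans (≤-reflexive (trans (≡-sym (*-distribˡ-+ N (suc k) g)) (cong (N *_) (≡-sym p≡))))
           (sys-rec W S (supported F U₀) hW))) (*-monoˡ-≤ W (≤-trans (s₂-mono G (support-⊆ F U₀)) hZ₀))
    a₂ : N ≤ (2 + k) * g * W
    -- As g ≥ 1, p = suc k + g is at most (2 + k) g.
    a₂ = ≤-trans (sys-≤* W S hW) (*-monoˡ-≤ W (≤-trans (≤-reflexive p≡) (≤-trans (+-monoˡ-≤ g (≤-trans (≤-reflexive (≡-sym (*-identityʳ (suc k)))) (*-monoʳ-≤ (suc k) (>-nonZero⁻¹ g)))) (≤-reflexive (+-comm (suc k * g) g)))))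
    key : N * N * g ≤ (2 + k) * Z * (W * W) * g
    key = begin
      N * N * g ≡⟨ *-assoc N N g ⟩
      N * (N * g) ≤⟨ *-mono-≤ a₂ a₁ ⟩
      (2 + k) * g * W * (Z * W) ≡⟨ lem (2 + k) g W Z ⟩
      (2 + k) * Z * (W * W) * g ∎
      where
      open ≤-Reasoning
      lem : ∀ a b c d → a * b * c * (d * c) ≡ a * d * (c * c) * b
      lem = solve-∀

  -- Greedy cliques, and families of 1-sets and 2-sets.

  CliqueBound : ℕ → Set
  CliqueBound r = ∀ xs → Clique G xs → length xs < r

  -- Fix a member v₁. Members v whose chosen vertex `σ v` lies in T v₁ belong to at most k W; for
  -- all others `σ v` is adjacent to `σ v₁`. Repeating this among the others builds a clique of
  -- chosen vertices, so nothing remains after `r` rounds.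
  greedy-clique : ∀ {F U r} k W (σ : Fin n → Fin n) → CliqueBound r →
    (∀ v → v ∈ᵖ F → degIn G U v ≤ k) → (∀ v → v ∈ᵖ F → σ v ∈ᵖ (U ∩ adj G v)) → (∀ a → a ∈ᵖ U → weight F a ≤ W) →
    (∀ v v′ → v ∈ᵖ F → v′ ∈ᵖ F → adj G (σ v) (σ v′) ≡ true ⊎ adj G v (σ v′) ≡ true) → count F ≤ r * (k * W)
  greedy-clique {F} {U} {r} k W σ cb hk hσ hW hp = go r [] [] F (+-identityʳ r) (λ _ e → e) (λ _ _ → [])
    where
    go : ∀ m xs → Clique G xs → ∀ F′ → m + length xs ≡ r → F′ ⊆ᵖ F →
         (∀ v → v ∈ᵖ F′ → All (λ x → adj G (σ v) x ≡ true) xs) → count F′ ≤ m * (k * W)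
    go zero xs cl F′ len s h = ⊥-elim (<-irrefl len (cb xs cl))
    go (suc m) xs cl F′ len s h with find F′
    ... | inj₂ none = ≤-trans (≤-reflexive (count-none none)) z≤n
    ... | inj₁ (v₁ , h₁) = ≤-trans (count-union {F = F′} {F″} (U ∩ adj G v₁) (λ a → F ∩ adj G a) cover)
            (≤-trans (+-mono-≤ (go m (σ v₁ ∷ xs) (h v₁ h₁ ∷ cl) F″ (trans (+-suc m _) len) (λ v e → s v (∧-fst e))
                       (λ v e → adj-sym G (∧-snd {F′ v} e) ∷ h v (∧-fst e)))
                     (≤-trans (sum-≤-count* (U ∩ adj G v₁) (weight F) W (λ a e → hW a (∧-fst e))) (*-monoˡ-≤ W (hk v₁ (s v₁ h₁)))))
              (≤-reflexive (+-comm _ (k * W))))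
      where
      F″ : Pred n
      F″ v = F′ v ∧ adj G (σ v₁) (σ v)
      cover : ∀ v → v ∈ᵖ F′ → v ∈ᵖ F″ ⊎ (∃ λ a → a ∈ᵖ (U ∩ adj G v₁) × v ∈ᵖ (F ∩ adj G a))
      cover v hv with hp v₁ v (s v₁ h₁) (s v hv)
      ... | inj₁ e = inj₁ (∧-intro hv e)
      ... | inj₂ e = inj₂ (σ v , ∧-intro (∧-fst (hσ v (s v hv))) e , ∧-intro (s v hv) (adj-sym G (∧-snd {U (σ v)} (hσ v (s v hv)))))

  pick : Pred n → Fin n → Fin n
  pick H d with find H
  ... | inj₁ (a , _) = a
  ... | inj₂ _ = d

  pick-∈ : ∀ H d {a} → a ∈ᵖ H → pick H d ∈ᵖ H
  pick-∈ H d {a} h with find H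
  ... | inj₁ (_ , e) = e
  ... | inj₂ none = ⊥-elim (t≢f h (none a))

  -- By `star`, two different singletons are adjacent, so all of them form a clique.
  sys-1 : ∀ {F U r} → CliqueBound r → Sys F U 1 → count F ≤ r
  sys-1 {F} {U} {r} cb S = ≤-trans
    (greedy-clique 1 1 σ cb (λ v hv → ≤-reflexive (size S v hv)) hσ (λ a ha → sys-0 (sys-link a ha S)) pair)
    (≤-reflexive (*-identityʳ r))
    where
    σ : Fin n → Fin n
    σ v = pick (U ∩ adj G v) v
    hσ : ∀ v → v ∈ᵖ F → σ v ∈ᵖ (U ∩ adj G v)
    hσ v hv with sys-member S v hv
    ... | a , ha , e = pick-∈ (U ∩ adj G v) v (∧-intro ha (adj-sym G (∧-snd {F v} e)))
    only : ∀ v → v ∈ᵖ F → ∀ z → z ∈ᵖ U → adj G v z ≡ true → z ≡ σ v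
    only v hv z hz vz with z ≟ σ v
    ... | yes e = e
    ... | no ne = ⊥-elim (t≢f (adj-sym G vz) (adj-sym G (degIn-0⇒ {U except σ v} {v} {z}
            (suc-injective (trans (≡-sym (degIn-except U v (σ v) (∧-fst (hσ v hv)) (∧-snd {U (σ v)} (hσ v hv)))) (size S v hv)))
            (except-intro {U = U} hz ne))))
    pair : ∀ v v′ → v ∈ᵖ F → v′ ∈ᵖ F → adj G (σ v) (σ v′) ≡ true ⊎ adj G v (σ v′) ≡ true
    pair v v′ hv hv′ with Bool-dichotomy (adj G v (σ v′))
    ... | inj₁ e = inj₂ e
    ... | inj₂ e with star S v′ v (σ v′) hv′ hv (∧-fst (hσ v′ hv′)) (∧-snd {U (σ v′)} (hσ v′ hv′)) e
    ...   | z , hz , zy , vz , _ = inj₁ (subst (λ x → adj G x (σ v′) ≡ true) (only v hv z hz vz) zy)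

  sys-2 : ∀ {F U r} Z → CliqueBound r → s₂ G U ≤ Z → Sys F U 2 → count F ≤ root 1 (3 * Z * (r * r) + 1)
  sys-2 {F} {U} {r} Z cb hZ S = root-max 1 (≤-trans (≤-reflexive (cong (count F *_) (*-identityʳ (count F))))
    (sys-sq r Z S hZ λ a ha → sys-1 cb (sys-link a ha S)))

-- Maximal independent 3-sets of a triangle-free graph: a minimal counterexample.

avoid : ∀ {n} (H : Pred n) xs → length xs < count H → ∃ λ v → v ∈ᵖ H × All (v ≢_) xs
avoid H [] lt = let (v , h) = count-inhabited {F = H} lt in v , h , []
avoid H (x ∷ xs) lt with avoid (H except x) xs (≤-pred (≤-trans lt le))
  where
  le : count H ≤ suc (count (H except x))
  le with Bool-dichotomy (H x)
  ... | inj₁ e = ≤-reflexive (count-except H e)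
  ... | inj₂ e = ≤-trans (count-mono {F = H} {H except x} λ v h → except-intro {U = H} h (λ { refl → t≢f h e })) (n≤1+n _)
... | v , h , a = v , ∧-fst h , except-≢ {U = H} h ∷ a

listPred : ∀ {n} → List (Fin n) → Pred n
listPred [] y = false
listPred (x ∷ xs) y = ⌊ y ≟ x ⌋ ∨ listPred xs y

listPred-∈ : ∀ {n} (xs : List (Fin n)) {y} → y ∈ᵖ listPred xs → y ∈ xs
listPred-∈ (x ∷ xs) {y} h with ∨-elim {⌊ y ≟ x ⌋} h
... | inj₁ e = here (⌊⌋-elim (y ≟ x) e)
... | inj₂ e = there (listPred-∈ xs e)

∈-listPred : ∀ {n} {xs : List (Fin n)} {y} → y ∈ xs → y ∈ᵖ listPred xs
∈-listPred {xs = x ∷ xs} {y} (here e) = ∨-introˡ (⌊⌋-intro (y ≟ x) e)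
∈-listPred {xs = x ∷ xs} {y} (there m) = ∨-introʳ {⌊ y ≟ x ⌋} (∈-listPred m)

listPred-count : ∀ {n} {xs : List (Fin n)} → AllPairs _≢_ xs → length xs ≤ count (listPred xs)
listPred-count [] = z≤n
listPred-count {xs = x ∷ xs} (ne ∷ u) = subst (suc (length xs) ≤_) (≡-sym (count-except (listPred (x ∷ xs)) {x} (∈-listPred {xs = x ∷ xs} (here refl))))
  (s≤s (≤-trans (listPred-count u) (count-mono {F = listPred xs} {listPred (x ∷ xs) except x} λ y h →
    except-intro {U = listPred (x ∷ xs)} {x} {y} (∨-introʳ {⌊ y ≟ x ⌋} h) λ { refl → All.lookup ne (listPred-∈ xs h) refl })))

pigeonhole : ∀ {A : Set} {P Q : A → Set} a b c → a ≢ b → a ≢ c → b ≢ c → P a ⊎ Q a → P b ⊎ Q b → P c ⊎ Q c →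
  (∃ λ i → ∃ λ j → i ≢ j × P i × P j) ⊎ (∃ λ i → ∃ λ j → i ≢ j × Q i × Q j)
pigeonhole a b c ab ac bc (inj₁ x) (inj₁ y) _ = inj₁ (a , b , ab , x , y)
pigeonhole a b c ab ac bc (inj₂ x) (inj₂ y) _ = inj₂ (a , b , ab , x , y)
pigeonhole a b c ab ac bc (inj₁ x) (inj₂ y) (inj₁ z) = inj₁ (a , c , ac , x , z)
pigeonhole a b c ab ac bc (inj₁ x) (inj₂ y) (inj₂ z) = inj₂ (b , c , bc , y , z)
pigeonhole a b c ab ac bc (inj₂ x) (inj₁ y) (inj₁ z) = inj₁ (b , c , bc , y , z)
pigeonhole a b c ab ac bc (inj₂ x) (inj₁ y) (inj₂ z) = inj₂ (a , c , ac , x , z)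

three : ∀ {n} (T : Pred n) {a b} → count T ≡ 3 → a ∈ᵖ T → b ∈ᵖ T → a ≢ b →
  ∃ λ c → c ∈ᵖ T × a ≢ c × b ≢ c × (∀ y → y ∈ᵖ T → y ≡ a ⊎ y ≡ b ⊎ y ≡ c)
three T {a} {b} e ha hb ab = c , ∧-fst (∧-fst hc) , (λ e → except-≢ {U = T} {a} {c} (∧-fst hc) (≡-sym e)) ,
    (λ e → except-≢ {U = T except a} {b} {c} hc (≡-sym e)) , only
  where
  T₁ = T except a
  T₂ = T₁ except b
  hb₁ : b ∈ᵖ T₁
  hb₁ = except-intro {U = T} hb (λ { refl → ab refl })
  e₂ : count T₂ ≡ 1
  e₂ = suc-injective (trans (≡-sym (count-except T₁ hb₁)) (suc-injective (trans (≡-sym (count-except T ha)) e)))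
  inh = count-inhabited {F = T₂} (≤-reflexive (≡-sym e₂))
  c = proj₁ inh
  hc = proj₂ inh
  only : ∀ y → y ∈ᵖ T → y ≡ a ⊎ y ≡ b ⊎ y ≡ c
  only y hy with y ≟ a | y ≟ b | y ≟ c
  ... | yes p | _ | _ = inj₁ p
  ... | no _ | yes p | _ = inj₂ (inj₁ p)
  ... | no _ | no _ | yes p = inj₂ (inj₂ p)
  ... | no p | no p′ | no p″ = ⊥-elim (<-irrefl (≡-sym (suc-injective (trans (≡-sym (count-except T₂ hc)) e₂)))
        (count-≥1 {F = T₂ except c} {y} (except-intro {U = T₂} (except-intro {U = T₁} (except-intro {U = T} hy p) p′) p″)))

module _ {n : ℕ} (G : SimpleGraph n) where

  -- A family of maximal independent 3-sets of the triangle-free graph induced on U.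
  record TriSys (F U : Pred n) : Set where
    field
      tf   : ∀ {x y z} → x ∈ᵖ U → y ∈ᵖ U → z ∈ᵖ U → adj G x y ≡ true → adj G y z ≡ true → adj G x z ≡ true → ⊥
      ind  : ∀ {v a b} → v ∈ᵖ F → a ∈ᵖ U → b ∈ᵖ U → adj G v a ≡ true → adj G v b ≡ true → adj G a b ≡ true → ⊥
      dom  : ∀ {v y} → v ∈ᵖ F → y ∈ᵖ U → adj G v y ≡ false → ∃ λ z → z ∈ᵖ U × adj G v z ≡ true × adj G z y ≡ true
      size : ∀ {v} → v ∈ᵖ F → degIn G U v ≡ 3
      dist : ∀ {v v′} → v ∈ᵖ F → v′ ∈ᵖ F → (∀ y → y ∈ᵖ U → adj G v y ≡ adj G v′ y) → v ≡ v′

  meets : Pred n → Pred n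
  meets V v = ⌊ 1 ≤? degIn G V v ⌋

  meets-elim : ∀ V {v} → v ∈ᵖ meets V → ∃ λ a → a ∈ᵖ V × adj G v a ≡ true
  meets-elim V {v} h = let (a , e) = count-inhabited {F = V ∩ adj G v} (⌊⌋-elim (1 ≤? degIn G V v) h) in a , ∧-fst e , ∧-snd {V a} e

  meets-intro : ∀ V {v a} → a ∈ᵖ V → adj G v a ≡ true → v ∈ᵖ meets V
  meets-intro V {v} {a} h e = ⌊⌋-intro (1 ≤? degIn G V v) (count-≥1 {F = V ∩ adj G v} {a} (∧-intro h e))

  -- The members that remain avoid `V`, so their sets and with them all dominating vertices survive.
  triSys-remove : ∀ {F U} V → TriSys F U → TriSys (λ v → F v ∧ not (meets V v)) (λ y → U y ∧ not (V y))
  triSys-remove {F} {U} V S = record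
    { tf = λ hx hy hz → tf (∧-fst hx) (∧-fst hy) (∧-fst hz)
    ; ind = λ hv ha hb → ind (∧-fst hv) (∧-fst ha) (∧-fst hb)
    ; dom = λ {v} hv hy e → let (z , hz , vz , zy) = dom (∧-fst hv) (∧-fst hy) e
                            in z , ∧-intro hz (not-intro (miss hv vz)) , vz , zy
    ; size = λ {v} hv → trans (count-cong λ y → pt hv y) (size (∧-fst hv))
    ; dist = λ {v} {v′} hv hv′ eq → dist (∧-fst hv) (∧-fst hv′) λ y hy → agree hv hv′ eq y hy }
    where
    open TriSys S
    miss : ∀ {v a} → F v ∧ not (meets V v) ≡ true → adj G v a ≡ true → V a ≡ false
    miss {v} hv va = ¬t⇒f λ h → t≢f (meets-intro V h va) (not-elim (∧-snd {F v} hv))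
    pt : ∀ {v} → F v ∧ not (meets V v) ≡ true → ∀ y → (U y ∧ not (V y)) ∧ adj G v y ≡ U y ∧ adj G v y
    pt {v} hv y with Bool-dichotomy (adj G v y)
    ... | inj₁ e rewrite miss hv e with U y
    ...   | true = refl
    ...   | false = refl
    pt {v} hv y | inj₂ e rewrite e | ∧-comm (U y ∧ not (V y)) false | ∧-comm (U y) false = refl
    agree : ∀ {v v′} → F v ∧ not (meets V v) ≡ true → F v′ ∧ not (meets V v′) ≡ true →
      (∀ y → U y ∧ not (V y) ≡ true → adj G v y ≡ adj G v′ y) → ∀ y → y ∈ᵖ U → adj G v y ≡ adj G v′ y
    agree {v} {v′} hv hv′ eq y hy with Bool-dichotomy (V y)
    ... | inj₂ e = eq y (∧-intro hy (not-intro e))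
    ... | inj₁ e = trans (¬t⇒f λ a → t≢f e (miss hv a)) (≡-sym (¬t⇒f λ a → t≢f e (miss hv′ a)))

  module Irreducible {F U : Pred n} (S : TriSys F U) (big : count U + 64 < count F)
    (irr : ∀ V → V ⊆ᵖ U → 1 ≤ count V → count V < count (F ∩ meets V)) where
    open TriSys S

    A : Fin n → Fin n → Set
    A x y = adj G x y ≡ true

    A-sym : ∀ {x y} → A x y → A y x
    A-sym = adj-sym G

    -- The form in which minimality is used: beyond any |V| known members there is another one that
    -- meets `V`.
    more : ∀ V → AllPairs _≢_ V → All (_∈ᵖ U) V → 1 ≤ length V → ∀ xs → length xs ≤ length V →
      ∃ λ v → v ∈ᵖ F × (∃ λ a → a ∈ V × A v a) × All (v ≢_) xs
    more V uq inU ne xs le with avoid (F ∩ meets (listPred V)) xs (≤-trans (s≤s (≤-trans le (listPred-count uq)))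
        (irr (listPred V) (λ y h → All.lookup inU (listPred-∈ V h)) (≤-trans ne (listPred-count uq))))
    ... | v , h , av = v , ∧-fst h , (let (a , ha , e) = meets-elim (listPred V) (∧-snd {F v} h) in a , listPred-∈ V ha , e) , av

    record Is (v a b c : Fin n) : Set where
      constructor is
      field
        aU : a ∈ᵖ U
        bU : b ∈ᵖ U
        cU : c ∈ᵖ U
        va : A v a
        vb : A v b
        vc : A v c
        ab : a ≢ b
        ac : a ≢ c
        bc : b ≢ c
        only : ∀ y → y ∈ᵖ U → A v y → y ≡ a ⊎ y ≡ b ⊎ y ≡ c
    open Is

    swap₁₂ : ∀ {v a b c} → Is v a b c → Is v b a c
    swap₁₂ (is aU bU cU va vb vc ab ac bc o) = is bU aU cU vb va vc (λ e → ab (≡-sym e)) bc ac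
      λ y hy e → case o y hy e of λ { (inj₁ p) → inj₂ (inj₁ p) ; (inj₂ (inj₁ p)) → inj₁ p ; (inj₂ (inj₂ p)) → inj₂ (inj₂ p) }

    swap₂₃ : ∀ {v a b c} → Is v a b c → Is v a c b
    swap₂₃ (is aU bU cU va vb vc ab ac bc o) = is aU cU bU va vc vb ac ab (λ e → bc (≡-sym e))
      λ y hy e → case o y hy e of λ { (inj₁ p) → inj₁ p ; (inj₂ (inj₁ p)) → inj₂ (inj₂ p) ; (inj₂ (inj₂ p)) → inj₂ (inj₁ p) }

    of₂ : ∀ {v a b} → v ∈ᵖ F → a ∈ᵖ U → b ∈ᵖ U → A v a → A v b → a ≢ b → ∃ λ c → Is v a b c
    of₂ {v} {a} {b} hv ha hb va vb ne with three (U ∩ adj G v) {a} {b} (size hv) (∧-intro ha va) (∧-intro hb vb) ne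
    ... | c , hc , ac , bc , o = c , is ha hb (∧-fst hc) va vb (∧-snd {U c} hc) ne ac bc λ y hy e → o y (∧-intro hy e)

    of₁ : ∀ {v a} → v ∈ᵖ F → a ∈ᵖ U → A v a → ∃ λ b → ∃ λ c → Is v a b c
    of₁ {v} {a} hv ha va with avoid (U ∩ adj G v) (a ∷ []) (≤-trans (s≤s (s≤s z≤n)) (≤-reflexive (≡-sym (size hv))))
    ... | b , hb , (ne ∷ []) = b , of₂ hv ha (∧-fst hb) va (∧-snd {U b} hb) (λ e → ne (≡-sym e))

    sub⇒≡ : ∀ {v v′} → v ∈ᵖ F → v′ ∈ᵖ F → (∀ y → y ∈ᵖ U → A v y → A v′ y) → v ≡ v′
    sub⇒≡ {v} {v′} hv hv′ s = dist hv hv′ go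
      where
      back : ∀ y → y ∈ᵖ U → A v′ y → A v y
      back y hy e = ∧-snd {U y} (count-≡⇒⊇ {F = U ∩ adj G v} {U ∩ adj G v′}
        (λ z h → ∧-intro (∧-fst h) (s z (∧-fst h) (∧-snd {U z} h))) (≤-reflexive (trans (size hv′) (≡-sym (size hv)))) y (∧-intro hy e))
      go : ∀ y → y ∈ᵖ U → adj G v y ≡ adj G v′ y
      go y hy with Bool-dichotomy (adj G v y)
      ... | inj₁ e = trans e (≡-sym (s y hy e))
      ... | inj₂ e = trans e (≡-sym (¬t⇒f λ e′ → t≢f (back y hy e′) e))

    same : ∀ {v v′ a b c} → v ∈ᵖ F → v′ ∈ᵖ F → Is v a b c → A v′ a → A v′ b → A v′ c → v ≡ v′
    same hv hv′ I x y z = sub⇒≡ hv hv′ λ w hw e → case only I w hw e of λ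
      { (inj₁ refl) → x ; (inj₂ (inj₁ refl)) → y ; (inj₂ (inj₂ refl)) → z }

    data Dom (a b c y : Fin n) : Set where
      eq₁ : y ≡ a → Dom a b c y
      eq₂ : y ≡ b → Dom a b c y
      eq₃ : y ≡ c → Dom a b c y
      ad₁ : A a y → Dom a b c y
      ad₂ : A b y → Dom a b c y
      ad₃ : A c y → Dom a b c y

    dominate : ∀ {v a b c} y → v ∈ᵖ F → Is v a b c → y ∈ᵖ U → Dom a b c y
    dominate {v} y hv I hy with Bool-dichotomy (adj G v y)
    ... | inj₁ e = case only I y hy e of λ { (inj₁ p) → eq₁ p ; (inj₂ (inj₁ p)) → eq₂ p ; (inj₂ (inj₂ p)) → eq₃ p }
    ... | inj₂ e with dom hv hy e
    ...   | z , hz , vz , zy = case only I z hz vz of λ { (inj₁ refl) → ad₁ zy ; (inj₂ (inj₁ refl)) → ad₂ zy ; (inj₂ (inj₂ refl)) → ad₃ zy }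

    -- A maximal independent set is determined by its part outside an independent set `I`: if y in I
    -- ∩ T v were missing from T v′, some z in T v′ would be adjacent to it. Then z is not in `I`,
    -- so z is in T v too, where it cannot be adjacent to y.
    determined : (I : Fin n → Set) → (∀ y z → I y → I z → y ∈ᵖ U → z ∈ᵖ U → A y z → ⊥) →
      ∀ {v v′} → v ∈ᵖ F → v′ ∈ᵖ F → (∀ y → y ∈ᵖ U → I y ⊎ adj G v y ≡ adj G v′ y) → v ≡ v′
    determined I indep {v} {v′} hv hv′ h = sub⇒≡ hv hv′ go
      where
      go : ∀ y → y ∈ᵖ U → A v y → A v′ y
      go y hy e with h y hy
      ... | inj₂ eq = trans (≡-sym eq) e
      ... | inj₁ Iy with Bool-dichotomy (adj G v′ y)
      ...   | inj₁ e′ = e′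
      ...   | inj₂ e′ with dom hv′ hy e′
      ...     | z , hz , v′z , zy with h z hz
      ...       | inj₁ Iz = ⊥-elim (indep y z Iy Iz hy hz (A-sym zy))
      ...       | inj₂ eq = ⊥-elim (ind hv hy hz e (trans eq v′z) (A-sym zy))

    -- The origin of the constant 64: if all but six vertices lie in an independent set, the members
    -- are determined by their traces on these six, so there are at most 2 ^ 6.
    few : (ys : List (Fin n)) (I : Fin n → Set) → (∀ y z → I y → I z → y ∈ᵖ U → z ∈ᵖ U → A y z → ⊥) →
      (∀ y → y ∈ᵖ U → I y ⊎ y ∈ ys) → length ys ≤ 6 → ⊥
    few ys I indep cov le = <-irrefl refl (≤-trans big (≤-trans
        (≤-trans (count-classes (mapᴸ (λ y v → adj G v y) ys) F 1 cls)
          (≤-trans (≤-reflexive (*-identityʳ _)) (^-monoʳ-≤ 2 (≤-trans (≤-reflexive (length-map _ ys)) le)))) (m≤n+m 64 (count U))))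
      where
      cls : ∀ F′ → F′ ⊆ᵖ F → Constant (mapᴸ (λ y v → adj G v y) ys) F′ → count F′ ≤ 1
      cls F′ s c = count-≤1 λ u v hu hv → determined I indep (s u hu) (s v hv) λ y hy → case cov y hy of λ
        { (inj₁ e) → inj₁ e ; (inj₂ m) → inj₂ (All.lookup c (∈-map⁺ (λ y v → adj G v y) m) u v hu hv) }

    -- The weights add up to 3 N > 3 p, so they cannot all be at most 3.
    heavy : ∃ λ d → d ∈ᵖ U × 4 ≤ weight G F d
    heavy with find (λ d → U d ∧ ⌊ 4 ≤? weight G F d ⌋)
    ... | inj₁ (d , h) = d , ∧-fst h , ⌊⌋-elim (4 ≤? weight G F d) (∧-snd {U d} h)
    ... | inj₂ none = ⊥-elim (<-irrefl refl (≤-trans big (≤-trans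
            (*-cancelʳ-≤ (count F) (count U) 3 (≤-trans (≤-reflexive sum3) (sum-≤-count* U (weight G F) 3 light))) (m≤m+n _ 64))))
      where
      light : ∀ a → a ∈ᵖ U → weight G F a ≤ 3
      light a ha = ≤-pred (≰⇒> λ le → t≢f (∧-intro ha (⌊⌋-intro (4 ≤? weight G F a) le)) (none a))
      sum3 : count F * 3 ≡ sumFin (λ a → 𝟙 (U a) * weight G F a)
      sum3 = sys-weight-sum G record { size = λ v hv → size hv ; dist = λ v v′ hv hv′ → dist hv hv′
        ; star = λ v v′ y hv hv′ hy vy v′y → let (z , hz , v′z , zy) = dom hv′ hy v′y in
            z , hz , zy , v′z , ¬t⇒f λ vz → ind hv hz hy vz vy zy }

    module AtHeavy {d : Fin n} (dU : d ∈ᵖ U) (d≥4 : 4 ≤ weight G F d) where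

      nbr-d-indep : ∀ {x y} → x ∈ᵖ U → y ∈ᵖ U → A d x → A d y → A x y → ⊥
      nbr-d-indep hx hy dx dy xy = tf dU hx hy dx xy dy

      module Shared {v v′ b c c* : Fin n} (hv : v ∈ᵖ F) (hv′ : v′ ∈ᵖ F) (I : Is v d b c) (I′ : Is v′ d b c*) (v≢v′ : v ≢ v′) where
        hb : b ∈ᵖ U
        hb = bU I
        d≢b : d ≢ b
        d≢b = ab I
        ¬db : ¬ A d b
        ¬db = ind hv dU hb (va I) (vb I)
        ¬bc : ¬ A b c
        ¬bc = ind hv hb (cU I) (vb I) (vc I)
        ¬bc* : ¬ A b c*
        ¬bc* = ind hv′ hb (cU I′) (vb I′) (vc I′)
        adj-third : ∀ {w x y} → w ∈ᵖ F → Is w d b x → ¬ (y ≡ x) → y ∈ᵖ U → d ≢ y → b ≢ y → ¬ A d y → ¬ A b y → A x y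
        adj-third {y = y} hw J y≢x hy d≢y b≢y ¬d ¬b with dominate y hw J hy
        ... | eq₁ e = ⊥-elim (d≢y (≡-sym e))
        ... | eq₂ e = ⊥-elim (b≢y (≡-sym e))
        ... | eq₃ e = ⊥-elim (y≢x e)
        ... | ad₁ e = ⊥-elim (¬d e)
        ... | ad₂ e = ⊥-elim (¬b e)
        ... | ad₃ e = e
        third-≢ : ∀ {w w′ x x′} → w ∈ᵖ F → w′ ∈ᵖ F → Is w d b x → Is w′ d b x′ → w ≢ w′ → ¬ (x ≡ x′)
        third-≢ hw hw′ J J′ ne refl = ne (same hw hw′ J (va J′) (vb J′) (vc J′))
        through-b : ∀ {w w′ x x′} → w ∈ᵖ F → w′ ∈ᵖ F → Is w d b x → Is w′ d b x′ → w ≢ w′ → A x x′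
        through-b hw hw′ J J′ ne = adj-third hw J (λ e → third-≢ hw hw′ J J′ ne (≡-sym e)) (cU J′) (ac J′) (bc J′)
          (ind hw′ dU (cU J′) (va J′) (vc J′)) (ind hw′ hb (cU J′) (vb J′) (vc J′))
        cc* : A c c*
        cc* = through-b hv hv′ I I′ v≢v′
        -- Both members dominate `y`. If they did so through `c` and `c*`, these two adjacent
        -- vertices would form a triangle with `y`.
        cover : ∀ y → y ∈ᵖ U → (y ≡ d ⊎ y ≡ b ⊎ y ≡ c ⊎ y ≡ c*) ⊎ A d y ⊎ A b y
        cover y hy with dominate y hv I hy | dominate y hv′ I′ hy
        ... | eq₁ e | _ = inj₁ (inj₁ e)
        ... | eq₂ e | _ = inj₁ (inj₂ (inj₁ e))
        ... | eq₃ e | _ = inj₁ (inj₂ (inj₂ (inj₁ e)))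
        ... | ad₁ e | _ = inj₂ (inj₁ e)
        ... | ad₂ e | _ = inj₂ (inj₂ e)
        ... | ad₃ _ | eq₁ e = inj₁ (inj₁ e)
        ... | ad₃ _ | eq₂ e = inj₁ (inj₂ (inj₁ e))
        ... | ad₃ _ | eq₃ e = inj₁ (inj₂ (inj₂ (inj₂ e)))
        ... | ad₃ _ | ad₁ e = inj₂ (inj₁ e)
        ... | ad₃ _ | ad₂ e = inj₂ (inj₂ e)
        ... | ad₃ cy | ad₃ c*y = ⊥-elim (tf (cU I) (cU I′) hy cc* c*y cy)
        -- The vertices that stand between `cover` and an application of `few` to N(d): two of them
        -- still fit beside `d`, `b`, `c`, `c*`. If there are three or more, too few members pass
        -- through `d`.
        Q : Pred n
        Q y = U y ∧ (adj G b y ∧ not (adj G d y))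
        Q-U : ∀ {y} → y ∈ᵖ Q → y ∈ᵖ U
        Q-U h = ∧-fst h
        Q-b : ∀ {y} → y ∈ᵖ Q → A b y
        Q-b {y} h = ∧-fst (∧-snd {U y} h)
        Q-d : ∀ {y} → y ∈ᵖ Q → ¬ A d y
        Q-d {y} h e = t≢f e (not-elim (∧-snd {adj G b y} (∧-snd {U y} h)))
        Q-indep : ∀ {x y} → x ∈ᵖ Q → y ∈ᵖ Q → ¬ A x y
        Q-indep hx hy e = tf hb (Q-U hx) (Q-U hy) (Q-b hx) e (Q-b hy)
        small : count Q ≤ 2 → ⊥
        small le = few (d ∷ b ∷ c ∷ c* ∷ elems Q) (A d) (λ y z dy dz hy hz → nbr-d-indep hy hz dy dz) cov
            (+-monoʳ-≤ 4 (≤-trans (≤-reflexive (elems-length Q)) le))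
          where
          cov : ∀ y → y ∈ᵖ U → A d y ⊎ y ∈ (d ∷ b ∷ c ∷ c* ∷ elems Q)
          cov y hy with cover y hy
          ... | inj₁ (inj₁ e) = inj₂ (here e)
          ... | inj₁ (inj₂ (inj₁ e)) = inj₂ (there (here e))
          ... | inj₁ (inj₂ (inj₂ (inj₁ e))) = inj₂ (there (there (here e)))
          ... | inj₁ (inj₂ (inj₂ (inj₂ e))) = inj₂ (there (there (there (here e))))
          ... | inj₂ (inj₁ e) = inj₁ e
          ... | inj₂ (inj₂ e) with Bool-dichotomy (adj G d y)
          ...   | inj₁ dy = inj₁ dy
          ...   | inj₂ dy = inj₂ (there (there (there (there (elems-∈ Q (∧-intro hy (∧-intro e (not-intro dy))))))))
        module Large (q≥3 : 3 ≤ count Q) where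
          undominated : ∀ {w y x z} → w ∈ᵖ F → Is w d y x → y ∈ᵖ Q → z ∈ᵖ Q → z ≢ y → z ≡ x ⊎ A x z
          undominated {z = z} hw J hy hz ne with dominate z hw J (Q-U hz)
          ... | eq₁ refl = ⊥-elim (¬db (A-sym (Q-b hz)))
          ... | eq₂ e = ⊥-elim (ne e)
          ... | eq₃ e = inj₁ e
          ... | ad₁ e = ⊥-elim (Q-d hz e)
          ... | ad₂ e = ⊥-elim (Q-indep hy hz e)
          ... | ad₃ e = inj₂ e
          -- A third member through `d` and `b` would make a triangle of third vertices. So `b` is
          -- dominated by some z of T w, which lies in `Q`. A third vertex x in `Q` would leave
          -- another vertex of `Q` undominated, as `Q` is independent and has no neighbours of `d`;
          -- by `cover`, x is `c` or `c*`.
          other : ∀ {w} → w ∈ᵖ F → A w d → w ≢ v → w ≢ v′ →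
            ∃ λ y → ∃ λ x → Is w d y x × y ∈ᵖ Q × (x ≡ c ⊎ x ≡ c*)
          other {w} hw wd w≢v w≢v′ with dom hw hb (¬t⇒f ¬wb)
            where
            ¬wb : ¬ A w b
            ¬wb wb with of₂ hw dU hb wd wb d≢b
            ... | c″ , K = tf (cU I) (cU I′) (cU K) cc* (through-b hv′ hw I′ K (λ e → w≢v′ (≡-sym e)))
                                (through-b hv hw I K (λ e → w≢v (≡-sym e)))
          ... | z , zU , wz , zb with of₂ hw dU zU wd wz (λ e → ¬db (subst (λ s → A s b) (≡-sym e) zb))
          ...   | x , J = z , x , J , zQ , which
            where
            zQ : z ∈ᵖ Q
            zQ = ∧-intro zU (∧-intro (A-sym zb) (not-intro (¬t⇒f (ind hw dU zU wd wz))))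
            which : x ≡ c ⊎ x ≡ c*
            which with cover x (cU J)
            ... | inj₁ (inj₁ e) = ⊥-elim (ac J (≡-sym e))
            ... | inj₁ (inj₂ (inj₁ e)) = ⊥-elim (ind hw zU (cU J) wz (vc J) (subst (A z) (≡-sym e) zb))
            ... | inj₁ (inj₂ (inj₂ (inj₁ e))) = inj₁ e
            ... | inj₁ (inj₂ (inj₂ (inj₂ e))) = inj₂ e
            ... | inj₂ (inj₁ e) = ⊥-elim (ind hw dU (cU J) wd (vc J) e)
            ... | inj₂ (inj₂ e) with avoid Q (z ∷ x ∷ []) q≥3
            ...   | q₃ , hq , (nz ∷ nx ∷ []) with undominated hw J zQ hq nz
            ...     | inj₁ e′ = ⊥-elim (nx e′)
            ...     | inj₂ e′ = ⊥-elim (Q-indep (∧-intro (cU J) (∧-intro e (not-intro (¬t⇒f (ind hw dU (cU J) wd (vc J)))))) hq e′)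
          clash-same : ∀ {w w′ y y′ x} → w ∈ᵖ F → w′ ∈ᵖ F → w ≢ w′ → Is w d y x → Is w′ d y′ x → y ∈ᵖ Q → y′ ∈ᵖ Q → ⊥
          clash-same {y = y} {y′} hw hw′ ne J J′ hy hy′ with y′ ≟ y
          ... | yes refl = ne (same hw hw′ J (va J′) (vb J′) (vc J′))
          ... | no y≢ with undominated hw J hy hy′ y≢
          ...   | inj₁ e = bc J′ e
          ...   | inj₂ e = ind hw′ (cU J′) (bU J′) (vc J′) (vb J′) e
          -- A vertex of `Q` other than `y` and `y′` has to be dominated by `c` and by `c*`, which
          -- are adjacent.
          clash-diff : ∀ {w w′ y y′} → w ∈ᵖ F → w′ ∈ᵖ F → Is w d y c → Is w′ d y′ c* → y ∈ᵖ Q → y′ ∈ᵖ Q → ⊥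
          clash-diff {y = y} {y′} hw hw′ J J′ hy hy′ with avoid Q (y ∷ y′ ∷ []) q≥3
          ... | q₃ , hq , (n₁ ∷ n₂ ∷ []) with undominated hw J hy hq n₁ | undominated hw′ J′ hy′ hq n₂
          ...   | inj₁ refl | _ = ¬bc (Q-b hq)
          ...   | inj₂ _ | inj₁ refl = ¬bc* (Q-b hq)
          ...   | inj₂ e | inj₂ e′ = tf (cU I) (cU I′) (Q-U hq) cc* e′ e
          clash : ∀ {w w′} → w ∈ᵖ F → w′ ∈ᵖ F → w ≢ w′ →
            (∃ λ y → ∃ λ x → Is w d y x × y ∈ᵖ Q × (x ≡ c ⊎ x ≡ c*)) → (∃ λ y → ∃ λ x → Is w′ d y x × y ∈ᵖ Q × (x ≡ c ⊎ x ≡ c*)) → ⊥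
          clash hw hw′ ne (_ , _ , J , hy , inj₁ refl) (_ , _ , J′ , hy′ , inj₁ refl) = clash-same hw hw′ ne J J′ hy hy′
          clash hw hw′ ne (_ , _ , J , hy , inj₂ refl) (_ , _ , J′ , hy′ , inj₂ refl) = clash-same hw hw′ ne J J′ hy hy′
          clash hw hw′ ne (_ , _ , J , hy , inj₁ refl) (_ , _ , J′ , hy′ , inj₂ refl) = clash-diff hw hw′ J J′ hy hy′
          clash hw hw′ ne (_ , _ , J , hy , inj₂ refl) (_ , _ , J′ , hy′ , inj₁ refl) = clash-diff hw′ hw J′ J hy′ hy
          large : ⊥
          large with avoid (F ∩ adj G d) (v ∷ v′ ∷ []) (≤-trans (n≤1+n 3) d≥4)
          ... | v₃ , h₃ , (n₁ ∷ n₂ ∷ []) with avoid (F ∩ adj G d) (v ∷ v′ ∷ v₃ ∷ []) d≥4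
          ...   | v₄ , h₄ , (m₁ ∷ m₂ ∷ m₃ ∷ []) = clash (∧-fst h₃) (∧-fst h₄) (λ e → m₃ (≡-sym e))
                    (other (∧-fst h₃) (A-sym (∧-snd {F v₃} h₃)) n₁ n₂) (other (∧-fst h₄) (A-sym (∧-snd {F v₄} h₄)) m₁ m₂)
        absurd : ⊥
        absurd with count Q ≤? 2
        ... | yes le = small le
        ... | no ¬le = Large.large (≰⇒> ¬le)

      -- Two members through d sharing a second vertex b force all but six vertices into N(d).
      no-share : ∀ {v v′ b} → v ∈ᵖ F → v′ ∈ᵖ F → A v d → A v′ d → b ∈ᵖ U → d ≢ b → A v b → A v′ b → v ≡ v′
      no-share {v} {v′} {b} hv hv′ vd v′d hb d≢b xb x′b with v ≟ v′
      ... | yes e = e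
      ... | no v≢v′ with of₂ hv dU hb vd xb d≢b | of₂ hv′ dU hb v′d x′b d≢b
      ...   | c , I | c* , I′ = ⊥-elim (Shared.absurd hv hv′ I I′ v≢v′)

-- Crowns: four members through a heavy vertex.

module _ {n : ℕ} (G : SimpleGraph n) where

  module Crowns {F U : Pred n} (S : TriSys G F U) (big : count U + 64 < count F)
    (irr : ∀ V → V ⊆ᵖ U → 1 ≤ count V → count V < count (F ∩ meets G V))
    {d : Fin n} (dU : d ∈ᵖ U) (d≥4 : 4 ≤ weight G F d) where
    open TriSys S
    open Irreducible G S big irr
    open AtHeavy dU d≥4
    open Is

    -- Four members {d , p i , q i} with p i adjacent to q j exactly when i ≢ j.
    record Crown : Set where
      field
        v p q : Fin 4 → Fin n
        vF    : ∀ i → v i ∈ᵖ F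
        I     : ∀ i → Is (v i) d (p i) (q i)
        cross : ∀ i j → i ≢ j → A (p i) (q j)
        v≢    : ∀ i j → i ≢ j → v i ≢ v j

    flip : Crown → Crown
    flip Cr = record { v = v ; p = q ; q = p ; vF = vF ; I = λ i → swap₂₃ (I i)
                     ; cross = λ i j ne → A-sym (cross j i (λ e → ne (≡-sym e))) ; v≢ = v≢ }
      where open Crown Cr

    cross-dom : ∀ {w w′ a b x y} → w ∈ᵖ F → w′ ∈ᵖ F → w ≢ w′ → Is w d a b → Is w′ d x y → A a x ⊎ A b x
    cross-dom {x = x} hw hw′ ne J J′ with dominate x hw J (bU J′)
    ... | eq₁ e = ⊥-elim (ab J′ (≡-sym e))
    ... | eq₂ refl = ⊥-elim (ne (no-share hw hw′ (va J) (va J′) (bU J) (ab J) (vb J) (vb J′)))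
    ... | eq₃ refl = ⊥-elim (ne (no-share hw hw′ (va J) (va J′) (cU J) (ac J) (vc J) (vb J′)))
    ... | ad₁ e = ⊥-elim (ind hw′ dU (bU J′) (va J′) (vb J′) e)
    ... | ad₂ e = inj₁ e
    ... | ad₃ e = inj₂ e

    -- By `cross-dom` in both directions, the bipartite graph between {p₀ , q₀} and {a , b} has no
    -- isolated vertex, hence a perfect matching. The names `p` and `q` are given so that this
    -- matching is p₀ q, q₀ p.
    orient : ∀ {w w′ p₀ q₀} → w ∈ᵖ F → w′ ∈ᵖ F → w ≢ w′ → Is w d p₀ q₀ → A w′ d →
      ∃ λ p → ∃ λ q → Is w′ d p q × A p₀ q × A q₀ p
    orient {w} {w′} {p₀} {q₀} hw hw′ ne J w′d with of₁ hw′ dU w′d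
    ... | a , b , K = go (cross-dom hw′ hw ne′ K J) (cross-dom hw′ hw ne′ K (swap₂₃ J)) (cross-dom hw hw′ ne J K) (cross-dom hw hw′ ne J (swap₂₃ K))
      where
      ne′ : w′ ≢ w
      ne′ e = ne (≡-sym e)
      go : A a p₀ ⊎ A b p₀ → A a q₀ ⊎ A b q₀ → A p₀ a ⊎ A q₀ a → A p₀ b ⊎ A q₀ b → ∃ λ p → ∃ λ q → Is w′ d p q × A p₀ q × A q₀ p
      go (inj₂ bp) _ (inj₂ qa) _ = a , b , K , A-sym bp , qa
      go (inj₂ bp) (inj₁ aq) (inj₁ pa) _ = a , b , K , A-sym bp , A-sym aq
      go (inj₂ bp) (inj₂ bq) (inj₁ pa) _ = b , a , swap₂₃ K , pa , A-sym bq
      go (inj₁ ap) _ _ (inj₂ qb) = b , a , swap₂₃ K , A-sym ap , qb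
      go (inj₁ ap) (inj₂ bq) _ (inj₁ pb) = b , a , swap₂₃ K , A-sym ap , A-sym bq
      go (inj₁ ap) (inj₁ aq) _ (inj₁ pb) = a , b , K , pb , A-sym aq

    private
      module Build {w₀ p₀ q₀ : Fin n} (h₀ : w₀ ∈ᵖ F) (J₀ : Is w₀ d p₀ q₀) (w : Fin 3 → Fin n)
        (hw : ∀ i → w i ∈ᵖ F) (wd : ∀ i → A (w i) d) (w≢₀ : ∀ i → w₀ ≢ w i) (w≢ : ∀ i j → i ≢ j → w i ≢ w j)
        (o : ∀ i → ∃ λ p → ∃ λ q → Is (w i) d p q × A p₀ q × A q₀ p) where
        vv pp qq : Fin 4 → Fin n
        vv fzero = w₀
        vv (fsuc i) = w i
        pp fzero = p₀
        pp (fsuc i) = proj₁ (o i)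
        qq fzero = q₀
        qq (fsuc i) = proj₁ (proj₂ (o i))
        II : ∀ i → Is (vv i) d (pp i) (qq i)
        II fzero = J₀
        II (fsuc i) = proj₁ (proj₂ (proj₂ (o i)))
        hh : ∀ i → vv i ∈ᵖ F
        hh fzero = h₀
        hh (fsuc i) = hw i
        cr : ∀ i j → i ≢ j → A (pp i) (qq j)
        cr fzero fzero ne = ⊥-elim (ne refl)
        cr fzero (fsuc j) ne = proj₁ (proj₂ (proj₂ (proj₂ (o j))))
        cr (fsuc i) fzero ne = A-sym (proj₂ (proj₂ (proj₂ (proj₂ (o i)))))
        cr (fsuc i) (fsuc j) ne with cross-dom (hw j) (hw i) (w≢ j i (λ e → ne (cong fsuc (≡-sym e)))) (II (fsuc j)) (II (fsuc i))
        ... | inj₂ e = A-sym e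
        -- Both `p` vertices are adjacent to `q₀`, so an edge between them would close a triangle.
        ... | inj₁ e = ⊥-elim (tf (cU J₀) (bU (II (fsuc j))) (bU (II (fsuc i))) (proj₂ (proj₂ (proj₂ (proj₂ (o j))))) e (proj₂ (proj₂ (proj₂ (proj₂ (o i))))))
        nn : ∀ i j → i ≢ j → vv i ≢ vv j
        nn fzero fzero ne = λ _ → ne refl
        nn fzero (fsuc j) ne = w≢₀ j
        nn (fsuc i) fzero ne = λ e → w≢₀ i (≡-sym e)
        nn (fsuc i) (fsuc j) ne = w≢ i j (λ e → ne (cong fsuc e))
        result : Crown
        result = record { v = vv ; p = pp ; q = qq ; vF = hh ; I = II ; cross = cr ; v≢ = nn }

    private
      assemble : ∀ {w₀ w₁ w₂ w₃ a b} → w₀ ∈ᵖ (F ∩ adj G d) → w₁ ∈ᵖ (F ∩ adj G d) → w₂ ∈ᵖ (F ∩ adj G d) → w₃ ∈ᵖ (F ∩ adj G d) →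
        All (w₁ ≢_) (w₀ ∷ []) → All (w₂ ≢_) (w₀ ∷ w₁ ∷ []) → All (w₃ ≢_) (w₀ ∷ w₁ ∷ w₂ ∷ []) → Is w₀ d a b → Crown
      assemble {w₀} {w₁} {w₂} {w₃} h₀ h₁ h₂ h₃ (n₁ ∷ []) (n₂ ∷ m₂ ∷ []) (n₃ ∷ m₃ ∷ k₃ ∷ []) J₀ =
        Build.result (∧-fst h₀) J₀ w (λ i → ∧-fst (hw i)) (λ i → A-sym (∧-snd {F (w i)} (hw i))) w≢₀ w≢
          (λ i → orient (∧-fst h₀) (∧-fst (hw i)) (w≢₀ i) J₀ (A-sym (∧-snd {F (w i)} (hw i))))
        where
        w : Fin 3 → Fin n
        w fzero = w₁
        w (fsuc fzero) = w₂
        w (fsuc (fsuc fzero)) = w₃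
        hw : ∀ i → w i ∈ᵖ (F ∩ adj G d)
        hw fzero = h₁
        hw (fsuc fzero) = h₂
        hw (fsuc (fsuc fzero)) = h₃
        w≢₀ : ∀ i → w₀ ≢ w i
        w≢₀ fzero e = n₁ (≡-sym e)
        w≢₀ (fsuc fzero) e = n₂ (≡-sym e)
        w≢₀ (fsuc (fsuc fzero)) e = n₃ (≡-sym e)
        w≢ : ∀ i j → i ≢ j → w i ≢ w j
        w≢ fzero fzero ne _ = ne refl
        w≢ fzero (fsuc fzero) _ e = m₂ (≡-sym e)
        w≢ fzero (fsuc (fsuc fzero)) _ e = m₃ (≡-sym e)
        w≢ (fsuc fzero) fzero _ e = m₂ e
        w≢ (fsuc fzero) (fsuc fzero) ne _ = ne refl
        w≢ (fsuc fzero) (fsuc (fsuc fzero)) _ e = k₃ (≡-sym e)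
        w≢ (fsuc (fsuc fzero)) fzero _ e = m₃ e
        w≢ (fsuc (fsuc fzero)) (fsuc fzero) _ e = k₃ e
        w≢ (fsuc (fsuc fzero)) (fsuc (fsuc fzero)) ne _ = ne refl

    crown : Crown
    crown =
      let (w₀ , h₀ , _)  = avoid (F ∩ adj G d) [] (≤-trans (s≤s z≤n) d≥4)
          (w₁ , h₁ , n₁) = avoid (F ∩ adj G d) (w₀ ∷ []) (≤-trans (s≤s (s≤s z≤n)) d≥4)
          (w₂ , h₂ , n₂) = avoid (F ∩ adj G d) (w₀ ∷ w₁ ∷ []) (≤-trans (n≤1+n 3) d≥4)
          (w₃ , h₃ , n₃) = avoid (F ∩ adj G d) (w₀ ∷ w₁ ∷ w₂ ∷ []) d≥4
          (a , b , J₀)   = of₁ (∧-fst h₀) dU (A-sym (∧-snd {F w₀} h₀))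
      in assemble h₀ h₁ h₂ h₃ n₁ n₂ n₃ J₀

    -- Four members leave three indices beside `i`, and two of these fall under the same
    -- alternative.
    others : ∀ {P Q : Fin 4 → Set} (i : Fin 4) → (∀ j → j ≢ i → P j ⊎ Q j) →
      (∃ λ j → ∃ λ k → j ≢ k × P j × P k) ⊎ (∃ λ j → ∃ λ k → j ≢ k × Q j × Q k)
    others i h = pigeonhole (punchIn i fzero) (punchIn i (fsuc fzero)) (punchIn i (fsuc (fsuc fzero)))
      (λ e → case punchIn-injective i _ _ e of λ ()) (λ e → case punchIn-injective i _ _ e of λ ()) (λ e → case punchIn-injective i _ _ e of λ ())
      (h _ (punchInᵢ≢i i _)) (h _ (punchInᵢ≢i i _)) (h _ (punchInᵢ≢i i _))

    module Side (Cr : Crown) where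
      open Crown Cr

      -- Non-neighbours of d on the side of the p i.
      X : Fin n → Set
      X u = ¬ A d u × d ≢ u × (∀ i → u ≡ p i ⊎ A u (q i))

      pU : ∀ i → p i ∈ᵖ U
      pU i = bU (I i)

      qU : ∀ i → q i ∈ᵖ U
      qU i = cU (I i)

      p-inj : ∀ {i j} → i ≢ j → p i ≢ p j
      p-inj {i} {j} ne e = v≢ i j ne (no-share (vF i) (vF j) (va (I i)) (va (I j)) (pU i) (ab (I i)) (vb (I i)) (subst (A (v j)) (≡-sym e) (vb (I j))))

      p-X : ∀ i → X (p i)
      p-X i = ind (vF i) dU (pU i) (va (I i)) (vb (I i)) , ab (I i) , λ j → case i ≟ j of λ
        { (yes refl) → inj₁ refl ; (no ne) → inj₂ (cross i j ne) }

      X-q : ∀ {u} i → X u → u ≢ p i → A u (q i)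
      X-q i (_ , _ , h) ne with h i
      ... | inj₁ e = ⊥-elim (ne e)
      ... | inj₂ e = e

      X-p : ∀ {u} i → X u → ¬ A u (q i) → u ≡ p i
      X-p i (_ , _ , h) ne with h i
      ... | inj₁ e = e
      ... | inj₂ e = ⊥-elim (ne e)

      -- Adjacent `x` and `y` have no common neighbour `q j`, so for each j one of them equals
      -- `p j`. Over three indices one of them would equal two different vertices.
      X-indep : ∀ {x y} → x ∈ᵖ U → y ∈ᵖ U → X x → X y → ¬ A x y
      X-indep {x} {y} hx hy Xx Xy xy with others {λ j → x ≡ p j} {λ j → y ≡ p j} fzero (λ j _ → f j)
        where
        f : ∀ j → x ≡ p j ⊎ y ≡ p j
        f j with proj₂ (proj₂ Xx) j | proj₂ (proj₂ Xy) j
        ... | inj₁ e | _ = inj₁ e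
        ... | inj₂ _ | inj₁ e = inj₂ e
        ... | inj₂ a | inj₂ b = ⊥-elim (tf hx hy (qU j) xy b a)
      ... | inj₁ (j , k , ne , a , b) = p-inj ne (trans (≡-sym a) b)
      ... | inj₂ (j , k , ne , a , b) = p-inj ne (trans (≡-sym a) b)

      -- A vertex of `X` differs from `p i` or from `p j`, so it is adjacent to `q i` or to `q j`
      -- and would close a triangle with `w`.
      two-q : ∀ {w i j} → w ∈ᵖ U → i ≢ j → A w (q i) → A w (q j) → ∀ x → x ∈ᵖ U → X x → ¬ A w x
      two-q {w} {i} {j} hw ne a b x hx Xx wx with x ≟ p i
      ... | no e = tf hw hx (qU i) wx (X-q i Xx e) a
      ... | yes refl = tf hw hx (qU j) wx (X-q j Xx (p-inj ne)) b

      -- For j ≠ 0, `p j` is adjacent to `q 0`, hence not to `u`, so member j dominates `u` by u = p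
      -- j, by u = q j or through `q j`. In the second case a `p l` with l other than 0 and j closes
      -- a triangle with `q 0` and `q j`.
      X-from-q : ∀ {u} → u ∈ᵖ U → ¬ A d u → d ≢ u → A u (q fzero) → X u
      X-from-q {u} hu ¬du d≢u uq = ¬du , d≢u , go
        where
        go : ∀ j → u ≡ p j ⊎ A u (q j)
        go j with fzero ≟ j
        ... | yes refl = inj₂ uq
        ... | no ne with dominate u (vF j) (I j) hu
        ...   | eq₁ e = ⊥-elim (d≢u (≡-sym e))
        ...   | eq₂ e = inj₁ e
        ...   | ad₁ e = ⊥-elim (¬du e)
        ...   | ad₂ e = ⊥-elim (tf (pU j) (qU fzero) hu (cross j fzero (λ e′ → ne (≡-sym e′))) (A-sym uq) e)
        ...   | ad₃ e = inj₂ (A-sym e)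
        ...   | eq₃ refl = ⊥-elim (third (punchIn fzero fzero) (punchIn fzero (fsuc fzero)) (λ ()) (λ ()) (λ ()))
          where
          bad : ∀ l → l ≢ fzero → l ≢ j → ⊥
          bad l l0 lj = tf (pU l) (qU fzero) (qU j) (cross l fzero l0) (A-sym uq) (cross l j lj)
          third : ∀ l m → l ≢ m → l ≢ fzero → m ≢ fzero → ⊥
          third l m lm l0 m0 with l ≟ j
          ... | no lj = bad l l0 lj
          ... | yes refl = bad m m0 (λ e → lm (≡-sym e))

      Xᵇ : Pred n
      Xᵇ u = not (adj G d u) ∧ (not ⌊ d ≟ u ⌋ ∧ ⌊ all? (λ i → (u ≟ p i) ⊎-dec (adj G u (q i) ≟ᵇ true)) ⌋)

      Xᵇ-elim : ∀ {u} → u ∈ᵖ Xᵇ → X u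
      Xᵇ-elim {u} h = (λ e → t≢f e (not-elim (∧-fst h))) ,
        ⌊⌋-refute (d ≟ u) (not-elim (∧-fst (∧-snd {not (adj G d u)} h))) ,
        ⌊⌋-elim (all? (λ i → (u ≟ p i) ⊎-dec (adj G u (q i) ≟ᵇ true))) (∧-snd {not ⌊ d ≟ u ⌋} (∧-snd {not (adj G d u)} h))

      Xᵇ-intro : ∀ {u} → X u → u ∈ᵖ Xᵇ
      Xᵇ-intro {u} (a , b , c) = ∧-intro (not-intro (¬t⇒f a)) (∧-intro (not-intro (⌊⌋-false (d ≟ u) b))
        (⌊⌋-intro (all? (λ i → (u ≟ p i) ⊎-dec (adj G u (q i) ≟ᵇ true))) c))

    -- The complement of `P` in `U` is independent, so by `determined` different members have
    -- different traces on `P`; only 1 + |P| traces have at most one vertex.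
    trace : (P : Pred n) → P ⊆ᵖ U → (∀ y z → P y ≡ false → P z ≡ false → y ∈ᵖ U → z ∈ᵖ U → A y z → ⊥) →
      count (λ v → F v ∧ ⌊ degIn G P v ≤? 1 ⌋) ≤ 1 + count P
    trace P P⊆U indep = ≤-trans (count-union {F = F₁} {F₀} P K split) (+-mono-≤ F₀≤1
        (≤-trans (sum-≤-count* P (count ∘ K) 1 K≤1) (≤-reflexive (*-identityʳ (count P)))))
      where
      F₁ F₀ : Pred n
      F₁ v = F v ∧ ⌊ degIn G P v ≤? 1 ⌋
      F₀ v = F v ∧ ⌊ degIn G P v ≤? 0 ⌋
      K : Fin n → Pred n
      K a v = F₁ v ∧ adj G v a
      split : ∀ v → v ∈ᵖ F₁ → v ∈ᵖ F₀ ⊎ (∃ λ a → a ∈ᵖ P × v ∈ᵖ K a)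
      split v h with degIn G P v ≤? 0
      ... | yes _ = inj₁ (∧-intro (∧-fst h) refl)
      ... | no ¬le with count-inhabited {F = P ∩ adj G v} (≰⇒> ¬le)
      ...   | a , e = inj₂ (a , ∧-fst e , ∧-intro h (∧-snd {P a} e))
      det : ∀ {u v} → u ∈ᵖ F → v ∈ᵖ F → (∀ y → y ∈ᵖ P → adj G u y ≡ adj G v y) → u ≡ v
      det hu hv h = determined (λ y → P y ≡ false) indep hu hv λ y _ → case Bool-dichotomy (P y) of λ
        { (inj₁ e) → inj₂ (h y e) ; (inj₂ e) → inj₁ e }
      F₀≤1 : count F₀ ≤ 1
      F₀≤1 = count-≤1 λ u v hu hv → det (∧-fst hu) (∧-fst hv) λ y hy → trans (none u hu y hy) (≡-sym (none v hv y hy))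
        where
        none : ∀ v → v ∈ᵖ F₀ → ∀ y → y ∈ᵖ P → adj G v y ≡ false
        none v hv y hy = degIn-0⇒ G {P} {v} (n≤0⇒n≡0 (⌊⌋-elim (degIn G P v ≤? 0) (∧-snd {F v} hv))) hy
      K≤1 : ∀ a → a ∈ᵖ P → count (K a) ≤ 1
      K≤1 a ha = count-≤1 λ u v hu hv → det (∧-fst (∧-fst hu)) (∧-fst (∧-fst hv)) λ y hy → eq hu hv y hy
        where
        rest : ∀ {v} → v ∈ᵖ K a → ∀ y → y ∈ᵖ P → y ≢ a → adj G v y ≡ false
        rest {v} hv y hy ne = degIn-0⇒ G {P except a} {v} (n≤0⇒n≡0 (≤-pred (≤-trans
          (≤-reflexive (≡-sym (degIn-except G P v a ha (∧-snd {F₁ v} hv)))) (⌊⌋-elim (degIn G P v ≤? 1) (∧-snd {F v} (∧-fst hv))))))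
          (except-intro {U = P} hy ne)
        eq : ∀ {u v} → u ∈ᵖ K a → v ∈ᵖ K a → ∀ y → y ∈ᵖ P → adj G u y ≡ adj G v y
        eq {u} {v} hu hv y hy with y ≟ a
        ... | yes refl = trans (∧-snd {F₁ u} hu) (≡-sym (∧-snd {F₁ v} hv))
        ... | no ne = trans (rest hu y hy ne) (≡-sym (rest hv y hy ne))

    -- N ≤ |U| + 2 when the induced graph is bipartite.
    bipartite : (P : Pred n) → P ⊆ᵖ U → (∀ y z → y ∈ᵖ P → z ∈ᵖ P → A y z → ⊥) →
      (∀ y z → P y ≡ false → P z ≡ false → y ∈ᵖ U → z ∈ᵖ U → A y z → ⊥) → ⊥
    bipartite P P⊆U i₁ i₂ = <-irrefl refl (≤-trans big (≤-trans (count-cover {F = F} {H₁} {H₂} split)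
        (≤-trans (+-mono-≤ (trace P P⊆U i₂) (trace Q Q⊆U i₂′)) (≤-trans (≤-reflexive (lem (count P) (count Q)))
          (≤-trans (≤-reflexive (cong (_+ 2) (≡-sym pq))) (+-monoʳ-≤ (count U) {2} {64} (s≤s (s≤s z≤n))))))))
      where
      Q H₁ H₂ : Pred n
      Q y = U y ∧ not (P y)
      H₁ v = F v ∧ ⌊ degIn G P v ≤? 1 ⌋
      H₂ v = F v ∧ ⌊ degIn G Q v ≤? 1 ⌋
      Q⊆U : Q ⊆ᵖ U
      Q⊆U y h = ∧-fst h
      lem : ∀ a b → 1 + a + (1 + b) ≡ a + b + 2
      lem = solve-∀
      UP : ∀ y → U y ∧ P y ≡ P y
      UP y with Bool-dichotomy (P y)
      ... | inj₁ e rewrite e | P⊆U y e = refl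
      ... | inj₂ e rewrite e = ∧-comm (U y) false
      pq : count U ≡ count P + count Q
      pq = trans (count-split U P) (cong (_+ count Q) (count-cong UP))
      i₂′ : ∀ y z → Q y ≡ false → Q z ≡ false → y ∈ᵖ U → z ∈ᵖ U → A y z → ⊥
      i₂′ y z a b hy hz = i₁ y z (∉Q⇒∈P y hy a) (∉Q⇒∈P z hz b)
        where
        ∉Q⇒∈P : ∀ y → y ∈ᵖ U → Q y ≡ false → y ∈ᵖ P
        ∉Q⇒∈P y hy e with Bool-dichotomy (P y)
        ... | inj₁ e′ = e′
        ... | inj₂ e′ = ⊥-elim (t≢f (∧-intro hy (not-intro e′)) e)
      -- A 3-set has at most one vertex on one of the two sides.
      split : ∀ v → v ∈ᵖ F → v ∈ᵖ H₁ ⊎ v ∈ᵖ H₂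
      split v hv with degIn G P v ≤? 1
      ... | yes _ = inj₁ (∧-intro hv refl)
      ... | no ¬le = inj₂ (∧-intro hv (⌊⌋-intro (degIn G Q v ≤? 1) (+-cancelˡ-≤ 2 (degIn G Q v) 1
              (≤-trans (+-monoˡ-≤ (degIn G Q v) (≰⇒> ¬le)) (≤-reflexive (trans (≡-sym (trans (count-split (U ∩ adj G v) P)
                (cong₂ _+_ (count-cong λ y → pt₁ y) (count-cong λ y → pt₂ (U y) (adj G v y) (not (P y)))))) (size hv)))))))
        where
        pt₂ : ∀ a b c → (a ∧ b) ∧ c ≡ (a ∧ c) ∧ b
        pt₂ false b c = refl
        pt₂ true b c = ∧-comm b c
        pt₁ : ∀ y → (U y ∧ adj G v y) ∧ P y ≡ P y ∧ adj G v y
        pt₁ y = trans (pt₂ (U y) (adj G v y) (P y)) (cong (_∧ adj G v y) (UP y))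

-- The vertex classes of a crown, and the case where all of N(d) sees X.

module _ {n : ℕ} (G : SimpleGraph n) where

  module CrownCases {F U : Pred n} (S : TriSys G F U) (big : count U + 64 < count F)
    (irr : ∀ V → V ⊆ᵖ U → 1 ≤ count V → count V < count (F ∩ meets G V))
    {d : Fin n} (dU : d ∈ᵖ U) (d≥4 : 4 ≤ weight G F d) where
    open TriSys S
    open Irreducible G S big irr
    open AtHeavy dU d≥4
    open Crowns G S big irr dU d≥4
    open Is

    NoX : Crown → Fin n → Set
    NoX Cr u = ∀ x → x ∈ᵖ U → Side.X Cr x → ¬ A u x

    module WithCrown (Cr : Crown) where
      open Crown Cr public
      open Side Cr public
      module Yˢ = Side (flip Cr)

      Y : Fin n → Set
      Y = Yˢ.X

      NoY : Fin n → Set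
      NoY = NoX (flip Cr)

      -- N(d), `X` and `Y` are independent, so the sides d ∪ X and N(d) ∪ Y show the graph to be
      -- bipartite unless some edge joins N(d) to `Y`; this is `caseA`. By symmetry an edge must
      -- also join N(d) to `X`.
      data Kind (u : Fin n) : Set where
        isD : u ≡ d → Kind u
        isI : A d u → Kind u
        isX : X u → Kind u
        isY : Y u → Kind u

      kind : ∀ u → u ∈ᵖ U → Kind u
      kind u hu with d ≟ u | Bool-dichotomy (adj G d u)
      ... | yes e | _ = isD (≡-sym e)
      ... | no _ | inj₁ e = isI e
      ... | no ne | inj₂ e with dominate u (vF fzero) (I fzero) hu
      ...   | eq₁ e′ = isD e′
      ...   | eq₂ refl = isX (p-X fzero)
      ...   | eq₃ refl = isY (Yˢ.p-X fzero)
      ...   | ad₁ e′ = isI e′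
      ...   | ad₂ e′ = isY (Yˢ.X-from-q hu (λ a → t≢f a e) ne (A-sym e′))
      ...   | ad₃ e′ = isX (X-from-q hu (λ a → t≢f a e) ne (A-sym e′))

      ¬dp : ∀ i → ¬ A d (p i)
      ¬dp i = proj₁ (p-X i)

      ¬dq : ∀ i → ¬ A d (q i)
      ¬dq i = proj₁ (Yˢ.p-X i)

      I-≢p : ∀ {u} i → A d u → u ≢ p i
      I-≢p i du refl = ¬dp i du

      I-≢q : ∀ {u} i → A d u → u ≢ q i
      I-≢q i du refl = ¬dq i du

      p≢q : ∀ i → p i ≢ q i
      p≢q i = bc (I i)

      member-p : ∀ {w} i → w ∈ᵖ F → w ≢ v i → A w (p i) → ¬ A w d × (∃ λ u → ∃ λ z → Is w u (p i) z × A d u)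
      member-p {w} i hw ne wp = ¬wd , found (dom hw dU (¬t⇒f ¬wd))
        where
        ¬wd : ¬ A w d
        ¬wd wd = ne (no-share hw (vF i) wd (va (I i)) (pU i) (ab (I i)) wp (vb (I i)))
        found : (∃ λ z → z ∈ᵖ U × A w z × A z d) → ∃ λ u → ∃ λ z → Is w u (p i) z × A d u
        found (u , hu , wu , ud) = let (z , J) = of₂ hw hu (pU i) wu wp (I-≢p i (A-sym ud)) in u , z , J , A-sym ud

      Through : Fin 4 → Fin n → Set
      Through i w = ∃ λ u → Is w u (p i) (q i) × A d u

      through-unique : ∀ {i w w′} → w ∈ᵖ F → w′ ∈ᵖ F → Through i w → Through i w′ → w ≡ w′
      through-unique {i} hw hw′ (u , J , du) (u′ , J′ , du′) with dominate u′ hw J (aU J′)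
      ... | eq₁ refl = same hw hw′ J (va J′) (vb J′) (vc J′)
      ... | eq₂ e = ⊥-elim (I-≢p i du′ e)
      ... | eq₃ e = ⊥-elim (I-≢q i du′ e)
      ... | ad₁ e = ⊥-elim (nbr-d-indep (aU J) (aU J′) du du′ e)
      ... | ad₂ e = ⊥-elim (ind hw′ (pU i) (aU J′) (vb J′) (va J′) e)
      ... | ad₃ e = ⊥-elim (ind hw′ (qU i) (aU J′) (vc J′) (va J′) e)

      p-dominated : ∀ {w u z} i → w ∈ᵖ F → Is w u (p i) z → A d u → ∀ j → j ≢ i → p j ≡ z ⊎ A u (p j) ⊎ A z (p j)
      p-dominated i hw J du j ne with dominate (p j) hw J (pU j)
      ... | eq₁ e = ⊥-elim (I-≢p j du (≡-sym e))
      ... | eq₂ e = ⊥-elim (p-inj ne e)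
      ... | eq₃ e = inj₁ e
      ... | ad₁ e = inj₂ (inj₁ e)
      ... | ad₂ e = ⊥-elim (X-indep (pU i) (pU j) (p-X i) (p-X j) e)
      ... | ad₃ e = inj₂ (inj₂ e)

      p-dominated-I : ∀ {w u z} i → w ∈ᵖ F → Is w u (p i) z → A d u → A d z → ∀ j → j ≢ i → A u (p j) ⊎ A z (p j)
      p-dominated-I i hw J du dz j ne with p-dominated i hw J du j ne
      ... | inj₁ e = ⊥-elim (I-≢p j dz (≡-sym e))
      ... | inj₂ e = e

      p-dominated-X : ∀ {w u z} i → w ∈ᵖ F → Is w u (p i) z → A d u → X z → ∃ λ j → ∃ λ k → j ≢ k × A u (p j) × A u (p k)
      p-dominated-X {u = u} {z} i hw J du Xz with others {λ j → A u (p j)} {λ j → p j ≡ z} i f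
        where
        f : ∀ j → j ≢ i → A u (p j) ⊎ p j ≡ z
        f j ne with p-dominated i hw J du j ne
        ... | inj₁ e = inj₂ e
        ... | inj₂ (inj₁ e) = inj₁ e
        ... | inj₂ (inj₂ e) = ⊥-elim (X-indep (cU J) (pU j) Xz (p-X j) e)
      ... | inj₁ two = two
      ... | inj₂ (j , k , ne , a , b) = ⊥-elim (p-inj ne (trans a (≡-sym b)))

      two-p⇒NoY : ∀ {u} → u ∈ᵖ U → (∃ λ j → ∃ λ k → j ≢ k × A u (p j) × A u (p k)) → NoY u
      two-p⇒NoY hu (j , k , ne , a , b) = Yˢ.two-q hu ne a b

      two-q⇒NoX : ∀ {u} → u ∈ᵖ U → (∃ λ j → ∃ λ k → j ≢ k × A u (q j) × A u (q k)) → NoX Cr u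
      two-q⇒NoX hu (j , k , ne , a , b) = two-q hu ne a b

      caseA : (∀ u y → u ∈ᵖ U → y ∈ᵖ U → A d u → Y y → ¬ A u y) → ⊥
      caseA h = bipartite P (λ y e → ∧-fst e) (λ y z hy hz → i₁ (cls hy) (cls hz) (∧-fst hy) (∧-fst hz))
          (λ y z hy hz yU zU → i₂ (kind y yU) (kind z zU) hy hz yU zU)
        where
        P : Pred n
        P u = U u ∧ (⌊ d ≟ u ⌋ ∨ Xᵇ u)
        cls : ∀ {u} → u ∈ᵖ P → d ≡ u ⊎ X u
        cls {u} e with ∨-elim {⌊ d ≟ u ⌋} (∧-snd {U u} e)
        ... | inj₁ a = inj₁ (⌊⌋-elim (d ≟ u) a)
        ... | inj₂ a = inj₂ (Xᵇ-elim a)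
        i₁ : ∀ {y z} → d ≡ y ⊎ X y → d ≡ z ⊎ X z → y ∈ᵖ U → z ∈ᵖ U → A y z → ⊥
        i₁ (inj₁ refl) (inj₁ refl) _ _ e = t≢f e (irrefl G d)
        i₁ (inj₁ refl) (inj₂ Xz) _ _ e = proj₁ Xz e
        i₁ (inj₂ Xy) (inj₁ refl) _ _ e = proj₁ Xy (A-sym e)
        i₁ (inj₂ Xy) (inj₂ Xz) hy hz e = X-indep hy hz Xy Xz e
        ¬d : ∀ {y} → P y ≡ false → y ∈ᵖ U → y ≡ d → ⊥
        ¬d {y} e hy refl = t≢f (∧-intro hy (∨-introˡ (⌊⌋-intro (d ≟ d) refl))) e
        ¬X : ∀ {y} → P y ≡ false → y ∈ᵖ U → X y → ⊥
        ¬X {y} e hy Xy = t≢f (∧-intro hy (∨-introʳ {⌊ d ≟ y ⌋} (Xᵇ-intro Xy))) e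
        i₂ : ∀ {y z} → Kind y → Kind z → P y ≡ false → P z ≡ false → y ∈ᵖ U → z ∈ᵖ U → A y z → ⊥
        i₂ (isD e) _ py _ hy _ _ = ¬d py hy e
        i₂ (isX e) _ py _ hy _ _ = ¬X py hy e
        i₂ _ (isD e) _ pz _ hz _ = ¬d pz hz e
        i₂ _ (isX e) _ pz _ hz _ = ¬X pz hz e
        i₂ (isI a) (isI b) _ _ hy hz e = nbr-d-indep hy hz a b e
        i₂ (isI a) (isY b) _ _ hy hz e = h _ _ hy hz a b e
        i₂ (isY a) (isI b) _ _ hy hz e = h _ _ hz hy b a (A-sym e)
        i₂ (isY a) (isY b) _ _ hy hz e = Yˢ.X-indep hy hz a b e

    Flipped : (Cr : Crown) → ∀ {i w} → WithCrown.Through (flip Cr) i w → WithCrown.Through Cr i w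
    Flipped Cr (u , J , du) = u , swap₂₃ J , du

    module CaseC (Cr : Crown) (noβ : ∀ u → u ∈ᵖ U → A d u → NoX Cr u → ⊥) where
      open WithCrown Cr
      module Fl = WithCrown (flip Cr)

      -- A third vertex in `X` is not adjacent to `q i`, so it is `p i`. A third vertex in `Y` or in
      -- N(d) would force some vertex of N(d) in T w to be adjacent to two of the `q j`, and so to
      -- have no neighbour in `X`, against `noβ`.
      through-q : ∀ {w} i → w ∈ᵖ F → w ≢ v i → A w (q i) → Through i w
      through-q {w} i hw ne wq = go (proj₂ (Fl.member-p i hw ne wq))
        where
        by-kind : ∀ {u z} → Is w u (q i) z → A d u → Kind z → Through i w
        by-kind J du (isD refl) = ⊥-elim (proj₁ (Fl.member-p i hw ne wq) (vc J))
        by-kind J du (isX Xz) = _ , swap₂₃ (subst (Is w _ (q i)) (X-p i Xz (λ e → ind hw (cU J) (bU J) (vc J) (vb J) e)) J) , du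
        by-kind J du (isY Yz) = ⊥-elim (noβ _ (aU J) du (two-q⇒NoX (aU J) (Fl.p-dominated-X i hw J du Yz)))
        by-kind J du (isI dz) with others i (Fl.p-dominated-I i hw J du dz)
        ... | inj₁ two = ⊥-elim (noβ _ (aU J) du (two-q⇒NoX (aU J) two))
        ... | inj₂ two = ⊥-elim (noβ _ (cU J) dz (two-q⇒NoX (cU J) two))
        go : (∃ λ u → ∃ λ z → Is w u (q i) z × A d u) → Through i w
        go (u , z , J , du) = by-kind J du (kind z (cU J))

      -- If the third vertex is in `X`, then u is adjacent to two of the `p j` and sees nothing of
      -- `Y`. If it were in N(d), one of the two vertices of N(d) would see nothing of `Y`; the
      -- other would then have to dominate `q i` and so see nothing of `X`, against `noβ`.
      no-Y-nbr : ∀ {w} i → w ∈ᵖ F → w ≢ v i → A w (p i) → ¬ A w (q i) → ∃ λ u → u ∈ᵖ U × A w u × A d u × NoY u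
      no-Y-nbr {w} i hw ne wp ¬wq = go (proj₂ (member-p i hw ne wp))
        where
        q-dominated : ∀ {u z} → Is w u (p i) z → A d u → A u (q i) ⊎ A z (q i)
        q-dominated J du with dominate (q i) hw J (qU i)
        ... | eq₁ e = ⊥-elim (I-≢q i du (≡-sym e))
        ... | eq₂ e = ⊥-elim (p≢q i (≡-sym e))
        ... | eq₃ refl = ⊥-elim (¬wq (vc J))
        ... | ad₁ e = inj₁ e
        ... | ad₂ e = ⊥-elim (ind (vF i) (pU i) (qU i) (vb (I i)) (vc (I i)) e)
        ... | ad₃ e = inj₂ e
        clash : ∀ {u z} → Is w u (p i) z → A d u → A d z → NoY u → A z (q i) → ⊥
        clash {u} {z} J du dz _ zq = noβ z (cU J) dz λ x hx Xx zx → ind hw (cU J) (pU i) (vc J) wp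
          (subst (A z) (X-p i Xx (λ xq → tf (cU J) hx (qU i) zx xq zq)) zx)
        by-kind : ∀ {u z} → Is w u (p i) z → A d u → Kind z → ∃ λ u → u ∈ᵖ U × A w u × A d u × NoY u
        by-kind J du (isD refl) = ⊥-elim (proj₁ (member-p i hw ne wp) (vc J))
        by-kind J du (isX Xz) = _ , aU J , va J , du , two-p⇒NoY (aU J) (p-dominated-X i hw J du Xz)
        by-kind J du (isY Yz) = ⊥-elim (¬wq (subst (A w) (Yˢ.X-p i Yz (λ e → ind hw (cU J) (bU J) (vc J) (vb J) e)) (vc J)))
        by-kind J du (isI dz) with others i (p-dominated-I i hw J du dz) | q-dominated J du
        ... | inj₁ two | inj₁ uq = ⊥-elim (two-p⇒NoY (aU J) two (q i) (qU i) (Yˢ.p-X i) uq)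
        ... | inj₁ two | inj₂ zq = ⊥-elim (clash J du dz (two-p⇒NoY (aU J) two) zq)
        ... | inj₂ two | inj₂ zq = ⊥-elim (two-p⇒NoY (cU J) two (q i) (qU i) (Yˢ.p-X i) zq)
        ... | inj₂ two | inj₁ uq = ⊥-elim (clash (swap₁₂ (swap₂₃ (swap₁₂ J))) dz du (two-p⇒NoY (cU J) two) uq)
        go : (∃ λ u → ∃ λ z → Is w u (p i) z × A d u) → ∃ λ u → u ∈ᵖ U × A w u × A d u × NoY u
        go (u , z , J , du) = by-kind J du (kind z (cU J))

      Alone : Fin 4 → Set
      Alone i = ∃ λ k → ∃ λ u → k ∈ᵖ F × Is k u (p i) (q i) × A d u × NoY u

      -- `more` yields a second member k through `q i`, then a third member w through `p i` or
      -- `q i`. By `through-unique`, w avoids `q i`, so it contains a vertex of N(d) without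
      -- neighbours in `Y`. That vertex can be dominated by k only by lying in it.
      alone : ∀ i → Alone i
      alone i = step₁ (more (q i ∷ []) ([] ∷ []) (qU i ∷ []) ≤-refl (v i ∷ []) ≤-refl)
        where
        step₃ : ∀ {k u w u′} → k ∈ᵖ F → Is k u (p i) (q i) → A d u → w ∈ᵖ F → A w (p i) →
                u′ ∈ᵖ U → A w u′ → A d u′ → NoY u′ → Alone i
        step₃ {u′ = u′} hk J du hw wp hu′ wu′ du′ ny with dominate u′ hk J hu′
        ... | eq₁ refl = _ , _ , hk , J , du , ny
        ... | eq₂ e = ⊥-elim (I-≢p i du′ e)
        ... | eq₃ e = ⊥-elim (I-≢q i du′ e)
        ... | ad₁ e = ⊥-elim (nbr-d-indep (aU J) hu′ du du′ e)
        ... | ad₂ e = ⊥-elim (ind hw (pU i) hu′ wp wu′ e)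
        ... | ad₃ e = ⊥-elim (ny (q i) (qU i) (Yˢ.p-X i) (A-sym e))
        step₂ : ∀ {k u} → k ∈ᵖ F → Is k u (p i) (q i) → A d u →
          (∃ λ w → w ∈ᵖ F × (∃ λ a → a ∈ (p i ∷ q i ∷ []) × A w a) × All (w ≢_) (v i ∷ k ∷ [])) → Alone i
        step₂ {k} {u} hk J du (w , hw , (a , m , wa) , (w≢v ∷ w≢k ∷ [])) = dec (Bool-dichotomy (adj G w (q i)))
          where
          wp : adj G w (q i) ≡ false → ∀ {a} → a ∈ (p i ∷ q i ∷ []) → A w a → A w (p i)
          wp _ (here refl) e = e
          wp nq (there (here refl)) e = ⊥-elim (t≢f e nq)
          dec : A w (q i) ⊎ adj G w (q i) ≡ false → Alone i
          dec (inj₁ wq) = ⊥-elim (w≢k (through-unique hw hk (through-q i hw w≢v wq) (u , J , du)))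
          dec (inj₂ nq) = let (u′ , hu′ , wu′ , du′ , ny) = no-Y-nbr i hw w≢v (wp nq m wa) (λ e → t≢f e nq)
                          in step₃ hk J du hw (wp nq m wa) hu′ wu′ du′ ny
        step₁ : (∃ λ w → w ∈ᵖ F × (∃ λ a → a ∈ (q i ∷ []) × A w a) × All (w ≢_) (v i ∷ [])) → Alone i
        step₁ (k , hk , (_ , here refl , kq) , (k≢v ∷ [])) = let (u , J , du) = through-q i hk k≢v kq in
          step₂ hk J du (more (p i ∷ q i ∷ []) ((p≢q i ∷ []) ∷ [] ∷ []) (pU i ∷ qU i ∷ []) (s≤s z≤n) (v i ∷ k ∷ []) ≤-refl)

      -- Each `Alone` member must dominate `u₀` through `p i` or `q i`. Two of the `p i` exclude
      -- neighbours in `Y`, two of the `q i` exclude neighbours in `X`.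
      caseC : ∀ u y → u ∈ᵖ U → y ∈ᵖ U → A d u → Y y → ¬ A u y
      caseC u₀ y₀ hu hy du Yy uy = finish (others fzero (λ i _ → f i (alone i)))
        where
        f : ∀ i → Alone i → A u₀ (p i) ⊎ A u₀ (q i)
        f i (k , u , hk , J , du′ , ny) with dominate u₀ hk J hu
        ... | eq₁ refl = ⊥-elim (ny y₀ hy Yy uy)
        ... | eq₂ e = ⊥-elim (I-≢p i du e)
        ... | eq₃ e = ⊥-elim (I-≢q i du e)
        ... | ad₁ e = ⊥-elim (nbr-d-indep (aU J) hu du′ du e)
        ... | ad₂ e = inj₁ (A-sym e)
        ... | ad₃ e = inj₂ (A-sym e)
        finish : (∃ λ j → ∃ λ k → j ≢ k × A u₀ (p j) × A u₀ (p k)) ⊎ (∃ λ j → ∃ λ k → j ≢ k × A u₀ (q j) × A u₀ (q k)) → ⊥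
        finish (inj₁ two) = two-p⇒NoY hu two y₀ hy Yy uy
        finish (inj₂ two) = noβ u₀ hu du (two-q⇒NoX hu two)

      contradiction : ⊥
      contradiction = caseA caseC

-- The case where vertices of N(d) miss X and miss Y.

module _ {n : ℕ} (G : SimpleGraph n) where

  module CaseB {F U : Pred n} (S : TriSys G F U) (big : count U + 64 < count F)
    (irr : ∀ V → V ⊆ᵖ U → 1 ≤ count V → count V < count (F ∩ meets G V))
    {d : Fin n} (dU : d ∈ᵖ U) (d≥4 : 4 ≤ weight G F d) where
    open TriSys S
    open Irreducible G S big irr
    open AtHeavy dU d≥4
    open Crowns G S big irr dU d≥4
    open CrownCases G S big irr dU d≥4
    open Is

    module Half (Cr : Crown) {u₀ : Fin n} (u₀U : u₀ ∈ᵖ U) (du₀ : A d u₀) (noX : NoX Cr u₀) where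
      open WithCrown Cr

      Special : Fin 4 → Fin n → Fin n → Set
      Special i w u = w ∈ᵖ F × Is w u u₀ (p i) × A d u × NoY u × (∀ x → x ∈ᵖ U → X x → x ≢ p i → A u x)

      -- `u₀` has no neighbours in N(d) or in `X`, so a member within N(d) ∪ X can dominate it only
      -- by containing it. A third vertex in `Y` is not adjacent to `q i`, hence equals `q i`.
      special : ∀ {w} i → w ∈ᵖ F → w ≢ v i → A w (p i) → Through i w ⊎ ∃ (Special i w)
      special {w} i hw ne wp = go (proj₂ (member-p i hw ne wp))
        where
        full : ∀ {u} → Is w u (p i) u₀ → A d u → ∀ x → x ∈ᵖ U → X x → x ≢ p i → A u x
        full J du x hx Xx x≢p with dominate x hw J hx
        ... | eq₁ refl = ⊥-elim (proj₁ Xx du)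
        ... | eq₂ e = ⊥-elim (x≢p e)
        ... | eq₃ refl = ⊥-elim (proj₁ Xx du₀)
        ... | ad₁ e = e
        ... | ad₂ e = ⊥-elim (X-indep (pU i) hx (p-X i) Xx e)
        ... | ad₃ e = ⊥-elim (noX x hx Xx e)
        mk : ∀ {u} → Is w u (p i) u₀ → A d u → Special i w u
        mk {u} J du = hw , swap₂₃ J , du , two-p⇒NoY (aU J) (punchIn i fzero , punchIn i (fsuc fzero) ,
            (λ e → case punchIn-injective i _ _ e of λ ()) , at fzero , at (fsuc fzero)) , full J du
          where
          at : ∀ j → A u (p (punchIn i j))
          at j = full J du (p (punchIn i j)) (pU _) (p-X _) (p-inj (punchInᵢ≢i i j))
        by-kind : ∀ {u z} → Is w u (p i) z → A d u → Kind z → Through i w ⊎ ∃ (Special i w)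
        by-kind J du (isD refl) = ⊥-elim (proj₁ (member-p i hw ne wp) (vc J))
        by-kind J du (isY Yz) = inj₁ (_ , subst (Is w _ (p i)) (Yˢ.X-p i Yz (λ e → ind hw (cU J) (bU J) (vc J) (vb J) e)) J , du)
        by-kind {u} {z} J du (isX Xz) with dominate u₀ hw J u₀U
        ... | eq₁ refl = let (j , _ , _ , uj , _) = p-dominated-X i hw J du Xz in ⊥-elim (noX (p j) (pU j) (p-X j) uj)
        ... | eq₂ e = ⊥-elim (I-≢p i du₀ e)
        ... | eq₃ refl = ⊥-elim (proj₁ Xz du₀)
        ... | ad₁ e = ⊥-elim (nbr-d-indep (aU J) u₀U du du₀ e)
        ... | ad₂ e = ⊥-elim (noX (p i) (pU i) (p-X i) (A-sym e))
        ... | ad₃ e = ⊥-elim (noX z (cU J) Xz (A-sym e))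
        by-kind {u} {z} J du (isI dz) with dominate u₀ hw J u₀U
        ... | eq₁ refl = inj₂ (z , mk (swap₁₂ (swap₂₃ (swap₁₂ J))) dz)
        ... | eq₂ e = ⊥-elim (I-≢p i du₀ e)
        ... | eq₃ refl = inj₂ (u , mk J du)
        ... | ad₁ e = ⊥-elim (nbr-d-indep (aU J) u₀U du du₀ e)
        ... | ad₂ e = ⊥-elim (noX (p i) (pU i) (p-X i) (A-sym e))
        ... | ad₃ e = ⊥-elim (nbr-d-indep (cU J) u₀U dz du₀ e)
        go : (∃ λ u → ∃ λ z → Is w u (p i) z × A d u) → Through i w ⊎ ∃ (Special i w)
        go (u , z , J , du) = by-kind J du (kind z (cU J))

    module Both (Cr : Crown) {u₀ u₁ : Fin n} (u₀U : u₀ ∈ᵖ U) (du₀ : A d u₀) (noX : NoX Cr u₀)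
      (u₁U : u₁ ∈ᵖ U) (du₁ : A d u₁) (noY : NoX (flip Cr) u₁) where
      open WithCrown Cr
      module Hp = Half Cr u₀U du₀ noX
      module Hq = Half (flip Cr) u₁U du₁ noY

      Fiveᵖ Fiveᵠ : Fin 4 → Set
      Fiveᵖ i = ∃ λ w → ∃ (Hp.Special i w)
      Fiveᵠ i = ∃ λ w → ∃ (Hq.Special i w)

      classify : ∀ {w a} i → w ∈ᵖ F → w ≢ v i → a ∈ (p i ∷ q i ∷ []) → A w a → Through i w ⊎ (Fiveᵖ i ⊎ Fiveᵠ i)
      classify i hw ne (here refl) wa with Hp.special i hw ne wa
      ... | inj₁ t = inj₁ t
      ... | inj₂ s = inj₂ (inj₁ (_ , s))
      classify i hw ne (there (here refl)) wa with Hq.special i hw ne wa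
      ... | inj₁ t = inj₁ (Flipped Cr t)
      ... | inj₂ s = inj₂ (inj₂ (_ , s))

      More : Fin 4 → List (Fin n) → Set
      More i xs = ∃ λ w → w ∈ᵖ F × (∃ λ a → a ∈ (p i ∷ q i ∷ []) × A w a) × All (w ≢_) xs

      more-pq : ∀ i xs → length xs ≤ 2 → More i xs
      more-pq i xs le = more (p i ∷ q i ∷ []) ((p≢q i ∷ []) ∷ [] ∷ []) (pU i ∷ qU i ∷ []) (s≤s z≤n) xs le

      -- By `more`, at least three members meet {p i , q i}. One is `v i` and at most one is
      -- `Through`, so one is special on either side.
      five : ∀ i → Fiveᵖ i ⊎ Fiveᵠ i
      five i = step₁ (more-pq i (v i ∷ []) (s≤s z≤n))
        where
        step₂ : ∀ {w} → w ∈ᵖ F → Through i w → More i (v i ∷ w ∷ []) → Fiveᵖ i ⊎ Fiveᵠ i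
        step₂ hw t (w′ , hw′ , (a , m , wa) , (ne ∷ ne′ ∷ [])) with classify i hw′ ne m wa
        ... | inj₁ t′ = ⊥-elim (ne′ (through-unique hw′ hw t′ t))
        ... | inj₂ s = s
        step₁ : More i (v i ∷ []) → Fiveᵖ i ⊎ Fiveᵠ i
        step₁ (w , hw , (a , m , wa) , (ne ∷ [])) with classify i hw ne m wa
        ... | inj₂ s = s
        ... | inj₁ t = step₂ hw t (more-pq i (v i ∷ w ∷ []) ≤-refl)

      private
        -- `u` sees neither N(d) nor `Y`, so the q-special member dominates it only by containing
        -- it, and u′ is excluded because it sees all of `Y` but `q l`.
        isU₁ : ∀ {i w u l w′ u′} → Hp.Special i w u → Hq.Special l w′ u′ → u ≡ u₁
        isU₁ {u = u} {l = l} (_ , J , du , ny , _) (hw′ , J′ , du′ , _ , full) with dominate u hw′ J′ (aU J)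
        ... | eq₁ refl = ⊥-elim (ny (q m) (qU m) (Yˢ.p-X m) (full (q m) (qU m) (Yˢ.p-X m) (Yˢ.p-inj (punchInᵢ≢i l fzero))))
          where m = punchIn l fzero
        ... | eq₂ e = e
        ... | eq₃ e = ⊥-elim (I-≢q l du e)
        ... | ad₁ e = ⊥-elim (nbr-d-indep (aU J′) (aU J) du′ du e)
        ... | ad₂ e = ⊥-elim (nbr-d-indep (bU J′) (aU J) du₁ du e)
        ... | ad₃ e = ⊥-elim (ny (q l) (qU l) (Yˢ.p-X l) (A-sym e))

      distinct : ∀ {i w u j w′ u′} → i ≢ j → Hp.Special i w u → Hp.Special j w′ u′ → u ≢ u′
      distinct {i} {w} {u} {j} ne (hw , J , _) (_ , J′ , _ , _ , full) refl =
        ind hw (aU J) (pU i) (va J) (vc J) (full (p i) (pU i) (p-X i) (p-inj ne))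

      exclude : ∀ {i j l} → i ≢ j → Fiveᵖ i → Fiveᵖ j → Fiveᵠ l → ⊥
      exclude ne (_ , _ , s) (_ , _ , s′) (_ , _ , t) = distinct ne s s′ (trans (isU₁ s t) (≡-sym (isU₁ s′ t)))

      module Triple {w w₁ w₂ u a₁ a₂ : Fin n} (s : Hp.Special fzero w u) (s₁ : Hp.Special (fsuc fzero) w₁ a₁)
        (s₂′ : Hp.Special (fsuc (fsuc fzero)) w₂ a₂) where

        hw = proj₁ s
        J = proj₁ (proj₂ s)
        du = proj₁ (proj₂ (proj₂ s))
        ny = proj₁ (proj₂ (proj₂ (proj₂ s)))
        full = proj₂ (proj₂ (proj₂ (proj₂ s)))

        known-p : ∀ {x} → x ∈ᵖ F → x ≢ v fzero → A x (p fzero) → x ≡ w ⊎ Through fzero x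
        known-p {x} hx ne xp with Hp.special fzero hx ne xp
        ... | inj₁ t = inj₂ t
        ... | inj₂ (u′ , _ , J′ , du′ , _) with dominate u′ hw J (aU J′)
        ...   | eq₁ refl = inj₁ (≡-sym (same hw hx J (va J′) (vb J′) (vc J′)))
        ...   | eq₂ e = ⊥-elim (ab J′ e)
        ...   | eq₃ e = ⊥-elim (I-≢p fzero du′ e)
        ...   | ad₁ e = ⊥-elim (nbr-d-indep (aU J) (aU J′) du du′ e)
        ...   | ad₂ e = ⊥-elim (nbr-d-indep u₀U (aU J′) du₀ du′ e)
        ...   | ad₃ e = ⊥-elim (ind hx (pU fzero) (aU J′) (vc J′) (va J′) e)

        known-q : ∀ {x} → x ∈ᵖ F → x ≢ v fzero → A x (q fzero) → Through fzero x
        known-q hx ne xq with Hq.special fzero hx ne xq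
        ... | inj₁ t = Flipped Cr t
        ... | inj₂ t = ⊥-elim (exclude {fzero} {fsuc fzero} (λ ()) (_ , _ , s) (_ , _ , s₁) (_ , t))

        contains : ∀ {x j w′ u′} → x ∈ᵖ F → A x u → ¬ A x (p fzero) → Hp.Special j w′ u′ → A x u′
        contains {x} {u′ = u′} hx xu ¬xp (_ , J′ , du′ , ny′ , _) with Bool-dichotomy (adj G x u′)
        ... | inj₁ e = e
        ... | inj₂ e with dom hx (aU J′) e
        ...   | z , hz , xz , zu = ⊥-elim (by-kind (kind z hz))
          where
          by-kind : Kind z → ⊥
          by-kind (isD refl) = ind hx dU (aU J) xz xu du
          by-kind (isI dz) = nbr-d-indep hz (aU J′) dz du′ zu
          by-kind (isY Yz) = ny′ z hz Yz (A-sym zu)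
          by-kind (isX Xz) with z ≟ p fzero
          ... | yes refl = ¬xp xz
          ... | no z≢ = ind hx (aU J) hz xu xz (full z hz Xz z≢)

        -- By `contains`, such a member would consist of the three distinct vertices `u`, `a₁`,
        -- `a₂`. None of them has a neighbour in `Y`, so `q 0` would be undominated.
        through-u : ∀ {x} → x ∈ᵖ F → A x u → ¬ A x (p fzero) → ¬ A x (q fzero) → ⊥
        through-u {x} hx xu ¬xp ¬xq = go (of₂ hx (aU J) (aU J₁) xu x₁ (distinct (λ ()) s s₁)) (dom hx (qU fzero) (¬t⇒f ¬xq))
          where
          J₁ = proj₁ (proj₂ s₁)
          x₁ : A x a₁
          x₁ = contains hx xu ¬xp s₁
          x₂ : A x a₂
          x₂ = contains hx xu ¬xp s₂′
          noq : ∀ {j w′ u′} → Hp.Special j w′ u′ → ¬ A u′ (q fzero)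
          noq (_ , _ , _ , ny′ , _) e = ny′ (q fzero) (qU fzero) (Yˢ.p-X fzero) e
          third : ∀ {c} → Is x u a₁ c → a₂ ≡ c
          third K with only K a₂ (aU (proj₁ (proj₂ s₂′))) x₂
          ... | inj₁ e = ⊥-elim (distinct (λ ()) s s₂′ (≡-sym e))
          ... | inj₂ (inj₁ e) = ⊥-elim (distinct (λ ()) s₁ s₂′ (≡-sym e))
          ... | inj₂ (inj₂ e) = e
          go : (∃ λ c → Is x u a₁ c) → (∃ λ z → z ∈ᵖ U × A x z × A z (q fzero)) → ⊥
          go (c , K) (z , hz , xz , zq) with only K z hz xz
          ... | inj₁ refl = noq s zq
          ... | inj₂ (inj₁ refl) = noq s₁ zq
          ... | inj₂ (inj₂ refl) = noq s₂′ (subst (λ y → A y (q fzero)) (≡-sym (third K)) zq)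

        known : ∀ {x a} → x ∈ᵖ F → x ≢ v fzero → x ≢ w → a ∈ (u ∷ p fzero ∷ q fzero ∷ []) → A x a → Through fzero x
        known {x} hx ne ne′ m xa = by (Bool-dichotomy (adj G x (p fzero))) (Bool-dichotomy (adj G x (q fzero))) m xa
          where
          by : A x (p fzero) ⊎ adj G x (p fzero) ≡ false → A x (q fzero) ⊎ adj G x (q fzero) ≡ false →
               ∀ {a} → a ∈ (u ∷ p fzero ∷ q fzero ∷ []) → A x a → Through fzero x
          by (inj₁ xp) _ _ _ with known-p hx ne xp
          ... | inj₁ e = ⊥-elim (ne′ e)
          ... | inj₂ t = t
          by (inj₂ _) (inj₁ xq) _ _ = known-q hx ne xq
          by (inj₂ a) (inj₂ b) (here refl) e = ⊥-elim (through-u hx e (λ e′ → t≢f e′ a) (λ e′ → t≢f e′ b))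
          by (inj₂ a) (inj₂ b) (there (here refl)) e = ⊥-elim (t≢f e a)
          by (inj₂ a) (inj₂ b) (there (there (here refl))) e = ⊥-elim (t≢f e b)

        MoreT : List (Fin n) → Set
        MoreT xs = ∃ λ x → x ∈ᵖ F × (∃ λ a → a ∈ (u ∷ p fzero ∷ q fzero ∷ []) × A x a) × All (x ≢_) xs

        more-T : ∀ xs → length xs ≤ 3 → MoreT xs
        more-T xs le = more (u ∷ p fzero ∷ q fzero ∷ [])
          ((I-≢p fzero du ∷ I-≢q fzero du ∷ []) ∷ (p≢q fzero ∷ []) ∷ [] ∷ []) (aU J ∷ pU fzero ∷ qU fzero ∷ []) (s≤s z≤n) xs le

        -- At most three members meet {u , p 0 , q 0}: `v 0`, `w` and a single `Through` member. By
        -- `more` there is a fourth.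
        absurd : ⊥
        absurd = step₁ (more-T (v fzero ∷ w ∷ []) (s≤s (s≤s z≤n)))
          where
          step₂ : ∀ {x} → x ∈ᵖ F → Through fzero x → MoreT (v fzero ∷ w ∷ x ∷ []) → ⊥
          step₂ hx t (x′ , hx′ , (_ , m , e) , (n₁ ∷ n₂ ∷ n₃ ∷ [])) = n₃ (through-unique hx′ hx (known hx′ n₁ n₂ m e) t)
          step₁ : MoreT (v fzero ∷ w ∷ []) → ⊥
          step₁ (x , hx , (_ , m , e) , (n₁ ∷ n₂ ∷ [])) = step₂ hx (known hx n₁ n₂ m e) (more-T (v fzero ∷ w ∷ x ∷ []) ≤-refl)

      all-five : (∃ λ i → ∃ λ j → i ≢ j × Fiveᵖ i × Fiveᵖ j) → ⊥
      all-five (i , j , ne , a , b) = go (pk fzero) (pk (fsuc fzero)) (pk (fsuc (fsuc fzero)))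
        where
        pk : ∀ l → Fiveᵖ l
        pk l = sel (five l)
          where
          sel : Fiveᵖ l ⊎ Fiveᵠ l → Fiveᵖ l
          sel (inj₁ s) = s
          sel (inj₂ t) = ⊥-elim (exclude ne a b t)
        go : Fiveᵖ fzero → Fiveᵖ (fsuc fzero) → Fiveᵖ (fsuc (fsuc fzero)) → ⊥
        go (_ , _ , s) (_ , _ , s₁) (_ , _ , s₂′) = Triple.absurd s s₁ s₂′

    caseB : (Cr : Crown) → ∀ {u₀ u₁} → u₀ ∈ᵖ U → A d u₀ → NoX Cr u₀ → u₁ ∈ᵖ U → A d u₁ → NoX (flip Cr) u₁ → ⊥
    caseB Cr u₀U du₀ noX u₁U du₁ noY = go (others fzero (λ i _ → M.five i))
      where
      module M = Both Cr u₀U du₀ noX u₁U du₁ noY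
      module M′ = Both (flip Cr) u₁U du₁ noY u₀U du₀ noX
      go : (∃ λ i → ∃ λ j → i ≢ j × M.Fiveᵖ i × M.Fiveᵖ j) ⊎ (∃ λ i → ∃ λ j → i ≢ j × M.Fiveᵠ i × M.Fiveᵠ j) → ⊥
      go (inj₁ two) = M.all-five two
      go (inj₂ two) = M′.all-five two

    absurd : ⊥
    -- Either every vertex of N(d) sees `X`, or every one sees `Y`, or exceptions to both exist and
    -- `caseB` applies.
    absurd = CaseC.contradiction crown λ u hu du nx → CaseC.contradiction (flip crown) λ u′ hu′ du′ ny → caseB crown hu du nx hu′ du′ ny

  -- In a smallest counterexample every set V of vertices meets more than |V| members.
  triSys-bound : ∀ {F U} → TriSys G F U → count F ≤ count U + 64
  triSys-bound {F} {U} S = go (count U) S ≤-refl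
    where
    go : ∀ m {F U} → TriSys G F U → count U ≤ m → count F ≤ count U + 64
    go m {F} {U} S le with count F ≤? count U + 64
    ... | yes h = h
    ... | no ¬h = ⊥-elim (finish (Irreducible.heavy G S (≰⇒> ¬h) irr))
      where
      irr : ∀ V → V ⊆ᵖ U → 1 ≤ count V → count V < count (F ∩ meets G V)
      irr V s ne = ≰⇒> λ few → ¬h (begin
          count F ≡⟨ count-split F (meets G V) ⟩
          count (F ∩ meets G V) + count F′ ≤⟨ +-mono-≤ few (IH m le) ⟩
          count V + (count U′ + 64) ≡⟨ ≡-sym (+-assoc (count V) (count U′) 64) ⟩
          count V + count U′ + 64 ≡⟨ cong (_+ 64) (≡-sym split) ⟩
          count U + 64 ∎)
        where
        open ≤-Reasoning
        F′ U′ : Pred n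
        F′ v = F v ∧ not (meets G V v)
        U′ y = U y ∧ not (V y)
        split : count U ≡ count V + count U′
        split = trans (count-split U V) (cong (_+ count U′) (count-cong pt))
          where
          pt : ∀ y → U y ∧ V y ≡ V y
          pt y with Bool-dichotomy (V y)
          ... | inj₁ e rewrite e | s y e = refl
          ... | inj₂ e rewrite e = ∧-comm (U y) false
        IH : ∀ m → count U ≤ m → count F′ ≤ count U′ + 64
        IH zero le = ⊥-elim (<-irrefl refl (≤-trans ne (≤-trans (m≤m+n _ _) (≤-trans (≤-reflexive (≡-sym split)) le))))
        IH (suc m) le = go m (triSys-remove G V S) (≤-pred (≤-trans (+-monoˡ-≤ (count U′) ne) (≤-trans (≤-reflexive (≡-sym split)) le)))
      finish : (∃ λ d → d ∈ᵖ U × 4 ≤ weight G F d) → ⊥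
      finish (d , dU , d≥4) = CaseB.absurd S (≰⇒> ¬h) irr dU d≥4

-- Families of 3-sets and 4-sets in triangle-free ground sets.

Y₃ : ℕ → ℕ → ℕ
Y₃ r Z = 4 * (Z * Z) * (3 * Z * (r * r) + 1) + 134 ^ 4

^4-square : ∀ N A B → N * N ≤ A → A * A ≤ B → N ^ 4 ≤ B
^4-square N A B h h′ = ≤-trans (≤-reflexive (lem N)) (≤-trans (*-mono-≤ h h) h′)
  where
  lem : ∀ N → N * (N * (N * (N * 1))) ≡ N * N * (N * N)
  lem = solve-∀

2ab≤a²+b² : ∀ a b → 2 * (a * b) ≤ a * a + b * b
2ab≤a²+b² a b with ≤-total a b
... | inj₁ h = subst (λ b → 2 * (a * b) ≤ a * a + b * b) (m+[n∸m]≡n h) (lem a (b ∸ a))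
  where
  lem : ∀ a c → 2 * (a * (a + c)) ≤ a * a + (a + c) * (a + c)
  lem a c = ≤-trans (m≤m+n _ (c * c)) (≤-reflexive (e a c))
    where
    e : ∀ a c → 2 * (a * (a + c)) + c * c ≡ a * a + (a + c) * (a + c)
    e = solve-∀
... | inj₂ h = subst (λ a → 2 * (a * b) ≤ a * a + b * b) (m+[n∸m]≡n h) (lem b (a ∸ b))
  where
  lem : ∀ b c → 2 * ((b + c) * b) ≤ (b + c) * (b + c) + b * b
  lem b c = ≤-trans (m≤m+n _ (c * c)) (≤-reflexive (e b c))
    where
    e : ∀ b c → 2 * ((b + c) * b) + c * c ≡ (b + c) * (b + c) + b * b
    e = solve-∀

module _ {n : ℕ} (G : SimpleGraph n) where
  open Sys

  TriangleFree : Pred n → Set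
  TriangleFree U = ∀ {x y z} → x ∈ᵖ U → y ∈ᵖ U → z ∈ᵖ U → adj G x y ≡ true → adj G y z ≡ true → adj G x z ≡ true → ⊥

  Independent : Pred n → Pred n → Set
  Independent F U = ∀ {v a b} → v ∈ᵖ F → a ∈ᵖ U → b ∈ᵖ U → adj G v a ≡ true → adj G v b ≡ true → adj G a b ≡ true → ⊥

  sys-tri : ∀ {F U} → Sys G F U 3 → TriangleFree U → Independent F U → count F ≤ count (support G F U) + 64
  sys-tri {F} {U} S tf ind = triSys-bound G record
    { tf = λ hx hy hz → tf (∧-fst hx) (∧-fst hy) (∧-fst hz)
    ; ind = λ hv ha hb → ind hv (∧-fst ha) (∧-fst hb)
    ; dom = λ {v} {y} hv hy e → dominated hv hy e (supported G F U y hy)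
    ; size = λ {v} hv → size S′ v hv
    ; dist = λ {v} {v′} → dist S′ v v′ }
    where
    S′ = sys-support G S
    dominated : ∀ {v y} → v ∈ᵖ F → y ∈ᵖ support G F U → adj G v y ≡ false → (∃ λ u → u ∈ᵖ F × adj G u y ≡ true) →
      ∃ λ z → z ∈ᵖ support G F U × adj G v z ≡ true × adj G z y ≡ true
    dominated hv hy e (u , hu , uy) = let (z , hz , zy , vz , _) = star S′ u _ _ hu hv hy uy e in z , hz , vz , zy

  -- `sys-rec` bounds N p by 3 N + Z W, where the links are 2-sets and W² ≤ 3 Z r² + 1. As p ≥ N -
  -- 64, N (N - 67) ≤ Z W and N⁴ = O(Z³). Families of at most 134 = 2 · 67 members are absorbed in
  -- the summand 134 ^ 4 of `Y₃`.
  sys-3 : ∀ {F U r} Z → CliqueBound G r → s₂ G U ≤ Z → Sys G F U 3 → TriangleFree U → Independent F U → count F ≤ root 3 (Y₃ r Z)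
  sys-3 {F} {U} {r} Z cb hZ S tf ind = root-max 3 (go (N ≤? 134))
    where
    N = count F
    U′ = support G F U
    p = count U′
    W = root 1 (3 * Z * (r * r) + 1)
    hW : ∀ a → a ∈ᵖ U′ → weight G F a ≤ W
    hW a ha = sys-2 G Z cb (≤-trans (s₂-mono G (λ y e → support-⊆ G F U y (∧-fst e))) hZ) (sys-link G a ha (sys-support G S))
    rec : N * p ≤ N * 3 + Z * W
    rec = ≤-trans (sys-rec G W (sys-support G S) (supported G F U) hW) (+-monoʳ-≤ (N * 3) (*-monoˡ-≤ W (≤-trans (s₂-mono G (support-⊆ G F U)) hZ)))
    WW : W * W ≤ 3 * Z * (r * r) + 1
    WW = ≤-trans (≤-reflexive (cong (W *_) (≡-sym (*-identityʳ W)))) (root-^ 1 (3 * Z * (r * r) + 1))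
    go : Dec (N ≤ 134) → N ^ 4 ≤ Y₃ r Z
    go (yes le) = ≤-trans (^-monoˡ-≤ 4 le) (m≤n+m _ _)
    go (no ¬le) = ≤-trans (^4-square N (2 * (Z * W)) _ NN (≤-trans (≤-reflexive (sq Z W)) (*-monoʳ-≤ (4 * (Z * Z)) WW))) (m≤m+n _ (134 ^ 4))
      where
      sq : ∀ a b → 2 * (a * b) * (2 * (a * b)) ≡ 4 * (a * a) * (b * b)
      sq = solve-∀
      g = N ∸ 134
      N≡ : N ≡ g + 134
      N≡ = ≡-sym (m∸n+n≡m (<⇒≤ (≰⇒> ¬le)))
      -- N (N - 67) ≤ Z W, and N ≤ 2 (N - 67).
      N*g : N * (g + 67) ≤ Z * W
      N*g = +-cancelˡ-≤ (N * 67) (N * (g + 67)) (Z * W) (begin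
        N * 67 + N * (g + 67) ≡⟨ e₁ N g 67 ⟩
        N * (g + 134) ≡⟨ cong (N *_) (≡-sym N≡) ⟩
        N * N ≤⟨ *-monoʳ-≤ N (sys-tri S tf ind) ⟩
        N * (p + 64) ≡⟨ *-distribˡ-+ N p 64 ⟩
        N * p + N * 64 ≤⟨ +-monoˡ-≤ (N * 64) rec ⟩
        N * 3 + Z * W + N * 64 ≡⟨ e₂ N (Z * W) 3 64 ⟩
        N * 67 + Z * W ∎)
        where
        open ≤-Reasoning
        e₁ : ∀ N g c → N * c + N * (g + c) ≡ N * (g + (c + c))
        e₁ = solve-∀
        e₂ : ∀ N b a c → N * a + b + N * c ≡ N * (a + c) + b
        e₂ = solve-∀
      NN : N * N ≤ 2 * (Z * W)
      NN = begin
        N * N ≡⟨ cong (N *_) N≡ ⟩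
        N * (g + 134) ≤⟨ *-monoʳ-≤ N (≤-trans (m≤m+n (g + 134) g) (≤-reflexive (e₃ g 67))) ⟩
        N * (2 * (g + 67)) ≡⟨ e₄ N (g + 67) ⟩
        2 * (N * (g + 67)) ≤⟨ *-monoʳ-≤ 2 N*g ⟩
        2 * (Z * W) ∎
        where
        open ≤-Reasoning
        e₃ : ∀ g c → g + (c + c) + g ≡ 2 * (g + c)
        e₃ = solve-∀
        e₄ : ∀ a b → a * (2 * b) ≡ 2 * (a * b)
        e₄ = solve-∀

  module Four {F U₀ : Pred n} (S₀ : Sys G F U₀ 4) (tf : TriangleFree U₀) (ind : Independent F U₀) where
    U = support G F U₀
    S = sys-support G S₀
    N = count F
    p = count U
    δ : Fin n → ℕ
    δ = degIn G U
    w : Fin n → ℕ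
    w = weight G F

    -- The sets through `a` are independent, so the support of the link avoids N(a) and has at most
    -- p - δ a vertices; `sys-tri` applies to it.
    link-bound : ∀ a → a ∈ᵖ U → w a + δ a ≤ p + 64
    link-bound a ha = begin
      w a + δ a ≤⟨ +-monoˡ-≤ (δ a) (sys-tri (sys-link G a ha S) (λ hx hy hz → tf (U₀of hx) (U₀of hy) (U₀of hz))
                      (λ hv hx hy → ind (∧-fst hv) (U₀of hx) (U₀of hy))) ⟩
      count T + 64 + δ a ≡⟨ e (count T) (δ a) 64 ⟩
      count T + δ a + 64 ≤⟨ +-monoˡ-≤ 64 (≤-trans (+-mono-≤ (count-mono {F = T} {U ∩ (not ∘ adj G a)} sub) ≤-refl)
                              (≤-reflexive (trans (+-comm (count (U ∩ (not ∘ adj G a))) (δ a)) (≡-sym (count-split U (adj G a)))))) ⟩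
      p + 64 ∎
      where
      open ≤-Reasoning
      T = support G (F ∩ adj G a) (U except a)
      e : ∀ a b c → a + c + b ≡ a + b + c
      e = solve-∀
      U₀of : ∀ {y} → y ∈ᵖ (U except a) → y ∈ᵖ U₀
      U₀of {y} h = support-⊆ G F U₀ y (∧-fst h)
      sub : T ⊆ᵖ (U ∩ (not ∘ adj G a))
      sub y hy with supported G (F ∩ adj G a) (U except a) y hy
      ... | v , hv , vy = ∧-intro yU (not-intro (¬t⇒f λ ay → ind (∧-fst hv) (support-⊆ G F U₀ a ha) (support-⊆ G F U₀ y yU) (adj-sym G (∧-snd {F v} hv)) vy ay))
        where
        yU : y ∈ᵖ U
        yU = ∧-fst (∧-fst hy)

    module _ (Z : ℕ) (hZ₀ : s₂ G U₀ ≤ Z) where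
      hZ : s₂ G U ≤ Z
      hZ = ≤-trans (s₂-mono G (support-⊆ G F U₀)) hZ₀

      four-linear : N ≤ 69 * Z + 1
      four-linear = go (p ≤? 4)
        where
        go : Dec (p ≤ 4) → N ≤ 69 * Z + 1
        go (yes le) = ≤-trans (sys-tiny G S le) (m≤n+m 1 _)
        go (no ¬le) = ≤-trans (*-cancelʳ-≤ N (69 * Z) g key) (m≤m+n _ 1)
          where
          g = p ∸ 4
          instance
            gnz : NonZero g
            gnz = >-nonZero (m<n⇒0<n∸m (≰⇒> ¬le))
          p≡ : p ≡ 4 + g
          p≡ = ≡-sym (m+[n∸m]≡n (<⇒≤ (≰⇒> ¬le)))
          open ≤-Reasoning
          key : N * g ≤ 69 * Z * g
          key = +-cancelˡ-≤ (N * 4) (N * g) (69 * Z * g) (begin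
            N * 4 + N * g ≡⟨ trans (≡-sym (*-distribˡ-+ N 4 g)) (cong (N *_) (≡-sym p≡)) ⟩
            N * p ≤⟨ sys-rec G (p + 64) S (supported G F U₀) (λ a ha → ≤-trans (m≤m+n _ _) (link-bound a ha)) ⟩
            N * 4 + s₂ G U * (p + 64) ≤⟨ +-monoʳ-≤ (N * 4) (*-mono-≤ hZ (≤-trans (≤-reflexive (cong (_+ 64) p≡)) (lem g (>-nonZero⁻¹ g)))) ⟩
            N * 4 + Z * (69 * g) ≡⟨ cong (N * 4 +_) (e Z g 69) ⟩
            N * 4 + 69 * Z * g ∎)
            where
            e : ∀ a b c → a * (c * b) ≡ c * a * b
            e = solve-∀
            lem : ∀ g → 1 ≤ g → 4 + g + 64 ≤ 69 * g
            lem g h = ≤-trans (≤-reflexive (e₁ g 64)) (+-monoʳ-≤ g (*-monoʳ-≤ 68 h))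
              where
              e₁ : ∀ g c → 4 + g + c ≡ g + (4 + c) * 1
              e₁ = solve-∀

      -- Tangent line at δ = p/4 of the convex function that bounds w: (w - 3 δ)² ≥ 0 after removing the slack.
      tangent : ∀ w δ p → w + δ ≤ p + 64 → 16 * (w * δ) ≤ w * p + (9 * p + 1024) * δ
      tangent w δ p h with w ≤? 64
      ... | yes le = ≤-trans (≤-trans (≤-reflexive (≡-sym (*-assoc 16 w δ))) (*-monoˡ-≤ δ (*-monoʳ-≤ 16 le)))
              (≤-trans (*-monoˡ-≤ δ (m≤n+m 1024 (9 * p))) (m≤n+m _ (w * p)))
      ... | no ¬le = begin
          16 * (w * δ) ≡⟨ cong (λ x → 16 * (x * δ)) w≡ ⟩
          16 * ((64 + x) * δ) ≡⟨ e₁ x δ 64 ⟩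
          16 * (x * δ) + 1024 * δ ≤⟨ +-monoˡ-≤ (1024 * δ) square ⟩
          (x * (x + δ) + 9 * (x + δ) * δ) + 1024 * δ ≤⟨ +-monoˡ-≤ (1024 * δ) (+-mono-≤ (*-mono-≤ (m≤n+m x 64) xδ) (*-monoˡ-≤ δ (*-monoʳ-≤ 9 xδ))) ⟩
          ((64 + x) * p + 9 * p * δ) + 1024 * δ ≡⟨ e₂ ((64 + x) * p) (9 * p) δ 1024 ⟩
          (64 + x) * p + (9 * p + 1024) * δ ≡⟨ cong (λ y → y * p + (9 * p + 1024) * δ) (≡-sym w≡) ⟩
          w * p + (9 * p + 1024) * δ ∎
        where
        open ≤-Reasoning
        x = w ∸ 64
        w≡ : w ≡ 64 + x
        w≡ = ≡-sym (m+[n∸m]≡n (<⇒≤ (≰⇒> ¬le)))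
        xδ : x + δ ≤ p
        xδ = +-cancelˡ-≤ 64 (x + δ) p (≤-trans (≤-reflexive (trans (≡-sym (+-assoc 64 x δ)) (cong (_+ δ) (≡-sym w≡)))) (≤-trans h (≤-reflexive (+-comm p 64))))
        e₁ : ∀ x δ c → 16 * ((c + x) * δ) ≡ 16 * (x * δ) + 16 * c * δ
        e₁ = solve-∀
        e₂ : ∀ a b c d → (a + b * c) + d * c ≡ a + (b + d) * c
        e₂ = solve-∀
        square : 16 * (x * δ) ≤ x * (x + δ) + 9 * (x + δ) * δ
        square = ≤-trans (≤-reflexive (e₃ x δ)) (≤-trans (+-monoˡ-≤ (10 * (x * δ)) (2ab≤a²+b² x (3 * δ))) (≤-reflexive (e₄ x δ)))
          where
          e₃ : ∀ x δ → 16 * (x * δ) ≡ 2 * (x * (3 * δ)) + 10 * (x * δ)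
          e₃ = solve-∀
          e₄ : ∀ x δ → x * x + 3 * δ * (3 * δ) + 10 * (x * δ) ≡ x * (x + δ) + 9 * (x + δ) * δ
          e₄ = solve-∀

      -- `tangent` is summed over `U`. The terms w a · p add up to 4 N p and are moved to the left;
      -- up to terms of lower order the result is N ≤ (3/4) Z.
      four-sharp : 12 * (N * p) ≤ 64 * N + (9 * p + 1024) * Z
      four-sharp = +-cancelˡ-≤ (4 * (N * p)) (12 * (N * p)) (64 * N + (9 * p + 1024) * Z) (begin
        4 * (N * p) + 12 * (N * p) ≡⟨ e₁ (N * p) ⟩
        16 * (N * p) ≤⟨ *-monoʳ-≤ 16 (sys-weigh G S (supported G F U₀)) ⟩
        16 * (N * 4 + sumFin (λ a → 𝟙 (U a) * (w a * δ a))) ≡⟨ trans (e₂ N _ 16 4) (cong (64 * N +_) (≡-sym (sum-*ˡ 16 (λ a → 𝟙 (U a) * (w a * δ a))))) ⟩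
        64 * N + sumFin (λ a → 16 * (𝟙 (U a) * (w a * δ a))) ≤⟨ +-monoʳ-≤ (64 * N) (sum-mono pt) ⟩
        64 * N + sumFin (λ a → 𝟙 (U a) * w a * p + 𝟙 (U a) * δ a * (9 * p + 1024))
          ≡⟨ cong (64 * N +_) (trans (sum-+ (λ a → 𝟙 (U a) * w a * p) (λ a → 𝟙 (U a) * δ a * (9 * p + 1024)))
               (cong₂ _+_ (sum-*ʳ (λ a → 𝟙 (U a) * w a) p) (sum-*ʳ (λ a → 𝟙 (U a) * δ a) (9 * p + 1024)))) ⟩
        64 * N + (sumFin (λ a → 𝟙 (U a) * w a) * p + s₂ G U * (9 * p + 1024))
          ≡⟨ cong (λ x → 64 * N + (x * p + s₂ G U * (9 * p + 1024))) (≡-sym (sys-weight-sum G S)) ⟩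
        64 * N + (N * 4 * p + s₂ G U * (9 * p + 1024)) ≤⟨ +-monoʳ-≤ (64 * N) (+-monoʳ-≤ (N * 4 * p) (*-monoˡ-≤ (9 * p + 1024) hZ)) ⟩
        64 * N + (N * 4 * p + Z * (9 * p + 1024)) ≡⟨ e₃ N p Z (9 * p + 1024) 64 ⟩
        4 * (N * p) + (64 * N + (9 * p + 1024) * Z) ∎)
        where
        open ≤-Reasoning
        e₁ : ∀ a → 4 * a + 12 * a ≡ 16 * a
        e₁ = solve-∀
        e₂ : ∀ a b k m → k * (a * m + b) ≡ k * m * a + k * b
        e₂ = solve-∀
        e₃ : ∀ N p Z c k → k * N + (N * 4 * p + Z * c) ≡ 4 * (N * p) + (k * N + c * Z)
        e₃ = solve-∀
        e₄ : ∀ x y z → 16 * (x * (y * z)) ≡ x * (16 * (y * z))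
        e₄ = solve-∀
        e₅ : ∀ x w p c δ → x * (w * p + c * δ) ≡ x * w * p + x * δ * c
        e₅ = solve-∀
        pt : ∀ a → 16 * (𝟙 (U a) * (w a * δ a)) ≤ 𝟙 (U a) * w a * p + 𝟙 (U a) * δ a * (9 * p + 1024)
        pt a with Bool-dichotomy (U a)
        ... | inj₂ e rewrite e = z≤n
        ... | inj₁ e = ≤-trans (≤-reflexive (e₄ (𝟙 (U a)) (w a) (δ a))) (≤-trans (*-monoʳ-≤ (𝟙 (U a)) (tangent (w a) (δ a) p (link-bound a e)))
                         (≤-reflexive (e₅ (𝟙 (U a)) (w a) p (9 * p + 1024) (δ a))))

      -- Either p ≤ M and the trivial bound applies, or p > M and division of `four-sharp` by p
      -- makes the error small relative to M. The linear bound on N enters there: 5440 = 64 · 69 +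
      -- 1024.
      four-asymptotic : ∀ M → N ≤ M ^ 4 ⊎ 12 * (M * N) ≤ 9 * (M * Z) + 5440 * Z + 64
      four-asymptotic M with p ≤? M
      ... | yes le = inj₁ (≤-trans (sys-≤^ G 4 S) (^-monoˡ-≤ 4 le))
      ... | no ¬le = inj₂ (*-cancelʳ-≤ (12 * (M * N)) _ p ⦃ >-nonZero (≤-trans (s≤s z≤n) (≰⇒> ¬le)) ⦄ (begin
          12 * (M * N) * p ≡⟨ e₁ M N p ⟩
          M * (12 * (N * p)) ≤⟨ *-monoʳ-≤ M four-sharp ⟩
          M * (64 * N + (9 * p + 1024) * Z) ≡⟨ e₂ M N p Z 64 1024 ⟩
          9 * (M * Z) * p + M * (64 * N + 1024 * Z) ≤⟨ +-monoʳ-≤ (9 * (M * Z) * p) (*-mono-≤ (<⇒≤ (≰⇒> ¬le)) (+-monoˡ-≤ (1024 * Z) (*-monoʳ-≤ 64 four-linear))) ⟩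
          9 * (M * Z) * p + p * (64 * (69 * Z + 1) + 1024 * Z) ≡⟨ e₃ (9 * (M * Z)) p Z 64 69 1024 ⟩
          (9 * (M * Z) + 5440 * Z + 64) * p ∎))
        where
        open ≤-Reasoning
        e₁ : ∀ M N p → 12 * (M * N) * p ≡ M * (12 * (N * p))
        e₁ = solve-∀
        e₂ : ∀ M N p Z a c → M * (a * N + (9 * p + c) * Z) ≡ 9 * (M * Z) * p + M * (a * N + c * Z)
        e₂ = solve-∀
        e₃ : ∀ a p Z c d e → a * p + p * (c * (d * Z + 1) + e * Z) ≡ (a + (c * d + e) * Z + c) * p
        e₃ = solve-∀

-- Families of 3-sets for general r, over a clique that is the whole trace on R.

listPred-≤ : ∀ {n} (xs : List (Fin n)) → count (listPred xs) ≤ length xs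
listPred-≤ {n} [] = ≤-reflexive (count-none {n} λ _ → refl)
listPred-≤ (x ∷ xs) = ≤-trans (count-cover {F = listPred (x ∷ xs)} {λ y → ⌊ y ≟ x ⌋} {listPred xs} λ y h → ∨-elim {⌊ y ≟ x ⌋} h)
  (+-mono-≤ (≤-reflexive (count-single x)) (listPred-≤ xs))

module _ {n : ℕ} (G : SimpleGraph n) where

  Clique-distinct : ∀ {xs} → Clique G xs → AllPairs _≢_ xs
  Clique-distinct [] = []
  Clique-distinct (h ∷ c) = All.map (adj⇒≢ G) h ∷ Clique-distinct c

  Clique-cover : ∀ {xs ys} → Clique G xs → (∀ {s} → s ∈ xs → s ∈ ys) → length ys ≤ length xs → ∀ {s} → s ∈ ys → s ∈ xs
  Clique-cover {xs} {ys} cl sub le {s} m = listPred-∈ xs (count-≡⇒⊇ {F = listPred xs} {listPred ys}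
    (λ v h → ∈-listPred (sub (listPred-∈ xs h))) (≤-trans (listPred-≤ ys) (≤-trans le (listPred-count (Clique-distinct cl)))) s (∈-listPred m))

  Clique-delete : ∀ {x xs} → Clique G xs → x ∈ xs → ∃ λ ys → length xs ≡ suc (length ys) × Clique G ys ×
    (∀ {s} → s ∈ ys → s ∈ xs × adj G s x ≡ true) × (∀ {s} → s ∈ xs → s ≢ x → s ∈ ys)
  Clique-delete {x} {_ ∷ xs} (h ∷ c) (here refl) = xs , refl , c , (λ m → there m , adj-sym G (All.lookup h m)) ,
    λ { (here e) ne → ⊥-elim (ne e) ; (there m) _ → m }
  Clique-delete {x} {y ∷ xs} (h ∷ c) (there m) with Clique-delete c m
  ... | ys , len , cl , a , b = y ∷ ys , cong suc len , All.tabulate (λ i → All.lookup h (proj₁ (a i))) ∷ cl ,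
        (λ { (here refl) → here refl , All.lookup h m ; (there i) → there (proj₁ (a i)) , proj₂ (a i) }) ,
        λ { (here refl) _ → here refl ; (there i) ne → there (b i ne) }

  module ClassThree {q : ℕ} (sat : Saturated (2 + q) G) {F P : Pred n} (xs : List (Fin n)) (len : length xs ≡ q) (cl : Clique G xs)
    (F-xs : ∀ {v x} → v ∈ᵖ F → x ∈ xs → adj G v x ≡ true)
    (F-nbr : ∀ {v y} → v ∈ᵖ F → adj G v y ≡ true → y ∈ xs ⊎ y ∈ᵖ P)
    (F-P : ∀ {v} → v ∈ᵖ F → P v ≡ false) (S : Sys G F P 3) where
    open Sys S

    r : ℕ
    r = 2 + q

    A : Fin n → Fin n → Set
    A x y = adj G x y ≡ true

    cb : CliqueBound G r
    cb ys c = ≰⇒> λ le → proj₁ sat (Clique⇒HasClique G c le)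

    T : Fin n → Pred n
    T v = P ∩ adj G v

    -- For general `r`, `P` need not be triangle-free. But the vertices of type `x` are adjacent to
    -- the q - 1 other vertices of `xs`, and among them a triangle would complete a forbidden
    -- clique.
    Type : Fin n → Fin n → Set
    Type x y = adj G y x ≡ false × All (λ s → s ≡ x ⊎ A y s) xs

    type? : ∀ x y → Dec (Type x y)
    type? x y = (adj G y x ≟ᵇ false) ×-dec All.all? (λ s → (s ≟ x) ⊎-dec (adj G y s ≟ᵇ true)) xs

    type-adj : ∀ {x y s} → Type x y → s ∈ xs → s ≢ x → A y s
    type-adj (_ , a) m ne with All.lookup a m
    ... | inj₁ e = ⊥-elim (ne e)
    ... | inj₂ e = e

    type-unique : ∀ {x x′ y} → x′ ∈ xs → Type x y → Type x′ y → x ≡ x′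
    type-unique {x} {x′} m t t′ with x′ ≟ x
    ... | yes e = ≡-sym e
    ... | no ne = ⊥-elim (t≢f (type-adj t m ne) (proj₁ t′))

    Mate : Fin n → Fin n → Set
    Mate y z = Any.Any (λ x → Type x y × Type x z) xs

    mate? : ∀ y z → Dec (Mate y z)
    mate? y z = Any.any? (λ x → type? x y ×-dec type? x z) xs

    -- The configurations that allow `v` to share a q-clique with a vertex that looks like `y` on
    -- `xs` although `y` is not adjacent to it. Without them `special-adj` produces adjacent chosen
    -- vertices, as `greedy-clique` requires.
    NonSpecial : Fin n → Fin n → Set
    NonSpecial v y = ∃ λ z → z ∈ᵖ T v × z ≢ y × adj G z y ≡ false × (Mate y z ⊎ ∃ λ z′ → z′ ∈ᵖ T v × A z z′)

    nonSpecial? : ∀ v y → Dec (NonSpecial v y)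
    nonSpecial? v y = any? λ z → (T v z ≟ᵇ true) ×-dec (¬? (z ≟ y)) ×-dec (adj G z y ≟ᵇ false) ×-dec
      (mate? y z ⊎-dec any? (λ z′ → (T v z′ ≟ᵇ true) ×-dec (adj G z z′ ≟ᵇ true)))

    special : Fin n → Pred n
    special v y = T v y ∧ not ⌊ nonSpecial? v y ⌋

    misses : ∀ {v y} → v ∈ᵖ F → y ∈ᵖ T v → ∃ λ x → x ∈ xs × adj G y x ≡ false
    misses {v} {y} hv hy with All.all? (λ x → adj G y x ≟ᵇ true) xs
    ... | yes a = ⊥-elim (<-irrefl refl (≤-trans (cb (v ∷ y ∷ xs) ((∧-snd {P y} hy ∷ All.tabulate (F-xs hv)) ∷ a ∷ cl)) (≤-reflexive (cong (2 +_) (≡-sym len)))))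
    ... | no ¬a with findᵐ (¬All⇒Any¬ (λ x → adj G y x ≟ᵇ true) xs ¬a)
    ...   | x , m , nx = x , m , ¬t⇒f nx

    no-clique : ∀ {x a b c} → x ∈ xs → A a b → A b c → A a c →
      (∀ {s} → s ∈ xs → s ≢ x → A a s) → (∀ {s} → s ∈ xs → s ≢ x → A b s) → (∀ {s} → s ∈ xs → s ≢ x → A c s) → ⊥
    no-clique {x} {a} {b} {c} m ab bc ac ha hb hc with Clique-delete cl m
    ... | ys , l , cl′ , sub , _ = <-irrefl refl (≤-trans (cb (a ∷ b ∷ c ∷ ys)
            ((ab ∷ ac ∷ All.tabulate (λ i → on ha i)) ∷ (bc ∷ All.tabulate (λ i → on hb i)) ∷ All.tabulate (λ i → on hc i) ∷ cl′))
            (≤-reflexive (cong (2 +_) (trans (≡-sym len) l))))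
      where
      on : ∀ {y} → (∀ {s} → s ∈ xs → s ≢ x → A y s) → ∀ {s} → s ∈ ys → A y s
      on h i = h (proj₁ (sub i)) (adj⇒≢ G (proj₂ (sub i)))

    -- If x ~ y in T v then both have to be mates of the third vertex, so they have the same type.
    edgeless : ∀ {v a b} → v ∈ᵖ F → (∀ y → y ∈ᵖ T v → NonSpecial v y) → a ∈ᵖ T v → b ∈ᵖ T v → A a b → ⊥
    edgeless {v} {a} {b} hv ns ha hb ab with three (T v) {a} {b} (size v hv) ha hb (adj⇒≢ G ab)
    ... | c , hc , ac , bc , only = clash (mate-c a b ha ab only) (mate-c b a hb (adj-sym G ab) (λ y h → rot (only y h)))
      where
      rot : ∀ {y} → y ≡ a ⊎ y ≡ b ⊎ y ≡ c → y ≡ b ⊎ y ≡ a ⊎ y ≡ c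
      rot (inj₁ e) = inj₂ (inj₁ e)
      rot (inj₂ (inj₁ e)) = inj₁ e
      rot (inj₂ (inj₂ e)) = inj₂ (inj₂ e)
      third : ∀ a′ b′ → a′ ∈ᵖ T v → A a′ b′ → (∀ y → y ∈ᵖ T v → y ≡ a′ ⊎ y ≡ b′ ⊎ y ≡ c) →
        adj G c a′ ≡ false × (Mate a′ c ⊎ ∃ λ z′ → z′ ∈ᵖ T v × A c z′)
      third a′ b′ ha′ ab′ on with ns a′ ha′
      ... | z , hz , z≢a , za , alt with on z hz
      ...   | inj₁ e = ⊥-elim (z≢a e)
      ...   | inj₂ (inj₁ refl) = ⊥-elim (t≢f (adj-sym G ab′) za)
      ...   | inj₂ (inj₂ refl) = za , alt
      mate-c : ∀ a′ b′ → a′ ∈ᵖ T v → A a′ b′ → (∀ y → y ∈ᵖ T v → y ≡ a′ ⊎ y ≡ b′ ⊎ y ≡ c) → Mate a′ c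
      mate-c a′ b′ ha′ ab′ on with third a′ b′ ha′ ab′ on
      ... | _ , inj₁ m = m
      ... | _ , inj₂ (z′ , hz′ , cz′) with only z′ hz′
      ...   | inj₁ refl = ⊥-elim (t≢f cz′ (proj₁ (third a b ha ab only)))
      ...   | inj₂ (inj₁ refl) = ⊥-elim (t≢f cz′ (proj₁ (third b a hb (adj-sym G ab) (λ y h → rot (only y h)))))
      ...   | inj₂ (inj₂ refl) = ⊥-elim (t≢f cz′ (irrefl G c))
      clash : Mate a c → Mate b c → ⊥
      clash m m′ with findᵐ m | findᵐ m′
      ... | x , xm , ta , tc | x′ , xm′ , tb , tc′ with type-unique xm′ tc tc′
      ...   | refl = no-clique xm ab (adj-sym G (∧-snd {P b} hb)) (adj-sym G (∧-snd {P a} ha))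
                 (type-adj ta) (type-adj tb) (λ m _ → F-xs hv m)

    Uniform : Fin n → Fin n → Set
    Uniform x v = (∀ y → y ∈ᵖ T v → Type x y) × (∀ y z → y ∈ᵖ T v → z ∈ᵖ T v → ¬ A y z)

    -- By `edgeless`, every element of T v has a mate of its own type in T v. A vertex has only one
    -- type, and three elements cannot be split into groups of at least two, so all types agree.
    uniform : ∀ {v} → v ∈ᵖ F → (∀ y → y ∈ᵖ T v → NonSpecial v y) → ∃ λ x → x ∈ xs × Uniform x v
    uniform {v} hv ns = go (avoid (T v) [] (≤-trans (s≤s z≤n) (≤-reflexive (≡-sym (size v hv)))))
      where
      indep : ∀ y z → y ∈ᵖ T v → z ∈ᵖ T v → ¬ A y z
      indep y z hy hz e = edgeless hv ns hy hz e
      mate : ∀ y → y ∈ᵖ T v → ∃ λ z → z ∈ᵖ T v × z ≢ y × (∃ λ x → x ∈ xs × Type x y × Type x z)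
      mate y hy with ns y hy
      ... | z , hz , ne , _ , inj₁ m = let (x , xm , t , t′) = findᵐ m in z , hz , ne , x , xm , t , t′
      ... | z , hz , ne , _ , inj₂ (z′ , hz′ , e) = ⊥-elim (indep z z′ hz hz′ e)
      go : (∃ λ a → a ∈ᵖ T v × All (a ≢_) []) → ∃ λ x → x ∈ xs × Uniform x v
      go (a , ha , []) with mate a ha
      ... | b , hb , b≢a , x , xm , ta , tb with three (T v) {a} {b} (size v hv) ha hb (λ e → b≢a (≡-sym e))
      ...   | c , hc , ac , bc , only = x , xm , types , indep
        where
        tc : Type x c
        tc with mate c hc
        ... | z , hz , z≢c , x′ , xm′ , tc′ , tz with only z hz
        ...   | inj₁ refl = subst (λ s → Type s c) (≡-sym (type-unique xm′ ta tz)) tc′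
        ...   | inj₂ (inj₁ refl) = subst (λ s → Type s c) (≡-sym (type-unique xm′ tb tz)) tc′
        ...   | inj₂ (inj₂ e) = ⊥-elim (z≢c e)
        types : ∀ y → y ∈ᵖ T v → Type x y
        types y hy with only y hy
        ... | inj₁ refl = ta
        ... | inj₂ (inj₁ refl) = tb
        ... | inj₂ (inj₂ refl) = tc

    -- If `y` is not adjacent to `y′`, take the q-clique shared by `v` and `y′`. It has a vertex z
    -- not adjacent to `y`, since otherwise it extends by `v` and `y`. As `y` and `y′` agree on
    -- `xs`, z is in T v. If z has no neighbour in T v, the other q - 1 vertices lie in `xs` and are
    -- adjacent to `y` and z, which are thus mates.
    special-adj : ∀ {v y y′} → v ∈ᵖ F → y ∈ᵖ special v → y′ ∈ᵖ P → adj G v y′ ≡ false →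
      (∀ {s} → s ∈ xs → adj G y s ≡ adj G y′ s) → A y y′
    special-adj {v} {y} {y′} hv hs hy′ vy′ same with Bool-dichotomy (adj G y y′)
    ... | inj₁ e = e
    ... | inj₂ yy′ with common-clique G sat (λ { refl → t≢f hy′ (F-P hv) }) vy′
    ...   | Q , lQ , clQ , nb = ⊥-elim (go (All.all? (λ z → adj G y z ≟ᵇ true) Q))
      where
      hy : y ∈ᵖ T v
      hy = ∧-fst hs
      vQ : ∀ {z} → z ∈ Q → A v z
      vQ m = proj₁ (All.lookup nb m)
      y′Q : ∀ {z} → z ∈ Q → A y′ z
      y′Q m = proj₂ (All.lookup nb m)
      nonSp : ¬ NonSpecial v y
      nonSp = ⌊⌋-refute (nonSpecial? v y) (not-elim (∧-snd {T v y} hs))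
      split : ∀ {z} → z ∈ Q → z ∈ xs ⊎ z ∈ᵖ T v
      split m with F-nbr hv (vQ m)
      ... | inj₁ e = inj₁ e
      ... | inj₂ e = inj₂ (∧-intro e (vQ m))
      outer : ∀ {z} → z ∈ Q → adj G y z ≡ false → ⊥
      outer {z} m yz with split m
      ... | inj₁ zx = t≢f (trans (same zx) (y′Q m)) yz
      ... | inj₂ zT = nonSp (z , zT , (λ { refl → t≢f (adj-sym G (y′Q m)) yy′ }) , adj-sym G yz , inj₁ mates)
        where
        noZ : ∀ {z′} → z′ ∈ᵖ T v → ¬ A z z′
        noZ {z′} hz′ e = nonSp (z , zT , (λ { refl → t≢f (adj-sym G (y′Q m)) yy′ }) , adj-sym G yz , inj₂ (z′ , hz′ , e))
        D = Clique-delete clQ m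
        Q′ = proj₁ D
        inX : ∀ {s} → s ∈ Q′ → s ∈ xs
        inX i with split (proj₁ (proj₁ (proj₂ (proj₂ (proj₂ D))) i))
        ... | inj₁ e = e
        ... | inj₂ e = ⊥-elim (noZ e (adj-sym G (proj₂ (proj₁ (proj₂ (proj₂ (proj₂ D))) i))))
        yQ′ : ∀ {s} → s ∈ Q′ → A y s
        yQ′ i = trans (same (inX i)) (y′Q (proj₁ (proj₁ (proj₂ (proj₂ (proj₂ D))) i)))
        zQ′ : ∀ {s} → s ∈ Q′ → A z s
        zQ′ i = adj-sym G (proj₂ (proj₁ (proj₂ (proj₂ (proj₂ D))) i))
        mates : Mate y z
        mates with misses hv hy | misses hv zT
        ... | x , xm , yx | x′ , xm′ , zx′ with Clique-delete cl xm
        ...   | ys , lys , clys , subys , allys = lose xm ((yx , types yQ′) , (subst (λ s → adj G z s ≡ false) x′≡x zx′ , types zQ′))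
          where
          Q′⊆ys : ∀ {s} → s ∈ Q′ → s ∈ ys
          Q′⊆ys i = allys (inX i) (λ { refl → t≢f (yQ′ i) yx })
          ys⊆Q′ : ∀ {s} → s ∈ ys → s ∈ Q′
          ys⊆Q′ = Clique-cover (proj₁ (proj₂ (proj₂ D))) Q′⊆ys (≤-reflexive (suc-injective (trans (≡-sym lys) (trans len (trans (≡-sym lQ) (proj₁ (proj₂ D)))))))
          types : ∀ {w} → (∀ {s} → s ∈ Q′ → A w s) → All (λ s → s ≡ x ⊎ A w s) xs
          types {w} h = All.tabulate λ {s} m → go s m
            where
            go : ∀ s → s ∈ xs → s ≡ x ⊎ A w s
            go s m with s ≟ x
            ... | yes e = inj₁ e
            ... | no ne = inj₂ (h (ys⊆Q′ (allys m ne)))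
          x′≡x : x′ ≡ x
          x′≡x with x′ ≟ x
          ... | yes e = e
          ... | no ne = ⊥-elim (t≢f (zQ′ (ys⊆Q′ (allys xm′ ne))) zx′)
      go : Dec (All (λ z → A y z) Q) → ⊥
      go (yes a) = <-irrefl refl (≤-trans (cb (v ∷ y ∷ Q) ((∧-snd {P y} hy ∷ All.tabulate vQ) ∷ a ∷ clQ)) (≤-reflexive (cong (2 +_) (≡-sym lQ))))
      go (no ¬a) with findᵐ (¬All⇒Any¬ (λ z → adj G y z ≟ᵇ true) Q ¬a)
      ... | z , m , nz = outer m (¬t⇒f nz)

    module _ (Z : ℕ) (hZ : s₂ G P ≤ Z) where
      W₂ : ℕ
      W₂ = root 1 (3 * Z * (r * r) + 1)

      σ : Fin n → Fin n
      σ v = pick G (special v) v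

      Fₛ : Pred n
      Fₛ v = F v ∧ special v (σ v)

      -- Once the trace of `σ v` on `xs` is fixed, which leaves 2 ^ q classes, `special-adj`
      -- supplies the hypothesis of `greedy-clique`; links are families of 2-sets.
      special-count : count Fₛ ≤ 2 ^ q * (r * (3 * W₂))
      special-count = subst (λ l → count Fₛ ≤ 2 ^ l * (r * (3 * W₂))) (trans (length-map test xs) len)
          (count-classes (mapᴸ test xs) Fₛ (r * (3 * W₂)) class)
        where
        test : Fin n → Pred n
        test s v = adj G (σ v) s
        class : ∀ F′ → F′ ⊆ᵖ Fₛ → Constant (mapᴸ test xs) F′ → count F′ ≤ r * (3 * W₂)
        class F′ s c = greedy-clique G {F = F′} {U = P} 3 W₂ σ cb (λ v hv → ≤-reflexive (size v (inF v hv)))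
            (λ v hv → ∧-fst (∧-snd {F v} (s v hv)))
            (λ a ha → sys-2 G Z cb (≤-trans (s₂-mono G {U = P except a} {U′ = P} (λ y e → ∧-fst e)) hZ) (sys-link G a ha (sys-sub G inF S))) pair
          where
          inF : F′ ⊆ᵖ F
          inF v hv = ∧-fst (s v hv)
          pair : ∀ v v′ → v ∈ᵖ F′ → v′ ∈ᵖ F′ → A (σ v) (σ v′) ⊎ A v (σ v′)
          pair v v′ hv hv′ with Bool-dichotomy (adj G v (σ v′))
          ... | inj₁ e = inj₂ e
          ... | inj₂ e = inj₁ (special-adj (inF v hv) (∧-snd {F v} (s v hv)) (∧-fst (∧-fst (∧-snd {F v′} (s v′ hv′)))) e
                  λ m → All.lookup c (∈-map⁺ test m) v v′ hv hv′)

      Uₓ : Fin n → Pred n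
      Uₓ x y = P y ∧ ⌊ type? x y ⌋

      Fₓ : Fin n → Pred n
      Fₓ x v = F v ∧ (⌊ all? (λ y → (T v y ≟ᵇ false) ⊎-dec type? x y) ⌋ ∧
                      ⌊ all? (λ y → all? λ z → (T v y ∧ T v z ≟ᵇ false) ⊎-dec (adj G y z ≟ᵇ false)) ⌋)

      module _ {x : Fin n} (xm : x ∈ xs) where
        inFₓ : Fₓ x ⊆ᵖ F
        inFₓ v h = ∧-fst h
        Fₓ-type : ∀ {v y} → v ∈ᵖ Fₓ x → y ∈ᵖ T v → Type x y
        Fₓ-type {v} {y} h hy with ⌊⌋-elim (all? (λ y → (T v y ≟ᵇ false) ⊎-dec type? x y)) (∧-fst (∧-snd {F v} h)) y
        ... | inj₁ e = ⊥-elim (t≢f hy e)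
        ... | inj₂ e = e
        Fₓ-indep : ∀ {v y z} → v ∈ᵖ Fₓ x → y ∈ᵖ T v → z ∈ᵖ T v → ¬ A y z
        Fₓ-indep {v} {y} {z} h hy hz yz with ⌊⌋-elim (all? (λ y → all? λ z → (T v y ∧ T v z ≟ᵇ false) ⊎-dec (adj G y z ≟ᵇ false)))
                                     (∧-snd {⌊ all? (λ y → (T v y ≟ᵇ false) ⊎-dec type? x y) ⌋} (∧-snd {F v} h)) y z
        ... | inj₁ e = t≢f (∧-intro hy hz) e
        ... | inj₂ e = t≢f yz e
        Uₓ-P : Uₓ x ⊆ᵖ P
        Uₓ-P y h = ∧-fst h
        Uₓ-type : ∀ {y} → y ∈ᵖ Uₓ x → Type x y
        Uₓ-type {y} h = ⌊⌋-elim (type? x y) (∧-snd {P y} h)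
        T-Uₓ : ∀ {v y} → v ∈ᵖ Fₓ x → y ∈ᵖ P → A v y → y ∈ᵖ Uₓ x
        T-Uₓ {v} {y} hv hy e = ∧-intro hy (⌊⌋-intro (type? x y) (Fₓ-type hv (∧-intro hy e)))

        Sₓ : Sys G (Fₓ x) (Uₓ x) 3
        Sₓ = record
          { size = λ v hv → trans (≤-antisym (degIn-⊆ G {U = Uₓ x} {U′ = P} v λ y h _ → Uₓ-P y h) (degIn-⊆ G {U = P} {U′ = Uₓ x} v λ y h e → T-Uₓ hv h e)) (size v (inFₓ v hv))
          ; dist = λ v v′ hv hv′ eq → dist v v′ (inFₓ v hv) (inFₓ v′ hv′) λ y hy → agree hv hv′ eq y hy (Bool-dichotomy (adj G v y)) (Bool-dichotomy (adj G v′ y))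
          ; star = λ v v′ y hv hv′ hy vy v′y → let (z , hz , zy , v′z , vz) = star v v′ y (inFₓ v hv) (inFₓ v′ hv′) (Uₓ-P y hy) vy v′y
                                               in z , T-Uₓ hv′ hz v′z , zy , v′z , vz }
          where
          agree : ∀ {v v′} → v ∈ᵖ Fₓ x → v′ ∈ᵖ Fₓ x → (∀ y → y ∈ᵖ Uₓ x → adj G v y ≡ adj G v′ y) → ∀ y → y ∈ᵖ P →
            A v y ⊎ adj G v y ≡ false → A v′ y ⊎ adj G v′ y ≡ false → adj G v y ≡ adj G v′ y
          agree hv hv′ eq y hy (inj₁ e) _ = eq y (T-Uₓ hv hy e)
          agree hv hv′ eq y hy _ (inj₁ e) = eq y (T-Uₓ hv′ hy e)
          agree hv hv′ eq y hy (inj₂ a) (inj₂ b) = trans a (≡-sym b)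

        uniform-count : count (Fₓ x) ≤ root 3 (Y₃ r Z)
        uniform-count = sys-3 G Z cb (≤-trans (s₂-mono G Uₓ-P) hZ) Sₓ
          (λ ha hb hc ab bc ac → no-clique xm ab bc ac (type-adj (Uₓ-type ha)) (type-adj (Uₓ-type hb)) (type-adj (Uₓ-type hc)))
          (λ {v} {a} {b} hv ha hb va vb ab → Fₓ-indep hv (∧-intro (Uₓ-P a ha) va) (∧-intro (Uₓ-P b hb) vb) ab)

      class-three : count F ≤ 2 ^ q * (r * (3 * W₂)) + q * root 3 (Y₃ r Z)
      class-three = ≤-trans (count-union {F = F} {Fₛ} (listPred xs) Fₓ split) (+-mono-≤ special-count
          (≤-trans (sum-≤-count* (listPred xs) (count ∘ Fₓ) (root 3 (Y₃ r Z)) (λ x h → uniform-count (listPred-∈ xs h)))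
            (*-monoˡ-≤ (root 3 (Y₃ r Z)) (≤-trans (listPred-≤ xs) (≤-reflexive len)))))
        where
        split : ∀ v → v ∈ᵖ F → v ∈ᵖ Fₛ ⊎ (∃ λ x → x ∈ᵖ listPred xs × v ∈ᵖ Fₓ x)
        split v hv = decide (find (special v))
          where
          Member = v ∈ᵖ Fₛ ⊎ (∃ λ x → x ∈ᵖ listPred xs × v ∈ᵖ Fₓ x)
          mk : (∃ λ x → x ∈ xs × Uniform x v) → ∃ λ x → x ∈ᵖ listPred xs × v ∈ᵖ Fₓ x
          mk (x , xm , ty , ind) = x , ∈-listPred xm , ∧-intro hv (∧-intro
            (⌊⌋-intro (all? (λ y → (T v y ≟ᵇ false) ⊎-dec type? x y)) λ y → case Bool-dichotomy (T v y) of λ { (inj₁ e) → inj₂ (ty y e) ; (inj₂ e) → inj₁ e })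
            (⌊⌋-intro (all? (λ y → all? λ z → (T v y ∧ T v z ≟ᵇ false) ⊎-dec (adj G y z ≟ᵇ false)))
              λ y z → case Bool-dichotomy (T v y ∧ T v z) of λ { (inj₁ e) → inj₂ (¬t⇒f (ind y z (∧-fst e) (∧-snd {T v y} e))) ; (inj₂ e) → inj₁ e }))
          ns : (∀ y → special v y ≡ false) → ∀ y → y ∈ᵖ T v → NonSpecial v y
          ns none y hy = by (nonSpecial? v y)
            where
            by : Dec (NonSpecial v y) → NonSpecial v y
            by (yes a) = a
            by (no ¬a) = ⊥-elim (t≢f (∧-intro hy (not-intro (⌊⌋-false (nonSpecial? v y) ¬a))) (none y))
          decide : (∃ λ y → y ∈ᵖ special v) ⊎ (∀ y → special v y ≡ false) → Member
          decide (inj₁ (y , hy)) = inj₁ (∧-intro hv (pick-∈ G (special v) v hy))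
          decide (inj₂ none) = inj₂ (mk (uniform hv (ns none)))

-- From admissible graphs to families of k-sets.

module _ {n : ℕ} (G : SimpleGraph n) where

  module Classes {q t C : ℕ} (adm : Admissible n (2 + q) t G) (t<C : t < C) (K : Core G q C) where
    open Core K public

    sat : Saturated (2 + q) G
    sat = proj₁ adm

    cb : CliqueBound G (2 + q)
    cb ys c = ≰⇒> λ le → proj₁ sat (Clique⇒HasClique G c le)

    A : Fin n → Fin n → Set
    A x y = adj G x y ≡ true

    L-¬R : ∀ {v} → v ∈ᵖ L → R v ≡ false
    L-¬R {v} h with R v | L v | P v | Q v | cls v
    ... | _ | _ | _ | _ | inL = refl
    L-¬R {v} () | _ | _ | _ | _ | inR
    L-¬R {v} () | _ | _ | _ | _ | inP
    L-¬R {v} () | _ | _ | _ | _ | inQ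

    L-¬P : ∀ {v} → v ∈ᵖ L → P v ≡ false
    L-¬P {v} h with R v | L v | P v | Q v | cls v
    ... | _ | _ | _ | _ | inL = refl
    L-¬P {v} () | _ | _ | _ | _ | inR
    L-¬P {v} () | _ | _ | _ | _ | inP
    L-¬P {v} () | _ | _ | _ | _ | inQ

    P-¬R : ∀ {v} → v ∈ᵖ P → R v ≡ false
    P-¬R {v} h with R v | L v | P v | Q v | cls v
    ... | _ | _ | _ | _ | inP = refl
    P-¬R {v} () | _ | _ | _ | _ | inR
    P-¬R {v} () | _ | _ | _ | _ | inL
    P-¬R {v} () | _ | _ | _ | _ | inQ

    vertex-count : n ≤ count R + (count L + (count P + count Q))
    vertex-count = ≤-trans (≤-reflexive (≡-sym (count-all {n} {λ _ → true} λ _ → refl)))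
      (≤-trans (count-cover {F = λ _ → true} {R} {λ v → L v ∨ (P v ∨ Q v)} λ v _ → c₁ (cls v))
        (+-monoʳ-≤ (count R) (≤-trans (count-cover {F = λ v → L v ∨ (P v ∨ Q v)} {L} {λ v → P v ∨ Q v} λ v h → ∨-elim {L v} h)
          (+-monoʳ-≤ (count L) (count-cover {F = λ v → P v ∨ Q v} {P} {Q} λ v h → ∨-elim {P v} h)))))
      where
      c₁ : ∀ {a b c d} → Cls a b c d → a ≡ true ⊎ b ∨ (c ∨ d) ≡ true
      c₁ inR = inj₁ refl
      c₁ inL = inj₂ refl
      c₁ inP = inj₂ refl
      c₁ inQ = inj₂ refl

    P-deg′ : ∀ {w} → w ∈ᵖ P → C ≤ deg G w
    P-deg′ {w} h = ≤-trans (P-deg w h) (count-mono {F = R ∩ adj G w} {adj G w} λ y e → ∧-snd {R y} e)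

    TNbr : Fin n → Set
    TNbr v = ∃ λ w → w ∈ᵖ R × A v w × deg G w ≡ t

    tNbr? : ∀ v → Dec (TNbr v)
    tNbr? v = any? λ w → (R w ≟ᵇ true) ×-dec (adj G v w ≟ᵇ true) ×-dec (deg G w ≟ℕ t)

    -- Twins are only tolerated with a common neighbour of degree `t`. Dropping the neighbours of
    -- such vertices of `R` costs at most |R| t vertices, and all vertices of `P` have degree at
    -- least C > t, so `Lᵒ` contains no twins.
    Lᵒ : Pred n
    Lᵒ v = L v ∧ not ⌊ tNbr? v ⌋

    Lᵒ-L : Lᵒ ⊆ᵖ L
    Lᵒ-L v h = ∧-fst h

    L-count : ∀ (H : Pred n) → count (L ∩ H) ≤ count (Lᵒ ∩ H) + count R * t
    L-count H = ≤-trans (count-union {F = L ∩ H} {Lᵒ ∩ H} Rₜ (λ w → adj G w) split) (+-monoʳ-≤ (count (Lᵒ ∩ H))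
        (≤-trans (sum-≤-count* Rₜ (deg G) t (λ w h → ≤-reflexive (⌊⌋-elim (deg G w ≟ℕ t) (∧-snd {R w} h))))
          (*-monoˡ-≤ t (count-mono {F = Rₜ} {R} λ w h → ∧-fst h))))
      where
      Rₜ : Pred n
      Rₜ w = R w ∧ ⌊ deg G w ≟ℕ t ⌋
      split : ∀ v → v ∈ᵖ (L ∩ H) → v ∈ᵖ (Lᵒ ∩ H) ⊎ (∃ λ w → w ∈ᵖ Rₜ × v ∈ᵖ adj G w)
      split v h = by (tNbr? v)
        where
        by : Dec (TNbr v) → v ∈ᵖ (Lᵒ ∩ H) ⊎ (∃ λ w → w ∈ᵖ Rₜ × v ∈ᵖ adj G w)
        by (yes (w , Rw , vw , d)) = inj₂ (w , ∧-intro Rw (⌊⌋-intro (deg G w ≟ℕ t) d) , adj-sym G vw)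
        by (no ¬w) = inj₁ (∧-intro (∧-intro (∧-fst h) (not-intro (⌊⌋-false (tNbr? v) ¬w))) (∧-snd {L v} h))

    L-indep : ∀ {u v} → u ∈ᵖ L → v ∈ᵖ L → adj G u v ≡ false
    L-indep {u} {v} hu hv = ¬t⇒f λ e → case L-nbr u v hu e of λ
      { (inj₁ r) → t≢f r (L-¬R hv) ; (inj₂ p) → t≢f p (L-¬P hv) }

    L-deg : ∀ {v} → v ∈ᵖ L → deg G v ≡ degIn G R v + degIn G P v
    L-deg {v} hv = trans (count-split (adj G v) R) (cong₂ _+_ (count-cong λ y → ∧-comm (adj G v y) (R y)) (count-cong pt))
      where
      pt : ∀ y → adj G v y ∧ not (R y) ≡ P y ∧ adj G v y
      pt y with Bool-dichotomy (adj G v y) | Bool-dichotomy (P y)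
      ... | inj₂ a | _ rewrite a = ∧-comm false (P y)
      ... | inj₁ a | inj₁ b rewrite a | b | P-¬R b = refl
      ... | inj₁ a | inj₂ b with L-nbr v y hv a
      ...   | inj₁ r rewrite a | b | r = refl
      ...   | inj₂ p = ⊥-elim (t≢f p b)

    R-deg : ∀ {v} → v ∈ᵖ L → q ≤ degIn G R v
    R-deg {v} hv with L-clique v hv
    ... | xs , len , cl , nb = ≤-trans (≤-reflexive (≡-sym len)) (≤-trans (listPred-count (Clique-distinct G cl))
          (count-mono {F = listPred xs} {R ∩ adj G v} λ y h → let (a , b) = All.lookup nb (listPred-∈ xs h) in ∧-intro a b))

    SameR : Pred n → Set
    SameR F = ∀ u v y → u ∈ᵖ F → v ∈ᵖ F → y ∈ᵖ R → adj G u y ≡ adj G v y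

    -- For `star`: `v′` and `y` share a q-clique, which `v` cannot see completely, since `v` and `y`
    -- would extend it. The vertex that `v` misses is in `P`, as `v` and `v′` agree on `R`.
    class-sys : ∀ {F k} → F ⊆ᵖ Lᵒ → SameR F → (∀ v → v ∈ᵖ F → degIn G P v ≡ k) → Sys G F P k
    class-sys {F} {k} s same sz = record { size = sz ; dist = dst ; star = str }
      where
      inL′ : F ⊆ᵖ L
      inL′ v h = Lᵒ-L v (s v h)
      dst : ∀ v v′ → v ∈ᵖ F → v′ ∈ᵖ F → (∀ y → y ∈ᵖ P → adj G v y ≡ adj G v′ y) → v ≡ v′
      dst v v′ hv hv′ eq with v ≟ v′
      ... | yes e = e
      ... | no ne = ⊥-elim (clash (proj₂ (proj₂ adm) v v′ (ne , agree)))
        where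
        other : ∀ {u} y → u ∈ᵖ F → R y ≡ false → P y ≡ false → adj G u y ≡ false
        other {u} y hu r p = ¬t⇒f λ e → case L-nbr u y (inL′ u hu) e of λ { (inj₁ r′) → t≢f r′ r ; (inj₂ p′) → t≢f p′ p }
        agree : ∀ w → adj G v w ≡ adj G v′ w
        agree w with Bool-dichotomy (R w) | Bool-dichotomy (P w)
        ... | inj₁ r | _ = same v v′ w hv hv′ r
        ... | inj₂ _ | inj₁ p = eq w p
        ... | inj₂ r | inj₂ p = trans (other w hv r p) (≡-sym (other w hv′ r p))
        clash : (∃ λ w → A v w × A v′ w × deg G w ≡ t) → ⊥
        clash (w , vw , _ , d) with L-nbr v w (inL′ v hv) vw
        ... | inj₁ r = ⌊⌋-refute (tNbr? v) (not-elim (∧-snd {L v} (s v hv))) (w , r , vw , d)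
        ... | inj₂ p = <-irrefl refl (≤-trans t<C (≤-trans (P-deg′ p) (≤-reflexive d)))
      str : ∀ v v′ y → v ∈ᵖ F → v′ ∈ᵖ F → y ∈ᵖ P → A v y → adj G v′ y ≡ false →
        ∃ λ z → z ∈ᵖ P × A z y × A v′ z × adj G v z ≡ false
      str v v′ y hv hv′ hy vy v′y with common-clique G sat (λ { refl → t≢f hy (L-¬P (inL′ v′ hv′)) }) v′y
      ... | ys , len , cl , nb with All.all? (λ z → adj G v z ≟ᵇ true) ys
      ...   | yes a = ⊥-elim (<-irrefl refl (≤-trans (cb (v ∷ y ∷ ys) ((vy ∷ a) ∷ All.map proj₂ nb ∷ cl)) (≤-reflexive (cong (2 +_) (≡-sym len)))))
      ...   | no ¬a with findᵐ (¬All⇒Any¬ (λ z → adj G v z ≟ᵇ true) ys ¬a)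
      ...     | z , m , nz with L-nbr v′ z (inL′ v′ hv′) (proj₁ (All.lookup nb m))
      ...       | inj₁ r = ⊥-elim (nz (trans (same v v′ z hv hv′ r) (proj₁ (All.lookup nb m))))
      ...       | inj₂ p = z , p , adj-sym G (proj₂ (All.lookup nb m)) , proj₁ (All.lookup nb m) , ¬t⇒f nz

    -- Splitting by the trace on R; all members of a class have the same trace sizes i and k.
    class-bound : ∀ (H : Pred n) d B → H ⊆ᵖ Lᵒ → (∀ v → v ∈ᵖ H → deg G v ≡ d) →
      (∀ F i k → F ⊆ᵖ H → SameR F → q ≤ i → i + k ≡ d → (∀ v → v ∈ᵖ F → degIn G R v ≡ i) → Sys G F P k → count F ≤ B) →
      count H ≤ 2 ^ count R * B
    class-bound H d B sub hd hB = subst (λ l → count H ≤ 2 ^ l * B) (trans (length-map test (elems R)) (elems-length R))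
        (count-classes (mapᴸ test (elems R)) H B class)
      where
      test : Fin n → Pred n
      test x v = adj G v x
      class : ∀ F → F ⊆ᵖ H → Constant (mapᴸ test (elems R)) F → count F ≤ B
      class F s c = by (find F)
        where
        same : SameR F
        same u v y hu hv hy = All.lookup c (∈-map⁺ test (elems-∈ R hy)) u v hu hv
        ptR : ∀ {u v} → u ∈ᵖ F → v ∈ᵖ F → ∀ y → R y ∧ adj G u y ≡ R y ∧ adj G v y
        ptR {u} {v} hu hv y with Bool-dichotomy (R y)
        ... | inj₁ e rewrite e = same u v y hu hv e
        ... | inj₂ e rewrite e = refl
        by : (∃ λ v → v ∈ᵖ F) ⊎ (∀ v → F v ≡ false) → count F ≤ B
        by (inj₂ none) = ≤-trans (≤-reflexive (count-none none)) z≤n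
        by (inj₁ (v₀ , h₀)) = hB F i k s same (R-deg (inLᵛ v₀ h₀)) (trans (≡-sym (L-deg (inLᵛ v₀ h₀))) (hd v₀ (s v₀ h₀))) sizeR
            (class-sys (λ v h → sub v (s v h)) same sizeP)
          where
          i = degIn G R v₀
          k = degIn G P v₀
          inLᵛ : F ⊆ᵖ L
          inLᵛ v h = Lᵒ-L v (sub v (s v h))
          sizeR : ∀ v → v ∈ᵖ F → degIn G R v ≡ i
          sizeR v hv = count-cong (ptR hv h₀)
          sizeP : ∀ v → v ∈ᵖ F → degIn G P v ≡ k
          sizeP v hv = +-cancelˡ-≡ i (degIn G P v) k (trans (cong (_+ degIn G P v) (≡-sym (sizeR v hv)))
            (trans (≡-sym (L-deg (inLᵛ v hv))) (trans (trans (hd v (s v hv)) (≡-sym (hd v₀ (s v₀ h₀)))) (L-deg (inLᵛ v₀ h₀)))))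

    W₂ X₃ B₃ : ℕ → ℕ
    W₂ Z = root 1 (3 * Z * ((2 + q) * (2 + q)) + 1)
    X₃ Z = root 3 (Y₃ (2 + q) Z)
    B₃ Z = 1 + (2 + q) + W₂ Z + (2 ^ q * ((2 + q) * (3 * W₂ Z)) + q * X₃ Z)

    -- Degrees at most r + 1: the traces on P have size at most 3.
    low-class : ∀ d Z → d ≤ 3 + q → s₂ G P ≤ Z → count (λ v → Lᵒ v ∧ ⌊ deg G v ≟ℕ d ⌋) ≤ 2 ^ count R * B₃ Z
    low-class d Z d≤ hZ = class-bound _ d (B₃ Z) (λ v h → ∧-fst h) (λ v h → ⌊⌋-elim (deg G v ≟ℕ d) (∧-snd {Lᵒ v} h)) by-size
      where
      by-size : ∀ F i k → F ⊆ᵖ (λ v → Lᵒ v ∧ ⌊ deg G v ≟ℕ d ⌋) → SameR F → q ≤ i → i + k ≡ d → (∀ v → v ∈ᵖ F → degIn G R v ≡ i) → Sys G F P k → count F ≤ B₃ Z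
      by-size F i 0 s same qi e sz S = ≤-trans (sys-0 G S) (s≤s z≤n)
      by-size F i 1 s same qi e sz S = ≤-trans (sys-1 G cb S) (≤-trans (≤-trans (n≤1+n _) (m≤m+n _ (W₂ Z))) (m≤m+n _ _))
      by-size F i 2 s same qi e sz S = ≤-trans (sys-2 G Z cb hZ S) (≤-trans (m≤n+m _ (1 + (2 + q))) (m≤m+n _ _))
      -- Degree at most 3 + q and three neighbours in `P` leave exactly q neighbours in `R`, namely
      -- the clique of `L-clique`; this is the setting of `ClassThree`.
      by-size F i 3 s same qi e sz S = by (find F)
        where
        i≡q : i ≡ q
        i≡q = ≤-antisym (+-cancelʳ-≤ 3 i q (≤-trans (≤-reflexive e) (≤-trans d≤ (≤-reflexive (+-comm 3 q))))) qi
        inLᵛ : F ⊆ᵖ L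
        inLᵛ v h = ∧-fst (∧-fst (s v h))
        by : (∃ λ v → v ∈ᵖ F) ⊎ (∀ v → F v ≡ false) → count F ≤ B₃ Z
        by (inj₂ none) = ≤-trans (≤-reflexive (count-none none)) z≤n
        by (inj₁ (v₀ , h₀)) = go (L-clique v₀ (inLᵛ v₀ h₀))
          where
          go : (∃ λ xs → length xs ≡ q × Clique G xs × All (λ z → z ∈ᵖ R × A v₀ z) xs) → count F ≤ B₃ Z
          go (xs , len , cl , nb) = ≤-trans (ClassThree.class-three G sat {F} {P} xs len cl
              (λ {v} {x} hv m → let (a , b) = All.lookup nb m in trans (same v v₀ x hv h₀ a) b)
              (λ {v} {y} hv e → case L-nbr v y (inLᵛ v hv) e of λ
                 { (inj₁ r) → inj₁ (inXs r (trans (same v₀ v y h₀ hv r) e)) ; (inj₂ p) → inj₂ p })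
              (λ {v} hv → L-¬P (inLᵛ v hv)) S Z hZ) (m≤n+m _ (1 + (2 + q) + W₂ Z))
            where
            inXs : ∀ {y} → y ∈ᵖ R → A v₀ y → y ∈ xs
            inXs {y} r e = listPred-∈ xs (count-≡⇒⊇ {F = listPred xs} {R ∩ adj G v₀}
              (λ z h → let (a , b) = All.lookup nb (listPred-∈ xs h) in ∧-intro a b)
              (≤-trans (≤-reflexive (trans (sz v₀ h₀) (trans i≡q (≡-sym len)))) (listPred-count (Clique-distinct G cl))) y (∧-intro r e))
      by-size F i (suc (suc (suc (suc k)))) s same qi e sz S = ⊥-elim (<-irrefl refl
        (≤-trans (≤-trans (≤-reflexive (+-comm 4 q)) (+-mono-≤ qi (s≤s (s≤s (s≤s (s≤s (z≤n {k}))))))) (≤-trans (≤-reflexive e) d≤)))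

-- Lower bounds on the excess over t n.

1≤^ : ∀ a k → 1 ≤ suc a ^ k
1≤^ a k = m^n>0 (suc a) k

^-distribʳ-* : ∀ k a b → (a * b) ^ k ≡ a ^ k * b ^ k
^-distribʳ-* zero a b = refl
^-distribʳ-* (suc k) a b rewrite ^-distribʳ-* k a b = lem a b (a ^ k) (b ^ k)
  where
  lem : ∀ a b c d → a * b * (c * d) ≡ a * c * (b * d)
  lem = solve-∀

-- `PolyBounds` has no additive constant beside the excess `s`. For n > c the excess is positive, so
-- 1 + s ≤ 2 s.
poly-finish : ∀ a k c n s → n ^ suc a ≤ c * suc s ^ suc k → c < n → n ^ suc a ≤ (2 * c * s) ^ suc k
poly-finish a k c n zero h c<n = ⊥-elim (<-irrefl refl (≤-trans c<n (≤-trans (m≤m^suc n a) (≤-trans h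
  (≤-reflexive (trans (cong (c *_) (^-zeroˡ (suc k))) (*-identityʳ c)))))))
poly-finish a k c n (suc s) h c<n = begin
  n ^ suc a ≤⟨ h ⟩
  c * suc (suc s) ^ suc k ≤⟨ *-mono-≤ (m≤m^suc c k) (^-monoˡ-≤ (suc k) (≤-trans (m≤m+n (2 + s) s) (≤-reflexive (e s)))) ⟩
  c ^ suc k * (2 * suc s) ^ suc k ≡⟨ ≡-sym (^-distribʳ-* (suc k) c (2 * suc s)) ⟩
  (c * (2 * suc s)) ^ suc k ≡⟨ cong (_^ suc k) (e₂ c (suc s)) ⟩
  (2 * c * suc s) ^ suc k ∎
  where
  open ≤-Reasoning
  e : ∀ s → 2 + s + s ≡ 2 * (1 + s)
  e = solve-∀
  e₂ : ∀ c s → c * (2 * s) ≡ 2 * c * s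
  e₂ = solve-∀

module _ {n : ℕ} (G : SimpleGraph n) where

  module Excess {q t : ℕ} (adm : Admissible n (2 + q) t G) (K : Core G q (suc t)) where
    open Classes G adm ≤-refl K public

    ρ s σ : ℕ
    ρ = coreSize (suc t) (3 * suc t)
    s = edges G ∸ t * n
    σ = s + t * ρ

    Lₜ L₊ : Pred n
    Lₜ v = Lᵒ v ∧ ⌊ deg G v ≟ℕ t ⌋
    L₊ v = L v ∧ ⌊ t <? deg G v ⌋

    private
      b = count P + count Q

      L-sum : count L * t + count L₊ ≤ sumFin (λ v → 𝟙 (L v) * deg G v)
      L-sum = ≤-trans (≤-reflexive (cong₂ _+_ (trans (cong (_* t) (count≡sum L)) (≡-sym (sum-*ʳ (𝟙 ∘ L) t))) (count≡sum L₊)))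
        (≤-trans (≤-reflexive (≡-sym (sum-+ (λ v → 𝟙 (L v) * t) (𝟙 ∘ L₊)))) (sum-mono pt))
        where
        pt : ∀ v → 𝟙 (L v) * t + 𝟙 (L₊ v) ≤ 𝟙 (L v) * deg G v
        pt v with L v
        ... | false = z≤n
        ... | true with t <? deg G v
        ...   | yes lt = ≤-trans (≤-reflexive (e t)) (≤-trans lt (≤-reflexive (≡-sym (+-identityʳ _))))
          where
          e : ∀ t → t + 0 + 1 ≡ 1 + t
          e = solve-∀
        ...   | no _ = ≤-trans (≤-reflexive (e t)) (≤-trans (proj₁ (proj₂ adm) v) (≤-reflexive (≡-sym (+-identityʳ _))))
          where
          e : ∀ t → t + 0 + 0 ≡ t
          e = solve-∀

      -- With C = t + 1, every vertex of `P`, `Q` and `L₊` weighs at least one more than its share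
      -- `t` of t n; only the at most ρ vertices of `R` may fall short, by `t` each. This is the
      -- slack t ρ in `σ`.
      main : 2 * (count L₊ + b) + s₂ G P ≤ 2 * σ
      main = +-cancelˡ-≤ (2 * (count L * t + t * b)) _ _ (begin
        2 * (count L * t + t * b) + (2 * (count L₊ + b) + s₂ G P) ≡⟨ e₁ (count L * t) t b (count L₊) (s₂ G P) ⟩
        2 * (count L * t + count L₊) + 2 * (suc t) * b + s₂ G P ≤⟨ +-monoˡ-≤ (s₂ G P) (+-monoˡ-≤ (2 * suc t * b) (*-monoʳ-≤ 2 L-sum)) ⟩
        2 * sumFin (λ v → 𝟙 (L v) * deg G v) + 2 * (suc t) * b + s₂ G P ≤⟨ core-weight G K ⟩
        2 * edges G ≤⟨ *-monoʳ-≤ 2 (m≤n+m∸n (edges G) (t * n)) ⟩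
        2 * (t * n + s) ≤⟨ *-monoʳ-≤ 2 (+-monoˡ-≤ s (*-monoʳ-≤ t vertex-count)) ⟩
        2 * (t * (count R + (count L + b)) + s) ≤⟨ *-monoʳ-≤ 2 (+-monoˡ-≤ s (*-monoʳ-≤ t (+-monoˡ-≤ (count L + b) R-small))) ⟩
        2 * (t * (ρ + (count L + b)) + s) ≡⟨ e₂ t ρ (count L) b s ⟩
        2 * (count L * t + t * b) + 2 * σ ∎)
        where
        open ≤-Reasoning
        e₁ : ∀ l t b h z → 2 * (l + t * b) + (2 * (h + b) + z) ≡ 2 * (l + h) + 2 * (1 + t) * b + z
        e₁ = solve-∀
        e₂ : ∀ t r l b s → 2 * (t * (r + (l + b)) + s) ≡ 2 * (l * t + t * b) + 2 * (s + t * r)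
        e₂ = solve-∀

    P-σ : count P ≤ σ
    P-σ = ≤-trans (m≤m+n (count P) (count Q)) (≤-trans (m≤n+m b (count L₊)) (*-cancelˡ-≤ 2 (≤-trans (m≤m+n _ _) main)))

    s₂-σ : s₂ G P ≤ 2 * σ
    s₂-σ = ≤-trans (m≤n+m _ _) main

    n-σ : n ≤ ρ + t * ρ + σ + count Lₜ
    n-σ = begin
      n ≤⟨ vertex-count ⟩
      count R + (count L + b) ≤⟨ +-mono-≤ R-small (+-monoˡ-≤ b (≤-trans L-cover (+-monoˡ-≤ (count L₊) (≤-trans (L-count (λ v → ⌊ deg G v ≟ℕ t ⌋)) (+-monoʳ-≤ (count Lₜ) (*-monoˡ-≤ t R-small)))))) ⟩
      ρ + ((count Lₜ + ρ * t + count L₊) + b) ≡⟨ e ρ t (count Lₜ) (count L₊) b ⟩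
      ρ + t * ρ + (count L₊ + b) + count Lₜ ≤⟨ +-monoˡ-≤ (count Lₜ) (+-monoʳ-≤ (ρ + t * ρ) (*-cancelˡ-≤ 2 (≤-trans (m≤m+n _ _) main))) ⟩
      ρ + t * ρ + σ + count Lₜ ∎
      where
      open ≤-Reasoning
      e : ∀ r t l h b → r + ((l + r * t + h) + b) ≡ r + t * r + (h + b) + l
      e = solve-∀
      L-cover : count L ≤ count (L ∩ (λ v → ⌊ deg G v ≟ℕ t ⌋)) + count L₊
      L-cover = count-cover {F = L} {L ∩ (λ v → ⌊ deg G v ≟ℕ t ⌋)} {L₊} λ v h → by v h (m≤n⇒m<n∨m≡n (proj₁ (proj₂ adm) v))
        where
        by : ∀ v → v ∈ᵖ L → t < deg G v ⊎ t ≡ deg G v → v ∈ᵖ (L ∩ (λ v → ⌊ deg G v ≟ℕ t ⌋)) ⊎ v ∈ᵖ L₊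
        by v h (inj₁ lt) = inj₂ (∧-intro h (⌊⌋-intro (t <? deg G v) lt))
        by v h (inj₂ e) = inj₁ (∧-intro h (⌊⌋-intro (deg G v ≟ℕ t) (≡-sym e)))

    count-Lₜ : ∀ B → (∀ F i k → F ⊆ᵖ Lₜ → SameR F → q ≤ i → i + k ≡ t → (∀ v → v ∈ᵖ F → degIn G R v ≡ i) → Sys G F P k → count F ≤ B) →
      count Lₜ ≤ 2 ^ ρ * B
    count-Lₜ B h = ≤-trans (class-bound Lₜ t B (λ v e → ∧-fst e) (λ v e → ⌊⌋-elim (deg G v ≟ℕ t) (∧-snd {Lᵒ v} e)) h)
      (*-monoˡ-≤ B (^-monoʳ-≤ 2 R-small))

lower₁ : ∀ q t k → q + suc k ≡ t → ∃ λ c → ∀ n (G : SimpleGraph n) → Admissible n (2 + q) t G →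
  n ≤ c * suc (edges G ∸ t * n) ^ suc k
lower₁ q t k refl = c , bound
  where
  ρ a c : ℕ
  ρ = coreSize (suc t) (3 * suc t)
  a = ρ + t * ρ + 1 + 2 ^ ρ
  c = a * suc (t * ρ) ^ suc k
  bound : ∀ n (G : SimpleGraph n) → Admissible n (2 + q) t G → n ≤ c * suc (edges G ∸ t * n) ^ suc k
  bound n G adm = begin
    n ≤⟨ n-σ ⟩
    ρ + t * ρ + σ + count Lₜ ≤⟨ +-mono-≤ (+-mono-≤ (m≤m*suc′ (ρ + t * ρ)) σ≤) (count-Lₜ (suc σ ^ suc k) cls₁) ⟩
    (ρ + t * ρ) * B + 1 * B + 2 ^ ρ * B ≡⟨ e (ρ + t * ρ) (2 ^ ρ) B ⟩
    a * B ≤⟨ *-monoʳ-≤ a (^-monoˡ-≤ (suc k) σ-s) ⟩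
    a * (suc (t * ρ) * suc s) ^ suc k ≡⟨ cong (a *_) (^-distribʳ-* (suc k) (suc (t * ρ)) (suc s)) ⟩
    a * (suc (t * ρ) ^ suc k * suc s ^ suc k) ≡⟨ ≡-sym (*-assoc a (suc (t * ρ) ^ suc k) (suc s ^ suc k)) ⟩
    c * suc s ^ suc k ∎
    where
    open Excess G adm (core G (proj₁ adm) (suc t)) hiding (ρ)
    open ≤-Reasoning
    B = suc σ ^ suc k
    m≤m*suc′ : ∀ m → m ≤ m * B
    m≤m*suc′ m = ≤-trans (≤-reflexive (≡-sym (*-identityʳ m))) (*-monoʳ-≤ m (1≤^ σ (suc k)))
    σ≤ : σ ≤ 1 * B
    σ≤ = ≤-trans (n≤1+n σ) (≤-trans (m≤m^suc (suc σ) k) (≤-reflexive (≡-sym (+-identityʳ B))))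
    σ-s : suc σ ≤ suc (t * ρ) * suc s
    σ-s = ≤-trans (m≤m+n (suc σ) (t * ρ * s)) (≤-reflexive (e′ s (t * ρ)))
      where
      e′ : ∀ s x → 1 + (s + x) + x * s ≡ (1 + x) * (1 + s)
      e′ = solve-∀
    e : ∀ x y b → x * b + 1 * b + y * b ≡ (x + 1 + y) * b
    e = solve-∀
    cls₁ : ∀ F i k′ → F ⊆ᵖ Lₜ → SameR F → q ≤ i → i + k′ ≡ t → (∀ v → v ∈ᵖ F → degIn G R v ≡ i) → Sys G F P k′ → count F ≤ B
    cls₁ F i k′ _ _ qi ik _ S = ≤-trans (sys-≤^ G k′ S) (≤-trans (^-monoˡ-≤ k′ (≤-trans P-σ (n≤1+n σ)))
      (^-monoʳ-≤ (suc σ) (+-cancelˡ-≤ q k′ (suc k) (≤-trans (+-monoˡ-≤ k′ qi) (≤-reflexive ik)))))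

module _ {n : ℕ} (G : SimpleGraph n) (cb : CliqueBound G 3) where

  cb-tf : ∀ U → TriangleFree G U
  cb-tf U {x} {y} {z} _ _ _ xy yz xz = <-irrefl refl (cb (x ∷ y ∷ z ∷ []) ((xy ∷ xz ∷ []) ∷ (yz ∷ []) ∷ [] ∷ []))

  cb-ind : ∀ F U → Independent G F U
  cb-ind F U {v} {a} {b} _ _ _ va vb ab = <-irrefl refl (cb (v ∷ a ∷ b ∷ []) ((va ∷ vb ∷ []) ∷ (ab ∷ []) ∷ [] ∷ []))

root-sq : ∀ Y → root 1 Y * root 1 Y ≤ Y
root-sq Y = ≤-trans (≤-reflexive (cong (root 1 Y *_) (≡-sym (*-identityʳ (root 1 Y))))) (root-^ 1 Y)

sq-root : ∀ {N Y} → N * N ≤ Y → N ≤ root 1 Y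
sq-root {N} h = root-max 1 (≤-trans (≤-reflexive (cong (N *_) (*-identityʳ N))) h)

1≤[1+Z]^ : ∀ Z j → 1 ≤ suc Z ^ j
1≤[1+Z]^ Z j = m^n>0 (suc Z) j

affine-sq : ∀ a b Z → a * Z * (b * Z + 1) + 1 ≤ (a * (b + 1) + 1) * suc Z ^ 2
affine-sq a b Z = ≤-trans (m≤m+n _ (a * b + a + a * b * (2 * Z) + a * Z + a * (Z * Z) + 2 * Z + Z * Z)) (≤-reflexive (e a b Z))
  where
  e : ∀ a b Z → a * Z * (b * Z + 1) + 1 + (a * b + a + a * b * (2 * Z) + a * Z + a * (Z * Z) + 2 * Z + Z * Z) ≡ (a * (b + 1) + 1) * ((1 + Z) * ((1 + Z) * 1))
  e = solve-∀

affine-sq₁ : ∀ a Z → (a * Z + 1) * (a * Z + 1) ≤ ((1 + a) * (1 + a)) * suc Z ^ 2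
affine-sq₁ a Z = ≤-trans (*-mono-≤ le le) (≤-reflexive (e a Z))
  where
  le : a * Z + 1 ≤ (1 + a) * (1 + Z)
  le = ≤-trans (m≤m+n _ (a + Z)) (≤-reflexive (e₀ a Z))
    where
    e₀ : ∀ a Z → a * Z + 1 + (a + Z) ≡ (1 + a) * (1 + Z)
    e₀ = solve-∀
  e : ∀ a Z → (1 + a) * (1 + Z) * ((1 + a) * (1 + Z)) ≡ ((1 + a) * (1 + a)) * ((1 + Z) * ((1 + Z) * 1))
  e = solve-∀

-- Stated for squares, since N = O(Z^((k-2)/2)) has a half-integral exponent for odd k.
FamilyBound : ℕ → ℕ → Set
FamilyBound J c = ∀ {n} (G : SimpleGraph n) → CliqueBound G 3 → ∀ {F U} k Z → k ≤ 4 + J → s₂ G U ≤ Z → Sys G F U k →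
  count F * count F ≤ c * suc Z ^ (2 + J)

family-bound-0 : ∃ (FamilyBound 0)
family-bound-0 = c , bound
  where
  c₂ c₃ c₄ c : ℕ
  c₂ = 28
  c₃ = 4 * (27 + 1) + 1
  c₄ = 70 * 70
  c = 1 + 9 + c₂ + c₃ + c₄
  up : ∀ {N a} Z → N ≤ a * suc Z ^ 2 → a ≤ c → N ≤ c * suc Z ^ 2
  up Z h le = ≤-trans h (*-monoˡ-≤ (suc Z ^ 2) le)
  const : ∀ a Z → a ≤ a * suc Z ^ 2
  const a Z = ≤-trans (≤-reflexive (≡-sym (*-identityʳ a))) (*-monoʳ-≤ a (1≤[1+Z]^ Z 2))
  bound : FamilyBound 0 c
  bound G cb 0 Z _ hZ S = up Z (≤-trans (*-mono-≤ (sys-0 G S) (sys-0 G S)) (const 1 Z)) (m≤m+n 1 _)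
  bound G cb 1 Z _ hZ S = up Z (≤-trans (*-mono-≤ (sys-1 G cb S) (sys-1 G cb S)) (const 9 Z)) (m≤m+n 9 _)
  bound G cb 2 Z _ hZ S = up Z (≤-trans (*-mono-≤ h h) (≤-trans (root-sq (3 * Z * 9 + 1)) (≤-trans (m≤m+n _ (27 + 28 * (Z * Z) + 29 * Z)) (≤-reflexive (e Z)))))
      (≤-trans (m≤n+m c₂ (1 + 9)) (≤-trans (m≤m+n _ c₃) (m≤m+n _ c₄)))
    where
    h = sys-2 G Z cb hZ S
    e : ∀ Z → 3 * Z * 9 + 1 + (27 + 28 * (Z * Z) + 29 * Z) ≡ 28 * ((1 + Z) * ((1 + Z) * 1))
    e = solve-∀
  bound G cb {U = U} 3 Z _ hZ S = up Z (≤-trans (sys-sq G W Z S hZ (λ a ha → sys-2 G Z cb (≤-trans (s₂-mono G {U = U except a} {U′ = U} λ y e → ∧-fst e) hZ) (sys-link G a ha S)))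
      (≤-trans (+-monoˡ-≤ 1 (*-monoʳ-≤ (4 * Z) (≤-trans (root-sq (3 * Z * 9 + 1)) (≤-reflexive (cong (_+ 1) (e Z)))))) (affine-sq 4 27 Z)))
      (≤-trans (m≤n+m c₃ (1 + 9 + c₂)) (m≤m+n _ c₄))
    where
    W = root 1 (3 * Z * 9 + 1)
    e : ∀ Z → 3 * Z * 9 ≡ 27 * Z
    e = solve-∀
  bound G cb {F} {U} 4 Z _ hZ S = up Z (≤-trans (*-mono-≤ h h) (affine-sq₁ 69 Z)) (m≤n+m c₄ (1 + 9 + c₂ + c₃))
    where h = Four.four-linear G S (cb-tf G cb U) (cb-ind G cb F U) Z hZ
  bound G cb (suc (suc (suc (suc (suc k))))) Z (s≤s (s≤s (s≤s (s≤s ())))) hZ S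

-- One more element in the sets costs one factor `suc Z` by `sys-sq`. The base is the linear bound
-- for 4-sets.
family-bound : ∀ J → ∃ (FamilyBound J)
family-bound zero = family-bound-0
family-bound (suc J) = next (family-bound J)
  where
  next : ∃ (FamilyBound J) → ∃ (FamilyBound (suc J))
  next (c , ih) = c′ , bound
    where
    c′ = (6 + J) * c + 1
    bound : FamilyBound (suc J) c′
    bound G cb {F} {U} k Z le hZ S with k ≤? 4 + J
    ... | yes k≤ = ≤-trans (ih G cb k Z k≤ hZ S) (*-mono-≤ (≤-trans (m≤m+n c ((5 + J) * c)) (m≤m+n _ 1)) (^-monoʳ-≤ (suc Z) (n≤1+n (2 + J))))
    ... | no k≰ with ≤-antisym le (≰⇒> k≰)
    ...   | refl = begin
        count F * count F ≤⟨ sys-sq G W Z S hZ (λ a ha → sq-root (ih G cb (4 + J) Z ≤-refl (≤-trans (s₂-mono G {U = U except a} {U′ = U} λ y e → ∧-fst e) hZ) (sys-link G a ha S))) ⟩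
        (6 + J) * Z * (W * W) + 1 ≤⟨ +-monoˡ-≤ 1 (*-monoʳ-≤ ((6 + J) * Z) (root-sq (c * suc Z ^ (2 + J)))) ⟩
        (6 + J) * Z * (c * suc Z ^ (2 + J)) + 1 ≤⟨ +-mono-≤ (*-monoˡ-≤ (c * suc Z ^ (2 + J)) (*-monoʳ-≤ (6 + J) (n≤1+n Z))) (1≤[1+Z]^ Z (3 + J)) ⟩
        (6 + J) * suc Z * (c * suc Z ^ (2 + J)) + suc Z ^ (3 + J) ≡⟨ e (6 + J) (suc Z) c (suc Z ^ (2 + J)) ⟩
        c′ * suc Z ^ (3 + J) ∎
      where
      open ≤-Reasoning
      W = root 1 (c * suc Z ^ (2 + J))
      e : ∀ a z c p → a * z * (c * p) + z * p ≡ (a * c + 1) * (z * p)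
      e = solve-∀

lower₂ : ∀ J → ∃ λ c → ∀ n (G : SimpleGraph n) → Admissible n 3 (5 + J) G →
  n ^ 2 ≤ c * suc (edges G ∸ (5 + J) * n) ^ (2 + J)
lower₂ J = go (family-bound J)
  where
  t ρ a : ℕ
  t = 5 + J
  ρ = coreSize (suc t) (3 * suc t)
  a = ρ + t * ρ + 1 + 2 ^ ρ
  go : ∃ (FamilyBound J) → ∃ λ c → ∀ n (G : SimpleGraph n) → Admissible n 3 t G → n ^ 2 ≤ c * suc (edges G ∸ t * n) ^ (2 + J)
  go (c₀ , fb) = c , bound
    where
    c₁ c : ℕ
    c₁ = a * a * (2 * (1 + c₀))
    c = c₁ * (2 + 2 * (t * ρ)) ^ (2 + J)
    bound : ∀ n (G : SimpleGraph n) → Admissible n 3 t G → n ^ 2 ≤ c * suc (edges G ∸ t * n) ^ (2 + J)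
    bound n G adm = begin
      n ^ 2 ≡⟨ cong (n *_) (*-identityʳ n) ⟩
      n * n ≤⟨ *-mono-≤ n≤ n≤ ⟩
      a * M * (a * M) ≡⟨ e₁ a M ⟩
      a * a * (M * M) ≤⟨ *-monoʳ-≤ (a * a) MM ⟩
      a * a * (2 * (1 + c₀) * E) ≡⟨ ≡-sym (*-assoc (a * a) (2 * (1 + c₀)) E) ⟩
      c₁ * E ≤⟨ *-monoʳ-≤ c₁ (^-monoˡ-≤ (2 + J) Z-s) ⟩
      c₁ * ((2 + 2 * (t * ρ)) * suc s) ^ (2 + J) ≡⟨ cong (c₁ *_) (^-distribʳ-* (2 + J) (2 + 2 * (t * ρ)) (suc s)) ⟩
      c₁ * ((2 + 2 * (t * ρ)) ^ (2 + J) * suc s ^ (2 + J)) ≡⟨ ≡-sym (*-assoc c₁ ((2 + 2 * (t * ρ)) ^ (2 + J)) (suc s ^ (2 + J))) ⟩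
      c * suc s ^ (2 + J) ∎
      where
      open Excess G adm (core G (proj₁ adm) (suc t)) hiding (ρ)
      open ≤-Reasoning
      Z = 2 * σ
      E = suc Z ^ (2 + J)
      B = root 1 (c₀ * E)
      M = suc σ + B
      e₁ : ∀ a b → a * b * (a * b) ≡ a * a * (b * b)
      e₁ = solve-∀
      cls₂ : ∀ F i k′ → F ⊆ᵖ Lₜ → SameR F → 1 ≤ i → i + k′ ≡ t → (∀ v → v ∈ᵖ F → degIn G R v ≡ i) → Sys G F P k′ → count F ≤ B
      cls₂ F i k′ _ _ qi ik _ S = sq-root (fb G cb k′ Z (≤-pred (≤-trans (+-monoˡ-≤ k′ qi) (≤-reflexive ik))) s₂-σ S)
      n≤ : n ≤ a * M
      n≤ = ≤-trans n-σ (≤-trans (+-monoʳ-≤ (ρ + t * ρ + σ) (count-Lₜ B cls₂)) (≤-trans (m≤m+n _ ((ρ + t * ρ) * (σ + B) + (1 + B) + 2 ^ ρ * suc σ))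
        (≤-reflexive (e (ρ + t * ρ) σ (2 ^ ρ) B))))
        where
        e : ∀ x σ y b → x + σ + y * b + (x * (σ + b) + (1 + b) + y * (1 + σ)) ≡ (x + 1 + y) * (1 + σ + b)
        e = solve-∀
      σ² : suc σ * suc σ ≤ E
      σ² = ≤-trans (*-mono-≤ le le) (≤-trans (≤-reflexive (cong (suc Z *_) (≡-sym (*-identityʳ (suc Z))))) (^-monoʳ-≤ (suc Z) (m≤m+n 2 J)))
        where
        le : suc σ ≤ suc Z
        le = s≤s (m≤m+n σ _)
      MM : M * M ≤ 2 * (1 + c₀) * E
      MM = begin
        M * M ≡⟨ sq (suc σ) B ⟩
        suc σ * suc σ + B * B + 2 * (suc σ * B) ≤⟨ +-monoʳ-≤ (suc σ * suc σ + B * B) (2ab≤a²+b² (suc σ) B) ⟩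
        suc σ * suc σ + B * B + (suc σ * suc σ + B * B) ≤⟨ +-mono-≤ (+-mono-≤ σ² (root-sq (c₀ * E))) (+-mono-≤ σ² (root-sq (c₀ * E))) ⟩
        E + c₀ * E + (E + c₀ * E) ≡⟨ dbl E c₀ ⟩
        2 * (1 + c₀) * E ∎
        where
        sq : ∀ a b → (a + b) * (a + b) ≡ a * a + b * b + 2 * (a * b)
        sq = solve-∀
        dbl : ∀ E c → E + c * E + (E + c * E) ≡ 2 * (1 + c) * E
        dbl = solve-∀
      Z-s : suc Z ≤ (2 + 2 * (t * ρ)) * suc s
      Z-s = ≤-trans (m≤m+n (suc Z) (1 + 2 * (t * ρ) * s)) (≤-reflexive (e s (t * ρ)))
        where
        e : ∀ s x → 1 + 2 * (s + x) + (1 + 2 * x * s) ≡ (2 + 2 * x) * (1 + s)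
        e = solve-∀

-- Lower bounds with error o(n).

smallo : ∀ A B c → ∃ λ N → ∀ n → N ≤ n → ∀ X → X ^ 4 ≤ c * n ^ 3 → A + B * X ≤ n
-- If A + B X > n, then n ≥ 2 A gives n ≤ 2 B X, and the fourth power gives n ≤ (2 B) ^ 4 · c.
smallo A B c = suc (2 * A + (2 * B) ^ 4 * c) , bound
  where
  bound : ∀ n → suc (2 * A + (2 * B) ^ 4 * c) ≤ n → ∀ X → X ^ 4 ≤ c * n ^ 3 → A + B * X ≤ n
  bound zero () X hX
  bound (suc n′) N≤ X hX = by (A + B * X ≤? n)
    where
    n = suc n′
    by : Dec (A + B * X ≤ n) → A + B * X ≤ n
    by (yes h) = h
    by (no ¬h) = ⊥-elim (<-irrefl refl (≤-trans N≤ (≤-trans n≤ (m≤n+m _ (2 * A)))))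
      where
      open ≤-Reasoning
      n≤2BX : n ≤ 2 * B * X
      n≤2BX = +-cancelˡ-≤ n n (2 * B * X) (begin
        n + n ≤⟨ +-mono-≤ (<⇒≤ (≰⇒> ¬h)) (<⇒≤ (≰⇒> ¬h)) ⟩
        A + B * X + (A + B * X) ≡⟨ e A B X ⟩
        2 * A + 2 * B * X ≤⟨ +-monoˡ-≤ (2 * B * X) (≤-trans (m≤m+n (2 * A) _) (≤-trans (n≤1+n _) N≤)) ⟩
        n + 2 * B * X ∎)
        where
        e : ∀ A B X → A + B * X + (A + B * X) ≡ 2 * A + 2 * B * X
        e = solve-∀
      n≤ : n ≤ (2 * B) ^ 4 * c
      n≤ = *-cancelʳ-≤ n ((2 * B) ^ 4 * c) (n ^ 3) ⦃ >-nonZero (m^n>0 n 3) ⦄ (begin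
        n ^ 4 ≤⟨ ^-monoˡ-≤ 4 n≤2BX ⟩
        (2 * B * X) ^ 4 ≡⟨ ^-distribʳ-* 4 (2 * B) X ⟩
        (2 * B) ^ 4 * X ^ 4 ≤⟨ *-monoʳ-≤ ((2 * B) ^ 4) hX ⟩
        (2 * B) ^ 4 * (c * n ^ 3) ≡⟨ ≡-sym (*-assoc ((2 * B) ^ 4) c (n ^ 3)) ⟩
        (2 * B) ^ 4 * c * n ^ 3 ∎)

-- Bounds for families of at most 3-sets in terms of one fourth root

βᴿ : ℕ → ℕ
βᴿ q = 1 + (2 + q) + 1 + (2 ^ q * ((2 + q) * 3) + q)

private
  affine : ∀ r Z → 3 * Z * r + 1 ≤ (3 * r + 1) * suc Z
  affine r Z = ≤-trans (m≤m+n _ (3 * r + Z)) (≤-reflexive (e r Z))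
    where
    e : ∀ r Z → 3 * Z * r + 1 + (3 * r + Z) ≡ (3 * r + 1) * (1 + Z)
    e = solve-∀

  Y-bound : ∀ h κ Z y → 1 ≤ h → y ≤ h * suc Z → 4 * (Z * Z) * y + κ ≤ (4 * (h * h) + κ) * suc Z ^ 3
  Y-bound h κ Z y 1≤h hy = begin
    4 * (Z * Z) * y + κ ≤⟨ +-mono-≤ (*-mono-≤ (*-monoʳ-≤ 4 (*-mono-≤ (n≤1+n Z) (n≤1+n Z))) hy)
                             (≤-trans (≤-reflexive (≡-sym (*-identityʳ κ))) (*-monoʳ-≤ κ (m^n>0 (suc Z) 3))) ⟩
    4 * (suc Z * suc Z) * (h * suc Z) + κ * suc Z ^ 3 ≤⟨ +-monoˡ-≤ (κ * suc Z ^ 3) (*-monoʳ-≤ (4 * (suc Z * suc Z)) (*-monoˡ-≤ (suc Z)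
        (≤-trans (≤-reflexive (≡-sym (*-identityʳ h))) (*-monoʳ-≤ h 1≤h)))) ⟩
    4 * (suc Z * suc Z) * (h * h * suc Z) + κ * suc Z ^ 3 ≡⟨ e h κ (suc Z) ⟩
    (4 * (h * h) + κ) * suc Z ^ 3 ∎
    where
    open ≤-Reasoning
    e : ∀ h κ z → 4 * (z * z) * (h * h * z) + κ * (z * (z * (z * 1))) ≡ (4 * (h * h) + κ) * (z * (z * (z * 1)))
    e = solve-∀

  A-bound : ∀ h κ Z y → y ≤ h * suc Z → y * y ≤ (4 * (h * h) + κ) * suc Z ^ 3
  A-bound h κ Z y hy = begin
    y * y ≤⟨ *-mono-≤ hy hy ⟩
    h * suc Z * (h * suc Z) ≤⟨ m≤m+n _ (h * h * (suc Z * suc Z) * Z + (3 * (h * h) + κ) * (suc Z * (suc Z * (suc Z * 1)))) ⟩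
    h * suc Z * (h * suc Z) + (h * h * (suc Z * suc Z) * Z + (3 * (h * h) + κ) * (suc Z * (suc Z * (suc Z * 1)))) ≡⟨ e h κ Z ⟩
    (4 * (h * h) + κ) * suc Z ^ 3 ∎
    where
    open ≤-Reasoning
    e : ∀ h κ Z → h * (1 + Z) * (h * (1 + Z)) + (h * h * ((1 + Z) * (1 + Z)) * Z + (3 * (h * h) + κ) * ((1 + Z) * ((1 + Z) * ((1 + Z) * 1)))) ≡ (4 * (h * h) + κ) * ((1 + Z) * ((1 + Z) * ((1 + Z) * 1)))
    e = solve-∀

abstract
  -- One coefficient for both `Y₃` and the square of the radicand of `W₂`, so that the single fourth
  -- root `Xᴿ` dominates the bounds for 2-sets and for 3-sets.
  quartic : ℕ → ℕ
  quartic q = 4 * ((3 * ((2 + q) * (2 + q)) + 1) * (3 * ((2 + q) * (2 + q)) + 1)) + 134 ^ 4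

  quartic-square : ∀ q Z → (3 * Z * ((2 + q) * (2 + q)) + 1) * (3 * Z * ((2 + q) * (2 + q)) + 1) ≤ quartic q * suc Z ^ 3
  quartic-square q Z = A-bound (3 * r² + 1) (134 ^ 4) Z (3 * Z * r² + 1) (affine r² Z)
    where
    r² : ℕ
    r² = (2 + q) * (2 + q)

  quartic-Y₃ : ∀ q Z → Y₃ (2 + q) Z ≤ quartic q * suc Z ^ 3
  quartic-Y₃ q Z = Y-bound (3 * r² + 1) (134 ^ 4) Z (3 * Z * r² + 1) (m≤n+m 1 (3 * r²)) (affine r² Z)
    where
    r² : ℕ
    r² = (2 + q) * (2 + q)

Xᴿ : ℕ → ℕ → ℕ
Xᴿ q Z = root 3 (quartic q * suc Z ^ 3)

W₂≤Xᴿ : ∀ q Z → root 1 (3 * Z * ((2 + q) * (2 + q)) + 1) ≤ Xᴿ q Z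
W₂≤Xᴿ q Z = root-max 3 (^4-square (root 1 Y) Y (quartic q * suc Z ^ 3) (root-sq Y) (quartic-square q Z))
  where Y = 3 * Z * ((2 + q) * (2 + q)) + 1

X₃≤Xᴿ : ∀ q Z → root 3 (Y₃ (2 + q) Z) ≤ Xᴿ q Z
X₃≤Xᴿ q Z = root-max 3 (≤-trans (root-^ 3 (Y₃ (2 + q) Z)) (quartic-Y₃ q Z))

B-bound : ∀ q p W X′ X → W ≤ X → X′ ≤ X → 1 + (2 + q) + W + (p * ((2 + q) * (3 * W)) + q * X′) ≤ (1 + (2 + q) + 1 + (p * ((2 + q) * 3) + q)) * suc X
B-bound q p W X′ X hW hX = ≤-trans (+-mono-≤ (+-monoʳ-≤ (1 + (2 + q)) hW) (+-mono-≤ (*-monoʳ-≤ p (*-monoʳ-≤ (2 + q) (*-monoʳ-≤ 3 hW))) (*-monoʳ-≤ q hX)))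
  (≤-trans (m≤m+n _ ((1 + (2 + q)) * X + 1 + p * ((2 + q) * 3) + q)) (≤-reflexive (e q p X)))
  where
  e : ∀ q p X → 1 + (2 + q) + X + (p * ((2 + q) * (3 * X)) + q * X) + ((1 + (2 + q)) * X + 1 + p * ((2 + q) * 3) + q) ≡ (1 + (2 + q) + 1 + (p * ((2 + q) * 3) + q)) * (1 + X)
  e = solve-∀

module _ {n : ℕ} (G : SimpleGraph n) where

  module Low {q t C : ℕ} (adm : Admissible n (2 + q) t G) (t<C : t < C) (K : Core G q C) where
    open Classes G adm t<C K public

    ρ : ℕ
    ρ = coreSize C (3 * C)

    b S : ℕ
    b = count P + count Q
    S = sumFin (λ v → 𝟙 (L v) * deg G v)

    Lₗ : Pred n
    Lₗ = L ∩ (λ v → ⌊ deg G v ≤? 3 + q ⌋)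

    B₃-X : ∀ Z → B₃ Z ≤ βᴿ q * suc (Xᴿ q Z)
    B₃-X Z = B-bound q (2 ^ q) (W₂ Z) (X₃ Z) (Xᴿ q Z) (W₂≤Xᴿ q Z) (X₃≤Xᴿ q Z)

    low-count : ∀ Z → s₂ G P ≤ Z → count Lₗ ≤ (4 + q) * (2 ^ ρ * (βᴿ q * suc (Xᴿ q Z))) + ρ * t
    low-count Z hZ = ≤-trans (L-count (λ v → ⌊ deg G v ≤? 3 + q ⌋)) (+-mono-≤
        (≤-trans (count-≤-cover {m = 4 + q} {F = Lᵒ ∩ (λ v → ⌊ deg G v ≤? 3 + q ⌋)} (λ _ → true) (λ d v → Lᵒ v ∧ ⌊ deg G v ≟ℕ toℕ d ⌋) (2 ^ ρ * (βᴿ q * suc (Xᴿ q Z)))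
            (λ d _ → ≤-trans (low-class (toℕ d) Z (≤-pred (toℕ<n d)) hZ) (*-mono-≤ (^-monoʳ-≤ 2 R-small) (B₃-X Z))) split)
          (≤-reflexive (cong (_* (2 ^ ρ * (βᴿ q * suc (Xᴿ q Z)))) (count-all {4 + q} {λ _ → true} λ _ → refl))))
        (*-monoˡ-≤ t R-small))
      where
      split : ∀ v → v ∈ᵖ (Lᵒ ∩ (λ v → ⌊ deg G v ≤? 3 + q ⌋)) → ∃ λ (d : Fin (4 + q)) → true ≡ true × Lᵒ v ∧ ⌊ deg G v ≟ℕ toℕ d ⌋ ≡ true
      split v h = fromℕ< lt , refl , ∧-intro (∧-fst h) (⌊⌋-intro (deg G v ≟ℕ toℕ (fromℕ< lt)) (≡-sym (toℕ-fromℕ< lt)))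
        where
        lt : deg G v < 4 + q
        lt = s≤s (⌊⌋-elim (deg G v ≤? 3 + q) (∧-snd {Lᵒ v} h))

    half-weight : S + C * b ≤ edges G
    half-weight = *-cancelˡ-≤ 2 (≤-trans (≤-reflexive (e S C b)) (≤-trans (m≤m+n _ (s₂ G P)) (core-weight G K)))
      where
      e : ∀ S C b → 2 * (S + C * b) ≡ 2 * S + 2 * C * b
      e = solve-∀

    s₂-edges : s₂ G P ≤ 2 * edges G
    s₂-edges = ≤-trans (m≤n+m _ (2 * S + 2 * C * b)) (core-weight G K)

    L-low-sum : count L * (4 + q) ≤ S + count Lₗ * (4 + q)
    L-low-sum = ≤-trans (≤-reflexive (trans (cong (_* (4 + q)) (count≡sum L)) (≡-sym (sum-*ʳ (𝟙 ∘ L) (4 + q)))))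
        (≤-trans (sum-mono pt) (≤-reflexive (trans (sum-+ (λ v → 𝟙 (L v) * deg G v) (λ v → 𝟙 (Lₗ v) * (4 + q)))
          (cong (S +_) (trans (sum-*ʳ (𝟙 ∘ Lₗ) (4 + q)) (cong (_* (4 + q)) (≡-sym (count≡sum Lₗ))))))))
      where
      pt : ∀ v → 𝟙 (L v) * (4 + q) ≤ 𝟙 (L v) * deg G v + 𝟙 (Lₗ v) * (4 + q)
      pt v with L v
      ... | false = z≤n
      ... | true with deg G v ≤? 3 + q
      ...   | yes _ = m≤n+m _ _
      ...   | no ¬le = ≤-trans (*-monoʳ-≤ 1 (≰⇒> ¬le)) (m≤m+n _ _)

    -- Vertices of L outside `Lₗ` have degree at least 4 + q, and vertices of `P` and `Q` weigh C;
    -- only `R` and `Lₗ` fall short.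
    linear : 4 + q ≤ C → (4 + q) * n ≤ edges G + (4 + q) * (ρ + count Lₗ)
    linear le = begin
      (4 + q) * n ≤⟨ *-monoʳ-≤ (4 + q) (≤-trans vertex-count (+-monoˡ-≤ (count L + b) R-small)) ⟩
      (4 + q) * (ρ + (count L + b)) ≡⟨ e₁ (4 + q) ρ (count L) b ⟩
      count L * (4 + q) + (4 + q) * b + (4 + q) * ρ ≤⟨ +-monoˡ-≤ ((4 + q) * ρ) (+-mono-≤ L-low-sum (*-monoˡ-≤ b le)) ⟩
      S + count Lₗ * (4 + q) + C * b + (4 + q) * ρ ≡⟨ e₂ S (count Lₗ) (4 + q) (C * b) ρ ⟩
      S + C * b + (4 + q) * (ρ + count Lₗ) ≤⟨ +-monoˡ-≤ ((4 + q) * (ρ + count Lₗ)) half-weight ⟩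
      edges G + (4 + q) * (ρ + count Lₗ) ∎
      where
      open ≤-Reasoning
      e₁ : ∀ x r l b → x * (r + (l + b)) ≡ l * x + x * b + x * r
      e₁ = solve-∀
      e₂ : ∀ s l x c r → s + l * x + c + x * r ≡ s + c + x * (r + l)
      e₂ = solve-∀

Xᴿ-^4 : ∀ q a n → 1 ≤ n → Xᴿ q (a * n) ^ 4 ≤ quartic q * suc a ^ 3 * n ^ 3
Xᴿ-^4 q a n 1≤n = ≤-trans (root-^ 3 (quartic q * suc (a * n) ^ 3)) (≤-trans (*-monoʳ-≤ (quartic q) (≤-trans (^-monoˡ-≤ 3 (+-monoˡ-≤ (a * n) 1≤n))
  (≤-reflexive (^-distribʳ-* 3 (suc a) n)))) (≤-reflexive (≡-sym (*-assoc (quartic q) (suc a ^ 3) (n ^ 3)))))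

lower₃ : ∀ q t → t ≤ 4 + q → ∀ m → ∃ λ N → ∀ n → N ≤ n → ∀ (G : SimpleGraph n) → Admissible n (2 + q) t G →
  m * (4 + q) * n ≤ m * edges G + n
lower₃ q t t≤ m = suc (proj₁ so) , bound
  where
  C ρ β A B a : ℕ
  C = 5 + q
  ρ = coreSize C (3 * C)
  β = (4 + q) * (2 ^ ρ * βᴿ q)
  A = m * ((4 + q) * (ρ + (β + ρ * t)))
  B = m * ((4 + q) * β)
  a = 2 * (4 + q)
  so = smallo A B (quartic q * suc a ^ 3)
  bound : ∀ n → suc (proj₁ so) ≤ n → ∀ (G : SimpleGraph n) → Admissible n (2 + q) t G → m * (4 + q) * n ≤ m * edges G + n
  -- If the number of edges is below (4 + q) n, then s₂ ≤ 2 e is linear in n, and `Lₗ` has only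
  -- O(n^(3/4)) vertices.
  bound n N≤ G adm = by ((4 + q) * n ≤? edges G)
    where
    open Low G adm (s≤s t≤) (core G (proj₁ adm) C) hiding (ρ; A)
    open ≤-Reasoning
    by : Dec ((4 + q) * n ≤ edges G) → m * (4 + q) * n ≤ m * edges G + n
    by (yes h) = ≤-trans (≤-reflexive (*-assoc m (4 + q) n)) (≤-trans (*-monoʳ-≤ m h) (m≤m+n _ n))
    by (no ¬h) = begin
      m * (4 + q) * n ≡⟨ *-assoc m (4 + q) n ⟩
      m * ((4 + q) * n) ≤⟨ *-monoʳ-≤ m (≤-trans (linear (n≤1+n (4 + q))) (+-monoʳ-≤ (edges G) (*-monoʳ-≤ (4 + q) (+-monoʳ-≤ ρ (low-count Z hZ))))) ⟩
      m * (edges G + (4 + q) * (ρ + ((4 + q) * (2 ^ ρ * (βᴿ q * suc X)) + ρ * t))) ≡⟨ e m (edges G) (4 + q) ρ (2 ^ ρ) (βᴿ q) X t ⟩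
      m * edges G + (A + B * X) ≤⟨ +-monoʳ-≤ (m * edges G) (proj₂ so n (≤-trans (n≤1+n _) N≤) X (Xᴿ-^4 q a n (≤-trans (s≤s z≤n) N≤))) ⟩
      m * edges G + n ∎
      where
      Z = a * n
      X = Xᴿ q Z
      hZ : s₂ G P ≤ Z
      hZ = ≤-trans s₂-edges (≤-trans (*-monoʳ-≤ 2 (<⇒≤ (≰⇒> ¬h))) (≤-reflexive (≡-sym (*-assoc 2 (4 + q) n))))
      e : ∀ m E x r p β X t → m * (E + x * (r + (x * (p * (β * (1 + X))) + r * t))) ≡
          m * E + (m * (x * (r + (x * (p * β) + r * t))) + m * (x * (x * (p * β))) * X)
      e = solve-∀

module _ {n : ℕ} (G : SimpleGraph n) where

  module Five {t : ℕ} (adm : Admissible n 3 t G) (t≤5 : t ≤ 5) (K : Core G 1 6) (Z : ℕ) (hZ : s₂ G (Core.P K) ≤ Z) where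
    open Low G adm (s≤s t≤5) K public

    -- In `Hₐ` at least two of the five neighbours are in `R`, so the traces on `P` have at most 3
    -- vertices and `Hₐ` is negligible. In `H₁` the traces are 4-sets.
    H₅ Hₐ H₁ : Pred n
    H₅ v = Lᵒ v ∧ ⌊ deg G v ≟ℕ 5 ⌋
    Hₐ v = H₅ v ∧ ⌊ 2 ≤? degIn G R v ⌋
    H₁ v = H₅ v ∧ not ⌊ 2 ≤? degIn G R v ⌋

    H₅-deg : ∀ {v} → v ∈ᵖ H₅ → deg G v ≡ 5
    H₅-deg {v} h = ⌊⌋-elim (deg G v ≟ℕ 5) (∧-snd {Lᵒ v} h)

    family-3 : ∀ {F U} → U ⊆ᵖ P → Sys G F U 3 → count F ≤ X₃ Z
    family-3 {F} {U} s S = sys-3 G Z cb (≤-trans (s₂-mono G s) hZ) S (cb-tf G cb U) (cb-ind G cb F U)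

    link-4 : ∀ {F z} → Sys G F P 4 → z ∈ᵖ P → weight G F z ≤ X₃ Z
    link-4 {F} {z} S hz = family-3 (λ y h → ∧-fst h) (sys-link G z hz S)

    Hₐ-count : count Hₐ ≤ 2 ^ ρ * B₃ Z
    Hₐ-count = ≤-trans (class-bound Hₐ 5 (B₃ Z) (λ v h → ∧-fst (∧-fst h)) (λ v h → H₅-deg (∧-fst h)) by-size) (*-monoˡ-≤ (B₃ Z) (^-monoʳ-≤ 2 R-small))
      where
      by-size : ∀ F i k → F ⊆ᵖ Hₐ → SameR F → 1 ≤ i → i + k ≡ 5 → (∀ v → v ∈ᵖ F → degIn G R v ≡ i) → Sys G F P k → count F ≤ B₃ Z
      by-size F i 0 s same qi e sz S = ≤-trans (sys-0 G S) (s≤s z≤n)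
      by-size F i 1 s same qi e sz S = ≤-trans (sys-1 G cb S) (≤-trans (m≤n+m 3 1) (≤-trans (m≤m+n 4 (W₂ Z)) (m≤m+n _ _)))
      by-size F i 2 s same qi e sz S = ≤-trans (sys-2 G Z cb hZ S) (≤-trans (m≤n+m _ (1 + 3)) (m≤m+n _ _))
      by-size F i 3 s same qi e sz S = ≤-trans (family-3 (λ y h → h) S) (≤-trans (≤-reflexive (≡-sym (+-identityʳ (X₃ Z)))) (≤-trans (m≤n+m _ (2 * (3 * (3 * W₂ Z)))) (m≤n+m _ (1 + 3 + W₂ Z))))
      by-size F i (suc (suc (suc (suc k)))) s same qi e sz S = by (find F)
        where
        by : (∃ λ v → v ∈ᵖ F) ⊎ (∀ v → F v ≡ false) → count F ≤ B₃ Z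
        by (inj₂ none) = ≤-trans (≤-reflexive (count-none none)) z≤n
        by (inj₁ (v , hv)) = ⊥-elim (<-irrefl refl (≤-trans (+-mono-≤ (≤-trans (⌊⌋-elim (2 ≤? degIn G R v) (∧-snd {H₅ v} (s v hv))) (≤-reflexive (sz v hv)))
                                 (s≤s (s≤s (s≤s (s≤s (z≤n {k})))))) (≤-reflexive e)))

    H₁-L : ∀ {v} → v ∈ᵖ H₁ → v ∈ᵖ L
    H₁-L h = ∧-fst (∧-fst (∧-fst h))

    H₁-R : ∀ {v} → v ∈ᵖ H₁ → degIn G R v ≡ 1
    H₁-R {v} h = ≤-antisym (≤-pred (≰⇒> (⌊⌋-refute (2 ≤? degIn G R v) (not-elim (∧-snd {H₅ v} h))))) (R-deg (H₁-L h))

    H₁-P : ∀ {v} → v ∈ᵖ H₁ → degIn G P v ≡ 4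
    H₁-P {v} h = suc-injective (trans (cong (_+ degIn G P v) (≡-sym (H₁-R h))) (trans (≡-sym (L-deg (H₁-L h))) (H₅-deg (∧-fst h))))

    only-R : ∀ {v y z} → v ∈ᵖ H₁ → y ∈ᵖ R → z ∈ᵖ R → A v y → A v z → y ≡ z
    only-R {v} {y} {z} hv hy hz vy vz with y ≟ z
    ... | yes e = e
    ... | no ne = ⊥-elim (t≢f vy (degIn-0⇒ G {R except z} {v} (suc-injective (trans (≡-sym (degIn-except G R v z hz vz)) (H₁-R hv))) (except-intro {U = R} hy ne)))

    one-class : ∀ {F x} → F ⊆ᵖ H₁ → x ∈ᵖ R → (∀ v → v ∈ᵖ F → A v x) → Sys G F P 4
    one-class {F} {x} s hx h = class-sys (λ v e → ∧-fst (∧-fst (s v e))) same (λ v e → H₁-P (s v e))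
      where
      same : SameR F
      same u v y hu hv hy with y ≟ x
      ... | yes refl = trans (h u hu) (≡-sym (h v hv))
      ... | no ne = trans (¬t⇒f λ e → ne (only-R (s u hu) hy hx e (h u hu))) (≡-sym (¬t⇒f λ e → ne (only-R (s v hv) hy hx e (h v hv))))

    common-nbr : ∀ {u v} → u ∈ᵖ L → v ∈ᵖ L → u ≢ v → ∃ λ z → A u z × A v z
    common-nbr hu hv ne with common-clique G sat ne (L-indep hu hv)
    ... | z ∷ [] , refl , _ , (h ∷ []) = z , h

    meet-P : ∀ {u v x} → u ∈ᵖ H₁ → v ∈ᵖ H₁ → x ∈ᵖ R → A u x → adj G v x ≡ false → ∃ λ z → z ∈ᵖ P × A u z × A v z
    meet-P {u} {v} {x} hu hv hx ux vx with common-nbr (H₁-L hu) (H₁-L hv) (λ { refl → t≢f ux vx })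
    ... | z , uz , vz with L-nbr u z (H₁-L hu) uz
    ...   | inj₂ p = z , p , uz , vz
    ...   | inj₁ r = ⊥-elim (t≢f (subst (A v) (only-R hu r hx uz ux) vz) vx)

    -- Adding the 2 ^ ρ classes would spoil the constant 3/4. But two vertices of `H₁` with
    -- different neighbours in `R` have a common neighbour in `P`. If both kinds occur, the sets of
    -- either kind all meet one 4-set of the other kind, so four families of links, which are
    -- 3-sets, cover them. Otherwise `H₁` is a single class.
    H₁-alt : count H₁ ≤ 4 * X₃ Z + 4 * (2 ^ ρ * X₃ Z) ⊎ (∃ λ F → Sys G F P 4 × count H₁ ≤ count F)
    H₁-alt = by (find H₁)
      where
      module _ {v₀ : Fin n} (h₀ : v₀ ∈ᵖ H₁) {x : Fin n} (hx : x ∈ᵖ R) (v₀x : A v₀ x) where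
        Fₐ Fᵦ : Pred n
        Fₐ = H₁ ∩ (λ v → adj G v x)
        Fᵦ = H₁ ∩ (λ v → not (adj G v x))
        Sₐ : Sys G Fₐ P 4
        Sₐ = one-class (λ v h → ∧-fst h) hx (λ v h → ∧-snd {H₁ v} h)
        P∩-4 : ∀ {v} → v ∈ᵖ H₁ → ∀ B → count (P ∩ adj G v) * B ≤ 4 * B
        P∩-4 h B = *-monoˡ-≤ B (≤-reflexive (H₁-P h))
        Fᵦ-count : count Fᵦ ≤ 4 * (2 ^ ρ * X₃ Z)
        Fᵦ-count = ≤-trans (count-≤-cover {F = Fᵦ} (P ∩ adj G v₀) (λ z → Fᵦ ∩ adj G z) (2 ^ ρ * X₃ Z) each cover) (P∩-4 h₀ _)
          where
          cover : ∀ v → v ∈ᵖ Fᵦ → ∃ λ z → z ∈ᵖ (P ∩ adj G v₀) × v ∈ᵖ (Fᵦ ∩ adj G z)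
          cover v h = let (z , p , a , c) = meet-P h₀ (∧-fst h) hx v₀x (not-elim (∧-snd {H₁ v} h)) in z , ∧-intro p a , ∧-intro h (adj-sym G c)
          each : ∀ z → z ∈ᵖ (P ∩ adj G v₀) → count (Fᵦ ∩ adj G z) ≤ 2 ^ ρ * X₃ Z
          each z hz = ≤-trans (class-bound (Fᵦ ∩ adj G z) 5 (X₃ Z) (λ v h → ∧-fst (∧-fst (∧-fst (∧-fst h)))) (λ v h → H₅-deg (∧-fst (∧-fst (∧-fst h)))) cl)
              (*-monoˡ-≤ (X₃ Z) (^-monoʳ-≤ 2 R-small))
            where
            cl : ∀ F i k → F ⊆ᵖ (Fᵦ ∩ adj G z) → SameR F → 1 ≤ i → i + k ≡ 5 → (∀ v → v ∈ᵖ F → degIn G R v ≡ i) → Sys G F P k → count F ≤ X₃ Z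
            cl F i k s same _ _ _ _ = ≤-trans (count-mono {F = F} {F ∩ adj G z} λ v h → ∧-intro h (∧-snd {Fᵦ v} (s v h)))
              (link-4 (class-sys (λ v h → ∧-fst (∧-fst (∧-fst (∧-fst (s v h))))) same (λ v h → H₁-P (∧-fst (∧-fst (s v h))))) (∧-fst hz))
        Fₐ-count : ∀ {v₁} → v₁ ∈ᵖ Fᵦ → count Fₐ ≤ 4 * X₃ Z
        Fₐ-count {v₁} h₁ = ≤-trans (count-≤-cover {F = Fₐ} (P ∩ adj G v₁) (λ z → Fₐ ∩ adj G z) (X₃ Z) (λ z hz → link-4 Sₐ (∧-fst hz)) cover) (P∩-4 (∧-fst h₁) _)
          where
          cover : ∀ v → v ∈ᵖ Fₐ → ∃ λ z → z ∈ᵖ (P ∩ adj G v₁) × v ∈ᵖ (Fₐ ∩ adj G z)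
          cover v h = let (z , p , a , c) = meet-P (∧-fst h) (∧-fst h₁) hx (∧-snd {H₁ v} h) (not-elim (∧-snd {H₁ v₁} h₁)) in z , ∧-intro p c , ∧-intro h (adj-sym G a)
        split : count H₁ ≡ count Fₐ + count Fᵦ
        split = count-split H₁ (λ v → adj G v x)
        alt : (∃ λ v → v ∈ᵖ Fᵦ) ⊎ (∀ v → Fᵦ v ≡ false) → count H₁ ≤ 4 * X₃ Z + 4 * (2 ^ ρ * X₃ Z) ⊎ (∃ λ F → Sys G F P 4 × count H₁ ≤ count F)
        alt (inj₁ (v₁ , h₁)) = inj₁ (≤-trans (≤-reflexive split) (+-mono-≤ (Fₐ-count h₁) Fᵦ-count))
        alt (inj₂ none) = inj₂ (Fₐ , Sₐ , ≤-reflexive (trans split (trans (cong (count Fₐ +_) (count-none none)) (+-identityʳ _))))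
      by : (∃ λ v → v ∈ᵖ H₁) ⊎ (∀ v → H₁ v ≡ false) → count H₁ ≤ 4 * X₃ Z + 4 * (2 ^ ρ * X₃ Z) ⊎ (∃ λ F → Sys G F P 4 × count H₁ ≤ count F)
      by (inj₂ none) = inj₁ (≤-trans (≤-reflexive (count-none none)) z≤n)
      by (inj₁ (v₀ , h₀)) = let (x , e) = count-inhabited {F = R ∩ adj G v₀} (≤-reflexive (≡-sym (H₁-R h₀)))
                            in alt h₀ (∧-fst e) (∧-snd {R x} e) (find _)

    E₂ : ℕ → ℕ
    E₂ M = 4 * X₃ Z + 4 * (2 ^ ρ * X₃ Z) + M ^ 4

    H₁-bound : ∀ M → 12 * (M * count H₁) ≤ 9 * (M * s₂ G P) + 5440 * s₂ G P + 64 + 12 * (M * E₂ M)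
    H₁-bound M = by H₁-alt
      where
      z = s₂ G P
      small : count H₁ ≤ E₂ M → 12 * (M * count H₁) ≤ 9 * (M * z) + 5440 * z + 64 + 12 * (M * E₂ M)
      small h = ≤-trans (*-monoʳ-≤ 12 (*-monoʳ-≤ M h)) (m≤n+m _ (9 * (M * z) + 5440 * z + 64))
      by : count H₁ ≤ 4 * X₃ Z + 4 * (2 ^ ρ * X₃ Z) ⊎ (∃ λ F → Sys G F P 4 × count H₁ ≤ count F) →
        12 * (M * count H₁) ≤ 9 * (M * z) + 5440 * z + 64 + 12 * (M * E₂ M)
      by (inj₁ h) = small (≤-trans h (m≤m+n _ (M ^ 4)))
      by (inj₂ (F , S′ , le)) = by′ (Four.four-asymptotic G S′ (cb-tf G cb P) (cb-ind G cb F P) z ≤-refl M)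
        where
        by′ : count F ≤ M ^ 4 ⊎ 12 * (M * count F) ≤ 9 * (M * z) + 5440 * z + 64 → 12 * (M * count H₁) ≤ 9 * (M * z) + 5440 * z + 64 + 12 * (M * E₂ M)
        by′ (inj₁ h) = small (≤-trans le (≤-trans h (m≤n+m (M ^ 4) (4 * X₃ Z + 4 * (2 ^ ρ * X₃ Z)))))
        by′ (inj₂ h) = ≤-trans (≤-trans (*-monoʳ-≤ 12 (*-monoʳ-≤ M le)) h) (m≤m+n _ (12 * (M * E₂ M)))

    L₅ : Pred n
    L₅ = L ∩ (λ v → ⌊ deg G v ≟ℕ 5 ⌋)

    L₅-count : count L₅ ≤ count H₁ + (2 ^ ρ * B₃ Z + ρ * t)
    L₅-count = begin
      count L₅ ≤⟨ L-count (λ v → ⌊ deg G v ≟ℕ 5 ⌋) ⟩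
      count H₅ + count R * t ≡⟨ cong (_+ count R * t) (count-split H₅ (λ v → ⌊ 2 ≤? degIn G R v ⌋)) ⟩
      count Hₐ + count H₁ + count R * t ≤⟨ +-mono-≤ (+-monoˡ-≤ (count H₁) Hₐ-count) (*-monoˡ-≤ t R-small) ⟩
      2 ^ ρ * B₃ Z + count H₁ + ρ * t ≡⟨ e (2 ^ ρ * B₃ Z) (count H₁) (ρ * t) ⟩
      count H₁ + (2 ^ ρ * B₃ Z + ρ * t) ∎
      where
      open ≤-Reasoning
      e : ∀ a b c → a + b + c ≡ b + (a + c)
      e = solve-∀

    L-five-sum : count L * 6 ≤ S + (count L₅ + count Lₗ * 6)
    L-five-sum = ≤-trans (≤-reflexive (trans (cong (_* 6) (count≡sum L)) (≡-sym (sum-*ʳ (𝟙 ∘ L) 6))))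
        (≤-trans (sum-mono pt) (≤-reflexive (trans (sum-+ (λ v → 𝟙 (L v) * deg G v) (λ v → 𝟙 (L₅ v) + 𝟙 (Lₗ v) * 6))
          (cong (S +_) (trans (sum-+ (𝟙 ∘ L₅) (λ v → 𝟙 (Lₗ v) * 6)) (cong₂ _+_ (≡-sym (count≡sum L₅)) (trans (sum-*ʳ (𝟙 ∘ Lₗ) 6) (cong (_* 6) (≡-sym (count≡sum Lₗ))))))))))
      where
      pt : ∀ v → 𝟙 (L v) * 6 ≤ 𝟙 (L v) * deg G v + (𝟙 (L₅ v) + 𝟙 (Lₗ v) * 6)
      pt v with L v
      ... | false = z≤n
      ... | true with deg G v ≤? 4 | deg G v ≟ℕ 5
      ...   | yes _ | _ = ≤-trans (m≤n+m 6 _) (m≤n+m _ (1 * deg G v))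
      ...   | no _ | yes e = ≤-trans (≤-reflexive (cong (λ d → 1 * d + 1) (≡-sym e))) (+-monoʳ-≤ (1 * deg G v) (m≤m+n 1 _))
      ...   | no ¬le | no ne = ≤-trans (*-monoʳ-≤ 1 (≤∧≢⇒< (≰⇒> ¬le) (λ e → ne (≡-sym e)))) (m≤m+n _ _)

    -- `core-weight` with C = 6, relative to weight 12 per vertex: a vertex of degree 5 lacks 2, and
    -- those of `R` and `Lₗ` lack at most 12.
    five-weight : 12 * n + s₂ G P ≤ 12 * (ρ + count Lₗ) + 2 * edges G + 2 * count L₅
    five-weight = begin
      12 * n + z ≤⟨ +-monoˡ-≤ z (*-monoʳ-≤ 12 (≤-trans vertex-count (+-monoˡ-≤ (count L + b) R-small))) ⟩
      12 * (ρ + (count L + b)) + z ≡⟨ e₁ ρ (count L) b z ⟩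
      2 * (count L * 6) + (12 * ρ + 12 * b + z) ≤⟨ +-monoˡ-≤ (12 * ρ + 12 * b + z) (*-monoʳ-≤ 2 L-five-sum) ⟩
      2 * (S + (count L₅ + count Lₗ * 6)) + (12 * ρ + 12 * b + z) ≡⟨ e₂ S (count L₅) (count Lₗ) ρ b z ⟩
      (2 * S + 2 * 6 * b + z) + (12 * (ρ + count Lₗ) + 2 * count L₅) ≤⟨ +-monoˡ-≤ (12 * (ρ + count Lₗ) + 2 * count L₅) (core-weight G K) ⟩
      2 * edges G + (12 * (ρ + count Lₗ) + 2 * count L₅) ≡⟨ e₃ (2 * edges G) (12 * (ρ + count Lₗ)) (2 * count L₅) ⟩
      12 * (ρ + count Lₗ) + 2 * edges G + 2 * count L₅ ∎
      where
      open ≤-Reasoning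
      z = s₂ G P
      e₁ : ∀ r l b z → 12 * (r + (l + b)) + z ≡ 2 * (l * 6) + (12 * r + 12 * b + z)
      e₁ = solve-∀
      e₂ : ∀ s f l r b z → 2 * (s + (f + l * 6)) + (12 * r + 12 * b + z) ≡ (2 * s + 2 * 6 * b + z) + (12 * (r + l) + 2 * f)
      e₂ = solve-∀
      e₃ : ∀ a b c → a + (b + c) ≡ b + a + c
      e₃ = solve-∀

-- Eliminates s₂ between the weight inequality and the bound on the number of vertices of degree 5.
arith₄ : ∀ κ c M n e z l₅ h₁ g E low → 12 * n + z ≤ 12 * low + 2 * e + 2 * l₅ → 12 * (M * h₁) ≤ 9 * (M * z) + κ * z + c + 12 * (M * E) →
  l₅ ≤ h₁ + g → l₅ ≤ n → 102 * (M * n) ≤ 18 * (M * e) + (108 * (M * low) + κ * z + c + 12 * (M * (E + g)))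
arith₄ κ c M n e z l₅ h₁ g E low hw h1 h5 hn = +-cancelˡ-≤ (6 * (M * n) + 9 * (M * z)) _ _ (begin
  6 * (M * n) + 9 * (M * z) + 102 * (M * n) ≡⟨ e₁ M n z ⟩
  9 * (M * (12 * n + z)) ≤⟨ *-monoʳ-≤ 9 (*-monoʳ-≤ M hw) ⟩
  9 * (M * (12 * low + 2 * e + 2 * l₅)) ≡⟨ e₂ M low e l₅ ⟩
  108 * (M * low) + 18 * (M * e) + 6 * (M * l₅) + 12 * (M * l₅) ≤⟨ +-mono-≤ (+-monoʳ-≤ (108 * (M * low) + 18 * (M * e)) (*-monoʳ-≤ 6 (*-monoʳ-≤ M hn)))
      (≤-trans (*-monoʳ-≤ 12 (*-monoʳ-≤ M h5)) (≤-trans (≤-reflexive (e₃ M h₁ g)) (+-monoˡ-≤ (12 * (M * g)) h1))) ⟩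
  108 * (M * low) + 18 * (M * e) + 6 * (M * n) + (9 * (M * z) + κ * z + c + 12 * (M * E) + 12 * (M * g)) ≡⟨ e₄ M low e n z κ c E g ⟩
  6 * (M * n) + 9 * (M * z) + (18 * (M * e) + (108 * (M * low) + κ * z + c + 12 * (M * (E + g)))) ∎)
  where
  open ≤-Reasoning
  e₁ : ∀ M n z → 6 * (M * n) + 9 * (M * z) + 102 * (M * n) ≡ 9 * (M * (12 * n + z))
  e₁ = solve-∀
  e₂ : ∀ M low e l → 9 * (M * (12 * low + 2 * e + 2 * l)) ≡ 108 * (M * low) + 18 * (M * e) + 6 * (M * l) + 12 * (M * l)
  e₂ = solve-∀
  e₃ : ∀ M h g → 12 * (M * (h + g)) ≡ 12 * (M * h) + 12 * (M * g)
  e₃ = solve-∀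
  e₄ : ∀ M low e n z κ c E g → 108 * (M * low) + 18 * (M * e) + 6 * (M * n) + (9 * (M * z) + κ * z + c + 12 * (M * E) + 12 * (M * g)) ≡
    6 * (M * n) + 9 * (M * z) + (18 * (M * e) + (108 * (M * low) + κ * z + c + 12 * (M * (E + g))))
  e₄ = solve-∀

-- `M` is chosen such that, for z ≤ 12 n, suc m times the error `suc κ * z` is at most M n.
finish₄ : ∀ κ c m M n e z low E → M ≡ suc κ * 12 * suc m → z ≤ 12 * n → 102 * (M * n) ≤ 18 * (M * e) + (108 * (M * low) + suc κ * z + c + 12 * (M * E)) →
  suc m * (108 * low + c + 12 * E) ≤ n → suc m * 17 * n ≤ suc m * 3 * e + 3 * n
finish₄ κ c m M n e z low E refl hz h he = *-cancelʳ-≤ (m′ * 17 * n) (m′ * 3 * e + 3 * n) (6 * M) (begin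
  m′ * 17 * n * (6 * M) ≡⟨ e₁ m′ n M ⟩
  m′ * (102 * (M * n)) ≤⟨ *-monoʳ-≤ m′ h ⟩
  m′ * (18 * (M * e) + (108 * (M * low) + suc κ * z + c + 12 * (M * E))) ≤⟨ *-monoʳ-≤ m′ (+-monoʳ-≤ (18 * (M * e)) (+-monoˡ-≤ (12 * (M * E)) (+-mono-≤
       (+-monoʳ-≤ (108 * (M * low)) (*-monoʳ-≤ (suc κ) hz)) (≤-trans (≤-reflexive (≡-sym (*-identityˡ c))) (*-monoˡ-≤ c 1≤M))))) ⟩
  m′ * (18 * (M * e) + (108 * (M * low) + suc κ * (12 * n) + M * c + 12 * (M * E))) ≡⟨ e₂ m′ M e low (suc κ) n c E ⟩
  18 * (m′ * (M * e)) + M * (m′ * (108 * low + c + 12 * E)) + suc κ * 12 * m′ * n ≤⟨ +-monoˡ-≤ (M * n) (+-monoʳ-≤ (18 * (m′ * (M * e))) (*-monoʳ-≤ M he)) ⟩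
  18 * (m′ * (M * e)) + M * n + M * n ≤⟨ m≤m+n _ (16 * (M * n)) ⟩
  18 * (m′ * (M * e)) + M * n + M * n + 16 * (M * n) ≡⟨ e₃ m′ M e n ⟩
  (m′ * 3 * e + 3 * n) * (6 * M) ∎)
  where
  open ≤-Reasoning
  m′ = suc m
  1≤M : 1 ≤ M
  1≤M = s≤s z≤n
  e₁ : ∀ m n M → m * 17 * n * (6 * M) ≡ m * (102 * (M * n))
  e₁ = solve-∀
  e₂ : ∀ m M e low κ n c E → m * (18 * (M * e) + (108 * (M * low) + κ * (12 * n) + M * c + 12 * (M * E))) ≡
    18 * (m * (M * e)) + M * (m * (108 * low + c + 12 * E)) + κ * 12 * m * n
  e₂ = solve-∀
  e₃ : ∀ m M e n → 18 * (m * (M * e)) + M * n + M * n + 16 * (M * n) ≡ (m * 3 * e + 3 * n) * (6 * M)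
  e₃ = solve-∀

-- κ and M are variables here to keep large numerals from being unfolded.
lower₄-step : ∀ t → t ≤ 5 → ∀ m κ → 5440 ≡ suc κ → ∀ M → M ≡ suc κ * 12 * suc m → ∃ λ N → ∀ n → N ≤ n → ∀ (G : SimpleGraph n) → Admissible n 3 t G →
  suc m * 17 * n ≤ suc m * 3 * edges G + 3 * n
lower₄-step t t≤5 m κ κ≡ M M≡ = suc (proj₁ so) , bound
  where
  ρ β A B : ℕ
  ρ = coreSize 6 18
  β = 2 ^ ρ * βᴿ 1
  A = suc m * (108 * (ρ + (5 * β + ρ * t)) + 64 + 12 * (M ^ 4 + (β + ρ * t)))
  B = suc m * (108 * (5 * β) + 12 * (4 + 4 * 2 ^ ρ + β))
  so = smallo A B (quartic 1 * 13 ^ 3)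
  bound : ∀ n → suc (proj₁ so) ≤ n → ∀ (G : SimpleGraph n) → Admissible n 3 t G → suc m * 17 * n ≤ suc m * 3 * edges G + 3 * n
  bound n N≤ G adm = by (17 * n ≤? 3 * edges G)
    where
    K = core G (proj₁ adm) 6
    by : Dec (17 * n ≤ 3 * edges G) → suc m * 17 * n ≤ suc m * 3 * edges G + 3 * n
    by (yes h) = ≤-trans (≤-trans (≤-reflexive (*-assoc (suc m) 17 n)) (≤-trans (*-monoʳ-≤ (suc m) h) (≤-reflexive (≡-sym (*-assoc (suc m) 3 (edges G)))))) (m≤m+n _ (3 * n))
    by (no ¬h) = finish₄ κ 64 m M n (edges G) (s₂ G P) (ρ + count Lₗ) (E₂ M + (2 ^ ρ * B₃ Z + ρ * t)) M≡ hZ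
        (arith₄ (suc κ) 64 M n (edges G) (s₂ G P) (count L₅) (count H₁) (2 ^ ρ * B₃ Z + ρ * t) (E₂ M) (ρ + count Lₗ) five-weight H₁≤ L₅-count
          (≤-trans (count-mono {F = L₅} {λ _ → true} λ _ _ → refl) (≤-reflexive (count-all {n} λ _ → refl))))
        (begin
          suc m * (108 * (ρ + count Lₗ) + 64 + 12 * (E₂ M + (2 ^ ρ * B₃ Z + ρ * t)))
            ≤⟨ *-monoʳ-≤ (suc m) (+-mono-≤ (+-monoˡ-≤ 64 (*-monoʳ-≤ 108 (+-monoʳ-≤ ρ (low-count Z hZ))))
                 (*-monoʳ-≤ 12 (+-mono-≤ (+-monoˡ-≤ (M ^ 4) (+-mono-≤ (*-monoʳ-≤ 4 X≤) (*-monoʳ-≤ 4 (*-monoʳ-≤ (2 ^ ρ) X≤)))) (+-monoˡ-≤ (ρ * t) (*-monoʳ-≤ (2 ^ ρ) (B₃-X Z)))))) ⟩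
          suc m * (108 * (ρ + (5 * (2 ^ ρ * (βᴿ 1 * suc X)) + ρ * t)) + 64 + 12 * (4 * X + 4 * (2 ^ ρ * X) + M ^ 4 + (2 ^ ρ * (βᴿ 1 * suc X) + ρ * t)))
            ≡⟨ e (suc m) ρ (2 ^ ρ) (βᴿ 1) X (ρ * t) 64 (M ^ 4) ⟩
          A + B * X ≤⟨ proj₂ so n (≤-trans (n≤1+n _) N≤) X (Xᴿ-^4 1 12 n (≤-trans (s≤s z≤n) N≤)) ⟩
          n ∎)
      where
      e<6n : edges G ≤ 6 * n
      e<6n = *-cancelˡ-≤ 3 (≤-trans (<⇒≤ (≰⇒> ¬h)) (≤-trans (*-monoˡ-≤ n (n≤1+n 17)) (≤-reflexive (*-assoc 3 6 n))))
      Z = 12 * n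
      X = Xᴿ 1 Z
      hZ : s₂ G (Core.P K) ≤ Z
      hZ = ≤-trans (Low.s₂-edges G adm (s≤s t≤5) K) (≤-trans (*-monoʳ-≤ 2 e<6n) (≤-reflexive (≡-sym (*-assoc 2 6 n))))
      open Five G adm t≤5 K Z hZ hiding (ρ; A)
      open ≤-Reasoning
      H₁≤ : 12 * (M * count H₁) ≤ 9 * (M * s₂ G P) + suc κ * s₂ G P + 64 + 12 * (M * E₂ M)
      H₁≤ = subst (λ k → 12 * (M * count H₁) ≤ 9 * (M * s₂ G P) + k * s₂ G P + 64 + 12 * (M * E₂ M)) κ≡ (H₁-bound M)
      X≤ : X₃ Z ≤ X
      X≤ = X₃≤Xᴿ 1 Z
      e₁ : ∀ r u X rt → r + (5 * (u + u * X) + rt) ≡ r + (5 * u + rt) + 5 * u * X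
      e₁ = solve-∀
      e₂ : ∀ p u X rt M → 4 * X + 4 * (p * X) + M + (u + u * X + rt) ≡ M + (u + rt) + (4 + 4 * p + u) * X
      e₂ = solve-∀
      e₃ : ∀ k a x c d y w X → k * (a + x * X) + c + d * (y + w * X) ≡ k * a + c + d * y + (k * x + d * w) * X
      e₃ = solve-∀
      e : ∀ m r p β X rt c M → m * (108 * (r + (5 * (p * (β * suc X)) + rt)) + c + 12 * (4 * X + 4 * (p * X) + M + (p * (β * suc X) + rt))) ≡
          m * (108 * (r + (5 * (p * β) + rt)) + c + 12 * (M + (p * β + rt))) + m * (108 * (5 * (p * β)) + 12 * (4 + 4 * p + p * β)) * X
      e m r p β X rt c M = trans (cong (m *_) (trans (cong₂ (λ x y → 108 * x + c + 12 * y)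
            (trans (cong (λ v → r + (5 * v + rt)) pβX) (e₁ r (p * β) X rt)) (trans (cong (λ v → 4 * X + 4 * (p * X) + M + (v + rt)) pβX) (e₂ p (p * β) X rt M)))
            (e₃ 108 (r + (5 * (p * β) + rt)) (5 * (p * β)) c 12 (M + (p * β + rt)) (4 + 4 * p + p * β) X)))
          (trans (*-distribˡ-+ m _ _) (cong (m * (108 * (r + (5 * (p * β) + rt)) + c + 12 * (M + (p * β + rt))) +_) (≡-sym (*-assoc m _ X))))
        where
        pβX : p * (β * suc X) ≡ p * β + p * β * X
        pβX = trans (≡-sym (*-assoc p β (suc X))) (*-suc (p * β) X)

lower₄ : ∀ t → t ≤ 5 → ∀ m → ∃ λ N → ∀ n → N ≤ n → ∀ (G : SimpleGraph n) → Admissible n 3 t G →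
  suc m * 17 * n ≤ suc m * 3 * edges G + 3 * n
lower₄ t t≤5 m = lower₄-step t t≤5 m 5439 refl (5440 * 12 * suc m) refl

-- Upper bounds: cyclic indices and the graph on words.

module Cyclic (k-1 : ℕ) where
  k : ℕ
  k = suc k-1

  shift : ℕ → Fin k → Fin k
  shift m i = fromℕ< (m%n<n (m + toℕ i) k)

  toℕ-shift : ∀ m i → toℕ (shift m i) ≡ (m + toℕ i) % k
  toℕ-shift m i = toℕ-fromℕ< (m%n<n (m + toℕ i) k)

  shift-shift : ∀ m p i → shift m (shift p i) ≡ shift (m + p) i
  shift-shift m p i = toℕ-injective (begin
    toℕ (shift m (shift p i)) ≡⟨ toℕ-shift m (shift p i) ⟩
    (m + toℕ (shift p i)) % k ≡⟨ cong (λ x → (m + x) % k) (toℕ-shift p i) ⟩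
    (m + (p + toℕ i) % k) % k ≡⟨ %-distribˡ-+ m ((p + toℕ i) % k) k ⟩
    (m % k + (p + toℕ i) % k % k) % k ≡⟨ cong (λ x → (m % k + x) % k) (m%n%n≡m%n (p + toℕ i) k) ⟩
    (m % k + (p + toℕ i) % k) % k ≡⟨ ≡-sym (%-distribˡ-+ m (p + toℕ i) k) ⟩
    (m + (p + toℕ i)) % k ≡⟨ cong (_% k) (≡-sym (+-assoc m p (toℕ i))) ⟩
    (m + p + toℕ i) % k ≡⟨ ≡-sym (toℕ-shift (m + p) i) ⟩
    toℕ (shift (m + p) i) ∎)
    where open ≡-Reasoning

  shift-k : ∀ i → shift k i ≡ i
  shift-k i = toℕ-injective (trans (toℕ-shift k i) (trans (cong (_% k) (+-comm k (toℕ i))) (trans ([m+n]%n≡m%n (toℕ i) k) (m<n⇒m%n≡m (toℕ<n i)))))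

  shift-≢ : ∀ {m} i → 0 < m → m < k → shift m i ≢ i
  shift-≢ {m} i m>0 m<k e with m + toℕ i <? k
  ... | yes lt = <-irrefl (≡-sym (trans (≡-sym (m<n⇒m%n≡m lt)) (trans (≡-sym (toℕ-shift m i)) (cong toℕ e)))) (+-monoˡ-≤ (toℕ i) m>0)
  ... | no ¬lt = <-irrefl m≡k m<k
    where
    r = m + toℕ i ∸ k
    r+k : r + k ≡ m + toℕ i
    r+k = m∸n+n≡m (≮⇒≥ ¬lt)
    r<k : r < k
    r<k = +-cancelʳ-≤ k (suc r) k (≤-trans (≤-reflexive (cong suc r+k)) (+-mono-≤ m<k (<⇒≤ (toℕ<n i))))
    r≡i : r ≡ toℕ i
    r≡i = trans (≡-sym (m<n⇒m%n≡m r<k)) (trans (≡-sym ([m+n]%n≡m%n r k)) (trans (cong (_% k) r+k) (trans (≡-sym (toℕ-shift m i)) (cong toℕ e))))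
    m≡k : m ≡ k
    m≡k = +-cancelˡ-≡ r m k (trans (+-comm r m) (trans (cong (m +_) r≡i) (≡-sym r+k)))

  next prev : Fin k → Fin k
  next = shift 1
  prev = shift k-1

  next-prev : ∀ i → next (prev i) ≡ i
  next-prev i = trans (shift-shift 1 k-1 i) (shift-k i)

  prev-next : ∀ i → prev (next i) ≡ i
  prev-next i = trans (shift-shift k-1 1 i) (trans (cong (λ m → shift m i) (+-comm k-1 1)) (shift-k i))

  next-injective : ∀ {i j} → next i ≡ next j → i ≡ j
  next-injective {i} {j} e = trans (≡-sym (prev-next i)) (trans (cong prev e) (prev-next j))

  module Long (4<k : 4 < k) where
    next≢ : ∀ i → next i ≢ i
    next≢ i = shift-≢ i (s≤s z≤n) (≤-trans (s≤s (s≤s z≤n)) 4<k)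

    next²≢ : ∀ i → next (next i) ≢ i
    next²≢ i e = shift-≢ {2} i (s≤s z≤n) (≤-trans (s≤s (s≤s (s≤s z≤n))) 4<k) (trans (≡-sym (shift-shift 1 1 i)) e)

    next³≢ : ∀ i → next (next (next i)) ≢ i
    next³≢ i e = shift-≢ {3} i (s≤s z≤n) (≤-trans (s≤s (s≤s (s≤s (s≤s z≤n)))) 4<k)
      (trans (≡-sym (trans (cong next (shift-shift 1 1 i)) (shift-shift 1 2 i))) e)

    Near : Fin k → Fin k → Set
    Near i j = j ≡ next i ⊎ i ≡ next j

    no-triangle : ∀ {i j l} → Near i j → Near j l → Near i l → ⊥
    no-triangle {i} (inj₁ refl) (inj₁ refl) (inj₁ e) = next≢ i (next-injective e)
    no-triangle {i} (inj₁ refl) (inj₁ refl) (inj₂ e) = next³≢ i (≡-sym e)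
    no-triangle {i} (inj₁ refl) (inj₂ e) h with next-injective e
    no-triangle {i} (inj₁ refl) (inj₂ e) (inj₁ e′) | refl = next≢ i (≡-sym e′)
    no-triangle {i} (inj₁ refl) (inj₂ e) (inj₂ e′) | refl = next≢ i (≡-sym e′)
    no-triangle {j = j} (inj₂ refl) (inj₁ refl) (inj₁ e) = next≢ (next j) (≡-sym e)
    no-triangle {j = j} (inj₂ refl) (inj₁ refl) (inj₂ e) = next≢ (next j) (≡-sym e)
    no-triangle {l = l} (inj₂ refl) (inj₂ refl) (inj₁ e) = next³≢ l (≡-sym e)
    no-triangle {l = l} (inj₂ refl) (inj₂ refl) (inj₂ e) = next≢ l (next-injective e)

-- The graph: apex ~ Λ, a ~ (i , a i , a (i + 1)), and (i , b , c) ~ (i + 1 , b′ , c′) iff c ≢ b′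

data Vtx (ℓ k Q : ℕ) : Set where
  lam  : Fin ℓ → Vtx ℓ k Q
  apex : Vtx ℓ k Q
  wv   : Fin k → Fin Q → Fin Q → Vtx ℓ k Q

module Gadget (k-1 Q-1 ℓ : ℕ) (4<k : 4 < suc k-1) (3≤Q : 3 ≤ suc Q-1)
  (x : Fin ℓ → Fin (suc k-1) → Fin (suc Q-1))
  (x-inj : ∀ a b → (∀ i → x a i ≡ x b i) → a ≡ b)
  (x-core : ∀ (f : Fin (suc k-1) → Fin (suc Q-1)) m → f m ≡ fzero → ∃ λ a → ∀ i → x a i ≡ f i) where

  open Cyclic k-1
  open Long 4<k

  Q : ℕ
  Q = suc Q-1

  V : Set
  V = Vtx ℓ k Q

  adjᵛ : V → V → Bool
  adjᵛ (lam a) (lam b) = false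
  adjᵛ (lam a) apex = true
  adjᵛ (lam a) (wv i b c) = ⌊ b ≟ x a i ⌋ ∧ ⌊ c ≟ x a (next i) ⌋
  adjᵛ apex (lam a) = true
  adjᵛ apex apex = false
  adjᵛ apex (wv i b c) = false
  adjᵛ (wv i b c) (lam a) = ⌊ b ≟ x a i ⌋ ∧ ⌊ c ≟ x a (next i) ⌋
  adjᵛ (wv i b c) apex = false
  adjᵛ (wv i b c) (wv j b′ c′) = (⌊ j ≟ next i ⌋ ∧ not ⌊ c ≟ b′ ⌋) ∨ (⌊ i ≟ next j ⌋ ∧ not ⌊ c′ ≟ b ⌋)

  Aᵛ : V → V → Set
  Aᵛ u v = adjᵛ u v ≡ true

  symᵛ : ∀ u v → adjᵛ u v ≡ adjᵛ v u
  symᵛ (lam a) (lam b) = refl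
  symᵛ (lam a) apex = refl
  symᵛ (lam a) (wv i b c) = refl
  symᵛ apex (lam a) = refl
  symᵛ apex apex = refl
  symᵛ apex (wv i b c) = refl
  symᵛ (wv i b c) (lam a) = refl
  symᵛ (wv i b c) apex = refl
  symᵛ (wv i b c) (wv j b′ c′) = ∨-comm (⌊ j ≟ next i ⌋ ∧ not ⌊ c ≟ b′ ⌋) (⌊ i ≟ next j ⌋ ∧ not ⌊ c′ ≟ b ⌋)

  ww-elim : ∀ i b c j b′ c′ → Aᵛ (wv i b c) (wv j b′ c′) → (j ≡ next i × c ≢ b′) ⊎ (i ≡ next j × c′ ≢ b)
  ww-elim i b c j b′ c′ h with ∨-elim {⌊ j ≟ next i ⌋ ∧ not ⌊ c ≟ b′ ⌋} h
  ... | inj₁ e = inj₁ (⌊⌋-elim (j ≟ next i) (∧-fst e) , ⌊⌋-refute (c ≟ b′) (not-elim (∧-snd {⌊ j ≟ next i ⌋} e)))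
  ... | inj₂ e = inj₂ (⌊⌋-elim (i ≟ next j) (∧-fst e) , ⌊⌋-refute (c′ ≟ b) (not-elim (∧-snd {⌊ i ≟ next j ⌋} e)))

  ww-intro : ∀ i b c j b′ c′ → j ≡ next i → c ≢ b′ → Aᵛ (wv i b c) (wv j b′ c′)
  ww-intro i b c j b′ c′ e ne = ∨-introˡ (∧-intro (⌊⌋-intro (j ≟ next i) e) (not-intro (⌊⌋-false (c ≟ b′) ne)))

  lw-elim : ∀ a i b c → Aᵛ (lam a) (wv i b c) → b ≡ x a i × c ≡ x a (next i)
  lw-elim a i b c h = ⌊⌋-elim (b ≟ x a i) (∧-fst h) , ⌊⌋-elim (c ≟ x a (next i)) (∧-snd {⌊ b ≟ x a i ⌋} h)

  lw-intro : ∀ a i {b c} → b ≡ x a i → c ≡ x a (next i) → Aᵛ (lam a) (wv i b c)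
  lw-intro a i {b} {c} e e′ = ∧-intro (⌊⌋-intro (b ≟ x a i) e) (⌊⌋-intro (c ≟ x a (next i)) e′)

  near : ∀ i b c j b′ c′ → Aᵛ (wv i b c) (wv j b′ c′) → Near i j
  near i b c j b′ c′ h with ww-elim i b c j b′ c′ h
  ... | inj₁ (e , _) = inj₁ e
  ... | inj₂ (e , _) = inj₂ e

  irreflᵛ : ∀ u → adjᵛ u u ≡ false
  irreflᵛ (lam a) = refl
  irreflᵛ apex = refl
  irreflᵛ (wv i b c) = ¬t⇒f λ h → case near i b c i b c h of λ { (inj₁ e) → next≢ i (≡-sym e) ; (inj₂ e) → next≢ i (≡-sym e) }

  lww : ∀ a i b c j b′ c′ → Aᵛ (lam a) (wv i b c) → Aᵛ (wv i b c) (wv j b′ c′) → Aᵛ (lam a) (wv j b′ c′) → ⊥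
  lww a i b c j b′ c′ h h₂ h₃ with lw-elim a i b c h | lw-elim a j b′ c′ h₃ | ww-elim i b c j b′ c′ h₂
  ... | refl , refl | refl , refl | inj₁ (refl , ne) = ne refl
  ... | refl , refl | refl , refl | inj₂ (refl , ne) = ne refl

  triangle-freeᵛ : ∀ u v w → Aᵛ u v → Aᵛ v w → Aᵛ u w → ⊥
  triangle-freeᵛ (lam a) (wv i b c) (wv j b′ c′) h₁ h₂ h₃ = lww a i b c j b′ c′ h₁ h₂ h₃
  triangle-freeᵛ (wv i b c) (lam a) (wv j b′ c′) h₁ h₂ h₃ = lww a i b c j b′ c′ h₁ h₃ h₂
  triangle-freeᵛ (wv i b c) (wv j b′ c′) (lam a) h₁ h₂ h₃ = lww a i b c j b′ c′ h₃ h₁ h₂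
  triangle-freeᵛ (wv i b c) (wv j b′ c′) (wv l b″ c″) h₁ h₂ h₃ =
    no-triangle (near i b c j b′ c′ h₁) (near j b′ c′ l b″ c″ h₂) (near i b c l b″ c″ h₃)
  triangle-freeᵛ (lam a) apex (lam b) h₁ h₂ ()
  triangle-freeᵛ (lam a) apex apex h₁ () h₃
  triangle-freeᵛ (lam a) (lam b) w () h₂ h₃
  triangle-freeᵛ (lam a) apex (wv _ _ _) h₁ () h₃
  triangle-freeᵛ (lam a) (wv _ _ _) (lam b) h₁ h₂ ()
  triangle-freeᵛ (lam a) (wv _ _ _) apex h₁ () h₃
  triangle-freeᵛ apex (lam a) (lam b) h₁ () h₃
  triangle-freeᵛ apex (lam a) apex h₁ h₂ ()
  triangle-freeᵛ apex (lam a) (wv _ _ _) h₁ h₂ ()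
  triangle-freeᵛ apex apex w () h₂ h₃
  triangle-freeᵛ apex (wv _ _ _) w () h₂ h₃
  triangle-freeᵛ (wv _ _ _) (lam a) (lam b) h₁ () h₃
  triangle-freeᵛ (wv _ _ _) (lam a) apex h₁ h₂ ()
  triangle-freeᵛ (wv _ _ _) apex w () h₂ h₃
  triangle-freeᵛ (wv _ _ _) (wv _ _ _) apex h₁ () h₃

  -- A member of Λ with prescribed entries at i, i + 1, j, j + 1; a further coordinate is 0,
  -- since only the words with a letter 0 are sure to lie in Λ.
  prescribe : ∀ i b c j b′ c′ → ∃ λ a → x a i ≡ b × x a (next i) ≡ c ×
    (j ≢ i → j ≢ next i → x a j ≡ b′) × (j ≢ i → next j ≢ i → x a (next j) ≡ c′)
  prescribe i b c j b′ c′ = go (avoid {k} (λ _ → true) (i ∷ next i ∷ j ∷ next j ∷ []) (≤-trans 4<k (≤-reflexive (≡-sym (count-all {k} λ _ → refl)))))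
    where
    f : Fin k → Fin Q
    f m with m ≟ i | m ≟ next i | m ≟ j | m ≟ next j
    ... | yes _ | _ | _ | _ = b
    ... | no _ | yes _ | _ | _ = c
    ... | no _ | no _ | yes _ | _ = b′
    ... | no _ | no _ | no _ | yes _ = c′
    ... | no _ | no _ | no _ | no _ = fzero
    f-zero : ∀ m → m ≢ i → m ≢ next i → m ≢ j → m ≢ next j → f m ≡ fzero
    f-zero m a b c d with m ≟ i | m ≟ next i | m ≟ j | m ≟ next j
    ... | yes e | _ | _ | _ = ⊥-elim (a e)
    ... | no _ | yes e | _ | _ = ⊥-elim (b e)
    ... | no _ | no _ | yes e | _ = ⊥-elim (c e)
    ... | no _ | no _ | no _ | yes e = ⊥-elim (d e)
    ... | no _ | no _ | no _ | no _ = refl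
    f-i : f i ≡ b
    f-i with i ≟ i
    ... | yes _ = refl
    ... | no ne = ⊥-elim (ne refl)
    f-ni : f (next i) ≡ c
    f-ni with next i ≟ i | next i ≟ next i
    ... | yes e | _ = ⊥-elim (next≢ i e)
    ... | no _ | yes _ = refl
    ... | no _ | no ne = ⊥-elim (ne refl)
    f-j : j ≢ i → j ≢ next i → f j ≡ b′
    f-j n₁ n₂ with j ≟ i | j ≟ next i | j ≟ j
    ... | yes e | _ | _ = ⊥-elim (n₁ e)
    ... | no _ | yes e | _ = ⊥-elim (n₂ e)
    ... | no _ | no _ | yes _ = refl
    ... | no _ | no _ | no ne = ⊥-elim (ne refl)
    f-nj : j ≢ i → next j ≢ i → f (next j) ≡ c′
    f-nj n₁ n₂ with next j ≟ i | next j ≟ next i | next j ≟ j | next j ≟ next j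
    ... | yes e | _ | _ | _ = ⊥-elim (n₂ e)
    ... | no _ | yes e | _ | _ = ⊥-elim (n₁ (next-injective e))
    ... | no _ | no _ | yes e | _ = ⊥-elim (next≢ j e)
    ... | no _ | no _ | no _ | yes _ = refl
    ... | no _ | no _ | no _ | no ne = ⊥-elim (ne refl)
    go : (∃ λ m → m ∈ᵖ (λ _ → true) × All (m ≢_) (i ∷ next i ∷ j ∷ next j ∷ [])) → _
    go (m , _ , (n₁ ∷ n₂ ∷ n₃ ∷ n₄ ∷ [])) with x-core f m (f-zero m n₁ n₂ n₃ n₄)
    ... | a , h = a , trans (h i) f-i , trans (h (next i)) f-ni , (λ p p′ → trans (h j) (f-j p p′)) , λ p p′ → trans (h (next j)) (f-nj p p′)

  differ : ∀ (b c : Fin Q) → ∃ λ d → d ≢ b × d ≢ c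
  differ b c with avoid {Q} (λ _ → true) (b ∷ c ∷ []) (≤-trans 3≤Q (≤-reflexive (≡-sym (count-all {Q} λ _ → refl))))
  ... | d , _ , (n₁ ∷ n₂ ∷ []) = d , n₁ , n₂

  Common : V → V → Set
  Common u v = ∃ λ z → Aᵛ u z × Aᵛ v z

  swapᶜ : ∀ {u v} → Common u v → Common v u
  swapᶜ (z , a , b) = z , b , a

  common-apex : ∀ i b c → Common apex (wv i b c)
  common-apex i b c = let (a , e , e′ , _) = prescribe i b c i b c in lam a , refl , lw-intro a i (≡-sym e) (≡-sym e′)

  -- A mismatch in the second letter is seen by the neighbour of the word at index i + 1, one in the
  -- first letter by its neighbour at index i - 1.
  common-lam : ∀ a i b c → adjᵛ (lam a) (wv i b c) ≡ false → Common (lam a) (wv i b c)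
  common-lam a i b c h with c ≟ x a (next i) | b ≟ x a i
  ... | no ne | _ = wv (next i) (x a (next i)) (x a (next (next i))) , lw-intro a (next i) refl refl , ww-intro i b c (next i) (x a (next i)) (x a (next (next i))) refl ne
  ... | yes _ | no ne = wv (prev i) (x a (prev i)) (x a (next (prev i))) , lw-intro a (prev i) refl refl ,
        trans (symᵛ (wv i b c) (wv (prev i) (x a (prev i)) (x a (next (prev i))))) (ww-intro (prev i) (x a (prev i)) (x a (next (prev i))) i b c (≡-sym (next-prev i))
          (λ e → ne (trans (≡-sym e) (cong (x a) (next-prev i)))))
  ... | yes _ | yes _ = ⊥-elim (case h of λ ())

  Prescribed : (i : Fin k) (b c : Fin Q) (j : Fin k) (b′ c′ : Fin Q) → Fin ℓ → Set
  Prescribed i b c j b′ c′ a = x a i ≡ b × x a (next i) ≡ c × (j ≢ i → j ≢ next i → x a j ≡ b′) × (j ≢ i → next j ≢ i → x a (next j) ≡ c′)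

  -- For equal indices a vertex (i + 1 , d , 0) with d ≠ c, c′ works. For different indices a word
  -- through both vertices exists: its letters could conflict only where the indices are
  -- consecutive, and there non-adjacency says that they agree.
  common-ww : ∀ i b c j b′ c′ → adjᵛ (wv i b c) (wv j b′ c′) ≡ false → Common (wv i b c) (wv j b′ c′)
  common-ww i b c j b′ c′ h = by (i ≟ j)
    where
    module _ (i≢j : i ≢ j) {a : Fin ℓ} (pr : Prescribed i b c j b′ c′ a) where
      at-j : Dec (j ≡ next i) → Dec (c ≡ b′) → b′ ≡ x a j
      at-j (no ne) _ = ≡-sym (proj₁ (proj₂ (proj₂ pr)) (λ e → i≢j (≡-sym e)) ne)
      at-j (yes e) (yes e′) = trans (≡-sym e′) (trans (≡-sym (proj₁ (proj₂ pr))) (cong (x a) (≡-sym e)))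
      at-j (yes e) (no ne) = ⊥-elim (t≢f (ww-intro i b c j b′ c′ e ne) h)
      at-nj : Dec (i ≡ next j) → Dec (c′ ≡ b) → c′ ≡ x a (next j)
      at-nj (no ne) _ = ≡-sym (proj₂ (proj₂ (proj₂ pr)) (λ e → i≢j (≡-sym e)) (λ e → ne (≡-sym e)))
      at-nj (yes e) (yes e′) = trans e′ (trans (≡-sym (proj₁ pr)) (cong (x a) e))
      at-nj (yes e) (no ne) = ⊥-elim (t≢f (trans (symᵛ (wv i b c) (wv j b′ c′)) (ww-intro j b′ c′ i b c e ne)) h)
    by : Dec (i ≡ j) → Common (wv i b c) (wv j b′ c′)
    by (yes refl) = let (d , n₁ , n₂) = differ c c′ in wv (next i) d fzero , ww-intro i b c (next i) d fzero refl (λ e → n₁ (≡-sym e)) , ww-intro i b′ c′ (next i) d fzero refl (λ e → n₂ (≡-sym e))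
    by (no i≢j) = found (prescribe i b c j b′ c′)
      where
      found : ∃ (Prescribed i b c j b′ c′) → Common (wv i b c) (wv j b′ c′)
      found (a , pr) = lam a , lw-intro a i (≡-sym (proj₁ pr)) (≡-sym (proj₁ (proj₂ pr))) ,
        lw-intro a j (at-j i≢j pr (j ≟ next i) (c ≟ b′)) (at-nj i≢j pr (i ≟ next j) (c′ ≟ b))

  commonᵛ : ∀ u v → u ≢ v → adjᵛ u v ≡ false → Common u v
  commonᵛ (lam a) (lam b) ne h = apex , refl , refl
  commonᵛ (lam a) apex ne ()
  commonᵛ apex (lam a) ne ()
  commonᵛ apex apex ne h = ⊥-elim (ne refl)
  commonᵛ apex (wv i b c) ne h = common-apex i b c
  commonᵛ (wv i b c) apex ne h = swapᶜ {apex} {wv i b c} (common-apex i b c)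
  commonᵛ (lam a) (wv i b c) ne h = common-lam a i b c h
  commonᵛ (wv i b c) (lam a) ne h = swapᶜ {lam a} {wv i b c} (common-lam a i b c h)
  commonᵛ (wv i b c) (wv j b′ c′) ne h = common-ww i b c j b′ c′ h

  Distinguished : V → V → Set
  Distinguished u v = ∃ λ z → adjᵛ u z ≢ adjᵛ v z

  swapᵈ : ∀ {u v} → Distinguished u v → Distinguished v u
  swapᵈ (z , ne) = z , λ e → ne (≡-sym e)

  dist-by : ∀ {u v} z → Aᵛ u z → ¬ Aᵛ v z → Distinguished u v
  dist-by z a b = z , λ e → b (trans (≡-sym e) a)

  dist-lam : ∀ a b → a ≢ b → Distinguished (lam a) (lam b)
  dist-lam a b ne with all? (λ i → x a i ≟ x b i)
  ... | yes h = ⊥-elim (ne (x-inj a b h))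
  ... | no ¬h with any? (λ i → ¬? (x a i ≟ x b i))
  ...   | no none = ⊥-elim (¬h λ i → decidable-stable (x a i ≟ x b i) λ p → none (i , p))
  ...   | yes (i , d) = dist-by {lam a} {lam b} (wv i (x a i) (x a (next i))) (lw-intro a i refl refl) λ h → d (proj₁ (lw-elim b i (x a i) (x a (next i)) h))

  -- For different indices take a word through the first vertex whose letters at j and j + 1 avoid
  -- b′ and c′. If j = i + 1 the letter at j is already fixed, but the one at j + 1 is still free.
  dist-ww : ∀ i b c j b′ c′ → wv {ℓ} i b c ≢ wv j b′ c′ → Distinguished (wv i b c) (wv j b′ c′)
  dist-ww i b c j b′ c′ ne = by (i ≟ j)
    where
    by : Dec (i ≡ j) → Distinguished (wv i b c) (wv j b′ c′)
    by (yes refl) = found (prescribe i b c i b c)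
      where
      found : ∃ (Prescribed i b c i b c) → Distinguished (wv i b c) (wv i b′ c′)
      found (a , e₁ , e₂ , _) = dist-by {wv i b c} {wv i b′ c′} (lam a) (lw-intro a i (≡-sym e₁) (≡-sym e₂))
        λ h → let (p , p′) = lw-elim a i b′ c′ h in ne (cong₂ (wv i) (trans (≡-sym e₁) (≡-sym p)) (trans (≡-sym e₂) (≡-sym p′)))
    by (no i≢j) = found (differ b′ b′) (differ c′ c′)
      where
      j≢i : j ≢ i
      j≢i e = i≢j (≡-sym e)
      clash : ∀ {a b″ c″} → b″ ≢ b′ → c″ ≢ c′ → Prescribed i b c j b″ c″ a → Dec (j ≡ next i) → b′ ≡ x a j × c′ ≡ x a (next j) → ⊥
      clash nb nc (_ , _ , e₃ , e₄) (no n) (p , p′) = nb (trans (≡-sym (e₃ j≢i n)) (≡-sym p))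
      clash nb nc (_ , _ , e₃ , e₄) (yes e) (p , p′) = nc (trans (≡-sym (e₄ j≢i (λ e′ → next²≢ i (trans (cong next (≡-sym e)) e′)))) (≡-sym p′))
      found : (∃ λ b″ → b″ ≢ b′ × b″ ≢ b′) → (∃ λ c″ → c″ ≢ c′ × c″ ≢ c′) → Distinguished (wv i b c) (wv j b′ c′)
      found (b″ , nb , _) (c″ , nc , _) = found′ (prescribe i b c j b″ c″)
        where
        found′ : ∃ (Prescribed i b c j b″ c″) → Distinguished (wv i b c) (wv j b′ c′)
        found′ (a , pr) = dist-by {wv i b c} {wv j b′ c′} (lam a) (lw-intro a i (≡-sym (proj₁ pr)) (≡-sym (proj₁ (proj₂ pr))))
          λ h → clash nb nc pr (j ≟ next i) (lw-elim a j b′ c′ h)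

  distinguishedᵛ : ∀ u v → u ≢ v → Distinguished u v
  distinguishedᵛ (lam a) (lam b) ne = dist-lam a b (λ e → ne (cong lam e))
  distinguishedᵛ (lam a) apex ne = dist-by {lam a} {apex} apex refl λ ()
  distinguishedᵛ apex (lam a) ne = swapᵈ {lam a} {apex} (dist-by {lam a} {apex} apex refl λ ())
  distinguishedᵛ apex apex ne = ⊥-elim (ne refl)
  distinguishedᵛ (lam a) (wv i b c) ne = dist-by {lam a} {wv i b c} apex refl λ ()
  distinguishedᵛ (wv i b c) (lam a) ne = swapᵈ {lam a} {wv i b c} (dist-by {lam a} {wv i b c} apex refl λ ())
  distinguishedᵛ apex (wv i b c) ne = let (d , n , _) = differ c c in swapᵈ {wv i b c} {apex} (dist-by {wv i b c} {apex} (wv (next i) d fzero) (ww-intro i b c (next i) d fzero refl (λ e → n (≡-sym e))) λ ())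
  distinguishedᵛ (wv i b c) apex ne = let (d , n , _) = differ c c in dist-by {wv i b c} {apex} (wv (next i) d fzero) (ww-intro i b c (next i) d fzero refl (λ e → n (≡-sym e))) λ ()
  distinguishedᵛ (wv i b c) (wv j b′ c′) ne = dist-ww i b c j b′ c′ ne

-- The construction as a graph on `Fin n`.

sum-split : ∀ a b (f : Fin (a + b) → ℕ) → sumFin f ≡ sumFin (λ i → f (i ↑ˡ b)) + sumFin (λ i → f (a ↑ʳ i))
sum-split zero b f = refl
sum-split (suc a) b f = trans (cong (f fzero +_) (sum-split a b (f ∘ fsuc))) (≡-sym (+-assoc (f fzero) _ _))

sum-≤-const : ∀ {n} {f : Fin n → ℕ} c → (∀ i → f i ≤ c) → sumFin f ≤ n * c
sum-≤-const {n} c h = ≤-trans (sum-mono h) (≤-reflexive (sum-const {n} c))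

-- Having no twins at all, such a graph is admissible for every bound up to `t` on the minimum
-- degree; hence the graphs for t = r + 3 also serve (3) and (4).
record TwinFreeSaturated (r t n e : ℕ) : Set where
  field
    graph     : SimpleGraph n
    saturated : Saturated r graph
    min-deg   : ∀ v → t ≤ deg graph v
    twin-free : ∀ u v → u ≢ v → ¬ (∀ w → adj graph u w ≡ adj graph v w)
    few-edges : edges graph ≤ e

module GadgetGraph (k-1 Q-1 ℓ : ℕ) (4<k : 4 < suc k-1) (3≤Q : 3 ≤ suc Q-1)
  (x : Fin ℓ → Fin (suc k-1) → Fin (suc Q-1))
  (x-inj : ∀ a b → (∀ i → x a i ≡ x b i) → a ≡ b)
  (x-core : ∀ (f : Fin (suc k-1) → Fin (suc Q-1)) m → f m ≡ fzero → ∃ λ a → ∀ i → x a i ≡ f i)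
  (ℓ-large : suc (suc k-1) ≤ ℓ) (Q-large : suc (suc k-1) ≤ suc Q-1) where

  open Gadget k-1 Q-1 ℓ 4<k 3≤Q x x-inj x-core
  open Cyclic k-1 using (k; next)

  w n : ℕ
  w = suc (k * (Q * Q))
  n = ℓ + w

  enc : V → Fin n
  enc (lam a) = a ↑ˡ w
  enc apex = ℓ ↑ʳ fzero
  enc (wv i b c) = ℓ ↑ʳ fsuc (combine i (combine b c))

  unpair : Fin k × Fin (Q * Q) → V
  unpair (i , bc) = wv i (proj₁ (remQuot {Q} Q bc)) (proj₂ (remQuot {Q} Q bc))

  decʷ : Fin w → V
  decʷ fzero = apex
  decʷ (fsuc j) = unpair (remQuot {k} (Q * Q) j)

  dec : Fin n → V
  dec u = [ lam , decʷ ]′ (splitAt ℓ u)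

  dec-enc : ∀ v → dec (enc v) ≡ v
  dec-enc (lam a) = cong [ lam , decʷ ]′ (splitAt-↑ˡ ℓ a w)
  dec-enc apex = cong [ lam , decʷ ]′ (splitAt-↑ʳ ℓ w fzero)
  dec-enc (wv i b c) = trans (cong [ lam , decʷ ]′ (splitAt-↑ʳ ℓ w (fsuc (combine i (combine b c)))))
    (trans (cong unpair (remQuot-combine {k} {Q * Q} i (combine b c))) (cong (λ y → wv i (proj₁ y) (proj₂ y)) (remQuot-combine {Q} {Q} b c)))

  enc-decʷ : ∀ j → enc (decʷ j) ≡ ℓ ↑ʳ j
  enc-decʷ fzero = refl
  enc-decʷ (fsuc j) = cong (λ z → ℓ ↑ʳ fsuc z) (trans (cong (combine (proj₁ (remQuot {k} (Q * Q) j))) (combine-remQuot {Q} Q (proj₂ (remQuot {k} (Q * Q) j)))) (combine-remQuot {k} (Q * Q) j))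

  enc-dec : ∀ u → enc (dec u) ≡ u
  enc-dec u with splitAt ℓ u in eq
  ... | inj₁ a = splitAt⁻¹-↑ˡ eq
  ... | inj₂ j = trans (enc-decʷ j) (splitAt⁻¹-↑ʳ eq)

  dec-injective : ∀ {u v} → dec u ≡ dec v → u ≡ v
  dec-injective {u} {v} e = trans (≡-sym (enc-dec u)) (trans (cong enc e) (enc-dec v))

  enc-injective : ∀ {u v} → enc u ≡ enc v → u ≡ v
  enc-injective {u} {v} e = trans (≡-sym (dec-enc u)) (trans (cong dec e) (dec-enc v))

  G : SimpleGraph n
  G = record { adj = λ u v → adjᵛ (dec u) (dec v) ; sym = λ u v → symᵛ (dec u) (dec v) ; irrefl = λ v → irreflᵛ (dec v) }

  adj-enc : ∀ u z → adj G u (enc z) ≡ adjᵛ (dec u) z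
  adj-enc u z = cong (adjᵛ (dec u)) (dec-enc z)

  no-K₃ : ¬ HasClique 3 (adj G)
  no-K₃ (f , h) = triangle-freeᵛ (dec (f fzero)) (dec (f (fsuc fzero))) (dec (f (fsuc (fsuc fzero)))) (h _ _ λ ()) (h _ _ λ ()) (h _ _ λ ())

  add-K₃ : ∀ u v → u ≢ v → adj G u v ≡ false → HasClique 3 (addEdge (adj G) u v)
  add-K₃ u v ne h = go (commonᵛ (dec u) (dec v) (λ e → ne (dec-injective e)) h)
    where
    go : Common (dec u) (dec v) → HasClique 3 (addEdge (adj G) u v)
    go (z , uz , vz) = f , clique
      where
      uz′ : adj G u (enc z) ≡ true
      uz′ = trans (adj-enc u z) uz
      vz′ : adj G v (enc z) ≡ true
      vz′ = trans (adj-enc v z) vz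
      f : Fin 3 → Fin n
      f fzero = u
      f (fsuc fzero) = v
      f (fsuc (fsuc fzero)) = enc z
      clique : ∀ i j → i ≢ j → addEdge (adj G) u v (f i) (f j) ≡ true
      clique fzero fzero ne = ⊥-elim (ne refl)
      clique fzero (fsuc fzero) _ = ∨-introʳ {adj G u v} (∨-introˡ (∧-intro (⌊⌋-intro (u ≟ u) refl) (⌊⌋-intro (v ≟ v) refl)))
      clique fzero (fsuc (fsuc fzero)) _ = ∨-introˡ uz′
      clique (fsuc fzero) fzero _ = ∨-introʳ {adj G v u} (∨-introʳ {⌊ v ≟ u ⌋ ∧ ⌊ u ≟ v ⌋} (∧-intro (⌊⌋-intro (v ≟ v) refl) (⌊⌋-intro (u ≟ u) refl)))
      clique (fsuc fzero) (fsuc fzero) ne = ⊥-elim (ne refl)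
      clique (fsuc fzero) (fsuc (fsuc fzero)) _ = ∨-introˡ vz′
      clique (fsuc (fsuc fzero)) fzero _ = ∨-introˡ (adj-sym G {u} {enc z} uz′)
      clique (fsuc (fsuc fzero)) (fsuc fzero) _ = ∨-introˡ (adj-sym G {v} {enc z} vz′)
      clique (fsuc (fsuc fzero)) (fsuc (fsuc fzero)) ne = ⊥-elim (ne refl)

  t : ℕ
  t = suc k

  nbrs : Fin ℓ → Fin t → V
  nbrs a fzero = apex
  nbrs a (fsuc i) = wv i (x a i) (x a (next i))

  degᵛ : ∀ v u → dec u ≡ v → t ≤ deg G u
  degᵛ (lam a) u e = ≤-count (adj G u) (enc ∘ nbrs a) inj on
    where
    inj : ∀ i j → enc (nbrs a i) ≡ enc (nbrs a j) → i ≡ j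
    inj i j h = inj′ i j (enc-injective h)
      where
      inj′ : ∀ i j → nbrs a i ≡ nbrs a j → i ≡ j
      inj′ fzero fzero _ = refl
      inj′ fzero (fsuc j) ()
      inj′ (fsuc i) fzero ()
      inj′ (fsuc i) (fsuc j) h = cong fsuc (wv-inj h)
        where
        wv-inj : ∀ {i j : Fin k} {b c b′ c′ : Fin Q} → wv {ℓ} i b c ≡ wv j b′ c′ → i ≡ j
        wv-inj refl = refl
    on : ∀ i → adj G u (enc (nbrs a i)) ≡ true
    on i = trans (adj-enc u (nbrs a i)) (trans (cong (λ v → adjᵛ v (nbrs a i)) e) (on′ i))
      where
      on′ : ∀ i → adjᵛ (lam a) (nbrs a i) ≡ true
      on′ fzero = refl
      on′ (fsuc i) = lw-intro a i refl refl
  degᵛ apex u e = ≤-trans ℓ-large (≤-count (adj G u) (enc ∘ lam) (λ i j h → lam-inj (enc-injective h))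
      λ i → trans (adj-enc u (lam i)) (cong (λ v → adjᵛ v (lam i)) e))
    where
    lam-inj : ∀ {i j : Fin ℓ} → lam {ℓ} {k} {Q} i ≡ lam j → i ≡ j
    lam-inj refl = refl
  degᵛ (wv i b c) u e = ≤-trans Q-large (go (differ c c))
    where
    wv-inj : ∀ {i j : Fin k} {b c b′ c′ : Fin Q} → wv {ℓ} i b c ≡ wv j b′ c′ → c ≡ c′
    wv-inj refl = refl
    go : (∃ λ d → d ≢ c × d ≢ c) → Q ≤ deg G u
    go (d , ne , _) = ≤-count (adj G u) (λ y → enc (wv (next i) d y)) (λ y y′ h → wv-inj (enc-injective {wv (next i) d y} {wv (next i) d y′} h))
      λ y → trans (adj-enc u (wv (next i) d y)) (trans (cong (λ v → adjᵛ v (wv (next i) d y)) e) (ww-intro i b c (next i) d y refl (λ e′ → ne (≡-sym e′))))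

  lam-deg : ∀ a → deg G (a ↑ˡ w) ≤ t
  lam-deg a = count-≤ (enc ∘ nbrs a) λ v h → let (j , e) = on (dec v) (trans (≡-sym (cong (λ z → adjᵛ z (dec v)) (dec-enc (lam a)))) h) in j , trans (cong enc e) (enc-dec v)
    where
    on : ∀ v → adjᵛ (lam a) v ≡ true → ∃ λ j → nbrs a j ≡ v
    on apex _ = fzero , refl
    on (wv i b c) h with lw-elim a i b c h
    ... | refl , refl = fsuc i , refl

  -- Words are numbered first, so edges are counted from the word if they have one; an edge counted
  -- from another vertex has both ends among the `w` vertices that are not words.
  edges-≤ : edges G ≤ ℓ * t + w * w
  edges-≤ = ≤-trans (≤-reflexive (sum-split ℓ w (λ i → count (later i)))) (+-mono-≤
      (sum-≤-const t λ a → ≤-trans (count-mono {F = later (a ↑ˡ w)} {adj G (a ↑ˡ w)} λ v h → ∧-fst h) (lam-deg a))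
      (sum-≤-const w λ j → count-≤ {F = later (ℓ ↑ʳ j)} (ℓ ↑ʳ_) λ v h → above j v (∧-snd {adj G (ℓ ↑ʳ j) v} h)))
    where
    later : Fin n → Pred n
    later i j = adj G i j ∧ (toℕ i <ᵇ toℕ j)
    above : ∀ j v → (toℕ (ℓ ↑ʳ j) <ᵇ toℕ v) ≡ true → ∃ λ j′ → ℓ ↑ʳ j′ ≡ v
    above j v h with splitAt ℓ v in eq
    ... | inj₂ j′ = j′ , splitAt⁻¹-↑ʳ eq
    ... | inj₁ a = ⊥-elim (t≢f h (<ᵇ-false (≤-trans (<⇒≤ (≤-trans (≤-reflexive (cong suc (trans (cong toℕ (≡-sym (splitAt⁻¹-↑ˡ eq))) (toℕ-↑ˡ a w)))) (toℕ<n a)))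
                     (≤-trans (m≤m+n ℓ (toℕ j)) (≤-reflexive (≡-sym (toℕ-↑ʳ ℓ j)))))))

  result : TwinFreeSaturated 3 t n (t * n + w * w)
  result = record
    { graph = G ; saturated = no-K₃ , add-K₃ ; min-deg = λ v → degᵛ (dec v) v refl
    ; twin-free = λ u v ne h → let (z , d) = distinguishedᵛ (dec u) (dec v) (λ e → ne (dec-injective e)) in d (trans (≡-sym (adj-enc u z)) (trans (h (enc z)) (adj-enc v z)))
    ; few-edges = ≤-trans edges-≤ (+-monoˡ-≤ (w * w) (≤-trans (*-monoˡ-≤ t (m≤m+n ℓ w)) (≤-reflexive (*-comm n t)))) }

-- Joining a vertex to everything

module _ {n : ℕ} (G : SimpleGraph n) where

  cone : SimpleGraph (suc n)
  cone = record { adj = a ; sym = s ; irrefl = λ { fzero → refl ; (fsuc v) → irrefl G v } }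
    where
    a : Fin (suc n) → Fin (suc n) → Bool
    a fzero fzero = false
    a fzero (fsuc v) = true
    a (fsuc u) fzero = true
    a (fsuc u) (fsuc v) = adj G u v
    s : ∀ u v → a u v ≡ a v u
    s fzero fzero = refl
    s fzero (fsuc v) = refl
    s (fsuc u) fzero = refl
    s (fsuc u) (fsuc v) = sym G u v

  cone-free : ∀ {r} → ¬ HasClique r (adj G) → ¬ HasClique (suc r) (adj cone)
  cone-free {r} free (f , h) = go (any? (λ i → f i ≟ fzero))
    where
    down : ∀ i → (∀ j → j ≢ i → f j ≢ fzero) → ⊥
    down i ne = free (g , λ j l j≢l → edge (punchIn i j) (punchIn i l) (ne _ (punchInᵢ≢i i j)) (ne _ (punchInᵢ≢i i l)) (h _ _ λ e → j≢l (punchIn-injective i j l e)))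
      where
      pred : ∀ (v : Fin (suc n)) → v ≢ fzero → Fin n
      pred fzero ne = ⊥-elim (ne refl)
      pred (fsuc v) _ = v
      g : Fin r → Fin n
      g j = pred (f (punchIn i j)) (ne _ (punchInᵢ≢i i j))
      edge : ∀ j l (nj : f j ≢ fzero) (nl : f l ≢ fzero) → adj cone (f j) (f l) ≡ true → adj G (pred (f j) nj) (pred (f l) nl) ≡ true
      edge j l nj nl e = on (f j) (f l) nj nl e
        where
        on : ∀ u v (nu : u ≢ fzero) (nv : v ≢ fzero) → adj cone u v ≡ true → adj G (pred u nu) (pred v nv) ≡ true
        on fzero v nu nv e = ⊥-elim (nu refl)
        on (fsuc u) fzero nu nv e = ⊥-elim (nv refl)
        on (fsuc u) (fsuc v) nu nv e = e
    go : Dec (∃ λ i → f i ≡ fzero) → ⊥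
    go (no none) = down fzero λ j _ e → none (j , e)
    go (yes (i , e)) = down i λ j j≢i e′ → t≢f (h j i j≢i) (trans (cong₂ (adj cone) e′ e) refl)

  cone-sat : ∀ {r} → Saturated r G → Saturated (suc r) cone
  cone-sat {r} (free , sat) = cone-free free , add
    where
    add : ∀ u v → u ≢ v → adj cone u v ≡ false → HasClique (suc r) (addEdge (adj cone) u v)
    add fzero fzero ne _ = ⊥-elim (ne refl)
    add fzero (fsuc v) ne ()
    add (fsuc u) fzero ne ()
    add (fsuc u) (fsuc v) ne h = go (sat u v (λ e → ne (cong fsuc e)) h)
      where
      ≟-suc : ∀ (y z : Fin n) → ⌊ fsuc y ≟ fsuc z ⌋ ≡ ⌊ y ≟ z ⌋
      ≟-suc y z with y ≟ z
      ... | yes _ = refl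
      ... | no _ = refl
      lift : ∀ y z → addEdge (adj G) u v y z ≡ addEdge (adj cone) (fsuc u) (fsuc v) (fsuc y) (fsuc z)
      lift y z rewrite ≟-suc y u | ≟-suc z v | ≟-suc y v | ≟-suc z u = refl
      go : HasClique r (addEdge (adj G) u v) → HasClique (suc r) (addEdge (adj cone) (fsuc u) (fsuc v))
      go (f , hf) = f′ , clique
        where
        f′ : Fin (suc r) → Fin (suc n)
        f′ fzero = fzero
        f′ (fsuc i) = fsuc (f i)
        clique : ∀ i j → i ≢ j → addEdge (adj cone) (fsuc u) (fsuc v) (f′ i) (f′ j) ≡ true
        clique fzero fzero ne = ⊥-elim (ne refl)
        clique fzero (fsuc j) ne = refl
        clique (fsuc i) fzero ne = refl
        clique (fsuc i) (fsuc j) ne = trans (≡-sym (lift (f i) (f j))) (hf i j (λ e → ne (cong fsuc e)))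

  cone-edges : edges cone ≡ n + edges G
  cone-edges = cong (_+ edges G) (count-all {n} λ _ → refl)

-- The cone adds n edges while the main term grows by n + t + 1, so the excess `E` is kept.
cone-step : ∀ {r t n E} → t < n → TwinFreeSaturated r t n (t * n + E) → TwinFreeSaturated (suc r) (suc t) (suc n) (suc t * suc n + E)
cone-step {r} {t} {n} {E} t<n T = record
  { graph = cone graph ; saturated = cone-sat graph saturated ; min-deg = md ; twin-free = tf
  ; few-edges = ≤-trans (≤-reflexive (cone-edges graph)) (≤-trans (+-monoʳ-≤ n few-edges) (≤-trans (m≤m+n _ (1 + t)) (≤-reflexive (e t n E)))) }
  where
  open TwinFreeSaturated T
  e : ∀ t n E → n + (t * n + E) + (1 + t) ≡ (1 + t) * (1 + n) + E
  e = solve-∀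
  md : ∀ v → suc t ≤ deg (cone graph) v
  md fzero = ≤-trans t<n (≤-reflexive (≡-sym (count-all {n} λ _ → refl)))
  md (fsuc v) = s≤s (min-deg v)
  tf : ∀ u v → u ≢ v → ¬ (∀ w → adj (cone graph) u w ≡ adj (cone graph) v w)
  tf fzero fzero ne _ = ne refl
  tf fzero (fsuc v) ne h = case h fzero of λ ()
  tf (fsuc u) fzero ne h = case h fzero of λ ()
  tf (fsuc u) (fsuc v) ne h = twin-free u v (λ e → ne (cong fsuc e)) λ w → h (fsuc w)

-- The choice of words and alphabet for each n.

extend : ∀ {M} d (F : Pred M) ℓ → d + count F ≡ ℓ → ℓ ≤ M → ∃ λ H → F ⊆ᵖ H × count H ≡ ℓ
extend zero F ℓ e le = F , (λ _ h → h) , e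
extend {M} (suc d) F ℓ e le = go (find (not ∘ F))
  where
  go : (∃ λ v → v ∈ᵖ (not ∘ F)) ⊎ (∀ v → not (F v) ≡ false) → ∃ λ H → F ⊆ᵖ H × count H ≡ ℓ
  go (inj₂ all) = ⊥-elim (<-irrefl refl (≤-trans (≤-trans (s≤s (m≤n+m (count F) d)) (≤-reflexive e)) (≤-trans le (≤-reflexive (≡-sym (count-all full))))))
    where
    full : ∀ v → F v ≡ true
    full v with F v | all v
    ... | true | _ = refl
  go (inj₁ (v , hv)) = let (H , s , c) = extend d F⁺ ℓ (trans (cong (d +_) cF) (trans (+-suc d (count F)) e)) le
                       in H , (λ u h → s u (∨-introʳ {⌊ u ≟ v ⌋} h)) , c
    where
    F⁺ : Pred M
    F⁺ u = ⌊ u ≟ v ⌋ ∨ F u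
    cF : count F⁺ ≡ suc (count F)
    cF = trans (count-except F⁺ {v} (∨-introˡ (⌊⌋-intro (v ≟ v) refl))) (cong suc (count-cong pt))
      where
      pt : ∀ u → (⌊ u ≟ v ⌋ ∨ F u) ∧ not ⌊ u ≟ v ⌋ ≡ F u
      pt u with u ≟ v
      ... | yes refl = ≡-sym (not-elim hv)
      ... | no _ = trans (∧-comm (F u) true) refl

enumerate : ∀ {M} (H : Pred M) → ∃ λ (g : Fin (count H) → Fin M) →
  (∀ i j → g i ≡ g j → i ≡ j) × (∀ v → v ∈ᵖ H → ∃ λ i → g i ≡ v)
enumerate {zero} H = (λ ()) , (λ ()) , λ ()
enumerate {suc M} H with Bool-dichotomy (H fzero) | enumerate (H ∘ fsuc)
... | inj₂ e | g , inj , sur rewrite e = (fsuc ∘ g) , (λ i j h → inj i j (fsuc-injective h)) ,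
      λ { fzero h → ⊥-elim (t≢f h e) ; (fsuc v) h → let (i , p) = sur v h in i , cong fsuc p }
... | inj₁ e | g , inj , sur rewrite e = g′ , inj′ , λ { fzero h → fzero , refl ; (fsuc v) h → let (i , p) = sur v h in fsuc i , cong fsuc p }
  where
  g′ : Fin (suc (count (H ∘ fsuc))) → Fin (suc M)
  g′ fzero = fzero
  g′ (fsuc i) = fsuc (g i)
  inj′ : ∀ i j → g′ i ≡ g′ j → i ≡ j
  inj′ fzero fzero _ = refl
  inj′ fzero (fsuc j) ()
  inj′ (fsuc i) fzero ()
  inj′ (fsuc i) (fsuc j) h = cong fsuc (inj i j (fsuc-injective h))

funToFin-cong : ∀ {m n} (f g : Fin m → Fin n) → (∀ i → f i ≡ g i) → funToFin f ≡ funToFin g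
funToFin-cong {zero} f g h = refl
funToFin-cong {suc m} f g h = cong₂ combine (h fzero) (funToFin-cong (f ∘ fsuc) (g ∘ fsuc) (h ∘ fsuc))

finToFun-injective : ∀ {m n} (a b : Fin (m ^ n)) → (∀ i → finToFun {m} {n} a i ≡ finToFun {m} {n} b i) → a ≡ b
finToFun-injective {m} {n} a b h = trans (≡-sym (funToFin-finToFin {n} {m} a)) (trans (funToFin-cong _ _ h) (funToFin-finToFin {n} {m} b))

-- At least q ^ k words avoid the letter 0. So the words with a 0 number at most ℓ, and they can be
-- filled up to exactly ℓ words.
words : ∀ k q ℓ → suc q ^ k ≤ ℓ + q ^ k → ℓ ≤ suc q ^ k → ∃ λ (x : Fin ℓ → Fin k → Fin (suc q)) →
  (∀ a b → (∀ i → x a i ≡ x b i) → a ≡ b) × (∀ (f : Fin k → Fin (suc q)) m → f m ≡ fzero → ∃ λ a → ∀ i → x a i ≡ f i)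
words k q ℓ lo hi = go (extend (ℓ ∸ count marked) marked ℓ (m∸n+n≡m marked≤) hi)
  where
  M = suc q ^ k
  word : Fin M → Fin k → Fin (suc q)
  word = finToFun {suc q} {k}
  marked : Pred M
  marked y = ⌊ any? (λ m → word y m ≟ fzero) ⌋
  nonzero : Fin (q ^ k) → Fin M
  nonzero i = funToFin (fsuc ∘ finToFun {q} {k} i)
  nz : q ^ k ≤ count (not ∘ marked)
  nz = ≤-count (not ∘ marked) nonzero
    (λ i j h → finToFun-injective {q} {k} i j λ m → fsuc-injective (trans (≡-sym (finToFun-funToFin (fsuc ∘ finToFun {q} {k} i) m))
       (trans (cong (λ y → word y m) h) (finToFun-funToFin (fsuc ∘ finToFun {q} {k} j) m))))
    λ i → not-intro (⌊⌋-false (any? (λ m → word (nonzero i) m ≟ fzero)) λ { (m , e) → case trans (≡-sym (finToFun-funToFin (fsuc ∘ finToFun {q} {k} i) m)) e of λ () })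
  marked≤ : count marked ≤ ℓ
  marked≤ = +-cancelʳ-≤ (q ^ k) (count marked) ℓ (≤-trans (+-monoʳ-≤ (count marked) nz)
    (≤-trans (≤-reflexive (trans (≡-sym (count-split (λ _ → true) marked)) (count-all {M} λ _ → refl))) lo))
  go : (∃ λ H → marked ⊆ᵖ H × count H ≡ ℓ) → _
  go (H , s , refl) = pack (enumerate H)
    where
    pack : (∃ λ (g : Fin (count H) → Fin M) → (∀ i j → g i ≡ g j → i ≡ j) × (∀ v → v ∈ᵖ H → ∃ λ i → g i ≡ v)) → _
    pack (g , inj , sur) = (λ a → word (g a)) , (λ a b h → inj a b (finToFun-injective {suc q} {k} (g a) (g b) h)) , λ f m e →
      let (a , p) = sur (funToFin f) (s _ (⌊⌋-intro (any? (λ m → word (funToFin f) m ≟ fzero)) (m , trans (finToFun-funToFin f m) e)))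
      in a , λ i → trans (cong (λ y → word y i) p) (finToFun-funToFin f i)

suc-^-≤ : ∀ k q → 1 ≤ q → suc q ^ suc k ≤ q ^ suc k + 3 ^ suc k * q ^ k
suc-^-≤ zero q 1≤q = ≤-trans (m≤m+n _ 2) (≤-reflexive (e q))
  where
  e : ∀ q → (1 + q) * 1 + 2 ≡ q * 1 + 3 * 1 * 1
  e = solve-∀
suc-^-≤ (suc k) q 1≤q = begin
  suc q * suc q ^ suc k ≤⟨ *-monoʳ-≤ (suc q) (suc-^-≤ k q 1≤q) ⟩
  suc q * (q * q ^ k + T * q ^ k) ≡⟨ e₁ q (q ^ k) T ⟩
  q * (q * q ^ k) + (1 * (q * q ^ k) + T * (q * q ^ k) + T * (1 * q ^ k)) ≤⟨ +-monoʳ-≤ (q * (q * q ^ k))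
     (+-mono-≤ (+-monoˡ-≤ (T * (q * q ^ k)) (*-monoˡ-≤ (q * q ^ k) (m^n>0 3 (suc k)))) (*-monoʳ-≤ T (*-monoˡ-≤ (q ^ k) 1≤q))) ⟩
  q * (q * q ^ k) + (T * (q * q ^ k) + T * (q * q ^ k) + T * (q * q ^ k)) ≡⟨ e₂ q (q ^ k) T ⟩
  q ^ suc (suc k) + 3 ^ suc (suc k) * q ^ suc k ∎
  where
  open ≤-Reasoning
  T = 3 ^ suc k
  e₁ : ∀ q p t → (1 + q) * (q * p + t * p) ≡ q * (q * p) + (1 * (q * p) + t * (q * p) + t * (1 * p))
  e₁ = solve-∀
  e₂ : ∀ q p t → q * (q * p) + (t * (q * p) + t * (q * p) + t * (q * p)) ≡ q * (q * p) + 3 * t * (q * p)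
  e₂ = solve-∀

module Alphabet (κ : ℕ) (4≤κ : 4 ≤ κ) where
  k : ℕ
  k = suc κ

  w f : ℕ → ℕ
  w Q = suc (k * (Q * Q))
  f Q = Q ^ k + w Q

  f-mono : ∀ p q → p ≤ q → f p ≤ f q
  f-mono p q le = +-mono-≤ (^-monoˡ-≤ k {p} {q} le) (s≤s (*-monoʳ-≤ k (*-mono-≤ le le)))

  q₀ : ℕ
  q₀ = 3 ^ k + 4 * k + 1

  -- For Q = suc q and f q < n ≤ f Q this gives w Q ≤ n and Q ^ k + w Q ≤ n + q ^ k, so ℓ = n - w Q
  -- is in the range of `words` and no large n is skipped. `q₀` is large enough for all terms of
  -- order q ^ κ to fit into one q ^ k.
  doubling : ∀ q → q₀ ≤ q → f (suc q) ≤ q ^ k + q ^ k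
  doubling q h = begin
    suc q ^ k + w (suc q) ≤⟨ +-mono-≤ (suc-^-≤ κ q 1≤q) w≤ ⟩
    q ^ k + 3 ^ k * q ^ κ + (4 * k + 1) * q ^ κ ≡⟨ e (q ^ k) (3 ^ k) (4 * k) (q ^ κ) ⟩
    q ^ k + q₀ * q ^ κ ≤⟨ +-monoʳ-≤ (q ^ k) (*-monoˡ-≤ (q ^ κ) h) ⟩
    q ^ k + q ^ k ∎
    where
    open ≤-Reasoning
    1≤q : 1 ≤ q
    1≤q = ≤-trans (m≤n+m 1 (3 ^ k + 4 * k)) h
    e : ∀ a b c p → a + b * p + (c + 1) * p ≡ a + (b + c + 1) * p
    e = solve-∀
    q²≤ : q * q ≤ q ^ κ
    q²≤ = ≤-trans (≤-reflexive (cong (q *_) (≡-sym (*-identityʳ q)))) (^-monoʳ-≤ q ⦃ >-nonZero 1≤q ⦄ {2} {κ} (≤-trans (s≤s (s≤s z≤n)) 4≤κ))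
    w≤ : w (suc q) ≤ (4 * k + 1) * q ^ κ
    w≤ = begin
      1 + k * (suc q * suc q) ≤⟨ +-mono-≤ (*-mono-≤ 1≤q 1≤q) (*-monoʳ-≤ k (*-mono-≤ s s)) ⟩
      q * q + k * ((q + q) * (q + q)) ≡⟨ e₂ q k ⟩
      (4 * k + 1) * (q * q) ≤⟨ *-monoʳ-≤ (4 * k + 1) q²≤ ⟩
      (4 * k + 1) * q ^ κ ∎
      where
      s : suc q ≤ q + q
      s = +-monoˡ-≤ q 1≤q
      e₂ : ∀ q k → q * q + k * ((q + q) * (q + q)) ≡ (4 * k + 1) * (q * q)
      e₂ = solve-∀

  least : ∀ n N → n ≤ f N → ∃ λ Q → n ≤ f Q × (Q ≡ 0 ⊎ ∃ λ q → Q ≡ suc q × f q < n)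
  least n zero h = 0 , h , inj₁ refl
  least n (suc N) h with n ≤? f N
  ... | yes h′ = least n N h′
  ... | no ¬h′ = suc N , h , inj₂ (N , refl , ≰⇒> ¬h′)

  alphabet : ∀ n → suc (f q₀) ≤ n → ∃ λ q → q₀ ≤ q × f q < n × n ≤ f (suc q)
  alphabet n big with least n n (≤-trans (m≤m^suc n κ) (m≤m+n _ (w n)))
  ... | _ , h , inj₁ refl = ⊥-elim (<-irrefl refl (≤-trans (≤-trans big h) (f-mono 0 q₀ z≤n)))
  ... | _ , h , inj₂ (q , refl , lt) = q , ≮⇒≥ (λ q< → <-irrefl refl (≤-trans (≤-trans big h) (f-mono (suc q) q₀ q<))) , lt , h

  -- From w Q ≤ (k + 1) Q² and Q ^ k ≤ 2 n; the factor 16 is 2 ^ 4.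
  C : ℕ
  C = suc k * suc k * 16

  base : ∀ n → suc (f q₀) ≤ n → ∃ λ E → TwinFreeSaturated 3 (suc k) n (suc k * n + E) × E ^ k ≤ C ^ k * n ^ 4
  base n big = go (alphabet n big)
    where
    go : (∃ λ q → q₀ ≤ q × f q < n × n ≤ f (suc q)) → ∃ λ E → TwinFreeSaturated 3 (suc k) n (suc k * n + E) × E ^ k ≤ C ^ k * n ^ 4
    go (q , q₀≤ , fq<n , n≤f) = w Q * w Q , subst (λ m → TwinFreeSaturated 3 (suc k) m (suc k * m + w Q * w Q)) ℓ+w graph , cost
      where
      open ≤-Reasoning
      Q = suc q
      dbl = doubling q q₀≤
      q^k≤n : q ^ k ≤ n
      q^k≤n = ≤-trans (m≤m+n _ (w q)) (<⇒≤ fq<n)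
      wQ≤n : w Q ≤ n
      wQ≤n = ≤-trans (+-cancelˡ-≤ (q ^ k) (w Q) (q ^ k) (≤-trans (+-monoˡ-≤ (w Q) (^-monoˡ-≤ k (n≤1+n q))) dbl)) q^k≤n
      ℓ = n ∸ w Q
      ℓ+w : ℓ + w Q ≡ n
      ℓ+w = m∸n+n≡m wQ≤n
      hi : ℓ ≤ Q ^ k
      hi = +-cancelʳ-≤ (w Q) ℓ (Q ^ k) (≤-trans (≤-reflexive ℓ+w) n≤f)
      lo : Q ^ k ≤ ℓ + q ^ k
      lo = +-cancelʳ-≤ (w Q) (Q ^ k) (ℓ + q ^ k) (begin
        Q ^ k + w Q ≤⟨ dbl ⟩
        q ^ k + q ^ k ≤⟨ +-monoˡ-≤ (q ^ k) q^k≤n ⟩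
        n + q ^ k ≡⟨ cong (_+ q ^ k) (≡-sym ℓ+w) ⟩
        ℓ + w Q + q ^ k ≡⟨ e ℓ (w Q) (q ^ k) ⟩
        ℓ + q ^ k + w Q ∎)
        where
        e : ∀ a b c → a + b + c ≡ a + c + b
        e = solve-∀
      k<q : suc k ≤ q
      k<q = ≤-trans (≤-trans (≤-reflexive (+-comm 1 k)) (+-monoˡ-≤ 1 (≤-trans (m≤m+n k (3 * k)) (m≤n+m (4 * k) (3 ^ k))))) q₀≤
      q≤q^κ : q ≤ q ^ κ
      q≤q^κ = ≤-trans (≤-reflexive (≡-sym (*-identityʳ q))) (^-monoʳ-≤ q ⦃ >-nonZero (≤-trans (s≤s z≤n) k<q) ⦄ {1} {κ} (≤-trans (s≤s z≤n) 4≤κ))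
      ℓ-large : suc k ≤ ℓ
      ℓ-large = ≤-trans k<q (≤-trans q≤q^κ (+-cancelʳ-≤ (q ^ k) (q ^ κ) ℓ (≤-trans (*-monoʳ-≤ Q (^-monoˡ-≤ κ (n≤1+n q))) lo)))
      graph : TwinFreeSaturated 3 (suc k) (ℓ + w Q) (suc k * (ℓ + w Q) + w Q * w Q)
      graph = let (x , inj , cr) = words k q ℓ lo hi in
        GadgetGraph.result κ q ℓ (s≤s 4≤κ) (s≤s (≤-trans (s≤s (s≤s z≤n)) k<q)) x inj cr ℓ-large (≤-trans k<q (n≤1+n q))
      w≤ : w Q ≤ suc k * (Q * Q)
      w≤ = +-monoˡ-≤ (k * (Q * Q)) (s≤s z≤n)
      Q^k≤ : Q ^ k ≤ 2 * n
      Q^k≤ = ≤-trans (m≤m+n _ (w Q)) (≤-trans dbl (≤-trans (+-mono-≤ q^k≤n q^k≤n) (≤-reflexive (cong (n +_) (≡-sym (+-identityʳ n))))))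
      cost : (w Q * w Q) ^ k ≤ C ^ k * n ^ 4
      cost = begin
        (w Q * w Q) ^ k ≤⟨ ^-monoˡ-≤ k (*-mono-≤ w≤ w≤) ⟩
        (suc k * (Q * Q) * (suc k * (Q * Q))) ^ k ≡⟨ cong (_^ k) (e (suc k) Q) ⟩
        (suc k * suc k * Q ^ 4) ^ k ≡⟨ trans (^-distribʳ-* k (suc k * suc k) (Q ^ 4)) (cong ((suc k * suc k) ^ k *_) swap^) ⟩
        (suc k * suc k) ^ k * (Q ^ k) ^ 4 ≤⟨ *-monoʳ-≤ ((suc k * suc k) ^ k) (≤-trans (^-monoˡ-≤ 4 Q^k≤) (≤-reflexive (^-distribʳ-* 4 2 n))) ⟩
        (suc k * suc k) ^ k * (16 * n ^ 4) ≤⟨ *-monoʳ-≤ ((suc k * suc k) ^ k) (*-monoˡ-≤ (n ^ 4) (m≤m^suc 16 κ)) ⟩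
        (suc k * suc k) ^ k * (16 ^ k * n ^ 4) ≡⟨ trans (≡-sym (*-assoc ((suc k * suc k) ^ k) (16 ^ k) (n ^ 4))) (cong (_* n ^ 4) (≡-sym (^-distribʳ-* k (suc k * suc k) 16))) ⟩
        C ^ k * n ^ 4 ∎
        where
        e : ∀ a Q → a * (Q * Q) * (a * (Q * Q)) ≡ a * a * (Q * (Q * (Q * (Q * 1))))
        e = solve-∀
        swap^ : (Q ^ 4) ^ k ≡ (Q ^ k) ^ 4
        swap^ = trans (^-*-assoc Q 4 k) (trans (cong (Q ^_) (*-comm 4 k)) (≡-sym (^-*-assoc Q k 4)))

cone-iter : ∀ i {r t n E} → t < n → TwinFreeSaturated r t n (t * n + E) → TwinFreeSaturated (i + r) (i + t) (i + n) ((i + t) * (i + n) + E)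
cone-iter zero lt T = T
cone-iter (suc i) {r} {t} {n} lt T = cone-step (≤-trans (≤-reflexive (≡-sym (+-suc i t))) (+-monoʳ-≤ i lt)) (cone-iter i lt T)

upper : ∀ κ → 4 ≤ κ → ∀ i → ∃ λ C → ∃ λ N → ∀ n → N ≤ n → ∃ λ E → TwinFreeSaturated (3 + i) (2 + κ + i) n ((2 + κ + i) * n + E) × E ^ suc κ ≤ C ^ suc κ * n ^ 4
upper κ 4≤κ i = C , i + N , bound
  where
  open Alphabet κ 4≤κ
  N = suc (f q₀) + suc (suc k)
  bound : ∀ n → i + N ≤ n → ∃ λ E → TwinFreeSaturated (3 + i) (2 + κ + i) n ((2 + κ + i) * n + E) × E ^ suc κ ≤ C ^ suc κ * n ^ 4
  bound n le = go (base n′ (≤-trans (m≤m+n (suc (f q₀)) _) N≤))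
    where
    n′ = n ∸ i
    i+n′ : i + n′ ≡ n
    i+n′ = m+[n∸m]≡n (≤-trans (m≤m+n i N) le)
    N≤ : N ≤ n′
    N≤ = +-cancelˡ-≤ i N n′ (≤-trans le (≤-reflexive (≡-sym i+n′)))
    go : (∃ λ E → TwinFreeSaturated 3 (suc k) n′ (suc k * n′ + E) × E ^ k ≤ C ^ k * n′ ^ 4) → _
    go (E , T , c) = E , T′ , ≤-trans c (*-monoʳ-≤ (C ^ k) (^-monoˡ-≤ 4 (m∸n≤m n i)))
      where
      T₀ : TwinFreeSaturated (i + 3) (i + suc k) n ((i + suc k) * n + E)
      T₀ = subst (λ m → TwinFreeSaturated (i + 3) (i + suc k) m ((i + suc k) * m + E)) i+n′ (cone-iter i (≤-trans (m≤n+m (suc (suc k)) (suc (f q₀))) N≤) T)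
      T′ : TwinFreeSaturated (3 + i) (suc k + i) n ((suc k + i) * n + E)
      T′ = subst (λ t → TwinFreeSaturated (3 + i) t n (t * n + E)) (+-comm i (suc k)) (subst (λ r → TwinFreeSaturated r (i + suc k) n ((i + suc k) * n + E)) (+-comm i 3) T₀)

-- Existence of the minimum by exhaustive search.

any-function? : ∀ {m k} {P : (Fin m → Fin k) → Set} → (∀ {f g} → (∀ i → f i ≡ g i) → P f → P g) →
  (∀ f → Dec (P f)) → Dec (∃ P)
any-function? {m} {k} resp P? with any? (λ a → P? (finToFun {k} {m} a))
... | yes (a , p) = yes (finToFun {k} {m} a , p)
... | no ¬p = no λ { (f , p) → ¬p (funToFin f , resp (λ i → ≡-sym (finToFun-funToFin f i)) p) }

hasClique? : ∀ {n} r (A : Fin n → Fin n → Bool) → Dec (HasClique r A)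
hasClique? r A = any-function?
  (λ {f} {g} e h i j ne → subst (λ x → A x (g j) ≡ true) (e i) (subst (λ y → A (f i) y ≡ true) (e j) (h i j ne)))
  λ f → all? λ i → all? λ j → ¬? (i ≟ j) →-dec (A (f i) (f j) ≟ᵇ true)

saturated? : ∀ {n} r (G : SimpleGraph n) → Dec (Saturated r G)
saturated? r G = ¬? (hasClique? r (adj G)) ×-dec
  all? λ u → all? λ v → ¬? (u ≟ v) →-dec ((adj G u v ≟ᵇ false) →-dec hasClique? r (addEdge (adj G) u v))

admissible? : ∀ n r t (G : SimpleGraph n) → Dec (Admissible n r t G)
admissible? n r t G = saturated? r G ×-dec ((all? λ v → t ≤? deg G v) ×-dec
  all? λ u → all? λ v → (¬? (u ≟ v) ×-dec all? λ w → adj G u w ≟ᵇ adj G v w) →-dec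
    any? λ w → (adj G u w ≟ᵇ true) ×-dec ((adj G v w ≟ᵇ true) ×-dec (deg G w ≟ℕ t)))

HasClique-resp : ∀ {n r} {A B : Fin n → Fin n → Bool} → (∀ u v → A u v ≡ B u v) → HasClique r A → HasClique r B
HasClique-resp e (f , h) = f , λ i j ne → trans (≡-sym (e (f i) (f j))) (h i j ne)

module _ {n} {G H : SimpleGraph n} (e : ∀ u v → adj G u v ≡ adj H u v) where
  edges-resp : edges G ≡ edges H
  edges-resp = sum-cong λ i → count-cong λ j → cong (_∧ (toℕ i <ᵇ toℕ j)) (e i j)

  deg-resp : ∀ v → deg G v ≡ deg H v
  deg-resp v = count-cong (e v)

  Admissible-resp : ∀ {r t} → Admissible n r t G → Admissible n r t H
  Admissible-resp ((free , add) , md , tw) =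
    ((λ c → free (HasClique-resp (λ u v → ≡-sym (e u v)) c)) ,
     λ u v ne h → HasClique-resp (λ x y → cong (_∨ ((⌊ x ≟ u ⌋ ∧ ⌊ y ≟ v ⌋) ∨ (⌊ x ≟ v ⌋ ∧ ⌊ y ≟ u ⌋))) (e x y)) (add u v ne (trans (e u v) h))) ,
    (λ v → ≤-trans (md v) (≤-reflexive (deg-resp v))) ,
    λ { u v (ne , h) → let (w , a , b , d) = tw u v (ne , λ w → trans (e u w) (trans (h w) (≡-sym (e v w)))) in
        w , trans (≡-sym (e u w)) a , trans (≡-sym (e v w)) b , trans (≡-sym (deg-resp w)) d }

bit : Fin 2 → Bool
bit fzero = false
bit (fsuc _) = true

unbit : Bool → Fin 2
unbit false = fzero
unbit true = fsuc fzero

bit-unbit : ∀ b → bit (unbit b) ≡ b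
bit-unbit false = refl
bit-unbit true = refl

-- A graph is encoded by its adjacency matrix and recovered only up to pointwise equality of `adj`;
-- hence the hypothesis that `P` respects it.
any-graph? : ∀ {n} {P : SimpleGraph n → Set} → (∀ {G H} → (∀ u v → adj G u v ≡ adj H u v) → P G → P H) →
  (∀ G → Dec (P G)) → Dec (∃ P)
any-graph? {n} {P} resp P? = map′ (λ (_ , G , _ , p) → G , p) encode (any-function? respᶜ decide)
  where
  matrix : (Fin (n * n) → Fin 2) → Fin n → Fin n → Bool
  matrix f u v = bit (f (combine u v))
  Coded : (Fin (n * n) → Fin 2) → Set
  Coded f = Σ (SimpleGraph n) λ G → (∀ u v → adj G u v ≡ matrix f u v) × P G
  respᶜ : ∀ {f g} → (∀ i → f i ≡ g i) → Coded f → Coded g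
  respᶜ e (G , h , p) = G , (λ u v → trans (h u v) (cong bit (e (combine u v)))) , p
  decide : ∀ f → Dec (Coded f)
  decide f with all? (λ u → all? λ v → matrix f u v ≟ᵇ matrix f v u) | all? (λ v → matrix f v v ≟ᵇ false)
  ... | no ¬s | _ = no λ { (G , h , _) → ¬s λ u v → trans (≡-sym (h u v)) (trans (sym G u v) (h v u)) }
  ... | yes _ | no ¬i = no λ { (G , h , _) → ¬i λ v → trans (≡-sym (h v v)) (irrefl G v) }
  ... | yes s | yes i = map′ (λ p → M , (λ _ _ → refl) , p) (λ { (G , h , p) → resp h p }) (P? M)
    where
    M : SimpleGraph n
    M = record { adj = matrix f ; sym = s ; irrefl = i }
  encode : ∃ P → ∃ Coded
  encode (G , p) = (λ c → let (u , v) = remQuot n c in unbit (adj G u v)) , G ,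
    (λ u v → ≡-sym (trans (bit-unbit _) (cong (λ (a , b) → adj G a b) (remQuot-combine u v)))) , p

least-witness : ∀ {P : ℕ → Set} → (∀ e → Dec (P e)) → ∀ b → P b → ∃ λ e → P e × e ≤ b × (∀ x → P x → e ≤ x)
least-witness {P} P? b p = [ (λ h → h) , (λ none → ⊥-elim (none b ≤-refl p)) ]′ (below b)
  where
  below : ∀ b → (∃ λ e → P e × e ≤ b × (∀ x → P x → e ≤ x)) ⊎ (∀ x → x ≤ b → ¬ P x)
  extend-search : ∀ b → (∀ x → x < b → ¬ P x) → Dec (P b) → (∃ λ e → P e × e ≤ b × (∀ x → P x → e ≤ x)) ⊎ (∀ x → x ≤ b → ¬ P x)
  extend-search b none (yes p) = inj₁ (b , p , ≤-refl , λ x px → ≮⇒≥ λ lt → none x lt px)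
  extend-search b none (no ¬p) = inj₂ λ x le px → [ (λ lt → none x lt px) , (λ { refl → ¬p px }) ]′ (m≤n⇒m<n∨m≡n le)
  below zero = extend-search 0 (λ _ ()) (P? 0)
  below (suc b) with below b
  ... | inj₁ (e , pe , le , min) = inj₁ (e , pe , m≤n⇒m≤1+n le , min)
  ... | inj₂ none = extend-search (suc b) (λ x lt → none x (s≤s⁻¹ lt)) (P? (suc b))

-- `IsTsat` asks for an attained minimum. Admissibility is decidable and there are finitely many
-- graphs, so the least edge number up to that of `G` can be searched for.
tsat-exists : ∀ {n r t} (G : SimpleGraph n) → Admissible n r t G → ∃ λ e → IsTsat n r t e × e ≤ edges G
tsat-exists {n} {r} {t} G ok =
  let (e , h , le , min) = least-witness
        (λ e → any-graph? {P = λ G → Admissible n r t G × edges G ≡ e}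
          (λ {G} {H} eq (a , b) → Admissible-resp {G = G} {H} eq a , trans (≡-sym (edges-resp {G = G} {H} eq)) b)
          λ G → admissible? n r t G ×-dec (edges G ≟ℕ e))
        (edges G) (G , ok , refl)
  in e , (h , λ H okH → min (edges H) (H , okH , refl)) , le

tsat-≤ : ∀ {r t t′ n b} → t ≤ t′ → TwinFreeSaturated r t′ n b → ∃ λ e → IsTsat n r t e × e ≤ b
tsat-≤ t≤ T = let (e , h , le) = tsat-exists graph (saturated , (λ v → ≤-trans t≤ (min-deg v)) , λ u v (ne , h) → ⊥-elim (twin-free u v ne h))
              in e , h , ≤-trans le few-edges
  where open TwinFreeSaturated T

poly-bounds : ∀ {r t a k κ} →
  (∃ λ c → ∀ n (G : SimpleGraph n) → Admissible n r t G → n ^ suc a ≤ c * suc (edges G ∸ t * n) ^ suc k) →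
  (∃ λ C → ∃ λ N → ∀ n → N ≤ n → ∃ λ E → TwinFreeSaturated r t n (t * n + E) × E ^ suc κ ≤ C ^ suc κ * n ^ 4) →
  PolyBounds r t (suc a) (suc k) 4 (suc κ)
poly-bounds {r} {t} {a} {k} {κ} (c , lower) (C , N , graphs) = 2 * c , C , suc c + N , bound
  where
  bound : ∀ n → suc c + N ≤ n → Σ ℕ λ e → IsTsat n r t e × (n ^ suc a ≤ (2 * c * (e ∸ t * n)) ^ suc k) × ((e ∸ t * n) ^ suc κ ≤ C ^ suc κ * n ^ 4)
  bound n le = go (graphs n (≤-trans (m≤n+m N (suc c)) le))
    where
    go : (∃ λ E → TwinFreeSaturated r t n (t * n + E) × E ^ suc κ ≤ C ^ suc κ * n ^ 4) → _
    go (E , T , cost) = pack (tsat-≤ ≤-refl T)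
      where
      pack : (∃ λ e → IsTsat n r t e × e ≤ t * n + E) → _
      pack (e , ts@((G , ok , refl) , _) , e≤) = e , ts ,
        poly-finish a k c n (edges G ∸ t * n) (lower n G ok) (≤-trans (m≤m+n (suc c) N) le) ,
        ≤-trans (^-monoˡ-≤ (suc κ) (≤-trans (∸-monoˡ-≤ (t * n) e≤) (≤-reflexive (m+n∸m≡n (t * n) E)))) cost

^-cancelˡ-≤ : ∀ k {a b} → a ^ suc k ≤ b ^ suc k → a ≤ b
^-cancelˡ-≤ k {a} {b} h = ≮⇒≥ λ lt → <-irrefl refl (≤-trans (^-monoˡ-< (suc k) lt) h)

lin-bounds : ∀ {r t t′ p p′ q} → t ≤ t′ → p′ ≡ q * t′ →
  (∀ m → 1 ≤ m → ∃ λ N → ∀ n → N ≤ n → ∀ (G : SimpleGraph n) → Admissible n r t G → m * p * n ≤ m * q * edges G + q * n) →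
  (∃ λ C → ∃ λ N → ∀ n → N ≤ n → ∃ λ E → TwinFreeSaturated r t′ n (t′ * n + E) × E ^ 5 ≤ C ^ 5 * n ^ 4) →
  LinBounds r t p p′ q
lin-bounds {r} {t} {t′} {p} {p′} {q} t≤ refl low (C , N , graphs) m 1≤m = go (low m 1≤m)
  where
  go : (∃ λ N′ → ∀ n → N′ ≤ n → ∀ (G : SimpleGraph n) → Admissible n r t G → m * p * n ≤ m * q * edges G + q * n) → _
  go (N′ , lower) = N′ + N + (m * C) ^ 5 , bound
    where
    bound : ∀ n → N′ + N + (m * C) ^ 5 ≤ n → Σ ℕ λ e → IsTsat n r t e × (m * p * n ≤ m * q * e + q * n) × (m * q * e ≤ m * (q * t′) * n + q * n)
    bound n le = go′ (graphs n (≤-trans (≤-trans (m≤n+m N N′) (m≤m+n _ _)) le))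
      where
      go′ : (∃ λ E → TwinFreeSaturated r t′ n (t′ * n + E) × E ^ 5 ≤ C ^ 5 * n ^ 4) → _
      go′ (E , T , cost) = pack (tsat-≤ t≤ T)
        where
        open ≤-Reasoning
        -- The graphs for t′ have excess O(n^(4/5)): by fifth powers, E ^ 5 ≤ C ^ 5 · n ^ 4 and n ≥
        -- (m C) ^ 5 suffice.
        mE≤n : m * E ≤ n
        mE≤n = ^-cancelˡ-≤ 4 (begin
          (m * E) ^ 5 ≡⟨ ^-distribʳ-* 5 m E ⟩
          m ^ 5 * E ^ 5 ≤⟨ *-monoʳ-≤ (m ^ 5) cost ⟩
          m ^ 5 * (C ^ 5 * n ^ 4) ≡⟨ ≡-sym (*-assoc (m ^ 5) (C ^ 5) (n ^ 4)) ⟩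
          m ^ 5 * C ^ 5 * n ^ 4 ≡⟨ cong (_* n ^ 4) (≡-sym (^-distribʳ-* 5 m C)) ⟩
          (m * C) ^ 5 * n ^ 4 ≤⟨ *-monoˡ-≤ (n ^ 4) (≤-trans (m≤n+m _ (N′ + N)) le) ⟩
          n ^ 5 ∎)
        e₁ : ∀ m q t n E → m * q * (t * n + E) ≡ m * (q * t) * n + q * (m * E)
        e₁ = solve-∀
        pack : (∃ λ e → IsTsat n r t e × e ≤ t′ * n + E) → _
        pack (e , ts@((G , ok , refl) , _) , e≤) = e , ts ,
          lower n (≤-trans (≤-trans (m≤m+n N′ N) (m≤m+n _ _)) le) G ok ,
          (begin
            m * q * e ≤⟨ *-monoʳ-≤ (m * q) e≤ ⟩
            m * q * (t′ * n + E) ≡⟨ e₁ m q t′ n E ⟩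
            m * (q * t′) * n + q * (m * E) ≤⟨ +-monoʳ-≤ (m * (q * t′) * n) (*-monoʳ-≤ q mE≤n) ⟩
            m * (q * t′) * n + q * n ∎)

part₁ : ∀ r t → 3 ≤ r → r + 3 ≤ t → PolyBounds r t 1 (t ∸ r + 2) 4 (t ∸ r + 2)
part₁ r t 3≤r r+3≤t with m≤n⇒∃[o]m+o≡n 3≤r | m≤n⇒∃[o]m+o≡n r+3≤t
... | j , refl | i , refl = subst (λ k → PolyBounds (3 + j) t 1 k 4 k) exponent
  (poly-bounds {a = 0} {4 + i} {4 + i} lower
    (subst (λ s → ∃ λ C → ∃ λ N → ∀ n → N ≤ n → ∃ λ E → TwinFreeSaturated (3 + j) s n (s * n + E) × E ^ (5 + i) ≤ C ^ (5 + i) * n ^ 4)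
      (e₁ i j) (upper (4 + i) (m≤m+n 4 i) j)))
  where
  e₁ : ∀ i j → 2 + (4 + i) + j ≡ 3 + j + 3 + i
  e₁ = solve-∀
  e₂ : ∀ i → 5 + i ≡ 3 + i + 2
  e₂ = solve-∀
  e₃ : ∀ i j → 1 + j + (5 + i) ≡ 3 + j + 3 + i
  e₃ = solve-∀
  exponent : 5 + i ≡ 3 + j + 3 + i ∸ (3 + j) + 2
  exponent = trans (e₂ i) (cong (_+ 2) (≡-sym (trans (cong (_∸ (3 + j)) (+-assoc (3 + j) 3 i)) (m+n∸m≡n (3 + j) (3 + i)))))
  lower : ∃ λ c → ∀ n (G : SimpleGraph n) → Admissible n (3 + j) (3 + j + 3 + i) G → n ^ 1 ≤ c * suc (edges G ∸ (3 + j + 3 + i) * n) ^ (5 + i)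
  lower = let (c , h) = lower₁ (1 + j) (3 + j + 3 + i) (4 + i) (e₃ i j) in
    c , λ n G ok → ≤-trans (≤-reflexive (*-identityʳ n)) (h n G ok)

part₂ : ∀ t → 6 ≤ t → PolyBounds 3 t 2 (t ∸ 3) 4 (t ∸ 1)
part₂ t 6≤t with m≤n⇒∃[o]m+o≡n 6≤t
... | i , refl = poly-bounds {a = 1} {2 + i} {4 + i} (lower₂ (1 + i))
  (subst (λ s → ∃ λ C → ∃ λ N → ∀ n → N ≤ n → ∃ λ E → TwinFreeSaturated 3 s n (s * n + E) × E ^ (5 + i) ≤ C ^ (5 + i) * n ^ 4)
      (+-identityʳ (6 + i)) (upper (4 + i) (m≤m+n 4 i) 0))

part₃ : ∀ r t → 3 ≤ r → t ≤ r + 2 → LinBounds r t (r + 2) (r + 3) 1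
part₃ r t 3≤r t≤ with m≤n⇒∃[o]m+o≡n 3≤r
... | j , refl = lin-bounds {t′ = 6 + j} (≤-trans t≤ (≤-trans (m≤m+n _ 1) (≤-reflexive (e₁ j)))) (e₂ j) lower (upper 4 ≤-refl j)
  where
  e₁ : ∀ j → 3 + j + 2 + 1 ≡ 6 + j
  e₁ = solve-∀
  e₂ : ∀ j → 3 + j + 3 ≡ 1 * (6 + j)
  e₂ = solve-∀
  e₃ : ∀ j → 3 + j + 2 ≡ 5 + j
  e₃ = solve-∀
  lower : ∀ m → 1 ≤ m → ∃ λ N → ∀ n → N ≤ n → ∀ (G : SimpleGraph n) → Admissible n (3 + j) t G →
    m * (3 + j + 2) * n ≤ m * 1 * edges G + 1 * n
  lower m _ = let (N , h) = lower₃ (1 + j) t (≤-trans t≤ (≤-reflexive (e₃ j))) m in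
    N , λ n le G ok → ≤-trans (≤-reflexive (cong (λ s → m * s * n) (e₃ j))) (≤-trans (h n le G ok)
      (≤-reflexive (cong₂ _+_ (cong (_* edges G) (≡-sym (*-identityʳ m))) (≡-sym (*-identityˡ n)))))

part₄ : ∀ t → t ≤ 5 → LinBounds 3 t 17 18 3
part₄ t t≤5 = lin-bounds {t′ = 6} (m≤n⇒m≤1+n t≤5) refl (λ { (suc m) _ → lower₄ t t≤5 m }) (upper 4 ≤-refl 0)

theorem3 :
    (∀ r t → 3 ≤ r → r + 3 ≤ t → PolyBounds r t 1 (t ∸ r + 2) 4 (t ∸ r + 2)) ×
    (∀ t → 6 ≤ t → PolyBounds 3 t 2 (t ∸ 3) 4 (t ∸ 1)) ×
    (∀ r t → 3 ≤ r → r ≤ t + 2 → t ≤ r + 2 → LinBounds r t (r + 2) (r + 3) 1) ×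
    (∀ t → 1 ≤ t → t ≤ 5 → LinBounds 3 t 17 18 3)
theorem3 = part₁ , part₂ , (λ r t 3≤r _ → part₃ r t 3≤r) , λ t _ → part₄ t
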